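{- Let $p$ be a prime. For all $\beta, \gamma>0$ there exists $\varepsilon>0$ such that for all $\alpha>0$ there is a value of $c$ for which the following holds. Let $A$ and $B$ be subsets of $\mathbb{Z}_p$ and let $1 \leq c_1 \leq |A|$ and $1 \leq c_2 \leq |B|$ be integers such that $c_1c_2 \geq c\max(|A|,|B|)$. Suppose that $2 \leq \min(|A|,|B|)$, $\alpha |B| \leq |A| \leq \alpha^{ -1} |B|$, $|A|+|B| \leq (1-\beta)p$, and $$\mathbb{E}_{A' \in A^{(c_1)},\ B' \in B^{(c_2)}} |A'+B'| \leq |A|+|B|-1 +\varepsilon \min(|A|,|B|).$$ Then there exist arithmetic progressions $P$ and $Q$ in $\mathbb{Z}_p$ with the same common difference such that $\max(|A\Delta P|, |B \Delta Q|) \leq \gamma \min(|A|,|B|)$.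
   Context: For a finite set $X$ and integer $m$, $X^{(m)}$ denotes the family of all $m$-element subsets of $X$; the expectation is over $A'$ and $B'$ chosen independently and uniformly from $A^{(c_1)}$ and $B^{(c_2)}$. $A'+B'$ is the sumset and $\Delta$ the symmetric difference. -}

module Defs where

open import Data.Nat as ℕ using (ℕ; zero; suc; NonZero)
open import Data.Nat.DivMod using (_%_; m%n<n)
open import Data.Fin as Fin using (Fin; toℕ; fromℕ<)
open import Data.Fin.Subset using (Subset; inside; outside; ∣_∣; _∪_; _─_)
open import Data.Bool using (Bool; true; false; _∧_; _∨_; if_then_else_)
open import Data.Vec using (Vec; []; _∷_; lookup; tabulate)
open import Data.List using (List; []; _∷_; map; filter; concatMap; length; allFin; upTo)
open import Data.Bool.ListAction using (any; all)
open import Data.Rational using (ℚ; 0ℚ; _/_; _*_; _+_)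
open import Data.Integer using (+_)
open import Data.Nat.ListAction using () renaming (sum to sumℕ)
open import Relation.Nullary.Decidable using (⌊_⌋)
open import Data.Nat.Properties using (_≟_)
import Data.Fin.Properties as FinP

-- Arithmetic of ℤ_p, with ℤ_p represented as Fin p (p is a prime, so p ≠ 0).
infixl 6 _⊕_
_⊕_ : ∀ {p} .{{_ : NonZero p}} → Fin p → Fin p → Fin p
_⊕_ {p} x y = fromℕ< (m%n<n (toℕ x ℕ.+ toℕ y) p)

_·_ : ∀ {p} .{{_ : NonZero p}} → ℕ → Fin p → Fin p
_·_ {p} i d = fromℕ< (m%n<n (i ℕ.* toℕ d) p)

mem : ∀ {n} → Fin n → Subset n → Bool
mem x S = lookup S x

sumset : ∀ {p} .{{_ : NonZero p}} → Subset p → Subset p → Subset p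
sumset {p} S T = tabulate λ z →
  any (λ x → any (λ y → mem x S ∧ mem y T ∧ ⌊ (x ⊕ y) FinP.≟ z ⌋) (allFin p)) (allFin p)

_Δ_ : ∀ {n} → Subset n → Subset n → Subset n
S Δ T = (S ─ T) ∪ (T ─ S)

AP : ∀ {p} .{{_ : NonZero p}} → Fin p → Fin p → ℕ → Subset p
AP {p} a d k = tabulate λ z → any (λ i → ⌊ (a ⊕ (i · d)) FinP.≟ z ⌋) (upTo k)

allSubsets : ∀ n → List (Subset n)
allSubsets zero = [] ∷ []
allSubsets (suc n) = concatMap (λ S → (inside ∷ S) ∷ (outside ∷ S) ∷ []) (allSubsets n)

subsetᵇ : ∀ {n} → Subset n → Subset n → Bool
subsetᵇ {n} S T = all (λ x → if mem x S then mem x T else true) (allFin n)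


choose : ∀ {n} → Subset n → ℕ → List (Subset n)
choose {n} X m = filter (λ S → Relation.Nullary.Decidable.Core.T? (subsetᵇ S X ∧ ⌊ ∣ S ∣ ≟ m ⌋)) (allSubsets n)
  where import Relation.Nullary.Decidable.Core

-- Expectation (uniform average) of a list of natural numbers, as a rational;
-- the average of the empty list is set to 0 (never used under the hypotheses).
average : List ℕ → ℚ
average [] = 0ℚ
average (x ∷ xs) = (+ (sumℕ (x ∷ xs))) / (suc (length xs))

expectedSumsetSize : ∀ {p} .{{_ : NonZero p}} → Subset p → Subset p → ℕ → ℕ → ℚ
expectedSumsetSize A B c₁ c₂ =
  average (concatMap (λ A' → map (λ B' → ∣ sumset A' B' ∣) (choose B c₂)) (choose A c₁))

ℕ→ℚ : ℕ → ℚ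
ℕ→ℚ n = (+ n) / 1

{-# OPTIONS --safe #-}

-- The second moment method shows that a sum with many representations almost surely
-- survives the sampling, so the hypothesis yields a set S with |S| ≤ |A| + |B| + εmin such
-- that almost all pairs of A × B have their sum in S.  With C = -Sᶜ this is a triple (A, B, C)
-- with few zero-sum triples and |A| + |B| + |C| ≈ p, and Pollard's theorem gives
-- |A| + |B| + |C| ≤ p + O(E) whenever there are at most E² zero-sum triples.
--
-- Put N_U(t) = |U \ (U + t)|.  Passing from (A, B) to (A ∩ (A + t), B ∪ (B - t)) and
-- using Pollard's bound gives N_B(t) ≤ N_A(t) + O(E), so the three norms agree, and passing to
-- (A ∩ (A + t), C ∪ (C - t)) keeps the triple near extremal; iterating, one member X becomes much
-- smaller than the other two.  Then D_k = {t : N_Z(t) ≤ kρ}, ρ ≈ |X|, satisfies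
-- D_j + D_k ⊆ D_{j+k} and |D_k| = 2kρ + o(ρ): from below by Cauchy–Davenport as X - X ⊆ D_1,
-- from above by Pollard's theorem for Z and -Zᶜ.
--
-- Choose x₀ on the boundary of D_101.  Its multiples cover D_303 by translates of N = D_117 and do not
-- return to N - N, so for t in D_186 translation by t permutes a set R of representatives
-- of N modulo x₀ up to multiples of x₀.  Summing over R, |R| t is a small multiple of x₀, hence
-- t is a small multiple of d = x₀/|R|.  So X is almost an interval in the direction d, all three norms of
-- i·d are at most i + o(h) for i ≤ h ≪ |X|, and a set with this property is, by counting along blocks of
-- length h, within O(h) of a progression with difference d.

module Submission where

-- The obstacle is that the three sets of a near-extremal triple may have comparable sizes, and then
-- the sets D_k have no room. The upper bound for |D_k| averages Pollard's inequality over many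
-- radii, and the largest radius must stay well below |Z| and |Zᶜ|; hence the passage to a small X.
-- It leaves Y unchanged, so the direction found for the small set can be carried back: to Y inside
-- the reduced triple, and from Y to the other two sets inside the original one. No rectification is
-- used. The common difference comes from division in the field: x₀ spans about |R| steps of the
-- hidden progression, so one step has to be x₀/|R|. The density hypothesis acts through the third
-- set: it makes |C| a large multiple of E. The constant α influences c alone, since it serves to
-- compare |A| + |B| with min(|A|, |B|) when popular sums are counted. Rational parameters are
-- replaced by reciprocals of their denominators, and the estimates run in the natural numbers with
-- explicit errors.

module StabilityProof where

  open import Defs using (allSubsets; subsetᵇ; choose; mem; sumset; average; expectedSumsetSize; ℕ→ℚ; AP; _Δ_; _⊕_; _·_)
  open import Data.Bool using (Bool; true; false; not; _∧_; _∨_; if_then_else_; T?)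
  open import Data.Bool.ListAction using (any; and)
  open import Data.Empty using (⊥; ⊥-elim)
  open import Data.Fin using (Fin; zero; suc; toℕ; fromℕ<)
  open import Data.Fin.Properties as Fin using (toℕ-fromℕ<; toℕ<n; toℕ-injective)
  open import Data.Fin.Subset using (Subset; ∣_∣)
  open import Data.Integer as ℤ using (ℤ; +_; -[1+_]) renaming (_+_ to _+ᶻ_; _-_ to _-ᶻ_; _*_ to _*ᶻ_; -_ to -ᶻ_)
  open import Data.Integer.DivMod using (_%ℕ_; _/ℕ_; a≡a%ℕn+[a/ℕn]*n; n%ℕd<d)
  import Data.Integer.Properties as ℤ
  import Data.Integer.Tactic.RingSolver as ℤR
  open import Data.List using (List; _∷_; []; map; concatMap; filter; length; tabulate; applyUpTo; upTo)
  open import Data.List.Properties using (map-tabulate; map-++; map-∘; map-cong; map-id)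
  open import Data.Nat
  open import Data.Nat.Coprimality using (prime⇒coprime; coprime-Bézout)
  open import Data.Nat.DivMod using (_/_; _%_; m≡m%n+[m/n]*n; m%n<n; /-monoˡ-≤; m*n/n≡m)
  open import Data.Nat.GCD using (module Bézout)
  open import Data.Nat.ListAction using () renaming (sum to sumℕ)
  open import Data.Nat.ListAction.Properties using (sum-++)
  open import Data.Nat.Primality using (Prime; prime⇒nonZero)
  open import Data.Nat.Properties
  open import Data.Nat.Tactic.RingSolver using (solve; solve-∀)
  open import Data.Product using (Σ; _×_; _,_; proj₁; proj₂; ∃)
  open import Data.Rational as ℚ using (ℚ; 0ℚ; 1ℚ; mkℚ; ↧ₙ_; toℚᵘ)
  import Data.Rational.Properties as ℚ
  open import Data.Rational.Solver using (module +-*-Solver)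
  open import Data.Rational.Unnormalised as ℚᵘ using (ℚᵘ; mkℚᵘ; *≡*; *≤*)
  import Data.Rational.Unnormalised.Properties as ℚᵘ
  open import Data.Sum using (_⊎_; inj₁; inj₂; [_,_]′)
  open import Data.Unit using (tt)
  import Data.Vec as Vec
  import Data.Vec.Properties as Vec
  open import Function using (_∘_)
  open import Relation.Binary.PropositionalEquality
  open import Relation.Nullary using (¬_; Dec; yes; no; does)
  open import Relation.Nullary.Decidable using (⌊_⌋; isYes≗does)

  infixl 6 _⊞_
  infixr 7 _⊠_

  _⊞_ : ∀ {a b c d} → a ≤ b → c ≤ d → a + c ≤ b + d
  _⊞_ = +-mono-≤

  _⊠_ : ∀ {a b} c → a ≤ b → c * a ≤ c * b
  c ⊠ h = *-monoʳ-≤ c h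

  -- A linear-arithmetic certificate: Y ≤ X is a nonnegative combination of the
  -- hypotheses and s is the slack; the identity is left to the ring solver.
  lin : ∀ {L R Y X} s → Y ≤ X → L + X + s ≡ R + Y → L ≤ R
  lin {L} {R} {Y} {X} s h e =
    +-cancelʳ-≤ Y L R (≤-trans (+-monoʳ-≤ L h) (≤-trans (m≤m+n (L + X) s) (≤-reflexive e)))

  ≤≡ : ∀ {a b} → a ≡ b → a ≤ b
  ≤≡ = ≤-reflexive

  ≥≡ : ∀ {a b} → a ≡ b → b ≤ a
  ≥≡ e = ≤-reflexive (sym e)

  -- Finite sums

  ∑ : ℕ → (ℕ → ℕ) → ℕ
  ∑ zero f = 0
  ∑ (suc n) f = ∑ n f + f n

  ∑-cong : ∀ n {f g : ℕ → ℕ} → (∀ i → i < n → f i ≡ g i) → ∑ n f ≡ ∑ n g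
  ∑-cong zero h = refl
  ∑-cong (suc n) h = cong₂ _+_ (∑-cong n (λ i i<n → h i (m≤n⇒m≤1+n i<n))) (h n ≤-refl)

  ∑-mono : ∀ n {f g : ℕ → ℕ} → (∀ i → i < n → f i ≤ g i) → ∑ n f ≤ ∑ n g
  ∑-mono zero h = z≤n
  ∑-mono (suc n) h = ∑-mono n (λ i i<n → h i (m≤n⇒m≤1+n i<n)) ⊞ h n ≤-refl

  ∑-+ : ∀ n (f g : ℕ → ℕ) → ∑ n (λ i → f i + g i) ≡ ∑ n f + ∑ n g
  ∑-+ zero f g = refl
  ∑-+ (suc n) f g rewrite ∑-+ n f g = lem (∑ n f) (∑ n g) (f n) (g n)
    where lem : ∀ a b c d → a + b + (c + d) ≡ a + c + (b + d)
          lem = solve-∀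

  ∑-* : ∀ n c (f : ℕ → ℕ) → ∑ n (λ i → c * f i) ≡ c * ∑ n f
  ∑-* zero c f = sym (*-zeroʳ c)
  ∑-* (suc n) c f rewrite ∑-* n c f = sym (*-distribˡ-+ c (∑ n f) (f n))

  ∑-const : ∀ n c → ∑ n (λ _ → c) ≡ n * c
  ∑-const zero c = refl
  ∑-const (suc n) c rewrite ∑-const n c = +-comm (n * c) c

  ∑-0 : ∀ n {f : ℕ → ℕ} → (∀ i → i < n → f i ≡ 0) → ∑ n f ≡ 0
  ∑-0 n h = trans (∑-cong n h) (trans (∑-const n 0) (*-zeroʳ n))

  ∑-swap : ∀ m n (f : ℕ → ℕ → ℕ) → ∑ m (λ i → ∑ n (f i)) ≡ ∑ n (λ j → ∑ m (λ i → f i j))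
  ∑-swap zero n f = sym (∑-0 n (λ _ _ → refl))
  ∑-swap (suc m) n f = trans (cong (_+ ∑ n (f m)) (∑-swap m n f)) (sym (∑-+ n _ (f m)))

  ∑-term : ∀ n (f : ℕ → ℕ) i → i < n → f i ≤ ∑ n f
  ∑-term (suc n) f i i<1+n with m≤n⇒m<n∨m≡n (≤-pred i<1+n)
  ... | inj₁ i<n = ≤-trans (∑-term n f i i<n) (m≤m+n _ _)
  ... | inj₂ refl = m≤n+m _ _

  ∑-split : ∀ m n (f : ℕ → ℕ) → ∑ (m + n) f ≡ ∑ m f + ∑ n (λ i → f (m + i))
  ∑-split m zero f rewrite +-identityʳ m = sym (+-identityʳ _)
  ∑-split m (suc n) f rewrite +-suc m n | ∑-split m n f = +-assoc (∑ m f) _ _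

  ∑-mono-n : ∀ {m n} (f : ℕ → ℕ) → m ≤ n → ∑ m f ≤ ∑ n f
  ∑-mono-n {m} {n} f m≤n with m≤n⇒∃[o]m+o≡n m≤n
  ... | k , refl = ≤-trans (m≤m+n _ _) (≥≡ (∑-split m k f))

  ∑-head : ∀ n (f : ℕ → ℕ) → ∑ (suc n) f ≡ f 0 + ∑ n (f ∘ suc)
  ∑-head n f = ∑-split 1 n f

  ∑-block : ∀ m h (f : ℕ → ℕ) → ∑ (m * h) f ≡ ∑ m (λ k → ∑ h (λ j → f (k * h + j)))
  ∑-block zero h f = refl
  ∑-block (suc m) h f = trans (cong (λ n → ∑ n f) (+-comm h (m * h)))
    (trans (∑-split (m * h) h f) (cong (_+ ∑ h (λ j → f (m * h + j))) (∑-block m h f)))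

  ∑-full : ∀ n (f : ℕ → ℕ) → (∀ i → i < n → f i ≤ 1) → n ≤ ∑ n f → ∀ i → i < n → f i ≡ 1
  ∑-full (suc n) f h le i i<1+n = go (m≤n⇒m<n∨m≡n (≤-pred i<1+n))
    where
      up : ∑ n f ≤ n
      up = ≤-trans (∑-mono n (λ j j<n → h j (m≤n⇒m≤1+n j<n))) (≤≡ (trans (∑-const n 1) (*-identityʳ n)))
      last : 1 ≤ f n
      last = arith (∑ n f) (f n) up le
        where arith : ∀ s x → s ≤ n → suc n ≤ s + x → 1 ≤ x
              arith s x h₁ h₂ = lin 0 (h₁ ⊞ h₂) (solve (s ∷ x ∷ n ∷ []))
      lower : n ≤ ∑ n f
      lower = arith (∑ n f) (f n) (h n ≤-refl) le
        where arith : ∀ s x → x ≤ 1 → suc n ≤ s + x → n ≤ s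
              arith s x h₁ h₂ = lin 0 (h₁ ⊞ h₂) (solve (s ∷ x ∷ n ∷ []))
      go : i < n ⊎ i ≡ n → f i ≡ 1
      go (inj₁ i<n) = ∑-full n f (λ j j<n → h j (m≤n⇒m≤1+n j<n)) lower i i<n
      go (inj₂ refl) = ≤-antisym (h i ≤-refl) last

  ∑-pos : ∀ n (f : ℕ → ℕ) → 1 ≤ ∑ n f → ∃ λ i → i < n × 1 ≤ f i
  ∑-pos (suc n) f h with f n in eq
  ... | suc m = n , ≤-refl , subst (1 ≤_) (sym eq) (s≤s z≤n)
  ... | zero with ∑-pos n f (subst (1 ≤_) (+-identityʳ _) h)
  ...   | i , i<n , 1≤ = i , m≤n⇒m≤1+n i<n , 1≤

  ⟦_⟧ : Bool → ℕ
  ⟦ true ⟧ = 1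
  ⟦ false ⟧ = 0

  ⟦⟧≤1 : ∀ b → ⟦ b ⟧ ≤ 1
  ⟦⟧≤1 true = ≤-refl
  ⟦⟧≤1 false = z≤n

  ⟦⟧-pos : ∀ {b} → 1 ≤ ⟦ b ⟧ → b ≡ true
  ⟦⟧-pos {true} _ = refl

  ⟦∧⟧ : ∀ a b → ⟦ a ∧ b ⟧ ≡ ⟦ a ⟧ * ⟦ b ⟧
  ⟦∧⟧ true b = sym (+-identityʳ _)
  ⟦∧⟧ false b = refl

  ⟦⟧+not : ∀ b → ⟦ b ⟧ + ⟦ not b ⟧ ≡ 1
  ⟦⟧+not true = refl
  ⟦⟧+not false = refl

  -- Congruence modulo p on the integers and sums over a period

  module Zp (p : ℕ) (pr : Prime p) where

    instance
      p≢0 : NonZero p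
      p≢0 = prime⇒nonZero pr

    P : ℤ
    P = + p

    infix 4 _≈_ _≈?_ _by_
    -- Residue classes are integers up to congruence, with an explicit quotient, so that identities
    -- between them are left to the ring solver over ℤ.
    record _≈_ (x y : ℤ) : Set where
      constructor _by_
      field
        quo : ℤ
        eqn : x ≡ y +ᶻ quo *ᶻ P

    ≈-refl : ∀ {x} → x ≈ x
    ≈-refl {x} = + 0 by sym (trans (cong (x +ᶻ_) (ℤ.*-zeroˡ P)) (ℤ.+-identityʳ x))

    ≡⇒≈ : ∀ {x y} → x ≡ y → x ≈ y
    ≡⇒≈ refl = ≈-refl

    ≈-sym : ∀ {x y} → x ≈ y → y ≈ x
    ≈-sym {x} {y} (k by refl) = -ᶻ k by lem y k P
      where lem : ∀ y k P → y ≡ (y +ᶻ k *ᶻ P) +ᶻ (-ᶻ k) *ᶻ P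
            lem = ℤR.solve-∀

    ≈-trans : ∀ {x y z} → x ≈ y → y ≈ z → x ≈ z
    ≈-trans {z = z} (k by refl) (l by refl) = l +ᶻ k by lem z k l P
      where lem : ∀ z k l P → (z +ᶻ l *ᶻ P) +ᶻ k *ᶻ P ≡ z +ᶻ (l +ᶻ k) *ᶻ P
            lem = ℤR.solve-∀

    ≈-+ : ∀ {x y u v} → x ≈ y → u ≈ v → x +ᶻ u ≈ y +ᶻ v
    ≈-+ {y = y} {v = v} (k by refl) (l by refl) = k +ᶻ l by lem y v k l P
      where lem : ∀ y v k l P → (y +ᶻ k *ᶻ P) +ᶻ (v +ᶻ l *ᶻ P) ≡ (y +ᶻ v) +ᶻ (k +ᶻ l) *ᶻ P
            lem = ℤR.solve-∀

    ≈-neg : ∀ {x y} → x ≈ y → -ᶻ x ≈ -ᶻ y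
    ≈-neg {y = y} (k by refl) = -ᶻ k by lem y k P
      where lem : ∀ y k P → -ᶻ (y +ᶻ k *ᶻ P) ≡ (-ᶻ y) +ᶻ (-ᶻ k) *ᶻ P
            lem = ℤR.solve-∀

    ≈-- : ∀ {x y u v} → x ≈ y → u ≈ v → x -ᶻ u ≈ y -ᶻ v
    ≈-- h k = ≈-+ h (≈-neg k)

    ≈-* : ∀ c {x y} → x ≈ y → c *ᶻ x ≈ c *ᶻ y
    ≈-* c {y = y} (k by refl) = c *ᶻ k by lem c y k P
      where lem : ∀ c y k P → c *ᶻ (y +ᶻ k *ᶻ P) ≡ c *ᶻ y +ᶻ (c *ᶻ k) *ᶻ P
            lem = ℤR.solve-∀

    x+P≈x : ∀ x → x +ᶻ P ≈ x
    x+P≈x x = + 1 by cong (x +ᶻ_) (sym (ℤ.*-identityˡ P))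

    res : ℤ → ℕ
    res x = x %ℕ p

    res<p : ∀ x → res x < p
    res<p x = n%ℕd<d x p

    ≈res : ∀ x → x ≈ + res x
    ≈res x = x /ℕ p by a≡a%ℕn+[a/ℕn]*n x p

    ≈⇒≡ : ∀ {i j} → i < p → j < p → + i ≈ + j → i ≡ j
    ≈⇒≡ {i} {j} i<p j<p (+ k by e) with k
    ... | zero = ℤ.+-injective (trans e (trans (cong (+ j +ᶻ_) (ℤ.*-zeroˡ P)) (ℤ.+-identityʳ _)))
    ... | suc k = ⊥-elim (<⇒≱ i<p (subst (p ≤_) (sym e′) (≤-trans (m≤m+n p (k * p)) (m≤n+m _ j))))
      where e′ : i ≡ j + (p + k * p)
            e′ = ℤ.+-injective (trans e (trans (cong (+ j +ᶻ_) (sym (ℤ.pos-* (suc k) p))) (sym (ℤ.pos-+ j _))))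
    ≈⇒≡ {i} {j} i<p j<p (-[1+ k ] by e) = ⊥-elim (<⇒≱ j<p (subst (p ≤_) (sym e′) (≤-trans (m≤m+n p (k * p)) (m≤n+m _ i))))
      where lem : ∀ j k P → j ≡ (j +ᶻ (-ᶻ k) *ᶻ P) +ᶻ k *ᶻ P
            lem = ℤR.solve-∀
            e′ : j ≡ i + (p + k * p)
            e′ = ℤ.+-injective (trans (trans (lem (+ j) (+ suc k) P) (cong (_+ᶻ + suc k *ᶻ P) (sym e)))
                   (trans (cong (+ i +ᶻ_) (sym (ℤ.pos-* (suc k) p))) (sym (ℤ.pos-+ i _))))

    0<p : 0 < p
    0<p = >-nonZero⁻¹ p

    opaque
      _≈?_ : ∀ x y → Dec (x ≈ y)
      x ≈? y with res x ≟ res y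
      ... | yes e = yes (≈-trans (≈res x) (subst (λ r → + r ≈ y) (sym e) (≈-sym (≈res y))))
      ... | no ne = no λ h → ne (≈⇒≡ (res<p x) (res<p y) (≈-trans (≈-sym (≈res x)) (≈-trans h (≈res y))))

    inverse : ∀ s → ¬ (s ≈ + 0) → Σ ℤ λ e → s *ᶻ e ≈ + 1
    inverse s s≉0 = go (res s) (res<p s) (≈res s) refl
      where
        go : ∀ n → n < p → s ≈ + n → res s ≡ n → Σ ℤ λ e → s *ᶻ e ≈ + 1
        go zero _ s≈ _ = ⊥-elim (s≉0 s≈)
        go (suc n) n<p (k by s≡) _ with coprime-Bézout (prime⇒coprime pr n<p)
        ... | Bézout.+- x y e = -ᶻ (+ y) , ((-ᶻ (k *ᶻ + y +ᶻ + x)) by pf)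
          where
            e′ : + 1 +ᶻ + y *ᶻ + suc n ≡ + x *ᶻ P
            e′ = trans (cong (+ 1 +ᶻ_) (sym (ℤ.pos-* y (suc n)))) (trans (cong +_ e) (ℤ.pos-* x p))
            lem : ∀ n k P x y → ((+ 1) +ᶻ y *ᶻ n) ≡ x *ᶻ P → (n +ᶻ k *ᶻ P) *ᶻ (-ᶻ y) ≡ + 1 +ᶻ (-ᶻ (k *ᶻ y +ᶻ x)) *ᶻ P
            lem n k P x y h = trans (l₁ n k P x y) (trans (cong (λ z → (+ 1 -ᶻ z) -ᶻ k *ᶻ y *ᶻ P) h) (l₂ n k P x y))
              where l₁ : ∀ n k P x y → (n +ᶻ k *ᶻ P) *ᶻ (-ᶻ y) ≡ (+ 1 -ᶻ (+ 1 +ᶻ y *ᶻ n)) -ᶻ k *ᶻ y *ᶻ P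
                    l₁ = ℤR.solve-∀
                    l₂ : ∀ n k P x y → (+ 1 -ᶻ x *ᶻ P) -ᶻ k *ᶻ y *ᶻ P ≡ + 1 +ᶻ (-ᶻ (k *ᶻ y +ᶻ x)) *ᶻ P
                    l₂ = ℤR.solve-∀
            pf : s *ᶻ (-ᶻ (+ y)) ≡ + 1 +ᶻ (-ᶻ (k *ᶻ + y +ᶻ + x)) *ᶻ P
            pf = trans (cong (_*ᶻ (-ᶻ (+ y))) s≡) (lem (+ suc n) k P (+ x) (+ y) e′)
        ... | Bézout.-+ x y e = + y , ((k *ᶻ + y +ᶻ + x) by pf)
          where
            e′ : + 1 +ᶻ + x *ᶻ P ≡ + y *ᶻ + suc n
            e′ = trans (cong (+ 1 +ᶻ_) (sym (ℤ.pos-* x p))) (trans (cong +_ e) (ℤ.pos-* y (suc n)))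
            lem : ∀ n k P x y → (+ 1) +ᶻ x *ᶻ P ≡ y *ᶻ n → (n +ᶻ k *ᶻ P) *ᶻ y ≡ + 1 +ᶻ (k *ᶻ y +ᶻ x) *ᶻ P
            lem n k P x y h = trans (l₁ n k P y) (trans (cong (_+ᶻ k *ᶻ y *ᶻ P) (sym h)) (l₂ k P x y))
              where l₁ : ∀ n k P y → (n +ᶻ k *ᶻ P) *ᶻ y ≡ y *ᶻ n +ᶻ k *ᶻ y *ᶻ P
                    l₁ = ℤR.solve-∀
                    l₂ : ∀ k P x y → (+ 1 +ᶻ x *ᶻ P) +ᶻ k *ᶻ y *ᶻ P ≡ + 1 +ᶻ (k *ᶻ y +ᶻ x) *ᶻ P
                    l₂ = ℤR.solve-∀
            pf : s *ᶻ + y ≡ + 1 +ᶻ (k *ᶻ + y +ᶻ + x) *ᶻ P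
            pf = trans (cong (_*ᶻ (+ y)) s≡) (lem (+ suc n) k P (+ x) (+ y) e′)

    ≈-cancel : ∀ s {x y} → ¬ (s ≈ + 0) → s *ᶻ x ≈ s *ᶻ y → x ≈ y
    ≈-cancel s {x} {y} s≉0 h with inverse s s≉0
    ... | e , se≈1 = ≈-trans (≈-sym (one x)) (≈-trans (≈-* e h) (one y))
      where
        l : ∀ e s x → e *ᶻ (s *ᶻ x) ≡ x *ᶻ (s *ᶻ e)
        l = ℤR.solve-∀
        one : ∀ z → e *ᶻ (s *ᶻ z) ≈ z
        one z = ≈-trans (≡⇒≈ (l e s z)) (≈-trans (≈-* z se≈1) (≡⇒≈ (ℤ.*-identityʳ z)))

    -- Sums over a full period

    opaque
      σ : (ℤ → ℕ) → ℕ
      σ f = ∑ p (λ i → f (+ i))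

    Per : ∀ {A : Set} → (ℤ → A) → Set
    Per f = ∀ x → f (x +ᶻ P) ≡ f x

    per-ℕ : ∀ {A : Set} {f : ℤ → A} → Per f → ∀ n x → f (x +ᶻ + n *ᶻ P) ≡ f x
    per-ℕ {f = f} pf zero x = cong f (trans (cong (x +ᶻ_) (ℤ.*-zeroˡ P)) (ℤ.+-identityʳ x))
    per-ℕ {f = f} pf (suc n) x = trans (cong f (lem x (+ n) P)) (trans (pf _) (per-ℕ pf n x))
      where lem : ∀ x n P → x +ᶻ (+ 1 +ᶻ n) *ᶻ P ≡ (x +ᶻ n *ᶻ P) +ᶻ P
            lem = ℤR.solve-∀

    per-≈ : ∀ {A : Set} {f : ℤ → A} → Per f → ∀ {x y} → x ≈ y → f x ≡ f y
    per-≈ {f = f} pf {y = y} (+ n by refl) = per-ℕ pf n y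
    per-≈ {f = f} pf {x} {y} (-[1+ n ] by e) = sym (trans (cong f (trans (lem y (+ suc n) P) (cong (_+ᶻ + suc n *ᶻ P) (sym e)))) (per-ℕ pf (suc n) x))
      where lem : ∀ y n P → y ≡ (y +ᶻ (-ᶻ n) *ᶻ P) +ᶻ n *ᶻ P
            lem = ℤR.solve-∀

    ≈-per : ∀ {A : Set} {f : ℤ → A} → (∀ {x y} → x ≈ y → f x ≡ f y) → Per f
    ≈-per h x = h (+ 1 by cong (x +ᶻ_) (sym (ℤ.*-identityˡ P)))

    opaque
      unfolding σ

      σ-cong : ∀ {f g : ℤ → ℕ} → (∀ x → f x ≡ g x) → σ f ≡ σ g
      σ-cong h = ∑-cong p (λ i _ → h (+ i))

      σ-mono : ∀ {f g : ℤ → ℕ} → (∀ x → f x ≤ g x) → σ f ≤ σ g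
      σ-mono h = ∑-mono p (λ i _ → h (+ i))

      σ-+ : ∀ (f g : ℤ → ℕ) → σ (λ x → f x + g x) ≡ σ f + σ g
      σ-+ f g = ∑-+ p _ _

      σ-* : ∀ c (f : ℤ → ℕ) → σ (λ x → c * f x) ≡ c * σ f
      σ-* c f = ∑-* p c _

      σ-*ʳ : ∀ c (f : ℤ → ℕ) → σ (λ x → f x * c) ≡ σ f * c
      σ-*ʳ c f = trans (σ-cong (λ x → *-comm (f x) c)) (trans (σ-* c f) (*-comm c _))

      σ-const : ∀ c → σ (λ _ → c) ≡ p * c
      σ-const c = ∑-const p c

      σ-1 : σ (λ _ → 1) ≡ p
      σ-1 = trans (σ-const 1) (*-identityʳ p)

      σ-swap : ∀ (f : ℤ → ℤ → ℕ) → σ (λ x → σ (f x)) ≡ σ (λ y → σ (λ x → f x y))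
      σ-swap f = ∑-swap p p _

      σ-term : ∀ (f : ℤ → ℕ) → Per f → ∀ x → f x ≤ σ f
      σ-term f pf x = subst (_≤ σ f) (sym (per-≈ pf (≈res x))) (∑-term p _ (res x) (res<p x))

      σ-pos : ∀ (f : ℤ → ℕ) → 1 ≤ σ f → ∃ λ x → 1 ≤ f x
      σ-pos f h with ∑-pos p _ h
      ... | i , _ , h′ = + i , h′

      σ-shift : ∀ {f : ℤ → ℕ} → Per f → ∀ t → σ (λ x → f (x +ᶻ t)) ≡ σ f
      σ-shift {f} pf t = int t
        where
          one : ∀ {g : ℤ → ℕ} → Per g → σ (λ x → g (x +ᶻ + 1)) ≡ σ g
          one {g} pg = trans (∑-cong p (λ i _ → cong (λ k → g (+ k)) (+-comm i 1)))
            (+-cancelˡ-≡ (g (+ 0)) _ _ (trans (sym (∑-head p (λ i → g (+ i)))) (trans (cong (λ z → σ g + z) (trans (cong g (sym (ℤ.+-identityˡ P))) (pg (+ 0)))) (+-comm (σ g) _))))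
          swap⁺ : ∀ x y z → (x +ᶻ y) +ᶻ z ≡ (x +ᶻ z) +ᶻ y
          swap⁺ = ℤR.solve-∀
          nat : ∀ {g : ℤ → ℕ} → Per g → ∀ n → σ (λ x → g (x +ᶻ + n)) ≡ σ g
          nat {g} pg zero = σ-cong (λ x → cong g (ℤ.+-identityʳ x))
          nat {g} pg (suc n) = trans (σ-cong (λ x → cong g (sym (ℤ.+-assoc x (+ 1) (+ n)))))
            (trans (one {λ x → g (x +ᶻ + n)} (λ x → trans (cong g (swap⁺ x P (+ n))) (pg _))) (nat pg n))
          int : ∀ t → σ (λ x → f (x +ᶻ t)) ≡ σ f
          int (+ n) = nat pf n
          int -[1+ n ] = trans (sym (nat {λ x → f (x +ᶻ -[1+ n ])} (λ x → trans (cong f (swap⁺ x P _)) (pf _)) (suc n)))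
            (σ-cong (λ x → cong f (lem x (+ suc n))))
            where lem : ∀ x n → (x +ᶻ n) +ᶻ (-ᶻ n) ≡ x
                  lem = ℤR.solve-∀

    δ : ℤ → ℕ
    δ x = ⟦ does (x ≈? + 0) ⟧

    does-≈ : ∀ {x y} → x ≈ y → does (x ≈? y) ≡ true
    does-≈ {x} {y} h with x ≈? y
    ... | yes _ = refl
    ... | no n = ⊥-elim (n h)

    does-≉ : ∀ {x y} → ¬ (x ≈ y) → does (x ≈? y) ≡ false
    does-≉ {x} {y} h with x ≈? y
    ... | yes e = ⊥-elim (h e)
    ... | no _ = refl

    δ-≈ : ∀ {x y} → x ≈ y → δ x ≡ δ y
    δ-≈ {x} {y} h with y ≈? + 0
    ... | yes e = cong ⟦_⟧ (does-≈ (≈-trans h e))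
    ... | no n = cong ⟦_⟧ (does-≉ (λ e → n (≈-trans (≈-sym h) e)))

    opaque
      unfolding σ

      σ-δ : ∀ a → σ (λ x → δ (x -ᶻ a)) ≡ 1
      σ-δ a = trans (σ-shift {δ} (≈-per δ-≈) (-ᶻ a)) (lem p refl)
        where
          lem : ∀ q → q ≡ p → ∑ q (λ i → δ (+ i)) ≡ 1
          lem zero e = ⊥-elim (<-irrefl e 0<p)
          lem (suc q) e = trans (∑-head q (λ i → δ (+ i))) (cong₂ _+_ (cong ⟦_⟧ (does-≈ (≈-refl {+ 0})))
            (∑-0 q (λ i i<q → cong ⟦_⟧ (does-≉ λ h → case (≈⇒≡ (subst (suc i <_) e (s≤s i<q)) 0<p h)))))
            where case : ∀ {i} → suc i ≡ 0 → ⊥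
                  case ()

    x-y≈0⇒x≈y : ∀ {x y} → x -ᶻ y ≈ + 0 → x ≈ y
    x-y≈0⇒x≈y {x} {y} h = ≈-trans (≡⇒≈ (l x y)) (≈-trans (≈-+ h ≈-refl) (≡⇒≈ (ℤ.+-identityˡ y)))
      where l : ∀ x y → x ≡ (x -ᶻ y) +ᶻ y
            l = ℤR.solve-∀

    δ-eval : ∀ {f : ℤ → ℕ} → Per f → ∀ a x → δ (x -ᶻ a) * f x ≡ δ (x -ᶻ a) * f a
    δ-eval {f} pf a x with (x -ᶻ a) ≈? + 0
    ... | yes e = cong (1 *_) (per-≈ pf (x-y≈0⇒x≈y e))
    ... | no _ = refl

    σ-eval : ∀ {f : ℤ → ℕ} → Per f → ∀ a → σ (λ x → δ (x -ᶻ a) * f x) ≡ f a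
    σ-eval {f} pf a = trans (σ-cong (δ-eval pf a)) (trans (σ-*ʳ (f a) (λ x → δ (x -ᶻ a))) (trans (cong (_* f a) (σ-δ a)) (*-identityˡ _)))

    -- After inserting `δ (y - d x)` and exchanging the sums, each y is met exactly once, namely for
    -- x ≡ e y.
    σ-dilate : ∀ {f : ℤ → ℕ} → Per f → ∀ d e → d *ᶻ e ≈ + 1 → σ (λ x → f (d *ᶻ x)) ≡ σ f
    σ-dilate {f} pf d e de≈1 = trans (σ-cong (λ x → sym (σ-eval pf (d *ᶻ x))))
      (trans (σ-swap (λ x y → δ (y -ᶻ d *ᶻ x) * f y)) (σ-cong λ y →
        trans (σ-*ʳ (f y) (λ x → δ (y -ᶻ d *ᶻ x))) (trans (cong (_* f y) (trans (σ-cong (conv y)) (σ-δ (e *ᶻ y)))) (*-identityˡ _))))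
      where
        l₁ : ∀ d e x y → x -ᶻ (e *ᶻ y) ≡ ((-ᶻ e) *ᶻ (y -ᶻ d *ᶻ x)) +ᶻ ((+ 1 -ᶻ d *ᶻ e) *ᶻ x)
        l₁ = ℤR.solve-∀
        l₂ : ∀ d e x y → y -ᶻ d *ᶻ x ≡ ((-ᶻ d) *ᶻ (x -ᶻ e *ᶻ y)) +ᶻ ((+ 1 -ᶻ d *ᶻ e) *ᶻ y)
        l₂ = ℤR.solve-∀
        l₃ : ∀ x → (+ 1 -ᶻ + 1) *ᶻ x ≡ + 0
        l₃ = ℤR.solve-∀
        small : ∀ z → (+ 1 -ᶻ d *ᶻ e) *ᶻ z ≈ + 0
        small z = ≈-trans (≡⇒≈ (ℤ.*-comm _ z)) (≈-trans (≈-* z (≈-- (≈-refl {+ 1}) de≈1)) (≡⇒≈ (ℤ.*-zeroʳ z)))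
        zero≈ : ∀ c {u} → u ≈ + 0 → c *ᶻ u ≈ + 0
        zero≈ c h = ≈-trans (≈-* c h) (≡⇒≈ (ℤ.*-zeroʳ c))
        conv : ∀ y x → δ (y -ᶻ d *ᶻ x) ≡ δ (x -ᶻ e *ᶻ y)
        conv y x with (x -ᶻ e *ᶻ y) ≈? + 0
        ... | yes h = cong ⟦_⟧ (does-≈ (≈-trans (≡⇒≈ (l₂ d e x y)) (≈-+ (zero≈ (-ᶻ d) h) (small y))))
        ... | no n = cong ⟦_⟧ (does-≉ λ h → n (≈-trans (≡⇒≈ (l₁ d e x y)) (≈-+ (zero≈ (-ᶻ e) h) (small x))))

    σ-neg : ∀ {f : ℤ → ℕ} → Per f → σ (λ x → f (-ᶻ x)) ≡ σ f
    σ-neg {f} pf = trans (σ-cong (λ x → cong f (l x))) (σ-dilate pf (-ᶻ (+ 1)) (-ᶻ (+ 1)) ≈-refl)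
      where l : ∀ x → -ᶻ x ≡ (-ᶻ (+ 1)) *ᶻ x
            l = ℤR.solve-∀

  -- Subsets of the cyclic group and Pollard's theorem

  pollard-base : ∀ p a c t T → t * (a + c) ≤ T + t * p → t * (a + t + c) ≤ T + t * t + t * p
  pollard-base p a c t T h = lin 0 h (solve (a ∷ c ∷ t ∷ T ∷ p ∷ []))

  pollard-lt : ∀ p a b t → a + b ≤ p + t → t < b → a < p
  pollard-lt p a b t h₁ h₂ = lin 0 (h₁ ⊞ h₂) (solve (a ∷ b ∷ t ∷ p ∷ []))

  pollard-small : ∀ p s c t T₁ T₂ T {s' c'} → s' ≡ s → c' ≡ c → T₁ + T₂ ≤ T → t * (s' + c') ≤ T₁ + t * t + t * p → t * (s + c) ≤ T + t * t + t * p
  pollard-small p s c t T₁ T₂ T refl refl h₁ h₂ = lin T₂ (h₁ ⊞ h₂) (solve (s ∷ c ∷ t ∷ T₁ ∷ T₂ ∷ T ∷ p ∷ []))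

  pollard-le : ∀ i t' t a' a → i + t' ≡ t → i + a' ≡ a → t ≤ a → t' ≤ a'
  pollard-le i t' _ a' _ refl refl h = +-cancelˡ-≤ i _ _ h

  pollard-sum : ∀ p i t' t a' b' a b → i + t' ≡ t → i + a' ≡ a → i + b' ≡ b → a + b ≤ p + t → a' + b' ≤ p + t'
  pollard-sum p i t' _ a' b' _ _ refl refl refl h = lin i h (solve (i ∷ t' ∷ a' ∷ b' ∷ p ∷ []))

  pollard-n : ∀ i b' b n → i + b' ≡ b → 1 ≤ i → b ≤ suc n → b' ≤ n
  pollard-n i b' _ n refl h₁ h₂ = lin 0 (h₁ ⊞ h₂) (solve (i ∷ b' ∷ n ∷ []))

  pollard-large : ∀ p i t' t a' b' a b u c c' T₁ T₂ T → i + t' ≡ t → i + a' ≡ a → i + b' ≡ b → i + u ≡ a + b → c' ≡ c →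
    T₁ + T₂ ≤ T → i * (u + c') ≤ T₁ + i * p → t' * (a' + b' + c') ≤ T₂ + t' * t' + t' * p →
    t * (a + b + c) ≤ T + t * t + t * p
  pollard-large p i t' _ a' b' _ _ u c _ T₁ T₂ T refl refl refl eu refl h₁ h₂ h₃
    with +-cancelˡ-≡ i u (a' + b' + i) (trans eu (solve (i ∷ a' ∷ b' ∷ [])))
  ... | refl = lin 0 (h₁ ⊞ h₂ ⊞ h₃) (solve (i ∷ t' ∷ a' ∷ b' ∷ c ∷ T₁ ∷ T₂ ∷ T ∷ p ∷ []))

  robust-bad : ∀ p s c T E → T ≤ E * E → E ≤ c → p + E < s → c * s ≤ T + c * p → c ≤ 0
  robust-bad p s c T E h₁ h₂ h₃ h₄ = lin 0 (h₁ ⊞ E ⊠ h₂ ⊞ c ⊠ h₃ ⊞ h₄) (solve (s ∷ c ∷ T ∷ E ∷ p ∷ []))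

  robust-scale : ∀ E s T p → T ≤ E * E → E * s ≤ T + E * E + E * p → E * s ≤ E * (p + 2 * E)
  robust-scale E s T p h₁ h₂ = lin 0 (h₁ ⊞ h₂) (solve (E ∷ s ∷ T ∷ p ∷ []))

  module Sets (p : ℕ) (pr : Prime p) where
    open Zp p pr

    -- Subsets of ℤ/p, as p-periodic subsets of ℤ

    record PSet : Set where
      constructor pset
      infix 5 _∋_
      field
        _∋_ : ℤ → Bool
        per : Per _∋_
    open PSet

    infix 4 _∈_ _∉_ _⊆_
    _∈_ _∉_ : ℤ → PSet → Set
    x ∈ U = (U ∋ x) ≡ true
    x ∉ U = (U ∋ x) ≡ false

    _⊆_ : PSet → PSet → Set
    U ⊆ V = ∀ x → x ∈ U → x ∈ V

    tf : ∀ {b : Bool} → b ≡ true → b ≡ false → ⊥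
    tf a b with trans (sym a) b
    ... | ()

    ∈-≈ : ∀ U {x y} → x ≈ y → (U ∋ x) ≡ (U ∋ y)
    ∈-≈ U = per-≈ (per U)

    ∁ : PSet → PSet
    ∁ U = pset (λ x → not (U ∋ x)) (λ x → cong not (per U x))

    infixl 7 _∩_ _∖_
    infixl 6 _∪_
    _∩_ _∪_ _∖_ : PSet → PSet → PSet
    U ∩ V = pset (λ x → (U ∋ x) ∧ (V ∋ x)) (λ x → cong₂ _∧_ (per U x) (per V x))
    U ∪ V = pset (λ x → (U ∋ x) ∨ (V ∋ x)) (λ x → cong₂ _∨_ (per U x) (per V x))
    U ∖ V = pset (λ x → (U ∋ x) ∧ not (V ∋ x)) (λ x → cong₂ (λ a b → a ∧ not b) (per U x) (per V x))

    infix 8 _⟨_⟩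
    _⟨_⟩ : PSet → ℤ → PSet
    U ⟨ t ⟩ = pset (λ x → U ∋ (x -ᶻ t)) (λ x → trans (cong (U ∋_) (l x t P)) (per U _))
      where l : ∀ x t P → (x +ᶻ P) -ᶻ t ≡ (x -ᶻ t) +ᶻ P
            l = ℤR.solve-∀

    neg : PSet → PSet
    neg U = pset (λ x → U ∋ (-ᶻ x)) (λ x → ∈-≈ U (≈-neg (x+P≈x x)))

    pt : ℤ → PSet
    pt a = pset (λ x → does (x ≈? a)) (≈-per λ {x} {y} h → eq x y h)
      where eq : ∀ x y → x ≈ y → does (x ≈? a) ≡ does (y ≈? a)
            eq x y h with y ≈? a
            ... | yes e = does-≈ (≈-trans h e)
            ... | no n = does-≉ (λ e → n (≈-trans (≈-sym h) e))

    # : PSet → ℕ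
    # U = σ (λ x → ⟦ U ∋ x ⟧)

    per1 : ∀ U → Per (λ x → ⟦ U ∋ x ⟧)
    per1 U x = cong ⟦_⟧ (per U x)

    ∧-l : ∀ {a b} → a ∧ b ≡ true → a ≡ true
    ∧-l {true} _ = refl

    ∧-r : ∀ {a b} → a ∧ b ≡ true → b ≡ true
    ∧-r {true} h = h

    ∧-i : ∀ {a b} → a ≡ true → b ≡ true → a ∧ b ≡ true
    ∧-i refl h = h

    ∨-l : ∀ {a b} → a ≡ true → a ∨ b ≡ true
    ∨-l refl = refl

    ∨-r : ∀ {a b} → b ≡ true → a ∨ b ≡ true
    ∨-r {true} _ = refl
    ∨-r {false} h = h

    ∨-e : ∀ {a b} → a ∨ b ≡ true → a ≡ true ⊎ b ≡ true
    ∨-e {true} _ = inj₁ refl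
    ∨-e {false} h = inj₂ h

    not-t : ∀ {a} → not a ≡ true → a ≡ false
    not-t {false} _ = refl

    not-f : ∀ {a} → a ≡ false → not a ≡ true
    not-f refl = refl

    ⟦⟧-mono : ∀ {a b} → (a ≡ true → b ≡ true) → ⟦ a ⟧ ≤ ⟦ b ⟧
    ⟦⟧-mono {true} {true} h = ≤-refl
    ⟦⟧-mono {false} h = z≤n
    ⟦⟧-mono {true} {false} h with h refl
    ... | ()

    #-mono : ∀ U V → U ⊆ V → # U ≤ # V
    #-mono U V h = σ-mono (λ x → ⟦⟧-mono (h x))

    #≤p : ∀ U → # U ≤ p
    #≤p U = ≤-trans (σ-mono (λ x → ⟦⟧≤1 (U ∋ x))) (≤≡ σ-1)

    #-shift : ∀ U t → # (U ⟨ t ⟩) ≡ # U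
    #-shift U t = σ-shift (per1 U) (-ᶻ t)

    #-neg : ∀ U → # (neg U) ≡ # U
    #-neg U = σ-neg (per1 U)

    #-∁ : ∀ U → # U + # (∁ U) ≡ p
    #-∁ U = trans (sym (σ-+ _ _)) (trans (σ-cong (λ x → ⟦⟧+not (U ∋ x))) σ-1)

    #-∩∪ : ∀ U V → # (U ∩ V) + # (U ∪ V) ≡ # U + # V
    #-∩∪ U V = trans (sym (σ-+ _ _)) (trans (σ-cong (λ x → b (U ∋ x) (V ∋ x))) (σ-+ _ _))
      where b : ∀ u v → ⟦ u ∧ v ⟧ + ⟦ u ∨ v ⟧ ≡ ⟦ u ⟧ + ⟦ v ⟧
            b true true = refl
            b true false = refl
            b false true = refl
            b false false = refl

    #-∩∖ : ∀ U V → # (U ∩ V) + # (U ∖ V) ≡ # U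
    #-∩∖ U V = trans (sym (σ-+ _ _)) (σ-cong (λ x → b (U ∋ x) (V ∋ x)))
      where b : ∀ u v → ⟦ u ∧ v ⟧ + ⟦ u ∧ not v ⟧ ≡ ⟦ u ⟧
            b true true = refl
            b true false = refl
            b false v = refl

    #-pt : ∀ a → # (pt a) ≡ 1
    #-pt a = trans (σ-cong (λ x → cong ⟦_⟧ (eq x))) (σ-δ a)
      where eq : ∀ x → does (x ≈? a) ≡ does ((x -ᶻ a) ≈? + 0)
            eq x with (x -ᶻ a) ≈? + 0
            ... | yes e = does-≈ (x-y≈0⇒x≈y e)
            ... | no n = does-≉ (λ h → n (≈-trans (≈-- h (≈-refl {a})) (≡⇒≈ (ℤ.+-inverseʳ a))))

    ∈⇒# : ∀ U {x} → x ∈ U → 1 ≤ # U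
    ∈⇒# U {x} h = ≤-trans (≥≡ (cong ⟦_⟧ h)) (σ-term _ (per1 U) x)

    #⇒∈ : ∀ U → 1 ≤ # U → ∃ λ x → x ∈ U
    #⇒∈ U h with σ-pos _ h
    ... | x , h′ = x , ⟦⟧-pos h′

    #0⇒∉ : ∀ U → # U ≡ 0 → ∀ x → x ∉ U
    #0⇒∉ U h x with U ∋ x in e
    ... | false = refl
    ... | true with subst (1 ≤_) h (∈⇒# U e)
    ...   | ()

    full⇒p : ∀ U → (∀ x → x ∈ U) → # U ≡ p
    full⇒p U h = trans (σ-cong (λ x → cong ⟦_⟧ (h x))) σ-1

    meet : ∀ U V W → U ⊆ W → V ⊆ W → # W < # U + # V → ∃ λ x → x ∈ U × x ∈ V
    meet U V W hu hv lt with #⇒∈ (U ∩ V) (ar (# (U ∩ V)) (# (U ∪ V)) (# W) (# U + # V) (#-∩∪ U V) sub lt)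
      where
        sub : # (U ∪ V) ≤ # W
        sub = #-mono (U ∪ V) W (λ x h → [ hu x , hv x ]′ (∨-e h))
        ar : ∀ i u w s → i + u ≡ s → u ≤ w → w < s → 1 ≤ i
        ar i u w _ refl h₁ h₂ = lin 0 (h₁ ⊞ h₂) (solve (i ∷ u ∷ w ∷ []))
    ... | x , h = x , ∧-l h , ∧-r {U ∋ x} h

    -- The translation pseudo-norm

    N r : PSet → ℤ → ℕ
    N U t = # (U ∖ U ⟨ t ⟩)
    r U t = # (U ∩ U ⟨ t ⟩)

    r+N : ∀ U t → r U t + N U t ≡ # U
    r+N U t = #-∩∖ U (U ⟨ t ⟩)

    N≤# : ∀ U t → N U t ≤ # U
    N≤# U t = ≤-trans (m≤n+m _ (r U t)) (≤≡ (r+N U t))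

    #∪shift : ∀ U t → # (U ∪ U ⟨ t ⟩) ≡ # U + N U t
    #∪shift U t = ar (r U t) (N U t) (# (U ∪ U ⟨ t ⟩)) (# U) (# (U ⟨ t ⟩)) (r+N U t) (#-∩∪ U (U ⟨ t ⟩)) (#-shift U t)
      where ar : ∀ r n u a a' → r + n ≡ a → r + u ≡ a + a' → a' ≡ a → u ≡ a + n
            ar r n u a _ refl h refl = +-cancelˡ-≡ r _ _ (trans h (solve (r ∷ n ∷ [])))

    N-≈ : ∀ U {s t} → s ≈ t → N U s ≡ N U t
    N-≈ U h = σ-cong (λ x → cong (λ b → ⟦ (U ∋ x) ∧ not b ⟧) (∈-≈ U (≈-- (≈-refl {x}) h)))

    N-0 : ∀ U → N U (+ 0) ≡ 0
    N-0 U = trans (σ-cong (λ x → trans (cong (λ z → ⟦ (U ∋ x) ∧ not (U ∋ z) ⟧) (ℤ.+-identityʳ x)) (b (U ∋ x)))) (trans (σ-const 0) (*-zeroʳ p))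
      where b : ∀ u → ⟦ u ∧ not u ⟧ ≡ 0
            b true = refl
            b false = refl

    r-neg : ∀ U t → r U (-ᶻ t) ≡ r U t
    r-neg U t = trans (sym (σ-shift (per1 (U ∩ U ⟨ -ᶻ t ⟩)) (-ᶻ t)))
      (σ-cong λ x → trans (cong (λ z → ⟦ (U ∋ (x -ᶻ t)) ∧ (U ∋ z) ⟧) (l x t)) (cong ⟦_⟧ (b (U ∋ (x -ᶻ t)) (U ∋ x))))
      where l : ∀ x t → (x +ᶻ (-ᶻ t)) -ᶻ (-ᶻ t) ≡ x
            l = ℤR.solve-∀
            b : ∀ u v → u ∧ v ≡ v ∧ u
            b true true = refl
            b true false = refl
            b false true = refl
            b false false = refl

    N-neg : ∀ U t → N U (-ᶻ t) ≡ N U t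
    N-neg U t = +-cancelˡ-≡ (r U t) _ _ (trans (cong (_+ N U (-ᶻ t)) (sym (r-neg U t))) (trans (r+N U (-ᶻ t)) (sym (r+N U t))))

    -- An element x of U outside U + s + t either has x - s outside U, or has x - s in U but outside
    -- U + t.
    N-+ : ∀ U s t → N U (s +ᶻ t) ≤ N U s + N U t
    N-+ U s t = ≤-trans (σ-mono pw) (≤≡ (trans (σ-+ _ _) (cong (λ z → N U s + z) (σ-shift (per1 (U ∖ U ⟨ t ⟩)) (-ᶻ s)))))
      where l : ∀ x s t → x -ᶻ (s +ᶻ t) ≡ (x -ᶻ s) -ᶻ t
            l = ℤR.solve-∀
            b : ∀ u v w → ⟦ u ∧ not w ⟧ ≤ ⟦ u ∧ not v ⟧ + ⟦ v ∧ not w ⟧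
            b true true w = ≤-refl
            b true false w = ≤-trans (⟦⟧≤1 _) (m≤m+n 1 _)
            b false v w = z≤n
            pw : ∀ x → ⟦ (U ∋ x) ∧ not (U ∋ (x -ᶻ (s +ᶻ t))) ⟧ ≤ ⟦ (U ∋ x) ∧ not (U ∋ (x -ᶻ s)) ⟧ + ⟦ (U ∋ (x -ᶻ s)) ∧ not (U ∋ ((x -ᶻ s) -ᶻ t)) ⟧
            pw x = ≤-trans (≤≡ (cong (λ z → ⟦ (U ∋ x) ∧ not (U ∋ z) ⟧) (l x s t))) (b (U ∋ x) (U ∋ (x -ᶻ s)) (U ∋ ((x -ᶻ s) -ᶻ t)))

    N-∁ : ∀ U t → N (∁ U) t ≡ N U t
    N-∁ U t = +-cancelˡ-≡ (# U) _ _ (trans (trans (sym (σ-+ _ _)) (trans (σ-cong λ x → b (U ∋ x) (U ∋ (x -ᶻ t))) refl)) (#∪shift U t))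
      where b : ∀ u v → ⟦ u ⟧ + ⟦ not u ∧ not (not v) ⟧ ≡ ⟦ u ∨ v ⟧
            b true v = refl
            b false true = refl
            b false false = refl

    -- Modulo a prime s is invertible, so every y is x + n s for some n ≥ 0.
    closed⇒full : ∀ U s {x} → ¬ (s ≈ + 0) → (∀ {y} → y ∈ U → y +ᶻ s ∈ U) → x ∈ U → ∀ y → y ∈ U
    closed⇒full U s {x} s≉0 cl x∈ y with inverse s s≉0
    ... | e , se≈1 = trans (∈-≈ U (≈-sym reach)) (steps n)
      where
        n = res ((y -ᶻ x) *ᶻ e)
        l₀ : ∀ x n s → (x +ᶻ n *ᶻ s) +ᶻ s ≡ x +ᶻ (+ 1 +ᶻ n) *ᶻ s
        l₀ = ℤR.solve-∀
        steps : ∀ n → x +ᶻ + n *ᶻ s ∈ U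
        steps zero = trans (cong (U ∋_) (trans (cong (x +ᶻ_) (ℤ.*-zeroˡ s)) (ℤ.+-identityʳ x))) x∈
        steps (suc n) = trans (cong (U ∋_) (sym (l₀ x (+ n) s))) (cl (steps n))
        l₁ : ∀ x y s e → s *ᶻ ((y -ᶻ x) *ᶻ e) ≡ (y -ᶻ x) *ᶻ (s *ᶻ e)
        l₁ = ℤR.solve-∀
        l₂ : ∀ x y → x +ᶻ (y -ᶻ x) *ᶻ + 1 ≡ y
        l₂ = ℤR.solve-∀
        reach : x +ᶻ + n *ᶻ s ≈ y
        reach = ≈-trans (≈-+ (≈-refl {x}) (≈-trans (≡⇒≈ (ℤ.*-comm (+ n) s)) (≈-trans (≈-* s (≈-sym (≈res _))) (≈-trans (≡⇒≈ (l₁ x y s e)) (≈-* (y -ᶻ x) se≈1))))) (≡⇒≈ (l₂ x y))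

    N-pos : ∀ U t → ¬ (t ≈ + 0) → 1 ≤ # U → # U < p → 1 ≤ N U t
    N-pos U t t≉0 ne lt with N U t in e
    ... | suc _ = s≤s z≤n
    ... | zero with #⇒∈ U ne
    ...   | x , x∈ = ⊥-elim (<-irrefl (full⇒p U (closed⇒full U (-ᶻ t) (λ h → t≉0 (≈-trans (≡⇒≈ (sym (ℤ.neg-involutive t))) (≈-neg h))) cl x∈)) lt)
      where
        cl : ∀ {y} → y ∈ U → y +ᶻ (-ᶻ t) ∈ U
        cl {y} y∈ with U ∋ (y -ᶻ t) in e′
        ... | true = refl
        ... | false = ⊥-elim (tf (∧-i y∈ (not-f e′)) (#0⇒∉ (U ∖ U ⟨ t ⟩) e y))

    -- Zero-sum triples and Pollard's theorem

    T : PSet → PSet → PSet → ℕ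
    T A B C = σ λ x → σ λ y → ⟦ A ∋ x ⟧ * (⟦ B ∋ y ⟧ * ⟦ C ∋ (-ᶻ (x +ᶻ y)) ⟧)

    T-comm : ∀ A B C → T A B C ≡ T B A C
    T-comm A B C = trans (σ-swap _) (σ-cong λ y → σ-cong λ x →
      trans (cong (λ z → ⟦ A ∋ x ⟧ * (⟦ B ∋ y ⟧ * ⟦ C ∋ (-ᶻ z) ⟧)) (ℤ.+-comm x y)) (l ⟦ A ∋ x ⟧ ⟦ B ∋ y ⟧ _))
      where l : ∀ a b c → a * (b * c) ≡ b * (a * c)
            l = solve-∀

    per-* : ∀ {f g : ℤ → ℕ} → Per f → Per g → Per (λ x → f x * g x)
    per-* hf hg x = cong₂ _*_ (hf x) (hg x)

    per-refl : ∀ C x → Per (λ y → ⟦ C ∋ (-ᶻ (x +ᶻ y)) ⟧)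
    per-refl C x = ≈-per (λ h → cong ⟦_⟧ (∈-≈ C (≈-neg (≈-+ (≈-refl {x}) h))))

    σ-reflect : ∀ {g : ℤ → ℕ} → Per g → ∀ x → σ (λ y → g (-ᶻ (x +ᶻ y))) ≡ σ g
    σ-reflect {g} pg x = trans (σ-cong (λ y → cong (λ z → g (-ᶻ z)) (ℤ.+-comm x y)))
      (trans (σ-shift {λ y → g (-ᶻ y)} (≈-per (λ h → per-≈ pg (≈-neg h))) x) (σ-neg pg))

    T-swap : ∀ A B C → T A B C ≡ T A C B
    T-swap A B C = σ-cong λ x → trans (σ-* ⟦ A ∋ x ⟧ _) (trans (cong (⟦ A ∋ x ⟧ *_)
      (trans (sym (σ-reflect (per-* (per1 B) (per-refl C x)) x)) (σ-cong λ y →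
        trans (*-comm ⟦ B ∋ (-ᶻ (x +ᶻ y)) ⟧ _) (cong (λ z → ⟦ C ∋ z ⟧ * ⟦ B ∋ (-ᶻ (x +ᶻ y)) ⟧) (l x y))))) (sym (σ-* ⟦ A ∋ x ⟧ _)))
      where l : ∀ x y → -ᶻ (x +ᶻ (-ᶻ (x +ᶻ y))) ≡ y
            l = ℤR.solve-∀

    T-shift : ∀ A B C e → T A (B ⟨ e ⟩) (C ⟨ -ᶻ e ⟩) ≡ T A B C
    T-shift A B C e = σ-cong λ x → trans (σ-cong λ y → cong (λ z → ⟦ A ∋ x ⟧ * (⟦ B ∋ (y -ᶻ e) ⟧ * ⟦ C ∋ z ⟧)) (l x y e))
      (σ-shift {λ y → ⟦ A ∋ x ⟧ * (⟦ B ∋ y ⟧ * ⟦ C ∋ (-ᶻ (x +ᶻ y)) ⟧)} (per-* {λ _ → ⟦ A ∋ x ⟧} (λ _ → refl) (per-* (per1 B) (per-refl C x))) (-ᶻ e))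
      where l : ∀ x y e → (-ᶻ (x +ᶻ y)) -ᶻ (-ᶻ e) ≡ -ᶻ (x +ᶻ (y +ᶻ (-ᶻ e)))
            l = ℤR.solve-∀

    -- Once y in B is fixed, the third entry is determined by x, and A and -y - C meet in at least
    -- |A| + |C| - p points.
    trivial-bound : ∀ A B C → # B * (# A + # C) ≤ T A B C + # B * p
    trivial-bound A B C = subst₂ _≤_ (σ-*ʳ (# A + # C) (λ y → ⟦ B ∋ y ⟧))
      (trans (σ-+ _ _) (cong₂ _+_ (trans (σ-cong λ y → sym (σ-* ⟦ B ∋ y ⟧ _)) (T-comm B A C)) (σ-*ʳ p (λ y → ⟦ B ∋ y ⟧))))
      (σ-mono λ y → ≤-trans (*-monoʳ-≤ ⟦ B ∋ y ⟧ (inner y)) (≤≡ (*-distribˡ-+ ⟦ B ∋ y ⟧ _ p)))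
      where
        b : ∀ u v → ⟦ u ⟧ + ⟦ v ⟧ ≤ ⟦ u ⟧ * ⟦ v ⟧ + 1
        b true true = ≤-refl
        b true false = ≤-refl
        b false v = ⟦⟧≤1 v
        inner : ∀ y → # A + # C ≤ σ (λ x → ⟦ A ∋ x ⟧ * ⟦ C ∋ (-ᶻ (y +ᶻ x)) ⟧) + p
        inner y = subst₂ _≤_ (trans (σ-+ _ _) (cong (λ z → # A + z) (σ-reflect (per1 C) y)))
          (trans (σ-+ _ _) (cong₂ _+_ refl σ-1))
          (σ-mono λ x → b (A ∋ x) (C ∋ (-ᶻ (y +ᶻ x))))

    -- The Dyson transform, with a remainder. Up to exchanging the two coordinates, U × I consists
    -- of A × I and I × (B minus A); together with the product of the two remainders these are
    -- disjoint pieces of A × B.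
    dyson : ∀ A B C → T (A ∪ B) (A ∩ B) C + T (A ∖ (A ∩ B)) (B ∖ (A ∩ B)) C ≤ T A B C
    dyson A B C = begin
        T U I C + T (A ∖ I) (B ∖ I) C
          ≡⟨ cong (_+ T (A ∖ I) (B ∖ I) C) (trans split (cong (λ z → T A I C + z) (T-comm (B ∖ A) I C))) ⟩
        T A I C + T I (B ∖ A) C + T (A ∖ I) (B ∖ I) C
          ≡⟨ sym (trans (trans (σ-cong λ x → trans (σ-+ _ _) (cong₂ _+_ (σ-+ _ _) refl)) (trans (σ-+ _ _) (cong₂ _+_ (σ-+ _ _) refl))) refl) ⟩
        σ (λ x → σ λ y → (f A I x y + f I (B ∖ A) x y) + f (A ∖ I) (B ∖ I) x y)
          ≤⟨ σ-mono (λ x → σ-mono λ y → b (A ∋ x) (B ∋ x) (A ∋ y) (B ∋ y) ⟦ C ∋ (-ᶻ (x +ᶻ y)) ⟧) ⟩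
        T A B C ∎
      where
        open ≤-Reasoning
        U = A ∪ B
        I = A ∩ B
        f : PSet → PSet → ℤ → ℤ → ℕ
        f A B x y = ⟦ A ∋ x ⟧ * (⟦ B ∋ y ⟧ * ⟦ C ∋ (-ᶻ (x +ᶻ y)) ⟧)
        b∪ : ∀ a b z → ⟦ a ∨ b ⟧ * z ≡ ⟦ a ⟧ * z + ⟦ b ∧ not a ⟧ * z
        b∪ true true z = sym (+-identityʳ _)
        b∪ true false z = sym (+-identityʳ _)
        b∪ false true z = refl
        b∪ false false z = refl
        split : T U I C ≡ T A I C + T (B ∖ A) I C
        split = trans (σ-cong λ x → trans (σ-cong λ y → b∪ (A ∋ x) (B ∋ x) _) (σ-+ _ _)) (σ-+ _ _)
        b : ∀ a b a' b' c → (⟦ a ⟧ * (⟦ a' ∧ b' ⟧ * c) + ⟦ a ∧ b ⟧ * (⟦ b' ∧ not a' ⟧ * c)) + ⟦ a ∧ not (a ∧ b) ⟧ * (⟦ b' ∧ not (a' ∧ b') ⟧ * c) ≤ ⟦ a ⟧ * (⟦ b' ⟧ * c)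
        b true true true true c = ≤≡ (solve (c ∷ []))
        b true true true false c = ≤≡ (solve (c ∷ []))
        b true true false true c = ≤≡ (solve (c ∷ []))
        b true true false false c = ≤≡ (solve (c ∷ []))
        b true false true true c = ≤≡ (solve (c ∷ []))
        b true false true false c = ≤≡ (solve (c ∷ []))
        b true false false true c = ≤≡ (solve (c ∷ []))
        b true false false false c = ≤≡ (solve (c ∷ []))
        b false b a' b' c = z≤n

    -- Take distinct b₁, b₂ in B. As A is nonempty and proper, it is not invariant under b₁ - b₂, so
    -- some a in A has a - b₁ + b₂ outside A. The translate of B by a - b₁ contains both points.
    properTranslate : ∀ A B → 1 ≤ # A → # A < p → 2 ≤ # B → ∃ λ e → 1 ≤ # (A ∩ B ⟨ e ⟩) × # (A ∩ B ⟨ e ⟩) < # B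
    properTranslate A B 1≤a a<p 2≤b with #⇒∈ B (≤-trans (s≤s z≤n) 2≤b)
    ... | b₁ , b₁∈ with #⇒∈ (B ∖ pt b₁) second
      where
        ar : ∀ i n s → i + n ≡ s → i ≤ 1 → 2 ≤ s → 1 ≤ n
        ar i n _ refl h₁ h₂ = lin 0 (h₁ ⊞ h₂) (solve (i ∷ n ∷ []))
        second : 1 ≤ # (B ∖ pt b₁)
        second = ar _ _ _ (#-∩∖ B (pt b₁)) (≤-trans (#-mono (B ∩ pt b₁) (pt b₁) (λ x → ∧-r {B ∋ x})) (≤≡ (#-pt b₁))) 2≤b
    ...   | b₂ , b₂∈ with #⇒∈ (A ∖ A ⟨ b₁ -ᶻ b₂ ⟩) (N-pos A (b₁ -ᶻ b₂) ne 1≤a a<p)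
      where
        ne : ¬ (b₁ -ᶻ b₂ ≈ + 0)
        ne h with trans (sym (does-≈ (≈-sym (x-y≈0⇒x≈y h)))) (not-t (∧-r {B ∋ b₂} b₂∈))
        ... | ()
    ...     | a , a∈ = a -ᶻ b₁ , ∈⇒# (A ∩ B ⟨ a -ᶻ b₁ ⟩) {a} (∧-i (∧-l a∈) (trans (cong (B ∋_) (l₁ a b₁)) b₁∈)) , lt
      where
        l₁ : ∀ a b → a -ᶻ (a -ᶻ b) ≡ b
        l₁ = ℤR.solve-∀
        l₂ : ∀ a b c → (a -ᶻ (b -ᶻ c)) -ᶻ (a -ᶻ b) ≡ c
        l₂ = ℤR.solve-∀
        B′ = B ⟨ a -ᶻ b₁ ⟩
        out : 1 ≤ # (B′ ∖ A)
        out = ∈⇒# (B′ ∖ A) {a -ᶻ (b₁ -ᶻ b₂)} (∧-i (trans (cong (B ∋_) (l₂ a b₁ b₂)) (∧-l b₂∈)) (∧-r {A ∋ a} a∈))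
        ar : ∀ i i' n s b → i' + n ≡ s → i ≤ i' → 1 ≤ n → s ≡ b → i < b
        ar i i' n _ _ refl h₁ h₂ refl = lin 0 (h₁ ⊞ h₂) (solve (i ∷ i' ∷ n ∷ []))
        lt : # (A ∩ B′) < # B
        lt = ar _ _ _ _ _ (#-∩∖ B′ A) (#-mono (A ∩ B′) (B′ ∩ A) (λ x h → ∧-i (∧-r {A ∋ x} h) (∧-l h))) out (#-shift B (a -ᶻ b₁))

    -- The classical form bounds the sum of min(t, r(x)) below by t(|A| + |B| - t), with r counting
    -- representations. Restricting to x in -C costs at most t(p - |C|), which yields this
    -- inequality. The index n bounds |B| for the induction.
    Pollard : ℕ → Set
    Pollard n = ∀ A B C t → # B ≤ n → t ≤ # A → t ≤ # B → # A + # B ≤ p + t →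
                t * (# A + # B + # C) ≤ T A B C + t * t + t * p

    -- If the intersection I still has t elements, the pair (U, I) carries the induction. Otherwise
    -- `trivial-bound` for (U, I) settles |I| of the t layers, and the induction applies to the two
    -- remainders with t - |I|.
    pollard-step : ∀ n → Pollard n → ∀ A B C t → # B ≤ suc n → t ≤ # A → t ≤ # B → # A + # B ≤ p + t →
              ∀ e → 1 ≤ # (A ∩ B ⟨ e ⟩) → # (A ∩ B ⟨ e ⟩) < # B → t * (# A + # B + # C) ≤ T A B C + t * t + t * p
    pollard-step n ih₀ A B C t b≤n t≤a t≤b ab≤ e 1≤i i<b = go (t ≤? # I)
      where
        B′ = B ⟨ e ⟩
        C′ = C ⟨ -ᶻ e ⟩
        I = A ∩ B′
        U = A ∪ B′
        A₁ = A ∖ I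
        B₁ = B′ ∖ I
        b′ : # B′ ≡ # B
        b′ = #-shift B e
        c′ : # C′ ≡ # C
        c′ = #-shift C (-ᶻ e)
        i≤n : # I ≤ n
        i≤n = ≤-pred (≤-trans i<b b≤n)
        ui : # I + # U ≡ # A + # B
        ui = trans (#-∩∪ A B′) (cong (λ z → # A + z) b′)
        idem : # (A ∩ I) ≡ # I
        idem = σ-cong λ x → cong ⟦_⟧ (bb (A ∋ x) (B′ ∋ x))
          where bb : ∀ a b → a ∧ (a ∧ b) ≡ a ∧ b
                bb true b = refl
                bb false b = refl
        idem′ : # (B′ ∩ I) ≡ # I
        idem′ = σ-cong λ x → cong ⟦_⟧ (bb (A ∋ x) (B′ ∋ x))
          where bb : ∀ a b → b ∧ (a ∧ b) ≡ a ∧ b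
                bb true true = refl
                bb false true = refl
                bb true false = refl
                bb false false = refl
        a₁ : # I + # A₁ ≡ # A
        a₁ = trans (cong (_+ # A₁) (sym idem)) (#-∩∖ A I)
        b₁ : # I + # B₁ ≡ # B
        b₁ = trans (cong (_+ # B₁) (sym idem′)) (trans (#-∩∖ B′ I) b′)
        big : T U I C′ + T A₁ B₁ C′ ≤ T A B C
        big = ≤-trans (dyson A B′ C′) (≤≡ (T-shift A B C e))
        go : Dec (t ≤ # I) → t * (# A + # B + # C) ≤ T A B C + t * t + t * p
        go (yes t≤i) = pollard-small p (# A + # B) (# C) t _ _ (T A B C) ui′ c′ big
            (ih₀ U I C′ t i≤n (≤-trans t≤a (#-mono A U (λ x → ∨-l))) t≤i (≤-trans (≤≡ ui′) ab≤))
          where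
            ui′ : # U + # I ≡ # A + # B
            ui′ = trans (+-comm (# U) (# I)) ui
        go (no t≰i) with m≤n⇒∃[o]m+o≡n (<⇒≤ (≰⇒> t≰i))
        ... | t' , it = pollard-large p (# I) t' t (# A₁) (# B₁) (# A) (# B) (# U) (# C) (# C′) _ _ _ it a₁ b₁ ui c′ big (trivial-bound U I C′) ih
          where
            ih : t' * (# A₁ + # B₁ + # C′) ≤ T A₁ B₁ C′ + t' * t' + t' * p
            ih = ih₀ A₁ B₁ C′ t' (pollard-n (# I) (# B₁) (# B) n b₁ 1≤i b≤n)
                   (pollard-le (# I) t' t (# A₁) (# A) it a₁ t≤a) (pollard-le (# I) t' t (# B₁) (# B) it b₁ t≤b) (pollard-sum p (# I) t' t (# A₁) (# B₁) (# A) (# B) it a₁ b₁ ab≤)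

    -- For t < |B| the hypotheses give |A| < p and |B| ≥ 2, so a proper translate exists; for t =
    -- |B| `trivial-bound` is already enough.
    pollard : ∀ n → Pollard n
    pollard n A B C zero _ _ _ _ = z≤n
    pollard zero A B C (suc t) b≤n _ t≤b _ = ⊥-elim (<⇒≱ (s≤s z≤n) (≤-trans t≤b b≤n))
    pollard (suc n) A B C t@(suc _) b≤n t≤a t≤b ab≤ = cases (m≤n⇒m<n∨m≡n t≤b)
      where
        Goal = t * (# A + # B + # C) ≤ T A B C + t * t + t * p
        translated : (∃ λ e → 1 ≤ # (A ∩ B ⟨ e ⟩) × # (A ∩ B ⟨ e ⟩) < # B) → Goal
        translated (e , 1≤i , i<b) = pollard-step n (pollard n) A B C t b≤n t≤a t≤b ab≤ e 1≤i i<b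
        cases : t < # B ⊎ t ≡ # B → Goal
        cases (inj₁ t<b) = translated (properTranslate A B (≤-trans (s≤s z≤n) t≤a)
          (pollard-lt p (# A) (# B) t ab≤ t<b) (≤-trans (s≤s (s≤s z≤n)) t<b))
        cases (inj₂ t≡b) = subst (λ b → t * (# A + b + # C) ≤ T A B C + t * t + t * p) t≡b
          (pollard-base p (# A) (# C) t (T A B C) (subst (λ b → b * (# A + # C) ≤ T A B C + b * p) (sym t≡b) (trivial-bound A B C)))

    -- Pollard's theorem with t = E, divided by E.
    robustCD : ∀ A B C E → 1 ≤ E → E ≤ # A → E ≤ # B → E ≤ # C → T A B C ≤ E * E → # A + # B + # C ≤ p + 2 * E
    robustCD A B C zero () _ _ _ _
    robustCD A B C E@(suc _) _ E≤a E≤b E≤c T≤ =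
      *-cancelˡ-≤ E (robust-scale E (# A + # B + # C) (T A B C) p T≤ (pollard (# B) A B C E ≤-refl E≤a E≤b ab≤))
      where
        ab≤ : # A + # B ≤ p + E
        ab≤ with # A + # B ≤? p + E
        ... | yes h = h
        -- Otherwise `trivial-bound` would give T ≥ |C|(|A| + |B| - p) > |C| E ≥ E².
        ... | no h = ⊥-elim (<⇒≱ (≤-trans (s≤s z≤n) E≤c) (robust-bad p (# A + # B) (# C) (T A B C) E T≤ E≤c (≰⇒> h)
                       (subst (λ z → # C * (# A + # B) ≤ z + # C * p) (sym (T-swap A B C)) (trivial-bound A C B))))

  -- Near-extremal triples and the reduction to one small set

  ≤ᵇ-true : ∀ {a b} → a ≤ b → (a ≤ᵇ b) ≡ true
  ≤ᵇ-true {a} {b} h with a ≤ᵇ b in e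
  ... | true = refl
  ... | false = ⊥-elim (subst Data.Bool.T e (≤⇒≤ᵇ h))

  ≤ᵇ-true⁻¹ : ∀ {a b} → (a ≤ᵇ b) ≡ true → a ≤ b
  ≤ᵇ-true⁻¹ {a} {b} h = ≤ᵇ⇒≤ a b (subst Data.Bool.T (sym h) tt)

  ≤ᵇ-false⁻¹ : ∀ {a b} → (a ≤ᵇ b) ≡ false → b < a
  ≤ᵇ-false⁻¹ {a} {b} h with a ≤? b
  ... | no n = ≰⇒> n
  ... | yes le with trans (sym h) (≤ᵇ-true le)
  ...   | ()

  2*-cancel : ∀ {a b} → 2 * a ≤ 2 * b → a ≤ b
  2*-cancel {a} {b} = *-cancelˡ-≤ {a} {b} 2

  transfer-ar : ∀ p a b c r n n' E u → p ≤ a + b + c + E → r + n ≡ a → u ≡ b + n' → r + u + c ≤ p + 2 * (2 * E) → n' ≤ n + 5 * E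
  transfer-ar p _ b c r n n' E _ h₁ refl refl h₂ = lin 0 (h₁ ⊞ h₂) (solve (p ∷ b ∷ c ∷ r ∷ n ∷ n' ∷ E ∷ []))

  double-ar : ∀ t E → t ≤ E * E → t + t ≤ 2 * E * (2 * E)
  double-ar t E h = lin (2 * (E * E)) (h ⊞ h) (solve (t ∷ E ∷ []))

  -- Multiply the energy inequality out and absorb |S| ≤ 3y, 4T ≤ xy and 6l ≤ x.
  energy-ar : ∀ q l x y T S → q * (2 * l * (x * y)) ≤ q * (x * y) + x * (y * y) + q * (l * l * S + 2 * l * T) →
    S ≤ 3 * y → 4 * T ≤ x * y → 6 * l ≤ x → 2 * (x * y * (q * l)) ≤ 2 * (x * y * (q + y))
  energy-ar q l x y T S h₁ h₂ h₃ h₄ =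
    lin 0 (2 ⊠ h₁ ⊞ (2 * (q * l * l)) ⊠ h₂ ⊞ (q * l) ⊠ h₃ ⊞ (q * l * y) ⊠ h₄) (solve (q ∷ l ∷ x ∷ y ∷ T ∷ S ∷ []))

  energy-end : ∀ k l x y → 50 * k * l ≤ 50 * k + y → y ≤ k * x → x ≤ 6 * l + 6 → 2 ≤ l → k ≤ 0
  energy-end k l x y h₁ h₂ h₃ h₄ = *-cancelˡ-≤ 32 (lin 0 (h₁ ⊞ h₂ ⊞ k ⊠ h₃ ⊞ (44 * k) ⊠ h₄) (solve (k ∷ l ∷ x ∷ y ∷ [])))

  subgroup-ar : ∀ q p x n → n + x * x ≡ p * x → q * n ≤ p * x → 2 * x ≤ p → q * p * x ≤ 2 * p * x
  subgroup-ar q p x n e h₁ h₂ = lin 0 (2 ⊠ h₁ ⊞ (q * x) ⊠ h₂ ⊞ (2 * q) ⊠ ≥≡ e) (solve (q ∷ p ∷ x ∷ n ∷ []))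

  third-ar : ∀ p x y z E → x + y + z ≤ p + 2 * E → x ≤ y → y ≤ z → 2 * E ≤ x → 2 * x ≤ p
  third-ar p x y z E h₁ h₂ h₃ h₄ = lin 0 (h₁ ⊞ 2 ⊠ h₂ ⊞ h₃ ⊞ h₄) (solve (p ∷ x ∷ y ∷ z ∷ E ∷ []))

  step-size : ∀ p x y z r n m u E → p ≤ x + y + z + E → r + n ≡ x → u ≡ z + m → n ≤ m + 5 * E → p ≤ r + y + u + 6 * E
  step-size p _ y z r n m _ E h₁ refl refl h₂ = lin 0 (h₁ ⊞ h₂) (solve (p ∷ y ∷ z ∷ r ∷ n ∷ m ∷ E ∷ []))

  step-T : ∀ t E → t ≤ E * E → t + t ≤ 6 * E * (6 * E)
  step-T t E h = lin (34 * (E * E)) (h ⊞ h) (solve (t ∷ E ∷ []))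

  step-far : ∀ x z r m n E → r + m ≡ z → r ≤ 2 * E → n ≤ x → x ≤ z → n ≤ m + 5 * E
  step-far x _ r m n E refl h₁ h₂ h₃ = lin (3 * E) (h₁ ⊞ h₂ ⊞ h₃) (solve (x ∷ r ∷ m ∷ n ∷ E ∷ []))

  step-fuel : ∀ k q x x' n y i → x' + n ≡ x → x ≤ q * n → y ≤ k * x → k * q * x ≤ y + i * y → k * q * x' ≤ i * y
  step-fuel k q _ x' n y i refl h₁ h₂ h₃ = lin 0 (k ⊠ h₁ ⊞ h₂ ⊞ h₃) (solve (k ∷ q ∷ x' ∷ n ∷ y ∷ i ∷ []))

  step-err : ∀ k q C E x x' y → C * (6 * E) * (k * q) ≤ y → y < k * x → x ≤ q * x' → (k * q) * (C * (6 * E)) < (k * q) * x'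
  step-err k q C E x x' y h₁ h₂ h₃ = lin 0 (h₁ ⊞ h₂ ⊞ k ⊠ h₃) (solve (k ∷ q ∷ C ∷ E ∷ x ∷ x' ∷ y ∷ []))

  module Tri (p : ℕ) (pr : Prime p) where
    open Zp p pr
    open Sets p pr
    open PSet

    -- When all three sets have at least E elements, `robustCD` bounds the total size by p + 2E, so
    -- `size` puts the triple within O(E) of the extremum. One E measures both conditions.
    record Triple (A B C : PSet) (E : ℕ) : Set where
      field
        E≥1 : 1 ≤ E
        T≤ : T A B C ≤ E * E
        size : p ≤ # A + # B + # C + E
    open Triple

    triple-comm : ∀ {A B C E} → Triple A B C E → Triple B A C E
    triple-comm {A} {B} {C} {E} t = record { E≥1 = E≥1 t ; T≤ = subst (_≤ _) (T-comm A B C) (T≤ t)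
                             ; size = subst (λ s → p ≤ s + # C + E) (+-comm (# A) (# B)) (size t) }

    triple-swap : ∀ {A B C E} → Triple A B C E → Triple A C B E
    triple-swap {A} {B} {C} {E} t = record { E≥1 = E≥1 t ; T≤ = subst (_≤ _) (T-swap A B C) (T≤ t)
                             ; size = subst (λ s → p ≤ s + E) (l (# A) (# B) (# C)) (size t) }
      where l : ∀ a b c → a + b + c ≡ a + c + b
            l = solve-∀

    σ-0 : ∀ {f : ℤ → ℕ} → (∀ x → f x ≡ 0) → σ f ≡ 0
    σ-0 h = trans (σ-cong h) (trans (σ-const 0) (*-zeroʳ p))

    #-∁neg : ∀ W → # W + # (∁ (neg W)) ≡ p
    #-∁neg W = trans (cong (_+ # (∁ (neg W))) (sym (#-neg W))) (#-∁ (neg W))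

    sumset⇒T≡0 : ∀ A B W → (∀ x y → x ∈ A → y ∈ B → x +ᶻ y ∈ W) → T A B (∁ (neg W)) ≡ 0
    sumset⇒T≡0 A B W h = σ-0 λ x → σ-0 (pw x)
      where
        pw : ∀ x y → ⟦ A ∋ x ⟧ * (⟦ B ∋ y ⟧ * ⟦ ∁ (neg W) ∋ (-ᶻ (x +ᶻ y)) ⟧) ≡ 0
        pw x y with A ∋ x in ea | B ∋ y in eb
        ... | false | _ = refl
        ... | true | false = refl
        ... | true | true = cong (λ b → 1 * (1 * ⟦ not b ⟧)) (trans (cong (W ∋_) (ℤ.neg-involutive (x +ᶻ y))) (h x y ea eb))

    -- The case E = 1 of `robustCD`, with no zero-sum triples at all; this route loses one against
    -- the classical constant, which is harmless here.
    cauchyDavenport : ∀ A B W → 1 ≤ # A → 1 ≤ # B → # W < p → (∀ x y → x ∈ A → y ∈ B → x +ᶻ y ∈ W) → # A + # B ≤ # W + 2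
    cauchyDavenport A B W 1≤a 1≤b w<p h = ar (# A) (# B) (# W) (# C) p c (robustCD A B C 1 ≤-refl 1≤a 1≤b 1≤c (≤-trans (≤≡ (sumset⇒T≡0 A B W h)) z≤n))
      where
        C = ∁ (neg W)
        c = #-∁neg W
        1≤c : 1 ≤ # C
        1≤c = +-cancelˡ-≤ (# W) _ _ (≤-trans (≤≡ (+-comm (# W) 1)) (≤-trans w<p (≥≡ c)))
        ar : ∀ a b w c p → w + c ≡ p → a + b + c ≤ p + 2 * 1 → a + b ≤ w + 2
        ar a b w c _ refl h = +-cancelʳ-≤ c _ _ (≤-trans h (≤≡ (l w c)))
          where l : ∀ w c → w + c + 2 * 1 ≡ w + 2 + c
                l = solve-∀

    -- Either (x, y) or (x - t, y + t) is a pair of A × B, and both have the same sum; so the count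
    -- at most doubles.
    T-∩∪ : ∀ A B C t → T (A ∩ A ⟨ t ⟩) (B ∪ B ⟨ -ᶻ t ⟩) C ≤ T A B C + T A B C
    T-∩∪ A B C t = ≤-trans (σ-mono λ x → σ-mono (pw x))
      (≤≡ (trans (σ-cong λ x → σ-+ _ _) (trans (σ-+ _ _) (cong₂ _+_ refl moved))))
      where
        f : ℤ → ℤ → ℕ
        f x y = ⟦ A ∋ x ⟧ * (⟦ B ∋ y ⟧ * ⟦ C ∋ (-ᶻ (x +ᶻ y)) ⟧)
        moved : σ (λ x → σ (λ y → f (x -ᶻ t) (y -ᶻ (-ᶻ t)))) ≡ T A B C
        moved = trans (σ-cong λ x → σ-shift {f (x -ᶻ t)} (per-* {λ _ → ⟦ A ∋ (x -ᶻ t) ⟧} (λ _ → refl) (per-* (per1 B) (per-refl C (x -ᶻ t)))) (-ᶻ (-ᶻ t)))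
          (σ-shift {λ x → σ (f x)} (λ x → σ-cong λ y → cong₂ _*_ (per1 A x) (cong (⟦ B ∋ y ⟧ *_) (cong ⟦_⟧ (∈-≈ C (≈-neg (≈-+ (x+P≈x x) (≈-refl {y}))))))) (-ᶻ t))
        l : ∀ x y t → -ᶻ (x +ᶻ y) ≡ -ᶻ ((x -ᶻ t) +ᶻ (y -ᶻ (-ᶻ t)))
        l = ℤR.solve-∀
        b : ∀ a a' b b' c → ⟦ a ∧ a' ⟧ * (⟦ b ∨ b' ⟧ * c) ≤ ⟦ a ⟧ * (⟦ b ⟧ * c) + ⟦ a' ⟧ * (⟦ b' ⟧ * c)
        b false a' b b' c = z≤n
        b true false b b' c = z≤n
        b true true true b' c = m≤m+n _ _
        b true true false b' c = ≤-refl
        pw : ∀ x y → ⟦ (A ∩ A ⟨ t ⟩) ∋ x ⟧ * (⟦ (B ∪ B ⟨ -ᶻ t ⟩) ∋ y ⟧ * ⟦ C ∋ (-ᶻ (x +ᶻ y)) ⟧) ≤ f x y + f (x -ᶻ t) (y -ᶻ (-ᶻ t))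
        pw x y = ≤-trans (b (A ∋ x) (A ∋ (x -ᶻ t)) (B ∋ y) (B ∋ (y -ᶻ (-ᶻ t))) ⟦ C ∋ (-ᶻ (x +ᶻ y)) ⟧)
          (≤≡ (cong (λ z → f x y + ⟦ A ∋ (x -ᶻ t) ⟧ * (⟦ B ∋ (y -ᶻ (-ᶻ t)) ⟧ * ⟦ C ∋ z ⟧)) (l x y t)))

    #∪shift⁻ : ∀ U t → # (U ∪ U ⟨ -ᶻ t ⟩) ≡ # U + N U t
    #∪shift⁻ U t = trans (#∪shift U (-ᶻ t)) (cong (λ z → # U + z) (N-neg U t))

    -- Apply robustCD to A ∩ (A + t) and B ∪ (B - t), which keep the same sums.
    transfer : ∀ {A B C E} → Triple A B C E → ∀ t → 2 * E ≤ r A t → 2 * E ≤ # B → 2 * E ≤ # C → N B t ≤ N A t + 5 * E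
    transfer {A} {B} {C} {E} tr t hr hb hc = transfer-ar p (# A) (# B) (# C) (r A t) (N A t) (N B t) E _ (size tr) (r+N A t) (#∪shift⁻ B t)
      (robustCD (A ∩ A ⟨ t ⟩) (B ∪ B ⟨ -ᶻ t ⟩) C (2 * E) (≤-trans (E≥1 tr) (m≤m+n E _)) hr
        (≤-trans hb (#-mono B (B ∪ B ⟨ -ᶻ t ⟩) (λ x → ∨-l))) hc (≤-trans (T-∩∪ A B C t) (double-ar _ E (T≤ tr))))

    -- Additive energy

    module Energy (X Y Z : PSet) where

      f : ℤ → ℤ → ℕ
      f z x = ⟦ X ∋ x ⟧ * ⟦ Y ∋ (z -ᶻ x) ⟧

      c : ℤ → ℕ
      c z = σ (f z)

      per-r : ∀ U → Per (r U)
      per-r U = ≈-per (λ h → σ-cong λ x → cong (λ b → ⟦ (U ∋ x) ∧ b ⟧) (∈-≈ U (≈-- (≈-refl {x}) h)))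

      σ-c : σ c ≡ # X * # Y
      σ-c = trans (σ-swap f) (trans (σ-cong λ x → trans (σ-* ⟦ X ∋ x ⟧ _) (cong (⟦ X ∋ x ⟧ *_) (σ-shift (per1 Y) (-ᶻ x)))) (σ-*ʳ (# Y) (λ x → ⟦ X ∋ x ⟧)))

      σ-Zc : σ (λ z → ⟦ Z ∋ (-ᶻ z) ⟧ * c z) ≡ T X Y Z
      σ-Zc = trans (σ-cong λ z → trans (sym (σ-* ⟦ Z ∋ (-ᶻ z) ⟧ (f z))) (σ-cong λ x → l ⟦ Z ∋ (-ᶻ z) ⟧ ⟦ X ∋ x ⟧ ⟦ Y ∋ (z -ᶻ x) ⟧))
        (trans (σ-swap (λ z x → ⟦ X ∋ x ⟧ * (⟦ Y ∋ (z -ᶻ x) ⟧ * ⟦ Z ∋ (-ᶻ z) ⟧))) (σ-cong λ x →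
          trans (σ-cong λ z → cong (λ w → ⟦ X ∋ x ⟧ * (⟦ Y ∋ (z -ᶻ x) ⟧ * ⟦ Z ∋ (-ᶻ w) ⟧)) (l′ x z))
            (σ-shift {λ y → ⟦ X ∋ x ⟧ * (⟦ Y ∋ y ⟧ * ⟦ Z ∋ (-ᶻ (x +ᶻ y)) ⟧)} (per-* {λ _ → ⟦ X ∋ x ⟧} (λ _ → refl) (per-* (per1 Y) (per-refl Z x))) (-ᶻ x))))
        where l : ∀ a b c → a * (b * c) ≡ b * (c * a)
              l = solve-∀
              l′ : ∀ x z → z ≡ x +ᶻ (z +ᶻ (-ᶻ x))
              l′ = ℤR.solve-∀

      σ-r : ∀ U → σ (r U) ≡ # U * # U
      σ-r U = trans (σ-swap (λ t x → ⟦ (U ∋ x) ∧ (U ∋ (x -ᶻ t)) ⟧)) (trans (σ-cong λ x →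
          trans (σ-cong λ t → ⟦∧⟧ (U ∋ x) _) (trans (σ-* ⟦ U ∋ x ⟧ _) (cong (⟦ U ∋ x ⟧ *_)
            (trans (σ-cong λ t → cong (λ w → ⟦ U ∋ w ⟧) (l x t)) (σ-reflect (per1 U) (-ᶻ x)))))) (σ-*ʳ (# U) (λ x → ⟦ U ∋ x ⟧)))
        where l : ∀ x t → x -ᶻ t ≡ -ᶻ ((-ᶻ x) +ᶻ t)
              l = ℤR.solve-∀

      corr : ∀ U x x' → σ (λ z → ⟦ U ∋ (z -ᶻ x) ⟧ * ⟦ U ∋ (z -ᶻ x') ⟧) ≡ r U (x' -ᶻ x)
      corr U x x' = trans (σ-cong λ z → trans (cong (λ w → ⟦ U ∋ (z -ᶻ x) ⟧ * ⟦ U ∋ w ⟧) (l x x' z)) (sym (⟦∧⟧ (U ∋ (z -ᶻ x)) _)))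
          (σ-shift (per1 (U ∩ U ⟨ x' -ᶻ x ⟩)) (-ᶻ x))
        where l : ∀ x x' z → z -ᶻ x' ≡ (z -ᶻ x) -ᶻ (x' -ᶻ x)
              l = ℤR.solve-∀

      -- Both sides count the quadruples with x + y = x' + y', on the right grouped by the common
      -- difference.
      σ-c² : σ (λ z → c z * c z) ≡ σ (λ t → r X t * r Y t)
      σ-c² = begin
        σ (λ z → c z * c z)
          ≡⟨ σ-cong (λ z → trans (sym (σ-*ʳ (c z) (f z))) (σ-cong λ x → sym (σ-* (f z x) (f z)))) ⟩
        σ (λ z → σ λ x → σ λ x' → f z x * f z x')
          ≡⟨ σ-swap _ ⟩
        σ (λ x → σ λ z → σ λ x' → f z x * f z x')
          ≡⟨ σ-cong (λ x → σ-swap _) ⟩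
        σ (λ x → σ λ x' → σ λ z → f z x * f z x')
          ≡⟨ σ-cong (λ x → σ-cong λ x' → trans (σ-cong λ z → l ⟦ X ∋ x ⟧ ⟦ Y ∋ (z -ᶻ x) ⟧ ⟦ X ∋ x' ⟧ ⟦ Y ∋ (z -ᶻ x') ⟧) (trans (σ-* (⟦ X ∋ x ⟧ * ⟦ X ∋ x' ⟧) _) (cong (⟦ X ∋ x ⟧ * ⟦ X ∋ x' ⟧ *_) (corr Y x x')))) ⟩
        σ (λ x → σ λ x' → ⟦ X ∋ x ⟧ * ⟦ X ∋ x' ⟧ * r Y (x' -ᶻ x))
          ≡⟨ σ-cong (λ x → trans (sym (σ-shift (per-* (per-* {λ _ → ⟦ X ∋ x ⟧} (λ _ → refl) (per1 X)) (perr x)) x)) (σ-cong λ t → cong₂ _*_ (trans (cong (λ w → ⟦ X ∋ x ⟧ * ⟦ X ∋ w ⟧) (l₂ x t)) (sym (⟦∧⟧ (X ∋ x) _))) (cong (r Y) (l₁ x t)))) ⟩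
        σ (λ x → σ λ t → ⟦ (X ∋ x) ∧ (X ∋ (x -ᶻ (-ᶻ t))) ⟧ * r Y t)
          ≡⟨ σ-swap _ ⟩
        σ (λ t → σ λ x → ⟦ (X ∋ x) ∧ (X ∋ (x -ᶻ (-ᶻ t))) ⟧ * r Y t)
          ≡⟨ σ-cong (λ t → trans (σ-*ʳ (r Y t) _) (cong (_* r Y t) (r-neg X t))) ⟩
        σ (λ t → r X t * r Y t) ∎
        where
          open ≡-Reasoning
          perr : ∀ x → Per (λ x' → r Y (x' -ᶻ x))
          perr x = ≈-per λ h → per-≈ (per-r Y) (≈-- h (≈-refl {x}))
          l : ∀ a b c d → a * b * (c * d) ≡ a * c * (b * d)
          l = solve-∀
          l₁ : ∀ x t → (t +ᶻ x) -ᶻ x ≡ t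
          l₁ = ℤR.solve-∀
          l₂ : ∀ x t → t +ᶻ x ≡ x -ᶻ (-ᶻ t)
          l₂ = ℤR.solve-∀

      -- Two estimates of the additive energy of X and Y. From below, `sq` is Cauchy-Schwarz in
      -- linear form with free multiplier l: sums outside -Z pay l², and the pairs with sum in -Z
      -- are the zero-sum triples. From above, the term t = 0 is trivial and all others have r X t ≤
      -- |X|/q.
      energyBound : ∀ q l → (∀ t → ¬ (t ≈ + 0) → q * r X t ≤ # X) →
        q * (2 * l * (# X * # Y)) ≤ q * (# X * # Y) + # X * (# Y * # Y) + q * (l * l * # (∁ Z) + 2 * l * T X Y Z)
      energyBound q l small = ≤-trans (*-monoʳ-≤ q lower) (≤-trans (≤≡ (*-distribˡ-+ q _ _)) (+-monoˡ-≤ _ upper))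
        where
          sq : ∀ b a → 2 * l * a ≤ a * a + (l * l * ⟦ not b ⟧ + 2 * l * (⟦ b ⟧ * a))
          sq true a = ≤-trans (≤≡ (cong (2 * l *_) (sym (+-identityʳ a)))) (≤-trans (m≤n+m _ (l * l * 0)) (m≤n+m _ (a * a)))
          sq false a = ≤-trans (go (≤-total l a)) (+-monoʳ-≤ (a * a) (m≤m+n _ _))
            where
              ord : ∀ l k → 2 * l * (l + k) ≤ (l + k) * (l + k) + l * l * 1
              ord l k = lin (k * k) (z≤n {0}) (solve (l ∷ k ∷ []))
              ord′ : ∀ a k → 2 * (a + k) * a ≤ a * a + (a + k) * (a + k) * 1
              ord′ a k = lin (k * k) (z≤n {0}) (solve (a ∷ k ∷ []))
              go : l ≤ a ⊎ a ≤ l → 2 * l * a ≤ a * a + l * l * 1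
              go (inj₁ h) with m≤n⇒∃[o]m+o≡n h
              ... | k , refl = ord l k
              go (inj₂ h) with m≤n⇒∃[o]m+o≡n h
              ... | k , refl = ord′ a k
          lower : 2 * l * (# X * # Y) ≤ σ (λ t → r X t * r Y t) + (l * l * # (∁ Z) + 2 * l * T X Y Z)
          lower = subst₂ _≤_ (trans (σ-* (2 * l) c) (cong (2 * l *_) σ-c))
            (trans (σ-+ _ _) (cong₂ _+_ σ-c² (trans (σ-+ _ _) (cong₂ _+_ (trans (σ-* (l * l) _) (cong (l * l *_) (σ-neg (per1 (∁ Z))))) (trans (σ-* (2 * l) _) (cong (2 * l *_) σ-Zc))))))
            (σ-mono λ z → sq (Z ∋ (-ᶻ z)) (c z))
          r≤ : ∀ U t → r U t ≤ # U
          r≤ U t = ≤-trans (m≤m+n _ _) (≤≡ (r+N U t))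
          pw : ∀ t → q * (r X t * r Y t) ≤ q * (δ t * (# X * # Y)) + # X * r Y t
          pw t with t ≈? + 0
          ... | yes _ = ≤-trans (*-monoʳ-≤ q (≤-trans (*-mono-≤ (r≤ X t) (r≤ Y t)) (≥≡ (+-identityʳ _)))) (m≤m+n _ _)
          ... | no n = ≤-trans (≤≡ (sym (*-assoc q (r X t) (r Y t)))) (≤-trans (*-monoˡ-≤ (r Y t) (small t n)) (m≤n+m _ (q * 0)))
          upper : q * σ (λ t → r X t * r Y t) ≤ q * (# X * # Y) + # X * (# Y * # Y)
          upper = subst₂ _≤_ (σ-* q _)
            (trans (σ-+ _ _) (cong₂ _+_ (trans (σ-* q _) (cong (q *_) (trans (σ-*ʳ (# X * # Y) δ) (trans (cong (_* (# X * # Y)) δ1) (*-identityˡ _))))) (trans (σ-* (# X) _) (cong (# X *_) (σ-r Y)))))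
            (σ-mono pw)
            where δ1 : σ δ ≡ 1
                  δ1 = trans (σ-cong λ x → cong δ (sym (ℤ.+-identityʳ x))) (σ-δ (+ 0))

    σ-N : ∀ U → σ (N U) + # U * # U ≡ p * # U
    σ-N U = trans (+-comm _ (# U * # U)) (trans (cong (_+ σ (N U)) (sym (Energy.σ-r U U U U))) (trans (sym (σ-+ (r U) (N U))) (trans (σ-cong (r+N U)) (σ-const (# U)))))

    level : (f : ℤ → ℕ) → Per f → (ℕ → Bool) → PSet
    level f pf b = pset (λ t → b (f t)) (λ t → cong b (pf t))

    per-N : ∀ U → Per (N U)
    per-N U = ≈-per (N-≈ U)

    -- A nonzero period of the small-norm translations would make every translation small-norm.
    smallNorm⇒⊥ : ∀ X q s → 3 ≤ q → 1 ≤ # X → 2 * # X ≤ p → ¬ (s ≈ + 0) → q * N X s < # X →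
      (∀ t → q * r X t < # X ⊎ q * N X t < # X) → ⊥
    smallNorm⇒⊥ X q s q≥3 1≤x 2x≤p s≉0 ns alt = <⇒≱ q≥3 (*-cancelʳ-≤ q 2 (p * # X) {{pos}}
        (subst₂ _≤_ (*-assoc q p (# X)) (*-assoc 2 p (# X)) (subgroup-ar q p (# X) (σ (N X)) (σ-N X) tot 2x≤p)))
      where
        instance
          pos : NonZero (p * # X)
          pos = >-nonZero (*-mono-≤ 0<p 1≤x)
        H = level (N X) (per-N X) (λ n → suc (q * n) ≤ᵇ # X)
        cl : ∀ {t} → t ∈ H → t +ᶻ s ∈ H
        cl {t} h with alt (t +ᶻ s)
        ... | inj₂ ok = ≤ᵇ-true ok
        ... | inj₁ bad = ⊥-elim (<⇒≱ (strict (# X) q (r X (t +ᶻ s)) (N X (t +ᶻ s)) _ _ bad (≤ᵇ-true⁻¹ h) ns (≤-trans (*-monoʳ-≤ q (N-+ X t s)) (≤≡ (*-distribˡ-+ q _ _))))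
                             (≤-trans (*-monoˡ-≤ (# X) q≥3) (≤≡ (cong (q *_) (sym (r+N X (t +ᶻ s)))))))
          where
            strict : ∀ x q r n a b → q * r < x → a < x → b < x → q * n ≤ a + b → q * (r + n) < 3 * x
            strict x q r n a b h₁ h₂ h₃ h₄ = lin 2 (h₁ ⊞ h₂ ⊞ h₃ ⊞ h₄) (solve (x ∷ q ∷ r ∷ n ∷ a ∷ b ∷ []))
        0∈H : + 0 ∈ H
        0∈H = ≤ᵇ-true {suc (q * N X (+ 0))} (≤-trans (≤≡ (cong suc (trans (cong (q *_) (N-0 X)) (*-zeroʳ q)))) 1≤x)
        tot : q * σ (N X) ≤ p * # X
        tot = subst₂ _≤_ (σ-* q (N X)) (σ-const (# X)) (σ-mono λ t → <⇒≤ (≤ᵇ-true⁻¹ (closed⇒full H s {+ 0} s≉0 cl 0∈H t)))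

    -- Supplies a t for which X ∩ (X + t) loses a definite proportion of X and keeps one. If there
    -- were none, every t would have small r or small norm. A nonzero t of small norm contradicts
    -- `smallNorm⇒⊥`. If no such t exists, X and Y have little additive energy, although most pairs
    -- have their sum in -∁ Z, a set of size at most 3|Y|.
    window : ∀ k X Y Z E → Triple X Y Z E → 1 ≤ k → # X ≤ # Y → # Y ≤ # Z → 12 * E ≤ # X → # Y < k * # X →
      ∃ λ t → # X ≤ 50 * k * r X t × # X ≤ 50 * k * N X t
    window k X Y Z E tr k≥1 x≤y y≤z big y<kx = cases (# W ≟ 0)
      where
        q = 50 * k
        x≥12 : 12 ≤ # X
        x≥12 = ≤-trans (*-monoʳ-≤ 12 (E≥1 tr)) big
        2E≤x : 2 * E ≤ # X
        2E≤x = ≤-trans (*-monoˡ-≤ E (s≤s (s≤s (z≤n {10})))) big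
        E≤x : E ≤ # X
        E≤x = ≤-trans (m≤m+n E _) 2E≤x
        x≥1 : 1 ≤ # X
        x≥1 = ≤-trans (s≤s z≤n) x≥12
        q≥3 : 3 ≤ q
        q≥3 = ≤-trans (s≤s (s≤s (s≤s (z≤n {47})))) (*-monoʳ-≤ 50 k≥1)
        2x≤p : 2 * # X ≤ p
        2x≤p = third-ar p (# X) (# Y) (# Z) E (robustCD X Y Z E (E≥1 tr) E≤x (≤-trans E≤x x≤y) (≤-trans E≤x (≤-trans x≤y y≤z)) (T≤ tr)) x≤y y≤z 2E≤x
        per-r : ∀ U → Per (r U)
        per-r = Energy.per-r X Y Z
        W = level (r X) (per-r X) (λ n → # X ≤ᵇ q * n) ∩ level (N X) (per-N X) (λ n → # X ≤ᵇ q * n)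
        S = level (N X) (per-N X) (λ n → suc (q * n) ≤ᵇ # X) ∖ pt (+ 0)
        4T : 4 * T X Y Z ≤ # X * # Y
        4T = ≤-trans (*-monoʳ-≤ 4 (T≤ tr)) (≤-trans (≤≡ (l E)) (*-mono-≤ 2E≤x (≤-trans 2E≤x x≤y)))
          where l : ∀ E → 4 * (E * E) ≡ 2 * E * (2 * E)
                l = solve-∀
        S3 : # (∁ Z) ≤ 3 * # Y
        S3 = ar (# X) (# Y) (# Z) (# (∁ Z)) E p (size tr) (#-∁ Z) x≤y E≤x
          where ar : ∀ x y z s E p → p ≤ x + y + z + E → z + s ≡ p → x ≤ y → E ≤ x → s ≤ 3 * y
                ar x y z s E _ h₁ refl h₂ h₃ = lin 0 (h₁ ⊞ 2 ⊠ h₂ ⊞ h₃) (solve (x ∷ y ∷ z ∷ s ∷ E ∷ []))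
        -- The multiplier l of `energyBound`. With 6l ≤ |X|, |∁ Z| ≤ 3|Y| and 4T ≤ |X||Y|, each of
        -- the two error terms is at most a quarter of the left side.
        lam = # X / 6
        xdiv : # X ≡ # X % 6 + lam * 6
        xdiv = m≡m%n+[m/n]*n (# X) 6
        6l≤x : 6 * lam ≤ # X
        6l≤x = ≤-trans (≤≡ (*-comm 6 lam)) (≤-trans (m≤n+m _ (# X % 6)) (≥≡ xdiv))
        x≤6l : # X ≤ 6 * lam + 6
        x≤6l = ≤-trans (≤≡ xdiv) (≤-trans (≤≡ (trans (+-comm _ (lam * 6)) (cong (_+ # X % 6) (*-comm lam 6)))) (+-monoʳ-≤ (6 * lam) (<⇒≤ (m%n<n (# X) 6))))
        l≥2 : 2 ≤ lam
        l≥2 with 2 ≤? lam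
        ... | yes h = h
        ... | no h = ⊥-elim (<⇒≱ (ar (# X) lam (# X % 6) xdiv (m%n<n (# X) 6) (≤-pred (≰⇒> h))) x≥12)
          where ar : ∀ x l m → x ≡ m + l * 6 → m < 6 → l ≤ 1 → x < 12
                ar _ l m refl h₁ h₂ = lin 0 (h₁ ⊞ 6 ⊠ h₂) (solve (l ∷ m ∷ []))
        noW : # W ≡ 0 → ∀ t → q * r X t < # X ⊎ q * N X t < # X
        noW w0 t with # X ≤ᵇ q * r X t in e | # X ≤ᵇ q * N X t in e′ | #0⇒∉ W w0 t
        ... | false | _ | _ = inj₁ (≤ᵇ-false⁻¹ e)
        ... | true | false | _ = inj₂ (≤ᵇ-false⁻¹ e′)
        absurdE : # W ≡ 0 → # S ≡ 0 → ⊥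
        absurdE w0 s0 = <⇒≱ k≥1 (energy-end k lam (# X) (# Y)
            (*-cancelˡ-≤ (# X * # Y) {{>-nonZero (*-mono-≤ x≥1 (≤-trans x≥1 x≤y))}} (2*-cancel (energy-ar q lam (# X) (# Y) (T X Y Z) (# (∁ Z)) (Energy.energyBound X Y Z q lam small) S3 4T 6l≤x)))
            (<⇒≤ y<kx) x≤6l l≥2)
          where
            small : ∀ t → ¬ (t ≈ + 0) → q * r X t ≤ # X
            small t t≉0 with noW w0 t
            ... | inj₁ h = <⇒≤ h
            ... | inj₂ h = ⊥-elim (tf (∧-i (≤ᵇ-true h) (not-f (does-≉ t≉0))) (#0⇒∉ S s0 t))
        absurdS : # W ≡ 0 → (∃ λ s → s ∈ S) → ⊥
        absurdS w0 (s , s∈) = smallNorm⇒⊥ X q s q≥3 x≥1 2x≤p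
          (λ h → tf (does-≈ h) (not-t (∧-r {suc (q * N X s) ≤ᵇ # X} s∈))) (≤ᵇ-true⁻¹ (∧-l s∈)) (noW w0)
        casesS : # W ≡ 0 → Dec (# S ≡ 0) → ⊥
        casesS w0 (yes s0) = absurdE w0 s0
        casesS w0 (no s≢0) = absurdS w0 (#⇒∈ S (n≢0⇒n>0 s≢0))
        found : (∃ λ t → t ∈ W) → ∃ λ t → # X ≤ 50 * k * r X t × # X ≤ 50 * k * N X t
        found (t , t∈) = t , ≤ᵇ-true⁻¹ (∧-l t∈) , ≤ᵇ-true⁻¹ (∧-r {# X ≤ᵇ q * r X t} t∈)
        cases : Dec (# W ≡ 0) → ∃ λ t → # X ≤ 50 * k * r X t × # X ≤ 50 * k * N X t
        cases (yes w0) = ⊥-elim (casesS w0 (# S ≟ 0))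
        cases (no w≢0) = found (#⇒∈ W (n≢0⇒n>0 w≢0))

    -- X loses `N X t` and Z gains `N Z t`, so the total survives once N X t ≤ N Z t + 5E. This is
    -- `transfer` from Z to X, unless Z and Z + t hardly meet; then N Z t is almost |Z| ≥ |X|.
    stepTriple : ∀ X Y Z E t → Triple X Y Z E → # X ≤ # Y → # Y ≤ # Z → 2 * E ≤ # X → Triple (X ∩ X ⟨ t ⟩) Y (Z ∪ Z ⟨ -ᶻ t ⟩) (6 * E)
    stepTriple X Y Z E t tr x≤y y≤z 2E≤x = record
      { E≥1 = ≤-trans (E≥1 tr) (m≤m+n E _)
      ; T≤ = ≤-trans (≤≡ (T-swap (X ∩ X ⟨ t ⟩) Y (Z ∪ Z ⟨ -ᶻ t ⟩))) (≤-trans (T-∩∪ X Z Y t) (step-T _ E (T≤ (triple-swap tr))))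
      ; size = step-size p (# X) (# Y) (# Z) (r X t) (N X t) (N Z t) _ E (size tr) (r+N X t) (#∪shift⁻ Z t) (n≤ (2 * E ≤? r Z t)) }
      where
        n≤ : Dec (2 * E ≤ r Z t) → N X t ≤ N Z t + 5 * E
        n≤ (yes h) = transfer (triple-comm (triple-swap tr)) t h 2E≤x (≤-trans 2E≤x x≤y)
        n≤ (no h) = step-far (# X) (# Z) (r Z t) (N Z t) (N X t) E (r+N Z t) (<⇒≤ (≰⇒> h)) (N≤# X t) (≤-trans x≤y y≤z)

    record Reduced (k C E : ℕ) (X Y : PSet) : Set where
      field
        X′ Z′ : PSet
        E′ : ℕ
        triple : Triple X′ Y Z′ E′
        x≪y : k * # X′ ≤ # Y
        y≤z : # Y ≤ # Z′
        err : C * E′ ≤ # X′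
        x′≤x : # X′ ≤ # X
        E≤E′ : E ≤ E′

    -- While |Y| < k|X|, a step removes at least |X|/(50k) > |Y|/(50k²) elements of X, which uses up
    -- one |Y| of fuel. As many elements are kept, and the factor 6 to the power i in the last
    -- hypothesis prepays the growth of E.
    reduce : ∀ i k C X Y Z E → 1 ≤ k → 12 ≤ C → Triple X Y Z E → # X ≤ # Y → # Y ≤ # Z → C * E ≤ # X →
      k * (50 * k) * # X ≤ i * # Y → C * (6 ^ i * E) * (k * (50 * k)) ≤ # Y → Reduced k C E X Y
    reduce i k C X Y Z E k≥1 C≥12 tr x≤y y≤z CE≤x fuel small = cases (k * # X ≤? # Y)
      where
        12E≤x : 12 * E ≤ # X
        12E≤x = ≤-trans (*-monoˡ-≤ E C≥12) CE≤x
        x≥1 : 1 ≤ # X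
        x≥1 = ≤-trans (E≥1 tr) (≤-trans (m≤m+n E _) 12E≤x)
        next : ∀ i → k * (50 * k) * # X ≤ i * # Y → C * (6 ^ i * E) * (k * (50 * k)) ≤ # Y → # Y < k * # X →
               (∃ λ t → # X ≤ 50 * k * r X t × # X ≤ 50 * k * N X t) → Reduced k C E X Y
        next zero fuel _ y<kx _ = ⊥-elim (<⇒≱ (*-mono-≤ (*-mono-≤ k≥1 (*-mono-≤ (s≤s (z≤n {49})) k≥1)) x≥1) fuel)
        next (suc i) fuel small y<kx (t , hr , hn) = record { Reduced rec hiding (x′≤x; E≤E′) ; x′≤x = ≤-trans (Reduced.x′≤x rec) x′≤ ; E≤E′ = ≤-trans (m≤m+n E _) (Reduced.E≤E′ rec) }
          where
            X₁ = X ∩ X ⟨ t ⟩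
            Z₁ = Z ∪ Z ⟨ -ᶻ t ⟩
            x′≤ : # X₁ ≤ # X
            x′≤ = ≤-trans (m≤m+n _ _) (≤≡ (r+N X t))
            pow : C * (6 ^ i * (6 * E)) * (k * (50 * k)) ≤ # Y
            pow = ≤-trans (≤≡ (cong (λ z → C * z * (k * (50 * k))) (l (6 ^ i) E))) small
              where l : ∀ a E → a * (6 * E) ≡ 6 * a * E
                    l = solve-∀
            low : C * (6 * E) * (k * (50 * k)) ≤ # Y
            low = ≤-trans (*-monoˡ-≤ (k * (50 * k)) (*-monoʳ-≤ C (≤-trans (≥≡ (*-identityˡ (6 * E))) (*-monoˡ-≤ (6 * E) (m^n>0 6 i))))) pow
            err₁ : C * (6 * E) ≤ # X₁
            err₁ = <⇒≤ (*-cancelˡ-< (k * (50 * k)) _ _ (step-err k (50 * k) C E (# X) (# X₁) (# Y) low y<kx hr))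
            rec : Reduced k C (6 * E) X₁ Y
            rec = reduce i k C X₁ Y Z₁ (6 * E) k≥1 C≥12 (stepTriple X Y Z E t tr x≤y y≤z (≤-trans (*-monoˡ-≤ E (s≤s (s≤s (z≤n {10})))) 12E≤x))
                    (≤-trans x′≤ x≤y) (≤-trans y≤z (#-mono Z Z₁ (λ x → ∨-l))) err₁
                    (step-fuel k (50 * k) (# X) (# X₁) (N X t) (# Y) i (r+N X t) hn (<⇒≤ y<kx) fuel) pow
        cases : Dec (k * # X ≤ # Y) → Reduced k C E X Y
        cases (yes h) = record { X′ = X ; Z′ = Z ; E′ = E ; triple = tr ; x≪y = h ; y≤z = y≤z ; err = CE≤x ; x′≤x = ≤-refl ; E≤E′ = ≤-refl }
        cases (no h) = next i fuel small (≰⇒> h) (window k X Y Z E tr k≥1 x≤y y≤z 12E≤x (≰⇒> h))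

  -- Chains of interval-like sets and the multiples of a boundary point

  far-ar : ∀ ρ w u v i n → u ≤ 200 * ρ + w → 202 * ρ ≤ v + w → i + n ≡ v → i ≤ u → 2 * w < 2 * ρ → 1 ≤ n
  far-ar ρ w u _ i n h₁ h₂ refl h₃ h₄ = lin 0 (h₁ ⊞ h₂ ⊞ h₃ ⊞ h₄) (solve (ρ ∷ w ∷ u ∷ i ∷ n ∷ []))

  NF-ar : ∀ ρ w r n v50 v52 → r + n ≡ v52 → r + (v50 + v50) ≤ v52 + v52 → 100 * ρ ≤ v50 + w → v52 ≤ 104 * ρ + w → 96 * ρ ≤ n + 3 * w
  NF-ar ρ w r n v50 _ refl h₁ h₂ h₃ = lin 0 (h₁ ⊞ 2 ⊠ h₂ ⊞ h₃) (solve (ρ ∷ w ∷ r ∷ n ∷ v50 ∷ []))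

  Z0-ar : ∀ ρ w v52 v101 v153 → v153 ≤ 306 * ρ + w → 104 * ρ ≤ v52 + w → 202 * ρ ≤ v101 + w → v153 ≤ v101 + v52 + 1 * (5 * w)
  Z0-ar ρ w v52 v101 v153 h₁ h₂ h₃ = lin (2 * w) (h₁ ⊞ h₂ ⊞ h₃) (solve (ρ ∷ w ∷ v52 ∷ v101 ∷ v153 ∷ []))

  Zs-ar : ∀ ρ w j g g' z z' q q' v52 v101 v153 → 1 ≤ w → v153 ≤ 306 * ρ + w → 104 * ρ ≤ v52 + w → 202 * ρ ≤ v101 + w →
    q + g' ≡ g + v101 → q' + z' ≡ z + v153 → q + v52 ≤ q' + 2 → z ≤ g + v52 + suc j * (5 * w) → z' ≤ g' + v52 + suc (suc j) * (5 * w)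
  Zs-ar ρ w j g g' z z' q q' v52 v101 v153 h₀ h₁ h₂ h₃ e₁ e₂ h₄ h₅ =
    lin 0 (2 ⊠ h₀ ⊞ h₁ ⊞ h₂ ⊞ h₃ ⊞ ≥≡ e₁ ⊞ ≤≡ e₂ ⊞ h₄ ⊞ h₅) (solve (ρ ∷ w ∷ j ∷ g ∷ g' ∷ z ∷ z' ∷ q ∷ q' ∷ v52 ∷ v101 ∷ v153 ∷ []))

  NG-near : ∀ ρ w w₁ ω j n n' → j ≤ 200 → 80 * w ≤ w₁ → 80 * w₁ ≤ ω → 96 * ρ ≤ n' + 3 * w → n' ≤ n + 5 * (suc j * (5 * w)) → 96 * ρ ≤ n + ω
  NG-near ρ w w₁ ω j n n' h₁ h₂ h₃ h₄ h₅ = lin (1372 * w) ((25 * w) ⊠ h₁ ⊞ 80 ⊠ h₂ ⊞ h₃ ⊞ h₄ ⊞ h₅) (solve (ρ ∷ w ∷ w₁ ∷ ω ∷ j ∷ n ∷ n' ∷ []))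

  NG-far : ∀ ρ w w₁ ω j n r g → j ≤ 200 → 80 * w ≤ w₁ → 80 * w₁ ≤ ω → 202 * ρ ≤ g + w → r + n ≡ g → r ≤ 2 * (suc j * (5 * w)) → 96 * ρ ≤ n + ω
  NG-far ρ w w₁ ω j n r _ h₁ h₂ h₃ h₄ refl h₅ = lin (106 * ρ + 4389 * w) ((10 * w) ⊠ h₁ ⊞ 80 ⊠ h₂ ⊞ h₃ ⊞ h₄ ⊞ h₅) (solve (ρ ∷ w ∷ w₁ ∷ ω ∷ j ∷ n ∷ r ∷ []))

  E-small : ∀ ρ w w₁ ω j → j ≤ 200 → 80 * w ≤ w₁ → 80 * w₁ ≤ ω → 300 * ω ≤ ρ → 2 * (suc j * (5 * w)) ≤ ρ
  E-small ρ w w₁ ω j h₁ h₂ h₃ h₄ = lin (299 * ω + 4390 * w) ((10 * w) ⊠ h₁ ⊞ 80 ⊠ h₂ ⊞ h₃ ⊞ h₄) (solve (ρ ∷ w ∷ w₁ ∷ ω ∷ j ∷ []))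

  G-step : ∀ ρ w ω j g g' n → 96 * ρ ≤ n + ω → g + n ≤ g' → 202 * ρ + 96 * j * ρ ≤ g + w + j * ω →
    202 * ρ + 96 * suc j * ρ ≤ g' + w + suc j * ω
  G-step ρ w ω j g g' n h₁ h₂ h₃ = lin 0 (h₁ ⊞ h₂ ⊞ h₃) (solve (ρ ∷ w ∷ ω ∷ j ∷ g ∷ g' ∷ n ∷ []))

  G-end : ∀ ρ w w₁ ω j g → j ≤ 200 → 80 * w ≤ w₁ → 80 * w₁ ≤ ω → 300 * ω ≤ ρ → 202 * ρ + 96 * j * ρ ≤ g + w + j * ω → 201 * ρ + 96 * j * ρ ≤ g
  G-end ρ w w₁ ω j g h₁ h₂ h₃ h₄ h₅ = lin (99 * ω + 6399 * w) (ω ⊠ h₁ ⊞ 80 ⊠ h₂ ⊞ h₃ ⊞ h₄ ⊞ h₅) (solve (ρ ∷ w ∷ w₁ ∷ ω ∷ j ∷ g ∷ []))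

  cover-ar : ∀ ρ w g v16 v404 → 201 * ρ + 96 * 6 * ρ ≤ g → 32 * ρ ≤ v16 + w → v404 ≤ 808 * ρ + w → 2 * w < ρ → v404 < g + v16
  cover-ar ρ w g v16 v404 h₁ h₂ h₃ h₄ = lin 0 (h₁ ⊞ h₂ ⊞ h₃ ⊞ h₄) (solve (ρ ∷ w ∷ g ∷ v16 ∷ v404 ∷ []))

  sep-ar : ∀ ρ w k g v → 201 * ρ + 96 * (20 * k) * ρ ≤ g → g ≤ v → v ≤ 2 * (2441 + 101 * k) * ρ + w → w ≤ ρ → 3 ≤ k → ρ ≤ 0
  sep-ar ρ w k g v h₁ h₂ h₃ h₄ h₅ = lin (471 * ρ) (h₁ ⊞ h₂ ⊞ h₃ ⊞ h₄ ⊞ (1718 * ρ) ⊠ h₅) (solve (ρ ∷ w ∷ k ∷ g ∷ v ∷ []))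

  2w<ρ-ar : ∀ ρ w w₁ ω → 1 ≤ w → 80 * w ≤ w₁ → 80 * w₁ ≤ ω → 300 * ω ≤ ρ → 2 * w < ρ
  2w<ρ-ar ρ w w₁ ω h₁ h₂ h₃ h₄ = lin (299 * ω + 6397 * w) (h₁ ⊞ 80 ⊠ h₂ ⊞ h₃ ⊞ h₄) (solve (ρ ∷ w ∷ w₁ ∷ ω ∷ []))

  ρ≤F-ar : ∀ ρ w f → 104 * ρ ≤ f + w → w ≤ ρ → ρ ≤ f
  ρ≤F-ar ρ w f h₁ h₂ = lin (102 * ρ) (h₁ ⊞ h₂) (solve (ρ ∷ w ∷ f ∷ []))

  lit : ∀ a b {_ : Data.Bool.T (a ≤ᵇ b)} → a ≤ b
  lit a b {h} = ≤ᵇ⇒≤ a b h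

  module Chains (p : ℕ) (pr : Prime p) where
    open Zp p pr
    open Sets p pr
    open PSet
    open Tri p pr

    -- Nested symmetric sets behaving, up to a tiny error w, like the intervals [-kρ, kρ].
    record Chain (K ρ w : ℕ) : Set where
      field
        D : ℕ → PSet
        D-0 : ∀ k → + 0 ∈ D k
        D-+ : ∀ j k x y → x ∈ D j → y ∈ D k → x +ᶻ y ∈ D (j + k)
        D-neg : ∀ k x → x ∈ D k → -ᶻ x ∈ D k
        lower : ∀ k → 1 ≤ k → k ≤ K → 2 * k * ρ ≤ # (D k) + w
        upper : ∀ k → k ≤ K → # (D k) ≤ 2 * k * ρ + w
        room : ∀ k → k ≤ K → # (D k) + ρ ≤ p
        w≥1 : 1 ≤ w
        w₁ ω : ℕ
        w≪w₁ : 80 * w ≤ w₁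
        w₁≪ω : 80 * w₁ ≤ ω
        ω≪ρ : 300 * ω ≤ ρ

    module Geometry {K ρ w : ℕ} (ch : Chain K ρ w) (K≥ : 20400 ≤ K) where
      open Chain ch

      -- The highest level below is 153 + 200 * 101 = 20353, reached in `NG`; this is the origin of
      -- 20400.
      ≤K : ∀ k {_ : Data.Bool.T (k ≤ᵇ 20400)} → k ≤ K
      ≤K k {h} = ≤-trans (≤ᵇ⇒≤ k 20400 h) K≥

      2w<ρ : 2 * w < ρ
      2w<ρ = 2w<ρ-ar ρ w w₁ ω w≥1 w≪w₁ w₁≪ω ω≪ρ

      w≤ρ : w ≤ ρ
      w≤ρ = ≤-trans (m≤m+n w _) (<⇒≤ 2w<ρ)

      ρ≥1 : 1 ≤ ρ
      ρ≥1 = ≤-trans w≥1 w≤ρ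

      D<p : ∀ k → k ≤ K → # (D k) < p
      D<p k h = ≤-trans (≤-trans (≤≡ (+-comm 1 (# (D k)))) (+-monoʳ-≤ _ ρ≥1)) (room k h)

      D-≡ : ∀ k {x y} → x ≡ y → x ∈ D k → y ∈ D k
      D-≡ k refl h = h

      D-≈ : ∀ k {x y} → x ≈ y → x ∈ D k → y ∈ D k
      D-≈ k h x∈ = trans (sym (∈-≈ (D k) h)) x∈

      D-mono : ∀ {j k} x → j ≤ k → x ∈ D j → x ∈ D k
      D-mono {j} x j≤k x∈ with m≤n⇒∃[o]m+o≡n j≤k
      ... | i , refl = D-≡ (j + i) (ℤ.+-identityʳ x) (D-+ j i x (+ 0) x∈ (D-0 i))

      D-- : ∀ j k x y → x ∈ D j → y ∈ D k → x -ᶻ y ∈ D (j + k)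
      D-- j k x y x∈ y∈ = D-+ j k x (-ᶻ y) x∈ (D-neg k y y∈)

      D-* : ∀ i m x → x ∈ D m → + i *ᶻ x ∈ D (i * m)
      D-* zero m x x∈ = D-≡ 0 (sym (ℤ.*-zeroˡ x)) (D-0 0)
      D-* (suc i) m x x∈ = D-≡ (m + i * m) (l x (+ i)) (D-+ m (i * m) x _ x∈ (D-* i m x x∈))
        where l : ∀ x i → x +ᶻ i *ᶻ x ≡ (+ 1 +ᶻ i) *ᶻ x
              l = ℤR.solve-∀

      -- Measuring i x from the middle multiple c x halves the level needed for 0 ≤ i ≤ 2c. The
      -- offsets 3x₀ and 10x₀ used later are such middles.
      centre : ∀ c i m x → x ∈ D m → i ≤ c + c → (+ i *ᶻ x) -ᶻ (+ c *ᶻ x) ∈ D (c * m)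
      centre c i m x x∈ i≤ with ≤-total c i
      ... | inj₁ c≤i with m≤n⇒∃[o]m+o≡n c≤i
      ...   | k , refl = D-mono _ (*-monoˡ-≤ m (+-cancelˡ-≤ c k c i≤)) (D-≡ (k * m) (l x (+ c) (+ k)) (D-* k m x x∈))
        where l : ∀ x c k → k *ᶻ x ≡ ((c +ᶻ k) *ᶻ x) -ᶻ (c *ᶻ x)
              l = ℤR.solve-∀
      centre c i m x x∈ i≤ | inj₂ i≤c with m≤n⇒∃[o]m+o≡n i≤c
      ...   | k , refl = D-mono _ (*-monoˡ-≤ m (m≤n+m k i)) (D-≡ (k * m) (l x (+ i) (+ k)) (D-neg (k * m) _ (D-* k m x x∈)))
        where l : ∀ x i k → -ᶻ (k *ᶻ x) ≡ (i *ᶻ x) -ᶻ ((i +ᶻ k) *ᶻ x)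
              l = ℤR.solve-∀

      opaque
        farPoint : ∃ λ x → x ∈ D 101 × x ∉ D 100
        farPoint = found (#⇒∈ (D 101 ∖ D 100) (far-ar ρ w (# (D 100)) (# (D 101)) _ _ (upper 100 (≤K 100)) (lower 101 (s≤s z≤n) (≤K 101))
            (#-∩∖ (D 101) (D 100)) (#-mono (D 101 ∩ D 100) (D 100) (λ x → ∧-r {D 101 ∋ x})) (≤-trans (s≤s (*-monoʳ-≤ 2 (≤-refl {w}))) (≤-trans 2w<ρ (m≤m+n ρ _)))))
          where found : (∃ λ x → x ∈ D 101 ∖ D 100) → ∃ λ x → x ∈ D 101 × x ∉ D 100
                found (x , h) = x , ∧-l h , not-t (∧-r {D 101 ∋ x} h)

      x₀ : ℤ
      x₀ = proj₁ farPoint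

      x₀∈ : x₀ ∈ D 101
      x₀∈ = proj₁ (proj₂ farPoint)

      x₀∉ : x₀ ∉ D 100
      x₀∉ = proj₂ (proj₂ farPoint)

      F : PSet
      F = D 52

      -- Since x₀ is not in D 100, D 50 and its translate by x₀ are disjoint. Hence F and its
      -- translate share at most 2(|F| - |D 50|), about 8ρ of the 104ρ elements of F.
      NF : 96 * ρ ≤ N F x₀ + 3 * w
      NF = NF-ar ρ w (r F x₀) (N F x₀) (# (D 50)) (# F) (r+N F x₀) sum (lower 50 (s≤s z≤n) (≤K 50)) (upper 52 (≤K 52))
        where
          b : ∀ f f' d d' → (d ≡ true → f ≡ true) → (d' ≡ true → f' ≡ true) → (d ≡ true → d' ≡ true → ⊥) →
              ⟦ f ∧ f' ⟧ + (⟦ d ⟧ + ⟦ d' ⟧) ≤ ⟦ f ⟧ + ⟦ f' ⟧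
          b f f' true true _ _ h = ⊥-elim (h refl refl)
          b true f' true false _ _ _ = ≤≡ (+-comm ⟦ f' ⟧ 1)
          b false f' true false h _ _ with h refl
          ... | ()
          b f true false true _ _ _ = ≤≡ (cong (_+ 1) (k f))
            where k : ∀ f → ⟦ f ∧ true ⟧ ≡ ⟦ f ⟧
                  k true = refl
                  k false = refl
          b f false false true _ h _ with h refl
          ... | ()
          b true f' false false _ _ _ = ≤-trans (≤≡ (+-identityʳ _)) (m≤n+m _ 1)
          b false f' false false _ _ _ = z≤n
          l : ∀ x y → x -ᶻ (x -ᶻ y) ≡ y
          l = ℤR.solve-∀
          sum : r F x₀ + (# (D 50) + # (D 50)) ≤ # F + # F
          sum = subst₂ _≤_ (trans (σ-+ _ _) (cong₂ _+_ refl (trans (σ-+ _ _) (cong₂ _+_ refl (#-shift (D 50) x₀)))))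
            (trans (σ-+ _ _) (cong₂ _+_ refl (#-shift F x₀)))
            (σ-mono λ x → b (F ∋ x) (F ∋ (x -ᶻ x₀)) (D 50 ∋ x) (D 50 ∋ (x -ᶻ x₀)) (D-mono x (lit 50 52)) (D-mono _ (lit 50 52))
              (λ h h′ → tf (D-≡ 100 (l x x₀) (D-- 50 50 x _ h h′)) x₀∉))

      G : ℕ → ℕ → PSet
      G L zero = D L
      G L (suc j) = G L j ∪ D L ⟨ + suc j *ᶻ x₀ ⟩

      G-intro : ∀ L j i x → i ≤ j → x -ᶻ (+ i *ᶻ x₀) ∈ D L → x ∈ G L j
      G-intro L zero zero x _ h = D-≡ L (l x x₀) h
        where l : ∀ x y → x -ᶻ (+ 0 *ᶻ y) ≡ x
              l = ℤR.solve-∀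
      G-intro L (suc j) i x i≤ h with m≤n⇒m<n∨m≡n i≤
      ... | inj₁ i< = ∨-l (G-intro L j i x (≤-pred i<) h)
      ... | inj₂ refl = ∨-r {G L j ∋ x} h

      G-elim : ∀ L j x → x ∈ G L j → ∃ λ i → i ≤ j × x -ᶻ (+ i *ᶻ x₀) ∈ D L
      G-elim L zero x h = 0 , z≤n , D-≡ L (l x x₀) h
        where l : ∀ x y → x ≡ x -ᶻ (+ 0 *ᶻ y)
              l = ℤR.solve-∀
      G-elim L (suc j) x h with ∨-e {G L j ∋ x} h
      ... | inj₂ h′ = suc j , ≤-refl , h′
      ... | inj₁ h′ with G-elim L j x h′
      ...   | i , i≤ , h″ = i , m≤n⇒m≤1+n i≤ , h″

      G+F : ∀ j x y → x ∈ G 101 j → y ∈ F → x +ᶻ y ∈ G 153 j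
      G+F j x y x∈ y∈ with G-elim 101 j x x∈
      ... | i , i≤ , h = G-intro 153 j i (x +ᶻ y) i≤ (D-≡ 153 (l x y (+ i *ᶻ x₀)) (D-+ 101 52 _ y h y∈))
        where l : ∀ x y z → (x -ᶻ z) +ᶻ y ≡ (x +ᶻ y) -ᶻ z
              l = ℤR.solve-∀

      G⊆D : ∀ L j → G L j ⊆ D (L + j * 101)
      G⊆D L j x x∈ with G-elim L j x x∈
      ... | i , i≤ , h = D-mono x (+-monoʳ-≤ L (*-monoˡ-≤ 101 i≤)) (D-≡ (L + i * 101) (l x (+ i *ᶻ x₀)) (D-+ L (i * 101) _ _ h (D-* i 101 x₀ x₀∈)))
        where l : ∀ x z → (x -ᶻ z) +ᶻ z ≡ x
              l = ℤR.solve-∀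

      1≤F : 1 ≤ # F
      1≤F = ∈⇒# F {+ 0} (D-0 52)

      -- The sumset of `G 101 j` and F is nearly as small as Cauchy-Davenport permits. The next
      -- translate adds about 202ρ - |Q| to one union and 306ρ - |Q′| to the other; as Q + F lies in
      -- Q′, |Q′| ≥ |Q| + |F| - 2 with |F| about 104ρ = 306ρ - 202ρ, so the excess grows by O(w).
      Z≤ : ∀ j → # (G 153 j) ≤ # (G 101 j) + # F + suc j * (5 * w)
      Z≤ zero = Z0-ar ρ w (# F) (# (D 101)) (# (D 153)) (upper 153 (≤K 153)) (lower 52 (s≤s z≤n) (≤K 52)) (lower 101 (s≤s z≤n) (≤K 101))
      Z≤ (suc j) = Zs-ar ρ w j _ _ _ _ (# Q) (# Q′) (# F) (# (D 101)) (# (D 153)) w≥1 (upper 153 (≤K 153)) (lower 52 (s≤s z≤n) (≤K 52)) (lower 101 (s≤s z≤n) (≤K 101))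
          (trans (#-∩∪ (G 101 j) (D 101 ⟨ y₀ ⟩)) (cong (λ z → # (G 101 j) + z) (#-shift (D 101) y₀)))
          (trans (#-∩∪ (G 153 j) (D 153 ⟨ y₀ ⟩)) (cong (λ z → # (G 153 j) + z) (#-shift (D 153) y₀)))
          (cauchyDavenport Q F Q′ (∈⇒# Q {y₀} (∧-i in₁ in₂)) 1≤F lt sums) (Z≤ j)
        where
          y₀ = + suc j *ᶻ x₀
          Q = G 101 j ∩ D 101 ⟨ y₀ ⟩
          Q′ = G 153 j ∩ D 153 ⟨ y₀ ⟩
          l₁ : ∀ j x → x ≡ ((+ 1 +ᶻ j) *ᶻ x) -ᶻ (j *ᶻ x)
          l₁ = ℤR.solve-∀
          l₂ : ∀ x y z → (x -ᶻ z) +ᶻ y ≡ (x +ᶻ y) -ᶻ z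
          l₂ = ℤR.solve-∀
          -- Consecutive translates overlap because x₀ lies in D 101, so Q is nonempty and
          -- Cauchy-Davenport applies.
          in₁ : y₀ ∈ G 101 j
          in₁ = G-intro 101 j j y₀ ≤-refl (D-≡ 101 (l₁ (+ j) x₀) x₀∈)
          in₂ : y₀ ∈ D 101 ⟨ y₀ ⟩
          in₂ = D-≡ 101 (sym (ℤ.+-inverseʳ y₀)) (D-0 101)
          lt : # Q′ < p
          lt = ≤-trans (s≤s (≤-trans (#-mono Q′ (D 153 ⟨ y₀ ⟩) (λ x → ∧-r {G 153 j ∋ x})) (≤≡ (#-shift (D 153) y₀)))) (D<p 153 (≤K 153))
          sums : ∀ x y → x ∈ Q → y ∈ F → x +ᶻ y ∈ Q′
          sums x y x∈ y∈ = ∧-i (G+F j x y (∧-l x∈) y∈) (D-≡ 153 (l₂ x y y₀) (D-+ 101 52 _ y (∧-r {G 101 j ∋ x} x∈) y∈))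

      D101⊆G : ∀ j → D 101 ⊆ G 101 j
      D101⊆G zero x h = h
      D101⊆G (suc j) x h = ∨-l (D101⊆G j x h)

      -- By `Z≤` the union, F and C form a near-extremal triple, so `transfer` carries the lower
      -- bound `NF` from F to the union. If the union hardly meets its translate, its norm is nearly
      -- its whole size, which is at least |D 101|.
      NG : ∀ j → j ≤ 200 → 96 * ρ ≤ N (G 101 j) x₀ + ω
      NG j j≤ = cases (2 * E ≤? r (G 101 j) x₀)
        where
          E = suc j * (5 * w)
          2E≤ρ : 2 * E ≤ ρ
          2E≤ρ = E-small ρ w w₁ ω j j≤ w≪w₁ w₁≪ω ω≪ρ
          C = ∁ (neg (G 153 j))
          tri : Triple (G 101 j) F C E
          tri = record { E≥1 = *-mono-≤ (s≤s (z≤n {j})) (*-mono-≤ (s≤s (z≤n {4})) w≥1)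
                       ; T≤ = ≤-trans (≤≡ (sumset⇒T≡0 (G 101 j) F (G 153 j) (G+F j))) z≤n
                       ; size = ar p (# (G 101 j)) (# F) _ _ E (#-∁neg (G 153 j)) (Z≤ j) }
            where ar : ∀ p g f z c E → z + c ≡ p → z ≤ g + f + E → p ≤ g + f + c + E
                  ar _ g f z c E refl h = ≤-trans (+-monoˡ-≤ c h) (≤≡ (l g f c E))
                    where l : ∀ g f c E → g + f + E + c ≡ g + f + c + E
                          l = solve-∀
          Zlevel : 153 + j * 101 ≤ K
          Zlevel = ≤-trans (+-monoʳ-≤ 153 (*-monoˡ-≤ 101 j≤)) (≤K 20353)
          2E≤C : 2 * E ≤ # C
          2E≤C = +-cancelˡ-≤ (# (G 153 j)) _ _ (≤-trans (#-mono (G 153 j) (D (153 + j * 101)) (G⊆D 153 j) ⊞ 2E≤ρ) (≤-trans (room _ Zlevel) (≥≡ (#-∁neg (G 153 j)))))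
          2E≤F : 2 * E ≤ # F
          2E≤F = ≤-trans 2E≤ρ (ρ≤F-ar ρ w (# F) (lower 52 (s≤s z≤n) (≤K 52)) w≤ρ)
          cases : Dec (2 * E ≤ r (G 101 j) x₀) → 96 * ρ ≤ N (G 101 j) x₀ + ω
          cases (yes h) = NG-near ρ w w₁ ω j (N (G 101 j) x₀) (N F x₀) j≤ w≪w₁ w₁≪ω NF (transfer tri x₀ h 2E≤F 2E≤C)
          cases (no h) = NG-far ρ w w₁ ω j _ (r (G 101 j) x₀) _ j≤ w≪w₁ w₁≪ω
            (≤-trans (lower 101 (s≤s z≤n) (≤K 101)) (+-monoˡ-≤ w (#-mono (D 101) (G 101 j) (D101⊆G j)))) (r+N (G 101 j) x₀) (<⇒≤ (≰⇒> h))

      G-grow : ∀ j → j ≤ 200 → 202 * ρ + 96 * j * ρ ≤ # (G 101 j) + w + j * ω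
      G-grow zero _ = ≤-trans (≤≡ (+-identityʳ _)) (≤-trans (lower 101 (s≤s z≤n) (≤K 101)) (≥≡ (+-identityʳ _)))
      G-grow (suc j) j< = G-step ρ w ω j (# (G 101 j)) _ (N (G 101 j) x₀) (NG j (<⇒≤ j<)) grow (G-grow j (<⇒≤ j<))
        where
          l : ∀ x j y → (x -ᶻ y) -ᶻ (j *ᶻ y) ≡ x -ᶻ ((+ 1 +ᶻ j) *ᶻ y)
          l = ℤR.solve-∀
          sub : G 101 j ∪ G 101 j ⟨ x₀ ⟩ ⊆ G 101 (suc j)
          sub x h with ∨-e {G 101 j ∋ x} h
          ... | inj₁ h′ = ∨-l h′
          ... | inj₂ h′ with G-elim 101 j (x -ᶻ x₀) h′
          ...   | i , i≤ , h″ = G-intro 101 (suc j) (suc i) x (s≤s i≤) (D-≡ 101 (l x (+ i) x₀) h″)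
          grow : # (G 101 j) + N (G 101 j) x₀ ≤ # (G 101 (suc j))
          grow = ≤-trans (≥≡ (#∪shift (G 101 j) x₀)) (#-mono (G 101 j ∪ G 101 j ⟨ x₀ ⟩) (G 101 (suc j)) sub)

      -- Every step gains 96ρ up to an error ω. As 300 ω ≤ ρ, the losses of 200 steps together stay
      -- below one ρ, which turns 202ρ into 201ρ.
      G-big : ∀ j → j ≤ 200 → 201 * ρ + 96 * j * ρ ≤ # (G 101 j)
      G-big j j≤ = G-end ρ w w₁ ω j _ j≤ w≪w₁ w₁≪ω ω≪ρ (G-grow j j≤)

      -- Pigeonhole inside D 404 + 3x₀, of size about 808ρ: it contains the seven translates of D
      -- 101, of union at least 201ρ + 576ρ, and the translate of D 16 by u + 3x₀, of size about
      -- 32ρ. A common point gives 117 = 101 + 16.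
      cover′ : ∀ u → u ∈ D 303 → ∃ λ i → i ≤ 6 × (u +ᶻ + 3 *ᶻ x₀) -ᶻ (+ i *ᶻ x₀) ∈ D 117
      cover′ u u∈ = finish (meet (G 101 6) V W sub₁ sub₂ lt)
        where
          V = D 16 ⟨ u +ᶻ + 3 *ᶻ x₀ ⟩
          W = D 404 ⟨ + 3 *ᶻ x₀ ⟩
          l₁ : ∀ x y z → (x -ᶻ y) +ᶻ (y -ᶻ z) ≡ x -ᶻ z
          l₁ = ℤR.solve-∀
          sub₁ : G 101 6 ⊆ W
          sub₁ x x∈ = go (G-elim 101 6 x x∈)
            where go : (∃ λ i → i ≤ 6 × x -ᶻ (+ i *ᶻ x₀) ∈ D 101) → x ∈ W
                  go (i , i≤ , h) = D-≡ 404 (l₁ x (+ i *ᶻ x₀) (+ 3 *ᶻ x₀)) (D-+ 101 303 _ _ h (centre 3 i 101 x₀ x₀∈ i≤))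
          l₂ : ∀ x u z → (x -ᶻ (u +ᶻ z)) +ᶻ u ≡ x -ᶻ z
          l₂ = ℤR.solve-∀
          sub₂ : V ⊆ W
          sub₂ x x∈ = D-mono _ (lit 319 404) (D-≡ 319 (l₂ x u (+ 3 *ᶻ x₀)) (D-+ 16 303 _ u x∈ u∈))
          lt : # W < # (G 101 6) + # V
          lt = subst₂ (λ a b → a < # (G 101 6) + b) (sym (#-shift (D 404) (+ 3 *ᶻ x₀))) (sym (#-shift (D 16) (u +ᶻ + 3 *ᶻ x₀)))
            (cover-ar ρ w (# (G 101 6)) (# (D 16)) (# (D 404)) (G-big 6 (lit 6 200)) (lower 16 (s≤s z≤n) (≤K 16)) (upper 404 (≤K 404)) 2w<ρ)
          l₃ : ∀ x i y → (x -ᶻ i) -ᶻ (x -ᶻ y) ≡ y -ᶻ i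
          l₃ = ℤR.solve-∀
          finish : (∃ λ x → x ∈ G 101 6 × x ∈ V) → ∃ λ i → i ≤ 6 × (u +ᶻ + 3 *ᶻ x₀) -ᶻ (+ i *ᶻ x₀) ∈ D 117
          finish (x , xg , xv) = go (G-elim 101 6 x xg)
            where go : (∃ λ i → i ≤ 6 × x -ᶻ (+ i *ᶻ x₀) ∈ D 101) → ∃ λ i → i ≤ 6 × (u +ᶻ + 3 *ᶻ x₀) -ᶻ (+ i *ᶻ x₀) ∈ D 117
                  go (i , i≤ , h) = i , i≤ , D-≡ 117 (l₃ x (+ i *ᶻ x₀) (u +ᶻ + 3 *ᶻ x₀)) (D-- 101 16 _ _ h xv)

      opaque
        cover : ∀ u → u ∈ D 303 → ∃ λ i → i ≤ 6 × (u +ᶻ + 3 *ᶻ x₀) -ᶻ (+ i *ᶻ x₀) ∈ D 117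
        cover = cover′

      -- If k x₀ were in D 234, writing i = b + a k with b < k and a ≤ 20 would fit `G 101 (20 * k)`
      -- into a translate of level 2441 + 101k, where 2441 = 101 + 10 * 234. That set has about
      -- (4882 + 202k)ρ elements, against 201ρ + 1920kρ; this is impossible from k = 3 on.
      separated′ : ∀ k → 3 ≤ k → k ≤ 10 → + k *ᶻ x₀ ∈ D 234 → ⊥
      separated′ k k≥3 k≤10 kx∈ = <⇒≱ ρ≥1 (sep-ar ρ w k (# (G 101 (20 * k))) (# (D (2441 + 101 * k))) (G-big (20 * k) (*-monoʳ-≤ 20 k≤10)) small
          (upper _ (≤-trans (+-monoʳ-≤ 2441 (*-monoʳ-≤ 101 k≤10)) (≤K 3451))) w≤ρ k≥3)
        where
          instance
            kk : NonZero k
            kk = >-nonZero (≤-trans (s≤s z≤n) k≥3)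
          c = + 10 *ᶻ (+ k *ᶻ x₀)
          l : ∀ x y a b k → (((x -ᶻ ((b +ᶻ a *ᶻ k) *ᶻ y)) +ᶻ b *ᶻ y) +ᶻ (a *ᶻ (k *ᶻ y) -ᶻ + 10 *ᶻ (k *ᶻ y))) ≡ x -ᶻ + 10 *ᶻ (k *ᶻ y)
          l = ℤR.solve-∀
          sub : G 101 (20 * k) ⊆ D (2441 + 101 * k) ⟨ c ⟩
          sub x x∈ = go (G-elim 101 (20 * k) x x∈)
            where
              go : (∃ λ i → i ≤ 20 * k × x -ᶻ (+ i *ᶻ x₀) ∈ D 101) → x ∈ D (2441 + 101 * k) ⟨ c ⟩
              go (i , i≤ , h) = D-mono _ lev (D-≡ (101 + b * 101 + 10 * 234) (trans (cong (λ z → ((x -ᶻ (z *ᶻ x₀)) +ᶻ + b *ᶻ x₀) +ᶻ (+ a *ᶻ (+ k *ᶻ x₀) -ᶻ c)) idiv) (l x x₀ (+ a) (+ b) (+ k)))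
                  (D-+ (101 + b * 101) (10 * 234) _ _ (D-+ 101 (b * 101) _ _ h (D-* b 101 x₀ x₀∈)) (centre 10 a 234 (+ k *ᶻ x₀) kx∈ a≤)))
                where
                  a = i / k
                  b = i % k
                  idiv : + i ≡ + b +ᶻ + a *ᶻ + k
                  idiv = trans (cong +_ (m≡m%n+[m/n]*n i k)) (trans (ℤ.pos-+ b (a * k)) (cong (+ b +ᶻ_) (ℤ.pos-* a k)))
                  a≤ : a ≤ 20
                  a≤ = *-cancelʳ-≤ a 20 k (≤-trans (m≤n+m _ b) (≤-trans (≥≡ (m≡m%n+[m/n]*n i k)) i≤))
                  lev : 101 + b * 101 + 10 * 234 ≤ 2441 + 101 * k
                  lev = ≤-trans (+-monoˡ-≤ 2340 (+-monoʳ-≤ 101 (*-monoˡ-≤ 101 (<⇒≤ (m%n<n i k))))) (≤≡ (l′ k))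
                    where l′ : ∀ k → 101 + k * 101 + 2340 ≡ 2441 + 101 * k
                          l′ = solve-∀
          small : # (G 101 (20 * k)) ≤ # (D (2441 + 101 * k))
          small = ≤-trans (#-mono (G 101 (20 * k)) (D (2441 + 101 * k) ⟨ c ⟩) sub) (≤≡ (#-shift (D (2441 + 101 * k)) c))

      opaque
        separated : ∀ k → 3 ≤ k → k ≤ 10 → + k *ᶻ x₀ ∈ D 234 → ⊥
        separated = separated′

  -- Coordinates along a common difference

  ∑-atMost1 : ∀ n (f : ℕ → ℕ) → (∀ i → f i ≤ 1) → (∀ i j → i < n → j < n → 1 ≤ f i → 1 ≤ f j → i ≡ j) → ∑ n f ≤ 1
  ∑-atMost1 zero f _ _ = z≤n
  ∑-atMost1 (suc n) f h u with f n in e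
  ... | zero = ≤-trans (≤≡ (+-identityʳ _)) (∑-atMost1 n f h (λ i j i< j< → u i j (m≤n⇒m≤1+n i<) (m≤n⇒m≤1+n j<)))
  ... | suc k = ≤-trans (≤≡ (cong (_+ suc k) rest)) (≤-trans (≥≡ e) (h n))
    where
      rest : ∑ n f ≡ 0
      rest = ∑-0 n λ i i<n → n<1⇒n≡0 (≰⇒> (λ 1≤ → <-irrefl (u i n (m≤n⇒m≤1+n i<n) ≤-refl 1≤ (subst (1 ≤_) (sym e) (s≤s z≤n))) i<n))

  ∑-≡ : ∀ n (f g : ℕ → ℕ) → (∀ i → i < n → f i ≤ g i) → ∑ n f ≡ ∑ n g → ∀ i → i < n → f i ≡ g i
  ∑-≡ (suc n) f g h e i i<1+n = go (m≤n⇒m<n∨m≡n (≤-pred i<1+n))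
    where
      le : ∑ n f ≤ ∑ n g
      le = ∑-mono n (λ j j<n → h j (m≤n⇒m≤1+n j<n))
      ar₁ : ∀ a b c d → a + c ≡ b + d → a ≤ b → d ≤ c
      ar₁ a b c d e h = +-cancelˡ-≤ a _ _ (≤-trans (+-monoˡ-≤ d h) (≥≡ e))
      ar₂ : ∀ a b c d → a + c ≡ b + d → c ≤ d → b ≤ a
      ar₂ a b c d e h = +-cancelʳ-≤ c _ _ (≤-trans (+-monoʳ-≤ b h) (≥≡ e))
      go : i < n ⊎ i ≡ n → f i ≡ g i
      go (inj₁ i<n) = ∑-≡ n f g (λ j j<n → h j (m≤n⇒m≤1+n j<n)) (≤-antisym le (ar₂ _ _ (f n) (g n) e (h n ≤-refl))) i i<n
      go (inj₂ refl) = ≤-antisym (h i ≤-refl) (ar₁ _ _ (f i) (g i) e le)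

  ∑-hit : ∀ n k → k < n → 1 ≤ ∑ n (λ m → ⟦ k ≡ᵇ m ⟧)
  ∑-hit n k k<n = ≤-trans (≥≡ (cong ⟦_⟧ (r k))) (∑-term n (λ m → ⟦ k ≡ᵇ m ⟧) k k<n)
    where r : ∀ k → (k ≡ᵇ k) ≡ true
          r zero = refl
          r (suc k) = r k

  module Coordinates (p : ℕ) (pr : Prime p) where
    open Zp p pr
    open Sets p pr
    open PSet
    open Tri p pr
    open Chains p pr

    opaque
      unfolding σ

      σ-≈ : ∀ (f g : ℤ → ℕ) → (∀ x → + f x ≈ + g x) → + σ f ≈ + σ g
      σ-≈ f g h = go p
        where go : ∀ n → + ∑ n (λ i → f (+ i)) ≈ + ∑ n (λ i → g (+ i))
              go zero = ≈-refl
              go (suc n) = ≈-trans (≡⇒≈ (ℤ.pos-+ (∑ n (λ i → f (+ i))) (f (+ n)))) (≈-trans (≈-+ (go n) (h (+ n))) (≡⇒≈ (sym (ℤ.pos-+ (∑ n (λ i → g (+ i))) (g (+ n))))))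

      σ-≡ : ∀ (f g : ℤ → ℕ) → (∀ x → f x ≤ g x) → σ f ≡ σ g → ∀ i → i < p → f (+ i) ≡ g (+ i)
      σ-≡ f g h e = ∑-≡ p _ _ (λ i _ → h (+ i)) e

      σ-cong< : ∀ {f g : ℤ → ℕ} → (∀ i → i < p → f (+ i) ≡ g (+ i)) → σ f ≡ σ g
      σ-cong< h = ∑-cong p h

      σ-atMost1 : ∀ (f : ℤ → ℕ) → (∀ x → f x ≤ 1) → (∀ x y → 1 ≤ f x → 1 ≤ f y → x ≈ y) → σ f ≤ 1
      σ-atMost1 f h u = ∑-atMost1 p _ (λ i → h (+ i)) (λ i j i< j< a b → ≈⇒≡ i< j< (u (+ i) (+ j) a b))

      ∑σ-swap : ∀ n (f : ℕ → ℤ → ℕ) → ∑ n (λ m → σ (f m)) ≡ σ (λ x → ∑ n (λ m → f m x))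
      ∑σ-swap n f = ∑-swap n p _

      σ-first : ∀ (f : ℤ → ℕ) L → L ≤ p → (∀ n → n < L → f (+ n) ≡ 1) → L ≤ σ f
      σ-first f L L≤p h = ≤-trans (≤≡ (sym (trans (∑-cong L h) (trans (∑-const L 1) (*-identityʳ L))))) (∑-mono-n (λ i → f (+ i)) L≤p)

    res-≈ : ∀ {x y} → x ≈ y → res x ≡ res y
    res-≈ {x} {y} h = ≈⇒≡ (res<p x) (res<p y) (≈-trans (≈-sym (≈res x)) (≈-trans h (≈res y)))

    res≈ : ∀ x → + res x ≈ x
    res≈ x = ≈-sym (≈res x)

    ≈-cancelˡ : ∀ a {x y} → a +ᶻ x ≈ a +ᶻ y → x ≈ y
    ≈-cancelˡ a {x} {y} h = ≈-trans (≡⇒≈ (l a x)) (≈-trans (≈-+ (≈-refl { -ᶻ a}) h) (≡⇒≈ (sym (l a y))))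
      where l : ∀ a x → x ≡ (-ᶻ a) +ᶻ (a +ᶻ x)
            l = ℤR.solve-∀

    #-affine : ∀ U c d e → d *ᶻ e ≈ + 1 → σ (λ x → ⟦ U ∋ (c +ᶻ d *ᶻ x) ⟧) ≡ # U
    #-affine U c d e de = trans (σ-dilate {λ x → ⟦ U ∋ (c +ᶻ x) ⟧} (≈-per λ h → cong ⟦_⟧ (∈-≈ U (≈-+ (≈-refl {c}) h))) d e de)
      (trans (σ-cong λ x → cong (λ z → ⟦ U ∋ z ⟧) (ℤ.+-comm c x)) (σ-shift (per1 U) c))

    -- The first p terms of a progression with invertible difference are distinct and fill the
    -- group, so in a proper subset the progression stops before it repeats.
    run≤# : ∀ U c d e L → d *ᶻ e ≈ + 1 → # U < p → (∀ n → n < L → c +ᶻ d *ᶻ + n ∈ U) → L ≤ # U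
    run≤# U c d e L de lt h = cases (≤-total L p)
      where
        ones : ∀ n → n < L → ⟦ U ∋ (c +ᶻ d *ᶻ + n) ⟧ ≡ 1
        ones n n< = cong ⟦_⟧ (h n n<)
        cases : L ≤ p ⊎ p ≤ L → L ≤ # U
        cases (inj₁ L≤p) = ≤-trans (σ-first _ L L≤p ones) (≤≡ (#-affine U c d e de))
        cases (inj₂ p≤L) = ⊥-elim (<⇒≱ lt (≤-trans (σ-first _ p ≤-refl (λ n n< → ones n (≤-trans n< p≤L))) (≤≡ (#-affine U c d e de))))

    module Lattice {K ρ w : ℕ} (ch : Chain K ρ w) (K≥ : 20400 ≤ K) where
      open Chain ch
      open Geometry ch K≥

      -- R keeps the first element of each string of multiples of x₀ in N₀. Looking two steps back
      -- is enough: by `separated`, u and u - k x₀ are never both in N₀ for 3 ≤ k ≤ 10, as N₀ - N₀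
      -- lies in D 234.
      N₀ R : PSet
      N₀ = D 117
      R = N₀ ∖ (N₀ ⟨ x₀ ⟩ ∪ N₀ ⟨ + 2 *ᶻ x₀ ⟩)

      R-intro : ∀ x → x ∈ N₀ → x -ᶻ x₀ ∉ N₀ → x -ᶻ + 2 *ᶻ x₀ ∉ N₀ → x ∈ R
      R-intro x h₀ h₁ h₂ = ∧-i h₀ (not-f (trans (cong (_∨ (N₀ ∋ (x -ᶻ + 2 *ᶻ x₀))) h₁) h₂))

      R-0 : ∀ x → x ∈ R → x ∈ N₀
      R-0 x h = ∧-l h

      R-1 : ∀ x → x ∈ R → x -ᶻ x₀ ∈ N₀ → ⊥
      R-1 x h h′ = tf (∨-l {b = N₀ ∋ (x -ᶻ + 2 *ᶻ x₀)} h′) (not-t (∧-r {N₀ ∋ x} h))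

      R-2 : ∀ x → x ∈ R → x -ᶻ + 2 *ᶻ x₀ ∈ N₀ → ⊥
      R-2 x h h′ = tf (∨-r {N₀ ∋ (x -ᶻ x₀)} h′) (not-t (∧-r {N₀ ∋ x} h))

      far : ∀ u k → 3 ≤ k → k ≤ 10 → u ∈ N₀ → u -ᶻ + k *ᶻ x₀ ∈ N₀ → ⊥
      far u k k≥3 k≤10 h h′ = separated k k≥3 k≤10 (D-≡ 234 (l u (+ k *ᶻ x₀)) (D-- 117 117 u _ h h′))
        where l : ∀ u y → u -ᶻ (u -ᶻ y) ≡ y
              l = ℤR.solve-∀

      notIn : ∀ x → (x ∈ N₀ → ⊥) → x ∉ N₀
      notIn x h with N₀ ∋ x
      ... | false = refl
      ... | true = ⊥-elim (h refl)

      rep′ : ∀ u → u ∈ N₀ → ∃ λ k → k ≤ 2 × u -ᶻ + k *ᶻ x₀ ∈ R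
      rep′ u u∈ = go (N₀ ∋ (u -ᶻ + 2 *ᶻ x₀)) (N₀ ∋ (u -ᶻ x₀)) refl refl
        where
          l₂₁ : ∀ u y → (u -ᶻ + 2 *ᶻ y) -ᶻ y ≡ u -ᶻ + 3 *ᶻ y
          l₂₁ = ℤR.solve-∀
          l₂₂ : ∀ u y → (u -ᶻ + 2 *ᶻ y) -ᶻ + 2 *ᶻ y ≡ u -ᶻ + 4 *ᶻ y
          l₂₂ = ℤR.solve-∀
          l₁₁ : ∀ u y → (u -ᶻ + 1 *ᶻ y) -ᶻ y ≡ u -ᶻ + 2 *ᶻ y
          l₁₁ = ℤR.solve-∀
          l₁₂ : ∀ u y → (u -ᶻ + 1 *ᶻ y) -ᶻ + 2 *ᶻ y ≡ u -ᶻ + 3 *ᶻ y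
          l₁₂ = ℤR.solve-∀
          l₁₀ : ∀ u y → u -ᶻ y ≡ u -ᶻ + 1 *ᶻ y
          l₁₀ = ℤR.solve-∀
          l₀ : ∀ u y → u -ᶻ + 0 *ᶻ y ≡ u
          l₀ = ℤR.solve-∀
          go : ∀ b₂ b₁ → (N₀ ∋ (u -ᶻ + 2 *ᶻ x₀)) ≡ b₂ → (N₀ ∋ (u -ᶻ x₀)) ≡ b₁ → ∃ λ k → k ≤ 2 × u -ᶻ + k *ᶻ x₀ ∈ R
          go true b₁ h₂ _ = 2 , ≤-refl , R-intro _ h₂
            (notIn _ λ h → far u 3 (lit 3 3) (lit 3 10) u∈ (D-≡ 117 (l₂₁ u x₀) h))
            (notIn _ λ h → far u 4 (lit 3 4) (lit 4 10) u∈ (D-≡ 117 (l₂₂ u x₀) h))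
          go false true h₂ h₁ = 1 , s≤s z≤n , R-intro _ (D-≡ 117 (l₁₀ u x₀) h₁)
            (trans (cong (N₀ ∋_) (l₁₁ u x₀)) h₂)
            (notIn _ λ h → far u 3 (lit 3 3) (lit 3 10) u∈ (D-≡ 117 (l₁₂ u x₀) h))
          go false false h₂ h₁ = 0 , z≤n , subst (_∈ R) (sym (l₀ u x₀)) (R-intro u u∈ h₁ h₂)

      opaque
        rep : ∀ u → u ∈ N₀ → ∃ λ k → k ≤ 2 × u -ᶻ + k *ᶻ x₀ ∈ R
        rep = rep′

      -- The definition of R excludes k = 1 and k = 2, and `separated` excludes 3 to 10.
      uniq : ∀ k x y → k ≤ 10 → x ∈ R → y ∈ R → x -ᶻ y ≈ + k *ᶻ x₀ → x ≈ y
      uniq k x y k≤10 x∈ y∈ e = go k k≤10 e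
        where
          back : ∀ z → x -ᶻ y ≈ z → x -ᶻ z ∈ N₀
          back z h = D-≈ 117 (≈-trans (≡⇒≈ (sym (l x y))) (≈-- (≈-refl {x}) h)) (R-0 y y∈)
            where l : ∀ x y → x -ᶻ (x -ᶻ y) ≡ y
                  l = ℤR.solve-∀
          go : ∀ k → k ≤ 10 → x -ᶻ y ≈ + k *ᶻ x₀ → x ≈ y
          go 0 _ h = x-y≈0⇒x≈y (≈-trans h (≡⇒≈ (ℤ.*-zeroˡ x₀)))
          go 1 _ h = ⊥-elim (R-1 x x∈ (back x₀ (≈-trans h (≡⇒≈ (ℤ.*-identityˡ x₀)))))
          go 2 _ h = ⊥-elim (R-2 x x∈ (back _ h))
          go (suc (suc (suc k))) k≤ h = ⊥-elim (far x _ (s≤s (s≤s (s≤s z≤n))) k≤ (R-0 x x∈) (back _ h))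

      -- x + t has level 117 + 186 = 303, so `cover` leads into N₀ within six multiples of x₀ and
      -- `rep` into R within two more.
      move′ : ∀ t x → t ∈ D 186 → x ∈ R → Σ (ℕ × ℤ) λ (o , y) → o ≤ 8 × y ∈ R × (x +ᶻ t) +ᶻ + 3 *ᶻ x₀ ≡ y +ᶻ + o *ᶻ x₀
      move′ t x t∈ x∈ with cover (x +ᶻ t) (D-+ 117 186 x t (R-0 x x∈) t∈)
      ... | i , i≤ , h with rep _ h
      ...   | k , k≤ , h′ = (i + k , _) , +-mono-≤ i≤ k≤ , h′ , l ((x +ᶻ t) +ᶻ + 3 *ᶻ x₀) x₀ (+ i) (+ k)
        where l : ∀ z y i k → z ≡ ((z -ᶻ i *ᶻ y) -ᶻ k *ᶻ y) +ᶻ (i +ᶻ k) *ᶻ y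
              l = ℤR.solve-∀

      opaque
        move : ∀ t x → t ∈ D 186 → x ∈ R → Σ (ℕ × ℤ) λ (o , y) → o ≤ 8 × y ∈ R × (x +ᶻ t) +ᶻ + 3 *ᶻ x₀ ≡ y +ᶻ + o *ᶻ x₀
        move = move′

      s : ℕ
      s = # R

      -- Translation by t permutes R up to multiples of x₀; summing over R linearises t.
      module Linear (t : ℤ) (t∈ : t ∈ D 186) where

        pick : ∀ x b → (R ∋ x) ≡ b → ℕ × ℤ
        pick x true e = proj₁ (move t x t∈ e)
        pick x false _ = 0 , x

        off : ℤ → ℕ
        off x = proj₁ (pick x (R ∋ x) refl)

        φ : ℤ → ℤ
        φ x = proj₂ (pick x (R ∋ x) refl)

        pick-ok : ∀ x b (e : (R ∋ x) ≡ b) → b ≡ true → proj₁ (pick x b e) ≤ 8 × proj₂ (pick x b e) ∈ R × (x +ᶻ t) +ᶻ + 3 *ᶻ x₀ ≡ proj₂ (pick x b e) +ᶻ + proj₁ (pick x b e) *ᶻ x₀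
        pick-ok x true e _ = proj₂ (move t x t∈ e)

        ok : ∀ x → x ∈ R → off x ≤ 8 × φ x ∈ R × (x +ᶻ t) +ᶻ + 3 *ᶻ x₀ ≡ φ x +ᶻ + off x *ᶻ x₀
        ok x x∈ = pick-ok x (R ∋ x) refl x∈

        -- If φ x and φ y agree, x - y is a multiple of x₀ with factor at most 8 in absolute value,
        -- and `uniq` applies to one of the two orders.
        φ-inj : ∀ x y → x ∈ R → y ∈ R → φ x ≈ φ y → x ≈ y
        φ-inj x y x∈ y∈ h = go (≤-total (off y) (off x))
          where
            l : ∀ x y t z a b w u v → (x +ᶻ t) +ᶻ z ≡ u +ᶻ a *ᶻ w → (y +ᶻ t) +ᶻ z ≡ v +ᶻ b *ᶻ w → x -ᶻ y ≡ (u -ᶻ v) +ᶻ (a -ᶻ b) *ᶻ w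
            l x y t z a b w u v e₁ e₂ = trans (l₁ x y t z) (trans (cong₂ _-ᶻ_ e₁ e₂) (l₂ a b w u v))
              where l₁ : ∀ x y t z → x -ᶻ y ≡ ((x +ᶻ t) +ᶻ z) -ᶻ ((y +ᶻ t) +ᶻ z)
                    l₁ = ℤR.solve-∀
                    l₂ : ∀ a b w u v → (u +ᶻ a *ᶻ w) -ᶻ (v +ᶻ b *ᶻ w) ≡ (u -ᶻ v) +ᶻ (a -ᶻ b) *ᶻ w
                    l₂ = ℤR.solve-∀
            dif : ∀ x y → x ∈ R → y ∈ R → φ x ≈ φ y → x -ᶻ y ≈ (+ off x -ᶻ + off y) *ᶻ x₀
            dif x y x∈ y∈ h = ≈-trans (≡⇒≈ (l x y t (+ 3 *ᶻ x₀) (+ off x) (+ off y) x₀ (φ x) (φ y) (proj₂ (proj₂ (ok x x∈))) (proj₂ (proj₂ (ok y y∈)))))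
              (≈-trans (≈-+ (≈-trans (≈-- h (≈-refl {φ y})) (≡⇒≈ (ℤ.+-inverseʳ (φ y)))) ≈-refl) (≡⇒≈ (ℤ.+-identityˡ _)))
            k≤ : ∀ a b c → a + c ≡ b → b ≤ 8 → c ≤ 10
            k≤ a b c refl h = ≤-trans (≤-trans (m≤n+m c a) h) (lit 8 10)
            sub : ∀ a c → + (a + c) -ᶻ + a ≡ + c
            sub a c = trans (cong (_-ᶻ + a) (ℤ.pos-+ a c)) (l₃ (+ a) (+ c))
              where l₃ : ∀ a c → (a +ᶻ c) -ᶻ a ≡ c
                    l₃ = ℤR.solve-∀
            go : off y ≤ off x ⊎ off x ≤ off y → x ≈ y
            go (inj₁ le) with m≤n⇒∃[o]m+o≡n le
            ... | c , e = uniq c x y (k≤ _ _ c e (proj₁ (ok x x∈))) x∈ y∈ (≈-trans (dif x y x∈ y∈ h) (≡⇒≈ (cong (_*ᶻ x₀) (trans (cong (λ z → + z -ᶻ + off y) (sym e)) (sub (off y) c)))))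
            go (inj₂ le) with m≤n⇒∃[o]m+o≡n le
            ... | c , e = ≈-sym (uniq c y x (k≤ _ _ c e (proj₁ (ok y y∈))) y∈ x∈ (≈-trans (dif y x y∈ x∈ (≈-sym h)) (≡⇒≈ (cong (_*ᶻ x₀) (trans (cong (λ z → + z -ᶻ + off x) (sym e)) (sub (off x) c))))))

        hits : ℤ → ℕ
        hits y = σ (λ x → ⟦ R ∋ x ⟧ * δ (y -ᶻ φ x))

        hit : ∀ x y → 1 ≤ ⟦ R ∋ x ⟧ * δ (y -ᶻ φ x) → x ∈ R × y ≈ φ x
        hit x y h = proj₁ (both (R ∋ x) _ h) , x-y≈0⇒x≈y (proj₂ (both (R ∋ x) _ h))
          where both : ∀ b z → 1 ≤ ⟦ b ⟧ * δ z → b ≡ true × z ≈ + 0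
                both true z h with z ≈? + 0
                ... | yes e = refl , e

        δ≤1 : ∀ x → δ x ≤ 1
        δ≤1 x = ⟦⟧≤1 _

        hits≤ : ∀ y → hits y ≤ ⟦ R ∋ y ⟧
        hits≤ y = go (R ∋ y) refl
          where
            go : ∀ b → (R ∋ y) ≡ b → hits y ≤ ⟦ b ⟧
            go true _ = σ-atMost1 _ (λ x → *-mono-≤ (⟦⟧≤1 (R ∋ x)) (δ≤1 (y -ᶻ φ x)))
              (λ x x' h h' → φ-inj x x' (proj₁ (hit x y h)) (proj₁ (hit x' y h')) (≈-trans (≈-sym (proj₂ (hit x y h))) (proj₂ (hit x' y h'))))
            go false e = ≤≡ (σ-0 λ x → n<1⇒n≡0 (≰⇒> λ h → tf (trans (∈-≈ R (proj₂ (hit x y h))) (proj₁ (proj₂ (ok x (proj₁ (hit x y h)))))) e))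

        σ-hits : σ hits ≡ σ (λ y → ⟦ R ∋ y ⟧)
        σ-hits = trans (σ-swap (λ y x → ⟦ R ∋ x ⟧ * δ (y -ᶻ φ x))) (σ-cong λ x → trans (σ-* ⟦ R ∋ x ⟧ (λ y → δ (y -ᶻ φ x))) (trans (cong (⟦ R ∋ x ⟧ *_) (σ-δ (φ x))) (*-identityʳ _)))

        -- By injectivity `hits` is at most the indicator of R, and by `σ-hits` it has the same
        -- total; hence the two agree and every class in R is hit once.
        permuted : σ (λ x → ⟦ R ∋ x ⟧ * res (φ x)) ≡ σ (λ x → ⟦ R ∋ x ⟧ * res x)
        permuted = begin
          σ (λ x → ⟦ R ∋ x ⟧ * res (φ x))
            ≡⟨ σ-cong (λ x → cong (⟦ R ∋ x ⟧ *_) (sym (σ-eval (≈-per res-≈) (φ x)))) ⟩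
          σ (λ x → ⟦ R ∋ x ⟧ * σ (λ y → δ (y -ᶻ φ x) * res y))
            ≡⟨ σ-cong (λ x → trans (sym (σ-* ⟦ R ∋ x ⟧ _)) (σ-cong λ y → sym (*-assoc ⟦ R ∋ x ⟧ _ _))) ⟩
          σ (λ x → σ (λ y → ⟦ R ∋ x ⟧ * δ (y -ᶻ φ x) * res y))
            ≡⟨ σ-swap _ ⟩
          σ (λ y → σ (λ x → ⟦ R ∋ x ⟧ * δ (y -ᶻ φ x) * res y))
            ≡⟨ σ-cong (λ y → σ-*ʳ (res y) _) ⟩
          σ (λ y → hits y * res y)
            ≡⟨ σ-cong< (λ i i< → cong (_* res (+ i)) (σ-≡ hits _ hits≤ σ-hits i i<)) ⟩
          σ (λ x → ⟦ R ∋ x ⟧ * res x) ∎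
          where open ≡-Reasoning

        O : ℕ
        O = σ (λ x → ⟦ R ∋ x ⟧ * off x)

        O≤ : O ≤ 8 * s
        O≤ = ≤-trans (σ-mono pw) (≤≡ (σ-* 8 (λ x → ⟦ R ∋ x ⟧)))
          where pw : ∀ x → ⟦ R ∋ x ⟧ * off x ≤ 8 * ⟦ R ∋ x ⟧
                pw x = go (R ∋ x) refl
                  where go : ∀ b → (R ∋ x) ≡ b → ⟦ b ⟧ * off x ≤ 8 * ⟦ b ⟧
                        go true e = ≤-trans (≤≡ (+-identityʳ _)) (proj₁ (ok x e))
                        go false _ = z≤n

        τ ξ S : ℕ
        τ = res (t +ᶻ + 3 *ᶻ x₀)
        ξ = res x₀
        S = σ (λ x → ⟦ R ∋ x ⟧ * res x)

        sums : + (S + s * τ) ≈ + (S + O * ξ)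
        sums = subst₂ (λ a b → + a ≈ + b) lhs rhs (σ-≈ _ _ pw)
          where
            lhs : σ (λ x → ⟦ R ∋ x ⟧ * (res x + τ)) ≡ S + s * τ
            lhs = trans (σ-cong λ x → *-distribˡ-+ ⟦ R ∋ x ⟧ (res x) τ) (trans (σ-+ _ _) (cong₂ _+_ refl (σ-*ʳ τ (λ x → ⟦ R ∋ x ⟧))))
            rhs : σ (λ x → ⟦ R ∋ x ⟧ * (res (φ x) + off x * ξ)) ≡ S + O * ξ
            rhs = trans (σ-cong λ x → trans (*-distribˡ-+ ⟦ R ∋ x ⟧ (res (φ x)) _) (cong₂ _+_ refl (sym (*-assoc ⟦ R ∋ x ⟧ (off x) ξ)))) (trans (σ-+ _ _) (cong₂ _+_ permuted (σ-*ʳ ξ _)))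
            pw : ∀ x → + (⟦ R ∋ x ⟧ * (res x + τ)) ≈ + (⟦ R ∋ x ⟧ * (res (φ x) + off x * ξ))
            pw x = go (R ∋ x) refl
              where
                main : x ∈ R → + (res x + τ) ≈ + (res (φ x) + off x * ξ)
                main x∈ = ≈-trans (≡⇒≈ (ℤ.pos-+ (res x) τ)) (≈-trans (≈-+ (res≈ x) (res≈ _)) (≈-trans (≡⇒≈ (trans (sym (ℤ.+-assoc x t _)) (proj₂ (proj₂ (ok x x∈)))))
                  (≈-trans (≈-+ (≈res (φ x)) (≈-* (+ off x) (≈res x₀))) (≡⇒≈ (trans (cong (+ res (φ x) +ᶻ_) (sym (ℤ.pos-* (off x) ξ))) (sym (ℤ.pos-+ (res (φ x)) _)))))))
                go : ∀ b → (R ∋ x) ≡ b → + (⟦ b ⟧ * (res x + τ)) ≈ + (⟦ b ⟧ * (res (φ x) + off x * ξ))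
                go true e = subst₂ (λ a b → + a ≈ + b) (sym (+-identityʳ _)) (sym (+-identityʳ _)) (main e)
                go false _ = ≈-refl

        -- Sum x + t + 3x₀ = φ x + `off x` * x₀ over R: the sums of x and of φ x cancel by
        -- `permuted`.
        linear : + s *ᶻ (t +ᶻ + 3 *ᶻ x₀) ≈ + O *ᶻ x₀
        linear = ≈-trans (≈-* (+ s) (≈res _)) (≈-trans (≡⇒≈ (sym (ℤ.pos-* s τ))) (≈-trans
          (≈-cancelˡ (+ S) (≈-trans (≡⇒≈ (sym (ℤ.pos-+ S _))) (≈-trans sums (≡⇒≈ (ℤ.pos-+ S _)))))
          (≈-trans (≡⇒≈ (ℤ.pos-* O ξ)) (≈-* (+ O) (res≈ x₀)))))

      s≥1 : 1 ≤ s
      s≥1 = ∈⇒# R (proj₂ (proj₂ (rep (+ 0) (D-0 117))))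

      s<p : s < p
      s<p = ≤-trans (s≤s (#-mono R N₀ (λ x → R-0 x))) (D<p 117 (≤K 117))

      s≉0 : ¬ (+ s ≈ + 0)
      s≉0 h = <-irrefl (sym (≈⇒≡ s<p 0<p h)) s≥1

      opaque
        step : Σ ℤ λ d → + s *ᶻ d ≈ x₀
        step = go (inverse (+ s) s≉0)
          where
            l : ∀ s e x → s *ᶻ (e *ᶻ x) ≡ x *ᶻ (s *ᶻ e)
            l = ℤR.solve-∀
            go : (Σ ℤ λ e → + s *ᶻ e ≈ + 1) → Σ ℤ λ d → + s *ᶻ d ≈ x₀
            go (e , se) = e *ᶻ x₀ , ≈-trans (≡⇒≈ (l (+ s) e x₀)) (≈-trans (≈-* x₀ se) (≡⇒≈ (ℤ.*-identityʳ x₀)))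

      d : ℤ
      d = proj₁ step

      sd≈x₀ : + s *ᶻ d ≈ x₀
      sd≈x₀ = proj₂ step

      x₀≉0 : ¬ (x₀ ≈ + 0)
      x₀≉0 h = tf (D-≈ 100 (≈-sym h) (D-0 100)) x₀∉

      d≉0 : ¬ (d ≈ + 0)
      d≉0 h = x₀≉0 (≈-trans (≈-sym sd≈x₀) (≈-trans (≈-* (+ s) h) (≡⇒≈ (ℤ.*-zeroʳ (+ s)))))

      coord′ : ∀ t → t ∈ D 186 → ∃ λ O → O ≤ 8 * s × t ≈ (+ O -ᶻ + 3 *ᶻ + s) *ᶻ d
      coord′ t t∈ = Linear.O t t∈ , Linear.O≤ t t∈ , ≈-cancel (+ s) s≉0 (≈-trans (≡⇒≈ (l₁ (+ s) t x₀)) (≈-trans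
          (≈-- (Linear.linear t t∈) (≈-refl {+ 3 *ᶻ + s *ᶻ x₀})) (≈-trans (≡⇒≈ (l₂ (+ Linear.O t t∈) (+ s) x₀))
          (≈-trans (≈-* (+ Linear.O t t∈ -ᶻ + 3 *ᶻ + s) (≈-sym sd≈x₀)) (≡⇒≈ (l₃ (+ Linear.O t t∈ -ᶻ + 3 *ᶻ + s) (+ s) d))))))
        where
          l₁ : ∀ s t x → s *ᶻ t ≡ s *ᶻ (t +ᶻ + 3 *ᶻ x) -ᶻ + 3 *ᶻ s *ᶻ x
          l₁ = ℤR.solve-∀
          l₂ : ∀ O s x → O *ᶻ x -ᶻ + 3 *ᶻ s *ᶻ x ≡ (O -ᶻ + 3 *ᶻ s) *ᶻ x
          l₂ = ℤR.solve-∀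
          l₃ : ∀ a s d → a *ᶻ (s *ᶻ d) ≡ s *ᶻ (a *ᶻ d)
          l₃ = ℤR.solve-∀

      opaque
        coord : ∀ t → t ∈ D 186 → ∃ λ O → O ≤ 8 * s × t ≈ (+ O -ᶻ + 3 *ᶻ + s) *ᶻ d
        coord = coord′

      R⊆ : ∀ x → x ∈ R → x ∈ D 186
      R⊆ x h = D-mono x (lit 117 186) (R-0 x h)

      label-b : ∀ x b → (R ∋ x) ≡ b → ℕ
      label-b x true e = proj₁ (coord x (R⊆ x e))
      label-b x false _ = 0

      label : ℤ → ℕ
      label x = label-b x (R ∋ x) refl

      label-ok : ∀ x → x ∈ R → label x ≤ 8 * s × x ≈ (+ label x -ᶻ + 3 *ᶻ + s) *ᶻ d
      label-ok x x∈ = go (R ∋ x) refl x∈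
        where go : ∀ b (e : (R ∋ x) ≡ b) → b ≡ true → label-b x b e ≤ 8 * s × x ≈ (+ label-b x b e -ᶻ + 3 *ᶻ + s) *ᶻ d
              go true e _ = proj₂ (coord x (R⊆ x e))

      instance
        s≢0 : NonZero s
        s≢0 = >-nonZero s≥1

      div : ∀ n → + n ≡ + (n % s) +ᶻ + (n / s) *ᶻ + s
      div n = trans (cong +_ (m≡m%n+[m/n]*n n s)) (trans (ℤ.pos-+ (n % s) _) (cong (+ (n % s) +ᶻ_) (ℤ.pos-* (n / s) s)))

      quot≤ : ∀ n c → n ≤ c * s → n / s ≤ c
      quot≤ n c h = *-cancelʳ-≤ (n / s) c s (≤-trans (m≤n+m _ (n % s)) (≤-trans (≥≡ (m≡m%n+[m/n]*n n s)) h))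

      label-dif : ∀ x y → x ∈ R → y ∈ R → label x % s ≡ label y % s → x -ᶻ y ≈ (+ (label x / s) -ᶻ + (label y / s)) *ᶻ x₀
      label-dif x y x∈ y∈ e = ≈-trans (≈-- (proj₂ (label-ok x x∈)) (proj₂ (label-ok y y∈)))
          (≈-trans (≡⇒≈ (trans (cong₂ (λ a b → (a -ᶻ + 3 *ᶻ + s) *ᶻ d -ᶻ (b -ᶻ + 3 *ᶻ + s) *ᶻ d) (div (label x)) (trans (div (label y)) (cong (λ m → + m +ᶻ + (label y / s) *ᶻ + s) (sym e)))) (l (+ (label x % s)) (+ (label x / s)) (+ (label y / s)) (+ s) d)))
            (≈-* (+ (label x / s) -ᶻ + (label y / s)) sd≈x₀))
        where l : ∀ m a b s d → ((m +ᶻ a *ᶻ s) -ᶻ + 3 *ᶻ s) *ᶻ d -ᶻ ((m +ᶻ b *ᶻ s) -ᶻ + 3 *ᶻ s) *ᶻ d ≡ (a -ᶻ b) *ᶻ (s *ᶻ d)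
              l = ℤR.solve-∀

      -- Labels congruent modulo s differ by at most 8 multiples of s, so x and y differ by as many
      -- multiples of s d = x₀, and `uniq` identifies them.
      label-inj : ∀ x y → x ∈ R → y ∈ R → label x % s ≡ label y % s → x ≈ y
      label-inj x y x∈ y∈ e = go (≤-total (label y / s) (label x / s))
        where
          k≤ : ∀ a b c → a + c ≡ b → b ≤ 8 → c ≤ 10
          k≤ a b c refl h = ≤-trans (≤-trans (m≤n+m c a) h) (lit 8 10)
          sub : ∀ a b c → a + c ≡ b → (+ b -ᶻ + a) *ᶻ x₀ ≡ + c *ᶻ x₀
          sub a _ c refl = cong (_*ᶻ x₀) (trans (cong (_-ᶻ + a) (ℤ.pos-+ a c)) (l₃ (+ a) (+ c)))
            where l₃ : ∀ a c → (a +ᶻ c) -ᶻ a ≡ c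
                  l₃ = ℤR.solve-∀
          up : ∀ x y → x ∈ R → y ∈ R → label x % s ≡ label y % s → (∃ λ c → label y / s + c ≡ label x / s) → x ≈ y
          up x y x∈ y∈ e (c , ce) = uniq c x y (k≤ _ _ c ce (quot≤ (label x) 8 (proj₁ (label-ok x x∈)))) x∈ y∈ (≈-trans (label-dif x y x∈ y∈ e) (≡⇒≈ (sub _ _ c ce)))
          go : label y / s ≤ label x / s ⊎ label x / s ≤ label y / s → x ≈ y
          go (inj₁ le) = up x y x∈ y∈ e (m≤n⇒∃[o]m+o≡n le)
          go (inj₂ le) = ≈-sym (up y x y∈ x∈ (sym e) (m≤n⇒∃[o]m+o≡n le))

      count : ℕ → ℕ
      count m = σ (λ x → ⟦ R ∋ x ⟧ * ⟦ label x % s ≡ᵇ m ⟧)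

      both : ∀ b k m → 1 ≤ ⟦ b ⟧ * ⟦ k ≡ᵇ m ⟧ → b ≡ true × k ≡ m
      both true k m h with k ≡ᵇ m in e
      ... | true = refl , ≡ᵇ⇒≡ k m (subst Data.Bool.T (sym e) tt)

      -- The labels modulo s are distinct on the s elements of R, so all residues occur.
      residues : ∀ m → m < s → ∃ λ x → x ∈ R × label x % s ≡ m
      residues m m<s = found (σ-pos _ (≥≡ (∑-full s count count≤1 total m m<s)))
        where
          count≤1 : ∀ m → m < s → count m ≤ 1
          count≤1 m _ = σ-atMost1 _ (λ x → *-mono-≤ (⟦⟧≤1 (R ∋ x)) (⟦⟧≤1 (label x % s ≡ᵇ m)))
            (λ x y h h' → label-inj x y (proj₁ (both (R ∋ x) (label x % s) m h)) (proj₁ (both (R ∋ y) (label y % s) m h')) (trans (proj₂ (both (R ∋ x) (label x % s) m h)) (sym (proj₂ (both (R ∋ y) (label y % s) m h')))))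
          total : s ≤ ∑ s count
          total = ≤-trans (σ-mono λ x → ≤-trans (≥≡ (*-identityʳ ⟦ R ∋ x ⟧)) (≤-trans (*-monoʳ-≤ ⟦ R ∋ x ⟧ (∑-hit s (label x % s) (m%n<n (label x) s))) (≥≡ (∑-* s ⟦ R ∋ x ⟧ _))))
            (≥≡ (∑σ-swap s (λ m x → ⟦ R ∋ x ⟧ * ⟦ label x % s ≡ᵇ m ⟧)))
          found : (∃ λ x → 1 ≤ ⟦ R ∋ x ⟧ * ⟦ label x % s ≡ᵇ m ⟧) → ∃ λ x → x ∈ R × label x % s ≡ m
          found (x , h) = x , both (R ∋ x) _ m h

      -- Take x in R whose label is congruent to n modulo s. The coordinates of x and of the target
      -- differ by a multiple of s, so the points differ by (a + 8 - b - 10) x₀, with a + 8 - b at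
      -- most 18. The level is 1127 = 117 + 10 * 101.
      multiples : ∀ n → n ≤ 10 * s → (+ n -ᶻ + 5 *ᶻ + s) *ᶻ d ∈ D 1127
      multiples n n≤ = go (residues (n % s) (m%n<n n s))
        where
          a = n / s
          l : ∀ m a b b' s d → b +ᶻ b' ≡ + 8 →
              (((m +ᶻ b *ᶻ s) -ᶻ + 3 *ᶻ s) *ᶻ d) +ᶻ ((a +ᶻ b') *ᶻ (s *ᶻ d) -ᶻ + 10 *ᶻ (s *ᶻ d)) ≡ ((m +ᶻ a *ᶻ s) -ᶻ + 5 *ᶻ s) *ᶻ d
          l m a b b' s d e = trans (l₁ m a b b' s d) (trans (cong (λ z → ((m +ᶻ a *ᶻ s) -ᶻ + 5 *ᶻ s) *ᶻ d +ᶻ (z -ᶻ + 8) *ᶻ (s *ᶻ d)) e) (l₂ m a s d))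
            where l₁ : ∀ m a b b' s d → (((m +ᶻ b *ᶻ s) -ᶻ + 3 *ᶻ s) *ᶻ d) +ᶻ ((a +ᶻ b') *ᶻ (s *ᶻ d) -ᶻ + 10 *ᶻ (s *ᶻ d)) ≡ ((m +ᶻ a *ᶻ s) -ᶻ + 5 *ᶻ s) *ᶻ d +ᶻ ((b +ᶻ b') -ᶻ + 8) *ᶻ (s *ᶻ d)
                  l₁ = ℤR.solve-∀
                  l₂ : ∀ m a s d → ((m +ᶻ a *ᶻ s) -ᶻ + 5 *ᶻ s) *ᶻ d +ᶻ (+ 8 -ᶻ + 8) *ᶻ (s *ᶻ d) ≡ ((m +ᶻ a *ᶻ s) -ᶻ + 5 *ᶻ s) *ᶻ d
                  l₂ = ℤR.solve-∀
          go : (∃ λ x → x ∈ R × label x % s ≡ n % s) → (+ n -ᶻ + 5 *ᶻ + s) *ᶻ d ∈ D 1127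
          go (x , x∈ , e) = fin (m≤n⇒∃[o]m+o≡n (quot≤ (label x) 8 (proj₁ (label-ok x x∈))))
            where
              b = label x / s
              fin : (∃ λ b' → b + b' ≡ 8) → (+ n -ᶻ + 5 *ᶻ + s) *ᶻ d ∈ D 1127
              fin (b' , be) = D-≈ 1127 eq (D-+ 117 1010 x _ (R-0 x x∈) (centre 10 (a + b') 101 x₀ x₀∈ (+-mono-≤ (quot≤ n 10 n≤) (≤-trans (m≤n+m b' b) (≤-trans (≤≡ be) (lit 8 10))))))
                where
                  eq : x +ᶻ (+ (a + b') *ᶻ x₀ -ᶻ + 10 *ᶻ x₀) ≈ (+ n -ᶻ + 5 *ᶻ + s) *ᶻ d
                  eq = ≈-trans (≈-+ (proj₂ (label-ok x x∈)) (≈-- (≈-* (+ (a + b')) (≈-sym sd≈x₀)) (≈-* (+ 10) (≈-sym sd≈x₀))))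
                    (≡⇒≈ (trans (cong (λ z → ((z -ᶻ + 3 *ᶻ + s) *ᶻ d) +ᶻ (+ (a + b') *ᶻ (+ s *ᶻ d) -ᶻ + 10 *ᶻ (+ s *ᶻ d))) (trans (div (label x)) (cong (λ m → + m +ᶻ + b *ᶻ + s) e)))
                      (trans (l (+ (n % s)) (+ a) (+ b) (+ b') (+ s) d (cong +_ be)) (cong (λ z → (z -ᶻ + 5 *ᶻ + s) *ᶻ d) (sym (div n))))))

      opaque
        dinv : Σ ℤ λ e → d *ᶻ e ≈ + 1
        dinv = inverse d d≉0

      -- The multiples of t together with the multiples of d below |t| fill out a long progression.
      bound : ∀ k M t → 1127 + k ≤ K → t ∈ D 1 → t ≈ + M *ᶻ d → M ≤ 5 * s → 2 * k * M ≤ # (D (1127 + k))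
      bound k zero t _ _ _ _ = ≤-trans (≤≡ (*-zeroʳ (2 * k))) z≤n
      bound k M@(suc _) t k≤ t∈ t≈ M≤ = run≤# (D (1127 + k)) c d (proj₁ dinv) (2 * k * M) (proj₂ dinv) (D<p _ k≤) inside
        where
          c = -ᶻ (+ k *ᶻ + M *ᶻ d)
          l : ∀ k M d a b → ((((b +ᶻ + 5 *ᶻ + s) -ᶻ + 5 *ᶻ + s) *ᶻ d) +ᶻ (a *ᶻ (M *ᶻ d) -ᶻ k *ᶻ (M *ᶻ d))) ≡ (-ᶻ (k *ᶻ M *ᶻ d)) +ᶻ d *ᶻ (b +ᶻ a *ᶻ M)
          l k M d a b = l′ k M d a b (+ s)
            where l′ : ∀ k M d a b s → ((((b +ᶻ + 5 *ᶻ s) -ᶻ + 5 *ᶻ s) *ᶻ d) +ᶻ (a *ᶻ (M *ᶻ d) -ᶻ k *ᶻ (M *ᶻ d))) ≡ (-ᶻ (k *ᶻ M *ᶻ d)) +ᶻ d *ᶻ (b +ᶻ a *ᶻ M)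
                  l′ = ℤR.solve-∀
          inside : ∀ n → n < 2 * k * M → c +ᶻ d *ᶻ + n ∈ D (1127 + k)
          inside n n< = D-≈ (1127 + k) eq (D-mono _ (≤≡ (cong (λ z → 1127 + z) (*-identityʳ k))) (D-+ 1127 (k * 1) _ _ (multiples (b + 5 * s) b≤) (centre k a 1 t t∈ a≤)))
            where
              a = n / M
              b = n % M
              ndiv : + n ≡ + b +ᶻ + a *ᶻ + M
              ndiv = trans (cong +_ (m≡m%n+[m/n]*n n M)) (trans (ℤ.pos-+ b (a * M)) (cong (+ b +ᶻ_) (ℤ.pos-* a M)))
              b≤ : b + 5 * s ≤ 10 * s
              b≤ = ≤-trans (+-monoˡ-≤ (5 * s) (≤-trans (<⇒≤ (m%n<n n M)) M≤)) (≤≡ (l₅ s))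
                where l₅ : ∀ s → 5 * s + 5 * s ≡ 10 * s
                      l₅ = solve-∀
              a≤ : a ≤ k + k
              a≤ = *-cancelʳ-≤ a (k + k) M (≤-trans (m≤n+m _ b) (≤-trans (≥≡ (m≡m%n+[m/n]*n n M)) (≤-trans (<⇒≤ n<) (≤≡ (cong (_* M) (cong (λ z → k + z) (+-identityʳ k)))))))
              eq : ((+ (b + 5 * s) -ᶻ + 5 *ᶻ + s) *ᶻ d) +ᶻ (+ a *ᶻ t -ᶻ + k *ᶻ t) ≈ c +ᶻ d *ᶻ + n
              eq = ≈-trans (≈-+ (≡⇒≈ (cong (λ z → (z -ᶻ + 5 *ᶻ + s) *ᶻ d) (trans (ℤ.pos-+ b (5 * s)) (cong (+ b +ᶻ_) (ℤ.pos-* 5 s))))) (≈-- (≈-* (+ a) t≈) (≈-* (+ k) t≈)))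
                (≡⇒≈ (trans (l (+ k) (+ M) d (+ a) (+ b)) (cong (λ z → c +ᶻ d *ᶻ z) (sym ndiv))))

      -- `coord` gives the coordinate O - 3s with O ≤ 8s; up to the sign of t it is some M ≤ 5s, as
      -- `bound` requires. Since |D (1127 + k)| is about 2(1127 + k)ρ, a large k forces M to exceed
      -- ρ only slightly.
      tight : ∀ k t → 1127 + k ≤ K → t ∈ D 1 → ∃ λ M → (t ≈ + M *ᶻ d ⊎ -ᶻ t ≈ + M *ᶻ d) × 2 * k * M ≤ # (D (1127 + k))
      tight k t k≤ t∈ = go (coord t (D-mono t (lit 1 186) t∈))
        where
          Goal = ∃ λ M → (t ≈ + M *ᶻ d ⊎ -ᶻ t ≈ + M *ᶻ d) × 2 * k * M ≤ # (D (1127 + k))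
          3s : + 3 *ᶻ + s ≡ + (3 * s)
          3s = sym (ℤ.pos-* 3 s)
          go : (∃ λ O → O ≤ 8 * s × t ≈ (+ O -ᶻ + 3 *ᶻ + s) *ᶻ d) → Goal
          go (O , O≤ , t≈) = cases (≤-total (3 * s) O)
            where
              cases : 3 * s ≤ O ⊎ O ≤ 3 * s → Goal
              cases (inj₁ le) = up (m≤n⇒∃[o]m+o≡n le)
                where
                  up : (∃ λ M → 3 * s + M ≡ O) → Goal
                  up (M , e) = M , inj₁ t≈′ , bound k M t k≤ t∈ t≈′ (+-cancelˡ-≤ (3 * s) _ _ (≤-trans (≤≡ e) (≤-trans O≤ (≤≡ (l₈ s)))))
                    where
                      l₈ : ∀ s → 8 * s ≡ 3 * s + 5 * s
                      l₈ = solve-∀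
                      l₉ : ∀ a b → (a +ᶻ b) -ᶻ a ≡ b
                      l₉ = ℤR.solve-∀
                      t≈′ : t ≈ + M *ᶻ d
                      t≈′ = ≈-trans t≈ (≡⇒≈ (cong (_*ᶻ d) (trans (cong₂ _-ᶻ_ (trans (cong +_ (sym e)) (ℤ.pos-+ (3 * s) M)) 3s) (l₉ (+ (3 * s)) (+ M)))))
              cases (inj₂ le) = down (m≤n⇒∃[o]m+o≡n le)
                where
                  down : (∃ λ M → O + M ≡ 3 * s) → Goal
                  down (M , e) = M , inj₂ t≈′ , bound k M (-ᶻ t) k≤ (D-neg 1 t t∈) t≈′ (≤-trans (m≤n+m M O) (≤-trans (≤≡ e) (*-monoˡ-≤ s (lit 3 5))))
                    where
                      l₉ : ∀ a b d → -ᶻ ((a -ᶻ (a +ᶻ b)) *ᶻ d) ≡ b *ᶻ d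
                      l₉ = ℤR.solve-∀
                      t≈′ : -ᶻ t ≈ + M *ᶻ d
                      t≈′ = ≈-trans (≈-neg t≈) (≡⇒≈ (trans (cong (λ z → -ᶻ ((+ O -ᶻ z) *ᶻ d)) (trans 3s (trans (cong +_ (sym e)) (ℤ.pos-+ O M)))) (l₉ (+ O) (+ M) d)))

  -- The norm balls of a large set form a chain

  crude-ar : ∀ s V → 1 ≤ s → 2 * s * V ≤ s * V + 2 * s * (2 * s) → V ≤ 4 * s
  crude-ar s V h₁ h₂ = *-cancelˡ-≤ s {{>-nonZero h₁}} (lin 0 h₂ (solve (s ∷ V ∷ [])))

  layer-ar : ∀ s k V n L → 1 ≤ s → suc k * s * V ≤ n + suc k * s * (suc k * s) → n + s * L ≤ suc k * s * V → L ≤ suc k * (suc k * s)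
  layer-ar s k V n L h₁ h₂ h₃ = *-cancelˡ-≤ s {{>-nonZero h₁}} (lin 0 (h₂ ⊞ h₃) (solve (s ∷ k ∷ V ∷ n ∷ L ∷ [])))

  upper-ar : ∀ k s v L Q → 2 * Q ≡ k * suc k → Q * v ≤ L + 2 * Q → L ≤ suc k * (suc k * s) → suc k * (k * v) ≤ suc k * (2 * suc k * s + 2 * k)
  upper-ar k s v L Q e h₁ h₂ = lin 0 (2 ⊠ h₁ ⊞ 2 ⊠ h₂ ⊞ v ⊠ ≥≡ e ⊞ 2 ⊠ ≤≡ e) (solve (k ∷ s ∷ v ∷ L ∷ Q ∷ []))

  width-ar : ∀ K B w x E ρ k v → ρ ≡ x + 3 * E → 3 * E ≤ x → x ≤ B * w + B → 3 ≤ w → k ≤ K →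
    (16 * K * B) * v ≤ 2 * suc (16 * K * B) * (k * ρ) + 2 * (16 * K * B) → (16 * K * B) * v ≤ (16 * K * B) * (2 * k * ρ + w)
  width-ar K B w x E ρ k v refl h₁ h₂ h₃ h₄ h₅ =
    lin 0 (h₅ ⊞ (2 * (x + 3 * E)) ⊠ h₄ ⊞ (2 * K) ⊠ h₁ ⊞ (4 * K) ⊠ h₂ ⊞ (12 * K * B) ⊠ h₃) (solve (K ∷ B ∷ w ∷ x ∷ E ∷ k ∷ v ∷ []))

  low-ar : ∀ K x x₀ E ρ k v v₁ w → ρ ≡ x + 3 * E → x ≤ x₀ + E → x₀ + x₀ ≤ v₁ + 2 → k * v₁ ≤ v + 2 * k → k ≤ K → 1 ≤ E → 12 * K * E ≤ w →
    2 * k * ρ ≤ v + w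
  low-ar K x x₀ E ρ k v v₁ w refl h₁ h₂ h₃ h₄ h₅ h₆ =
    lin 0 ((2 * k) ⊠ h₁ ⊞ k ⊠ h₂ ⊞ h₃ ⊞ (12 * E) ⊠ h₄ ⊞ (4 * k) ⊠ h₅ ⊞ h₆) (solve (K ∷ x ∷ x₀ ∷ E ∷ k ∷ v ∷ v₁ ∷ w ∷ []))

  wlow-ar : ∀ K B x w E → 12 * K * B * E ≤ x → x < B * w + B → B * (12 * K * E) < B * suc w
  wlow-ar K B x w E h₁ h₂ = lin 0 (h₁ ⊞ h₂) (solve (K ∷ B ∷ x ∷ w ∷ E ∷ []))

  ball-ar : ∀ τ p a b c V T → a + b ≡ p → c ≡ V → τ * (a + b + c) ≤ T + τ * τ + τ * p → τ * V ≤ T + τ * τ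
  ball-ar τ _ a b _ V T refl refl h = lin 0 h (solve (τ ∷ a ∷ b ∷ V ∷ T ∷ []))

  diff-ar : ∀ p x y z c g E → p ≤ x + y + z + E → z + c ≡ p → ∀ n → g + n ≡ c → y ≤ g + 2 * E → n ≤ x + 3 * E
  diff-ar _ x y z _ g E h₁ refl n refl h₂ = lin 0 (h₁ ⊞ h₂) (solve (x ∷ y ∷ z ∷ g ∷ E ∷ n ∷ []))

  good-ar : ∀ x x₀ m E t → x₀ + m ≡ x → suc E * m ≤ t → t ≤ E * E → x ≤ x₀ + E
  good-ar _ x₀ m E t refl h₁ h₂ = +-monoʳ-≤ x₀ (≮⇒≥ λ E<m → <⇒≱ (sq< E m E<m) (≤-trans h₁ h₂))
    where sq< : ∀ E m → E < m → E * E < suc E * m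
          sq< E m h = lin (2 * E) (suc E ⊠ h) (solve (E ∷ m ∷ []))

  ext-ar : ∀ n x₀ x E i M → n + x₀ ≤ E + (i + suc M) → x ≤ x₀ + E → n + x ≤ i + (2 * E + 1 + M)
  ext-ar n x₀ x E i M h₁ h₂ = lin 0 (h₁ ⊞ h₂) (solve (n ∷ x₀ ∷ x ∷ E ∷ i ∷ M ∷ []))

  room-ar : ∀ K k ρ p z c m v → z + c ≡ p → k ≤ K → 1 ≤ K → 2 * (suc (suc m) * (K * ρ)) ≤ z → 2 * (suc (suc m) * (K * ρ)) ≤ c → v ≤ 4 * (k * ρ) → v + ρ ≤ p
  room-ar K k ρ _ z c m v refl h₁ h₂ h₃ h₄ h₅ =
    lin (3 * (K * ρ) + 4 * (m * (K * ρ))) ((4 * ρ) ⊠ h₁ ⊞ ρ ⊠ h₂ ⊞ h₃ ⊞ h₄ ⊞ h₅) (solve (K ∷ k ∷ ρ ∷ z ∷ c ∷ m ∷ v ∷ []))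

  ∑-suc² : ∀ n → 2 * ∑ n suc ≡ n * suc n
  ∑-suc² zero = refl
  ∑-suc² (suc n) = trans (*-distribˡ-+ 2 (∑ n suc) (suc n)) (trans (cong (_+ 2 * suc n) (∑-suc² n)) (l n))
    where l : ∀ n → n * suc n + 2 * suc n ≡ suc n * suc (suc n)
          l = solve-∀

  ∑-slide : ∀ L (f : ℤ → ℕ) → (∀ x → f x ≤ 1) → ∀ i → ∑ L (λ n → f (+ n -ᶻ + i)) ≤ i + ∑ L (λ n → f (+ n))
  ∑-slide L f h zero = ≤≡ (∑-cong L λ n _ → cong f (ℤ.+-identityʳ (+ n)))
  ∑-slide L f h (suc i) = ≤-trans (one L (λ x → f (x -ᶻ + i)) (λ x → h _)) (s≤s (∑-slide L f h i))
    where
      one : ∀ L (g : ℤ → ℕ) → (∀ x → g x ≤ 1) → ∑ L (λ n → f (+ n -ᶻ + suc i)) ≤ 1 + ∑ L (λ n → f (+ n -ᶻ + i))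
      one zero g _ = z≤n
      one (suc L) g b = ≤-trans (≤≡ (∑-head L _)) (≤-trans (h _ ⊞ ≤≡ (∑-cong L λ n _ → cong f (l (+ n) (+ i)))) (s≤s (m≤m+n _ _)))
        where l : ∀ n i → (+ 1 +ᶻ n) -ᶻ (+ 1 +ᶻ i) ≡ n -ᶻ i
              l = ℤR.solve-∀

  least : ∀ (f : ℕ → Bool) n → f n ≡ true → ∃ λ m → f m ≡ true × m ≤ n × (∀ k → f k ≡ true → m ≤ k)
  least f n fn = go n 0 refl (λ k k< → ⊥-elim (n≮0 k<))
    where
      go : ∀ fuel i → i + fuel ≡ n → (∀ k → k < i → f k ≡ false) → ∃ λ m → f m ≡ true × m ≤ n × (∀ k → f k ≡ true → m ≤ k)
      go fuel i e below with f i in fi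
      ... | true = i , fi , subst (i ≤_) e (m≤m+n i fuel) , λ k fk → ≮⇒≥ λ k<i → absurd fk (below k k<i)
        where absurd : ∀ {b : Bool} → b ≡ true → b ≡ false → ⊥
              absurd refl ()
      go zero i e below | false with trans (sym fn) (trans (cong f (trans (sym e) (+-identityʳ i))) fi)
      ... | ()
      go (suc fuel) i e below | false = go fuel (suc i) (trans (sym (+-suc i fuel)) e) λ k k< → [ (λ lt → below k lt) , (λ { refl → fi }) ]′ (m≤n⇒m<n∨m≡n (≤-pred k<))

  module Cores (p : ℕ) (pr : Prime p) where
    open Zp p pr
    open Sets p pr
    open PSet
    open Tri p pr
    open Triple
    open Chains p pr
    open Coordinates p pr

    opaque
      unfolding σ

      σ-support : ∀ (f : ℤ → ℕ) L → L ≤ p → (∀ n → n < p → L ≤ n → f (+ n) ≡ 0) → σ f ≡ ∑ L (λ n → f (+ n))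
      σ-support f L L≤p h with m≤n⇒∃[o]m+o≡n L≤p
      ... | k , e = trans (cong (λ q → ∑ q (λ n → f (+ n))) (sym e)) (trans (∑-split L k _) (trans (cong₂ _+_ refl (∑-0 k (λ i i<k → h (L + i) (subst (L + i <_) e (+-monoʳ-< L i<k)) (m≤m+n L i)))) (+-identityʳ _)))

    σ∑-swap : ∀ n (f : ℕ → ℤ → ℕ) → σ (λ x → ∑ n (λ m → f m x)) ≡ ∑ n (λ m → σ (f m))
    σ∑-swap n f = sym (∑σ-swap n f)

    module Balls (Z : PSet) where

      ball : ℕ → PSet
      ball m = level (N Z) (per-N Z) (λ n → n ≤ᵇ m)

      ball-≤ : ∀ {m t} → N Z t ≤ m → t ∈ ball m
      ball-≤ = ≤ᵇ-true

      ≤-ball : ∀ {m} t → t ∈ ball m → N Z t ≤ m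
      ≤-ball t = ≤ᵇ-true⁻¹ {N Z t}

      ball-+ : ∀ {i j} x y → x ∈ ball i → y ∈ ball j → x +ᶻ y ∈ ball (i + j)
      ball-+ x y h k = ball-≤ {t = x +ᶻ y} (≤-trans (N-+ Z x y) (+-mono-≤ (≤-ball x h) (≤-ball y k)))

      ball-neg : ∀ {i} x → x ∈ ball i → -ᶻ x ∈ ball i
      ball-neg x h = ball-≤ {t = -ᶻ x} (≤-trans (≤≡ (N-neg Z x)) (≤-ball x h))

      ball-0 : ∀ i → + 0 ∈ ball i
      ball-0 i = ball-≤ {t = + 0} (≤-trans (≤≡ (N-0 Z)) z≤n)

      -- Pollard's theorem for Z, -Zᶜ and a set W of translations.
      ballSum : ∀ W τ → τ ≤ # Z → τ ≤ # (∁ Z) → τ * # W ≤ σ (λ t → ⟦ W ∋ t ⟧ * N Z t) + τ * τ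
      ballSum W τ h₁ h₂ = ball-ar τ p (# Z) (# (neg (∁ Z))) (# (neg W)) (# W) _ ab (#-neg W)
          (subst (λ T → τ * (# Z + # (neg (∁ Z)) + # (neg W)) ≤ T + τ * τ + τ * p) count
            (pollard _ Z (neg (∁ Z)) (neg W) τ ≤-refl h₁ (≤-trans h₂ (≥≡ (#-neg (∁ Z)))) (≤-trans (≤≡ ab) (m≤m+n p τ))))
        where
          ab : # Z + # (neg (∁ Z)) ≡ p
          ab = trans (cong₂ _+_ refl (#-neg (∁ Z))) (#-∁ Z)
          l₁ : ∀ x t → -ᶻ (t +ᶻ (-ᶻ x)) ≡ x -ᶻ t
          l₁ = ℤR.solve-∀
          l₂ : ∀ x t → -ᶻ (-ᶻ (x +ᶻ (t +ᶻ (-ᶻ x)))) ≡ t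
          l₂ = ℤR.solve-∀
          l₃ : ∀ a b c → a * (b * c) ≡ c * (a * b)
          l₃ = solve-∀
          pw : ∀ x t → ⟦ Z ∋ x ⟧ * (⟦ neg (∁ Z) ∋ (t +ᶻ (-ᶻ x)) ⟧ * ⟦ neg W ∋ (-ᶻ (x +ᶻ (t +ᶻ (-ᶻ x)))) ⟧) ≡ ⟦ W ∋ t ⟧ * ⟦ (Z ∋ x) ∧ not (Z ∋ (x -ᶻ t)) ⟧
          pw x t = trans (cong₂ (λ a b → ⟦ Z ∋ x ⟧ * (⟦ not (Z ∋ a) ⟧ * ⟦ W ∋ b ⟧)) (l₁ x t) (l₂ x t))
            (trans (l₃ ⟦ Z ∋ x ⟧ ⟦ not (Z ∋ (x -ᶻ t)) ⟧ ⟦ W ∋ t ⟧) (cong (⟦ W ∋ t ⟧ *_) (sym (⟦∧⟧ (Z ∋ x) _))))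
          count : T Z (neg (∁ Z)) (neg W) ≡ σ (λ t → ⟦ W ∋ t ⟧ * N Z t)
          count = trans (σ-cong λ x → trans (sym (σ-shift (per-* {λ _ → ⟦ Z ∋ x ⟧} (λ _ → refl) (per-* (per1 (neg (∁ Z))) (per-refl (neg W) x))) (-ᶻ x))) (σ-cong (pw x)))
            (trans (σ-swap (λ x t → ⟦ W ∋ t ⟧ * ⟦ (Z ∋ x) ∧ not (Z ∋ (x -ᶻ t)) ⟧)) (σ-cong λ t → σ-* ⟦ W ∋ t ⟧ _))

      -- `ballSum` with τ = 2m: norms in the ball V are at most m, so 2m|V| ≤ m|V| + 4m².
      crude : ∀ m → 1 ≤ m → 2 * m ≤ # Z → 2 * m ≤ # (∁ Z) → # (ball m) ≤ 4 * m
      crude m m≥1 h₁ h₂ = crude-ar m (# (ball m)) m≥1 (≤-trans (ballSum (ball m) (2 * m) h₁ h₂) (+-monoˡ-≤ _ (≤-trans (σ-mono pw) (≤≡ (σ-* m _)))))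
        where
          pw : ∀ t → ⟦ ball m ∋ t ⟧ * N Z t ≤ m * ⟦ ball m ∋ t ⟧
          pw t = go (ball m ∋ t) refl
            where go : ∀ b → (ball m ∋ t) ≡ b → ⟦ b ⟧ * N Z t ≤ m * ⟦ b ⟧
                  go true e = ≤-trans (≤≡ (+-identityʳ _)) (≤-trans (≤-ball t e) (≥≡ (*-identityʳ m)))
                  go false _ = z≤n

      layers : ℕ → ℕ → ℕ → ℕ
      layers s k n = ∑ k (λ i → ⟦ n ≤ᵇ suc i * s ⟧)

      layers-out : ∀ s k n → suc k * s < n → layers s k n ≡ 0
      layers-out s k n lt = ∑-0 k λ i i<k → cong ⟦_⟧ (f i i<k)
        where f : ∀ i → i < k → (n ≤ᵇ suc i * s) ≡ false
              f i i<k with n ≤ᵇ suc i * s in e′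
              ... | false = refl
              ... | true = ⊥-elim (<⇒≱ lt (≤-trans (≤ᵇ-true⁻¹ e′) (*-monoˡ-≤ s (≤-trans i<k (n≤1+n k)))))

      layers-in : ∀ s k n → n ≤ suc k * s → n + s * layers s k n ≤ suc k * s
      layers-in s zero n h = ≤-trans (≤≡ (trans (cong₂ _+_ refl (*-zeroʳ s)) (+-identityʳ n))) h
      layers-in s (suc k) n h with n ≤ᵇ suc k * s in e
      ... | true = ≤-trans (≤≡ (l n s (layers s k n))) (≤-trans (+-monoʳ-≤ s (layers-in s k n (≤ᵇ-true⁻¹ e))) ≤-refl)
        where l : ∀ n s L → n + s * (L + 1) ≡ s + (n + s * L)
              l = solve-∀
      ... | false = ≤-trans (≤≡ (trans (cong (λ z → n + s * z) (trans (+-identityʳ _) (layers-out s k n (≤ᵇ-false⁻¹ e)))) (trans (cong₂ _+_ refl (*-zeroʳ s)) (+-identityʳ n)))) h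

      -- Put τ = (k + 1)s in `ballSum`. On W the norm of t plus s times the number of listed balls
      -- containing t is at most τ; summed over W this cancels τ|W| and leaves τ².
      layerCake : ∀ s k → 1 ≤ s → suc k * s ≤ # Z → suc k * s ≤ # (∁ Z) → ∑ k (λ i → # (ball (suc i * s))) ≤ suc k * (suc k * s)
      layerCake s k s≥1 h₁ h₂ = layer-ar s k (# W) (σ (λ t → ⟦ W ∋ t ⟧ * N Z t)) _ s≥1 (ballSum W (suc k * s) h₁ h₂)
          (subst₂ _≤_ (trans (σ-+ _ _) (cong₂ _+_ refl (trans (σ-* s _) (cong (s *_) (σ∑-swap k _))))) (σ-* (suc k * s) _) (σ-mono pw))
        where
          W = ball (suc k * s)
          pw : ∀ t → ⟦ W ∋ t ⟧ * N Z t + s * layers s k (N Z t) ≤ suc k * s * ⟦ W ∋ t ⟧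
          pw t = go (W ∋ t) refl
            where go : ∀ b → (W ∋ t) ≡ b → ⟦ b ⟧ * N Z t + s * layers s k (N Z t) ≤ suc k * s * ⟦ b ⟧
                  go true e = ≤-trans (+-monoˡ-≤ (s * layers s k (N Z t)) (≤≡ (+-identityʳ (N Z t)))) (≤-trans (layers-in s k (N Z t) (≤-ball t e)) (≥≡ (*-identityʳ (suc k * s))))
                  go false e = ≤-trans (≤≡ (trans (cong (s *_) (layers-out s k (N Z t) (≤ᵇ-false⁻¹ {N Z t} e))) (*-zeroʳ s))) z≤n

      superadd : ∀ k s → # (ball (k * s)) < p → k * # (ball s) ≤ # (ball (k * s)) + 2 * k
      superadd zero s _ = z≤n
      superadd (suc k) s lt = ar k _ _ _ (superadd k s (≤-trans (s≤s (#-mono (ball (k * s)) (ball (s + k * s)) sub)) lt))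
          (cauchyDavenport (ball s) (ball (k * s)) (ball (s + k * s)) (∈⇒# (ball s) {+ 0} (ball-0 s)) (∈⇒# (ball (k * s)) {+ 0} (ball-0 (k * s))) lt (λ x y → ball-+ x y))
        where
          sub : ball (k * s) ⊆ ball (s + k * s)
          sub x h = ball-≤ {t = x} (≤-trans (≤-ball x h) (m≤n+m _ s))
          ar : ∀ k a b c → k * a ≤ b + 2 * k → a + b ≤ c + 2 → suc k * a ≤ c + 2 * suc k
          ar k a b c h₁ h₂ = lin 0 (h₁ ⊞ h₂) (solve (k ∷ a ∷ b ∷ c ∷ []))

      -- `crude` loses a factor of two by using a single radius. Here i|ball s| ≤ |ball (i s)| + 2i
      -- is summed over i ≤ k and compared with `layerCake`, whose bound (k + 1)² s is nearly
      -- attained by balls of size 2is. The outcome is |ball s| ≤ 2s(1 + 1/k) + 2.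
      upperBall : ∀ k s → 1 ≤ s → 2 * (suc k * s) < # Z → 2 * (suc k * s) ≤ # (∁ Z) → k * # (ball s) ≤ 2 * suc k * s + 2 * k
      upperBall k s s≥1 h₁ h₂ = *-cancelˡ-≤ (suc k) (upper-ar k s (# (ball s)) _ (∑ k suc) (∑-suc² k) sum
          (layerCake s k s≥1 (≤-trans (m≤m+n _ _) (<⇒≤ h₁)) (≤-trans (m≤m+n _ _) h₂)))
        where
          small : ∀ i → i ≤ suc k → 1 ≤ i → # (ball (i * s)) < p
          small i i≤ i≥1 = ≤-trans (s≤s (crude (i * s) (*-mono-≤ i≥1 s≥1) (≤-trans m≤ (<⇒≤ h₁)) (≤-trans m≤ h₂))) (≤-trans (ar (i * s) (suc k * s) (# Z) (# (∁ Z)) (*-monoˡ-≤ s i≤) h₁ h₂) (≤≡ (#-∁ Z)))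
            where m≤ : 2 * (i * s) ≤ 2 * (suc k * s)
                  m≤ = *-monoʳ-≤ 2 (*-monoˡ-≤ s i≤)
                  ar : ∀ a b z c → a ≤ b → 2 * b < z → 2 * b ≤ c → 4 * a < z + c
                  ar a b z c h₁ h₂ h₃ = lin 0 (4 ⊠ h₁ ⊞ h₂ ⊞ h₃) (solve (a ∷ b ∷ z ∷ c ∷ []))
          sum : ∑ k suc * # (ball s) ≤ ∑ k (λ i → # (ball (suc i * s))) + 2 * ∑ k suc
          sum = subst₂ _≤_ (trans (∑-cong k (λ i _ → *-comm (suc i) _)) (trans (∑-* k (# (ball s)) suc) (*-comm _ (∑ k suc))))
            (trans (∑-+ k _ _) (cong₂ _+_ refl (∑-* k 2 suc)))
            (∑-mono k (λ i i<k → superadd (suc i) s (small (suc i) (≤-trans i<k (n≤1+n k)) (s≤s z≤n))))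

    -- w = |X|/B is the error granted to the chain. With K₁ = 16KB radii, the relative error 1/K₁ of
    -- `upperBall` costs at most w at each level up to K. Twice the largest radius (K₁ + 1)Kρ, where
    -- ρ ≤ 2|X|, must fit into |Z| and |∁ Z|, whence the factor 4(K₁ + 1)K.
    module Core (K B : ℕ) (X Y Z : PSet) (E : ℕ) (tr : Triple X Y Z E)
                (hB : ∀ w → 300 * (80 * (80 * w)) ≤ B * w) (B≥1 : 1 ≤ B) (K≥ : 20400 ≤ K)
                (E≪x : 12 * K * B * E ≤ # X)
                (x≪y : 4 * (suc (16 * K * B) * K) * # X < # Y) (x≪z : 4 * (suc (16 * K * B) * K) * # X < # Z) where
      open Balls Z

      instance
        B≢0 : NonZero B
        B≢0 = >-nonZero B≥1

      x ρ w K₁ : ℕ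
      x = # X
      ρ = x + 3 * E
      w = x / B
      K₁ = 16 * K * B

      D : ℕ → PSet
      D k = ball (k * ρ)

      K≥1 : 1 ≤ K
      K≥1 = ≤-trans (lit 1 20400) K≥

      12E≤x : 12 * E ≤ x
      12E≤x = ≤-trans (≤-trans (≥≡ (*-identityʳ (12 * E))) (≤-trans (*-monoʳ-≤ (12 * E) (*-mono-≤ K≥1 B≥1)) (≤≡ (l K B E)))) E≪x
        where l : ∀ K B E → 12 * E * (K * B) ≡ 12 * K * B * E
              l = solve-∀

      3E≤x : 3 * E ≤ x
      3E≤x = ≤-trans (*-monoˡ-≤ E (lit 3 12)) 12E≤x

      E≤x : E ≤ x
      E≤x = ≤-trans (m≤m+n E _) 12E≤x

      x≥1 : 1 ≤ x
      x≥1 = ≤-trans (E≥1 tr) E≤x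

      ρ≥1 : 1 ≤ ρ
      ρ≥1 = ≤-trans x≥1 (m≤m+n x _)

      x<y : x < # Y
      x<y = ≤-trans (s≤s (≤-trans (≥≡ (*-identityˡ x)) (*-monoˡ-≤ x (*-mono-≤ (lit 1 4) (*-mono-≤ (s≤s (z≤n {16 * K * B})) K≥1))))) x≪y

      x<z : x < # Z
      x<z = ≤-trans (s≤s (≤-trans (≥≡ (*-identityˡ x)) (*-monoˡ-≤ x (*-mono-≤ (lit 1 4) (*-mono-≤ (s≤s (z≤n {16 * K * B})) K≥1))))) x≪z

      y≤c : # Y ≤ # (∁ Z)
      y≤c = ar p x (# Y) (# Z) (# (∁ Z)) E (robustCD X Y Z E (E≥1 tr) E≤x (≤-trans E≤x (<⇒≤ x<y)) (≤-trans E≤x (<⇒≤ x<z)) (T≤ tr)) (#-∁ Z) (≤-trans (*-monoˡ-≤ E (lit 2 3)) 3E≤x)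
        where ar : ∀ p x y z c E → x + y + z ≤ p + 2 * E → z + c ≡ p → 2 * E ≤ x → y ≤ c
              ar _ x y z c E h₁ refl h₂ = lin 0 (h₁ ⊞ h₂) (solve (x ∷ y ∷ z ∷ c ∷ E ∷ []))

      top : ∀ k → k ≤ K → 2 * (suc K₁ * (k * ρ)) ≤ 4 * (suc K₁ * K) * x
      top k k≤ = ≤-trans (*-monoʳ-≤ 2 (*-monoʳ-≤ (suc K₁) (*-mono-≤ k≤ (+-monoʳ-≤ x 3E≤x)))) (≤≡ (l K₁ K x))
        where l : ∀ k K x → 2 * (suc k * (K * (x + x))) ≡ 4 * (suc k * K) * x
              l = solve-∀

      topZ : ∀ k → k ≤ K → 2 * (suc K₁ * (k * ρ)) < # Z
      topZ k k≤ = ≤-trans (s≤s (top k k≤)) x≪z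

      topC : ∀ k → k ≤ K → 2 * (suc K₁ * (k * ρ)) ≤ # (∁ Z)
      topC k k≤ = ≤-trans (top k k≤) (≤-trans (<⇒≤ x≪y) y≤c)

      xdiv : x ≡ x % B + w * B
      xdiv = m≡m%n+[m/n]*n x B

      x<Bw : x < B * w + B
      x<Bw = ≤-trans (≤≡ (cong suc xdiv)) (≤-trans (+-monoˡ-≤ (w * B) (m%n<n x B)) (≤≡ (trans (+-comm B _) (cong (_+ B) (*-comm w B)))))

      Bw≤x : B * w ≤ x
      Bw≤x = ≤-trans (≤≡ (*-comm B w)) (≤-trans (m≤n+m _ (x % B)) (≥≡ xdiv))

      12KE≤w : 12 * K * E ≤ w
      12KE≤w = ≤-pred (*-cancelˡ-< B _ _ (wlow-ar K B x w E E≪x x<Bw))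

      w≥3 : 3 ≤ w
      w≥3 = ≤-trans (≤-trans (lit 3 12) (*-mono-≤ (*-mono-≤ (≤-refl {12}) K≥1) (E≥1 tr))) 12KE≤w

      f : ℤ → ℕ
      f u = σ (λ y → ⟦ Y ∋ y ⟧ * ⟦ Z ∋ (-ᶻ (u +ᶻ y)) ⟧)

      f-≈ : ∀ {u v} → u ≈ v → f u ≡ f v
      f-≈ h = σ-cong λ y → cong (λ b → ⟦ Y ∋ y ⟧ * ⟦ b ⟧) (∈-≈ Z (≈-neg (≈-+ h (≈-refl {y}))))

      Good : PSet
      Good = X ∩ level f (≈-per f-≈) (λ n → n ≤ᵇ E)

      Good⊆X : Good ⊆ X
      Good⊆X u h = ∧-l h

      -- An element of X outside `Good` lies in more than E zero-sum triples, and there are at most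
      -- E² of them.
      good-size : x ≤ # Good + E
      good-size = good-ar x (# Good) (# (X ∖ Good)) E (T X Y Z) (trans (cong (_+ # (X ∖ Good)) (σ-cong λ u → cong ⟦_⟧ (idem (X ∋ u) (f u ≤ᵇ E)))) (#-∩∖ X Good))
          (≤-trans (≤≡ (sym (σ-* (suc E) _))) (σ-mono λ u → ≤-trans (pw u) (≥≡ (σ-* ⟦ X ∋ u ⟧ _)))) (T≤ tr)
        where
          idem : ∀ a b → a ∧ b ≡ a ∧ (a ∧ b)
          idem true b = refl
          idem false b = refl
          pw : ∀ u → suc E * ⟦ (X ∖ Good) ∋ u ⟧ ≤ ⟦ X ∋ u ⟧ * f u
          pw u = go (X ∋ u) (f u ≤ᵇ E) refl
            where go : ∀ a b → (f u ≤ᵇ E) ≡ b → suc E * ⟦ a ∧ not (a ∧ b) ⟧ ≤ ⟦ a ⟧ * f u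
                  go false b _ = ≤≡ (*-zeroʳ (suc E))
                  go true true _ = ≤-trans (≤≡ (*-zeroʳ (suc E))) z≤n
                  go true false e = ≤-trans (≤≡ (*-identityʳ (suc E))) (≤-trans (≤ᵇ-false⁻¹ {f u} e) (m≤m+n (f u) 0))

      -- All but E of the points -(u + y), and all but E of the -(v + y), with y in Y avoid Z. So ∁
      -- Z meets its translate by v - u in at least |Y| - 2E points; as |∁ Z| ≤ |X| + |Y| + E, the
      -- norm is at most |X| + 3E, which explains the value of ρ.
      good-diff : ∀ u v → u ∈ Good → v ∈ Good → u -ᶻ v ∈ D 1
      good-diff u v u∈ v∈ = ball-≤ {t = u -ᶻ v} (≤-trans (≤≡ (sym (trans (N-∁ Z (-ᶻ (u -ᶻ v))) (N-neg Z (u -ᶻ v)))))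
          (≤-trans (diff-ar p x (# Y) (# Z) (# (∁ Z)) (r (∁ Z) t) E (size tr) (#-∁ Z) (N (∁ Z) t) (r+N (∁ Z) t) many) (≥≡ (+-identityʳ ρ))))
        where
          t = -ᶻ (u -ᶻ v)
          l : ∀ u v y → (-ᶻ (u +ᶻ y)) -ᶻ (-ᶻ (u -ᶻ v)) ≡ -ᶻ (v +ᶻ y)
          l = ℤR.solve-∀
          b : ∀ y z z' → ⟦ y ⟧ ≤ ⟦ not z ∧ not z' ⟧ + (⟦ y ⟧ * ⟦ z ⟧ + ⟦ y ⟧ * ⟦ z' ⟧)
          b false z z' = z≤n
          b true true z' = s≤s z≤n
          b true false true = ≤-refl
          b true false false = ≤-refl
          many : # Y ≤ r (∁ Z) t + 2 * E
          many = ≤-trans (σ-mono λ y → ≤-trans (b (Y ∋ y) (Z ∋ (-ᶻ (u +ᶻ y))) (Z ∋ (-ᶻ (v +ᶻ y))))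
                    (≤≡ (cong₂ _+_ (cong (λ z → ⟦ not (Z ∋ (-ᶻ (u +ᶻ y))) ∧ not (Z ∋ z) ⟧) (sym (l u v y))) refl)))
            (≤-trans (≤≡ (trans (σ-+ _ _) (cong₂ _+_ (σ-reflect (per1 (∁ Z ∩ ∁ Z ⟨ t ⟩)) u) (σ-+ _ _))))
              (+-monoʳ-≤ (r (∁ Z) t) (≤-trans (+-mono-≤ (≤ᵇ-true⁻¹ {f u} (∧-r {X ∋ u} u∈)) (≤ᵇ-true⁻¹ {f v} (∧-r {X ∋ v} v∈))) (≤≡ (cong (λ z → E + z) (sym (+-identityʳ E)))))))

      crudeD : ∀ k → 1 ≤ k → k ≤ K → # (D k) ≤ 4 * (k * ρ)
      crudeD k k≥1 k≤ = crude (k * ρ) (*-mono-≤ k≥1 ρ≥1) (≤-trans half (<⇒≤ (topZ k k≤))) (≤-trans half (topC k k≤))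
        where half : 2 * (k * ρ) ≤ 2 * (suc K₁ * (k * ρ))
              half = *-monoʳ-≤ 2 (m≤m+n (k * ρ) _)

      K₁≥1 : 1 ≤ K₁
      K₁≥1 = *-mono-≤ (*-mono-≤ (lit 1 16) K≥1) B≥1

      roomD : ∀ k → 1 ≤ k → k ≤ K → # (D k) + ρ ≤ p
      roomD k k≥1 k≤ = go (m≤n⇒∃[o]m+o≡n K₁≥1)
        where go : (∃ λ m → 1 + m ≡ K₁) → # (D k) + ρ ≤ p
              go (m , e) = room-ar K k ρ p (# Z) (# (∁ Z)) m (# (D k)) (#-∁ Z) k≤ K≥1
                (subst (λ q → 2 * (suc q * (K * ρ)) ≤ # Z) (sym e) (<⇒≤ (topZ K ≤-refl)))
                (subst (λ q → 2 * (suc q * (K * ρ)) ≤ # (∁ Z)) (sym e) (topC K ≤-refl)) (crudeD k k≥1 k≤)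

      <pD : ∀ k → 1 ≤ k → k ≤ K → # (D k) < p
      <pD k k≥1 k≤ = ≤-trans (≤-trans (≤≡ (+-comm 1 _)) (+-monoʳ-≤ _ ρ≥1)) (roomD k k≥1 k≤)

      D0⊆ : ∀ k → D 0 ⊆ D k
      D0⊆ k t h = ball-≤ {t = t} (≤-trans (≤-ball t h) z≤n)

      good-nonempty : 1 ≤ # Good
      good-nonempty = +-cancelʳ-≤ E _ _ (≤-trans (≤-trans (+-monoˡ-≤ E (E≥1 tr)) (≤-trans (+-monoʳ-≤ E (m≤m+n E _)) 3E≤x)) good-size)

      one-low : # Good + # Good ≤ # (D 1) + 2
      one-low = ≤-trans (≤≡ (cong (λ z → # Good + z) (sym (#-neg Good))))
        (cauchyDavenport Good (neg Good) (D 1) good-nonempty (≤-trans good-nonempty (≥≡ (#-neg Good))) (<pD 1 ≤-refl K≥1)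
          (λ a b a∈ b∈ → trans (cong (D 1 ∋_) (cong (λ z → a +ᶻ z) (sym (ℤ.neg-involutive b)))) (good-diff a (-ᶻ b) a∈ b∈)))

      -- By `one-low` D 1 has size about 2|X|, and `superadd` multiplies this by k. The losses are
      -- O(KE), which `12KE≤w` absorbs.
      lowerD : ∀ k → 1 ≤ k → k ≤ K → 2 * k * ρ ≤ # (D k) + w
      lowerD k k≥1 k≤ = low-ar K x (# Good) E ρ k (# (D k)) (# (D 1)) w refl good-size one-low
          (subst (λ m → k * # (D 1) ≤ # m + 2 * k) eq (superadd k (1 * ρ) (subst (λ m → # m < p) (sym eq) (<pD k k≥1 k≤)))) k≤ (E≥1 tr) 12KE≤w
        where eq : ball (k * (1 * ρ)) ≡ D k
              eq = cong (λ z → ball (k * z)) (+-identityʳ ρ)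

      upper₁ : ∀ k → 1 ≤ k → k ≤ K → # (D k) ≤ 2 * k * ρ + w
      upper₁ k k≥1 k≤ = *-cancelˡ-≤ K₁ {{>-nonZero K₁≥1}} (width-ar K B w x E ρ k (# (D k)) refl 3E≤x (<⇒≤ x<Bw) w≥3 k≤
        (upperBall K₁ (k * ρ) (*-mono-≤ k≥1 ρ≥1) (topZ k k≤) (topC k k≤)))

      -- Z is neither empty nor everything, hence has no nonzero period.
      D0≤1 : # (D 0) ≤ 1
      D0≤1 = ≤-trans (#-mono (D 0) (pt (+ 0)) zero-only) (≤≡ (#-pt (+ 0)))
        where
          zero-only : D 0 ⊆ pt (+ 0)
          zero-only t h = go (t ≈? + 0)
            where
              z<p : # Z < p
              z<p = ≤-trans (≤-trans (≤≡ (+-comm 1 _)) (+-monoʳ-≤ (# Z) (≤-trans x≥1 (≤-trans (<⇒≤ x<y) y≤c)))) (≤≡ (#-∁ Z))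
              go : Dec (t ≈ + 0) → t ∈ pt (+ 0)
              go (yes e) = does-≈ e
              go (no n) = ⊥-elim (<⇒≱ (N-pos Z t n (≤-trans x≥1 (<⇒≤ x<z)) z<p) (≤-ball t h))

      upperD : ∀ k → k ≤ K → # (D k) ≤ 2 * k * ρ + w
      upperD zero _ = ≤-trans D0≤1 (≤-trans (lit 1 3) w≥3)
      upperD (suc k) h = upper₁ (suc k) (s≤s z≤n) h

      opaque
        chain : Chain K ρ w
        chain = record
          { D = D ; D-0 = λ k → ball-0 (k * ρ)
          ; D-+ = λ j k u v h₁ h₂ → trans (cong (λ m → ball m ∋ (u +ᶻ v)) (*-distribʳ-+ ρ j k)) (ball-+ u v h₁ h₂)
          ; D-neg = λ k u h → ball-neg u h
          ; lower = lowerD ; upper = upperD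
          ; room = λ k k≤ → rm k k≤
          ; w≥1 = ≤-trans (lit 1 3) w≥3
          ; w₁ = 80 * w ; ω = 80 * (80 * w) ; w≪w₁ = ≤-refl ; w₁≪ω = ≤-refl
          ; ω≪ρ = ≤-trans (hB w) (≤-trans Bw≤x (m≤m+n x _)) }
          where
            rm : ∀ k → k ≤ K → # (D k) + ρ ≤ p
            rm zero _ = ≤-trans (+-monoˡ-≤ ρ (#-mono (D 0) (D 1) (D0⊆ 1))) (roomD 1 ≤-refl K≥1)
            rm (suc k) h = roomD (suc k) (s≤s z≤n) h

        -- Outside this block the chain is opaque, so the inclusion at level 1 is exported
        -- separately.
        chain-D : ∀ t → t ∈ D 1 → t ∈ Chain.D chain 1
        chain-D t h = h

  -- One direction for all three sets

  tight-ar : ∀ g ρ w M v → v ≤ 2 * (1127 + 1128 * g) * ρ + w → 2 * (1128 * g) * M ≤ v → w ≤ ρ → g * M ≤ ρ + g * ρ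
  tight-ar g ρ w M v h₁ h₂ h₃ = *-cancelˡ-≤ {g * M} {ρ + g * ρ} 2256 (lin ρ (h₁ ⊞ h₂ ⊞ h₃) (solve (g ∷ ρ ∷ w ∷ M ∷ v ∷ [])))

  six-ar : ∀ ρ w v p m → 2 * 4 * ρ ≤ v + w → v + ρ ≤ p → 2 * w < ρ → m ≤ ρ → 3 * (ρ + m) < p
  six-ar ρ w v p m h₁ h₂ h₃ h₄ = lin (2 * ρ + w) (h₁ ⊞ h₂ ⊞ h₃ ⊞ 3 ⊠ h₄) (solve (ρ ∷ w ∷ v ∷ p ∷ m ∷ []))

  core-ar : ∀ n x E i q → n + x ≤ i + (2 * E + 1 + (x + 3 * E + q)) → n ≤ i + (5 * E + 1 + q)
  core-ar n x E i q h = lin 0 h (solve (n ∷ x ∷ E ∷ i ∷ q ∷ []))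

  -- With h = ⌊x/G⌋, the errors 15E + 1 and ρ/g are at most h/10.
  slack-ar : ∀ G x E h q → x < G * h + G → 1000 * G * E ≤ x → 1 ≤ E → 80 * G * q ≤ x + 3 * E → 1 ≤ G → G * (10 * (15 * E + 1 + q)) ≤ G * h
  slack-ar G x E h q h₁ h₂ h₃ h₄ h₅ = *-cancelˡ-≤ {G * (10 * (15 * E + 1 + q))} {G * h} 8 (lin (5709 * (G * E) + 8) (8 ⊠ h₁ ⊞ 7 ⊠ h₂ ⊞ h₄ ⊞ (88 * G) ⊠ h₃ ⊞ (3 * E) ⊠ h₅) (solve (G ∷ x ∷ E ∷ h ∷ q ∷ [])))

  left-ar : ∀ x r n h E → r + n ≡ x → 10 * n ≤ 11 * h → 4 * h ≤ x → 12 * E ≤ x → 2 * E ≤ r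
  left-ar _ r n h E refl h₁ h₂ h₃ = *-cancelˡ-≤ {2 * E} {r} 40 (lin (22 * r + 22 * n + 4 * E) (4 ⊠ h₁ ⊞ 11 ⊠ h₂ ⊞ 7 ⊠ h₃) (solve (r ∷ n ∷ h ∷ E ∷ [])))

  third-ineq : ∀ n i h E E' q m → n ≤ i + (5 * E' + 1 + q) + 5 * E' + 5 * E → i ≤ h → E ≤ E' → m ≡ 15 * E' + 1 + q → 10 * m ≤ h → 10 * n ≤ 11 * h
  third-ineq n i h E E' q _ h₁ h₂ h₃ refl h₄ = lin 0 (10 ⊠ h₁ ⊞ 10 ⊠ h₂ ⊞ 50 ⊠ h₃ ⊞ h₄) (solve (n ∷ i ∷ h ∷ E ∷ E' ∷ q ∷ []))

  hpos-ar : ∀ G x E h → x < G * h + G → 1000 * G * E ≤ x → 1 ≤ E → G * 1 < G * suc h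
  hpos-ar G x E h h₁ h₂ h₃ = lin (999 * G) (h₁ ⊞ h₂ ⊞ (1000 * G) ⊠ h₃) (solve (G ∷ x ∷ E ∷ h ∷ []))

  module Alignment (p : ℕ) (pr : Prime p) where
    open Zp p pr
    open Sets p pr
    open PSet
    open Tri p pr
    open Triple
    open Chains p pr
    open Coordinates p pr
    open Cores p pr

    -- Differences of at most M₀ steps put X₀ into a block of M₀ + 1 consecutive terms of a
    -- progression; the condition 3M₀ < p prevents wrapping around, and X differs from X₀ by at most
    -- E points.
    module Extent (X X₀ : PSet) (d e : ℤ) (de : d *ᶻ e ≈ + 1) (M₀ E : ℕ) (sub : X₀ ⊆ X) (big : # X ≤ # X₀ + E)
                  (3M<p : 3 * M₀ < p) (b₀ : ℤ) (b₀∈ : b₀ ∈ X₀)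
                  (near : ∀ u v → u ∈ X₀ → v ∈ X₀ → ∃ λ M → M ≤ M₀ × (u -ᶻ v ≈ + M *ᶻ d ⊎ -ᶻ (u -ᶻ v) ≈ + M *ᶻ d)) where

      d-cancel : ∀ a b → a *ᶻ d ≈ b *ᶻ d → a ≈ b
      d-cancel a b h = ≈-trans (≈-sym (one a)) (≈-trans (≈-* e h) (one b))
        where
          l : ∀ e a d → e *ᶻ (a *ᶻ d) ≡ a *ᶻ (d *ᶻ e)
          l = ℤR.solve-∀
          one : ∀ a → e *ᶻ (a *ᶻ d) ≈ a
          one a = ≈-trans (≡⇒≈ (l e a d)) (≈-trans (≈-* a de) (≡⇒≈ (ℤ.*-identityʳ a)))

      line : ℕ → ℤ
      line n = b₀ +ᶻ (+ n -ᶻ + M₀) *ᶻ d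

      first : ∃ λ m → (X₀ ∋ line m) ≡ true × m ≤ M₀ × (∀ k → (X₀ ∋ line k) ≡ true → m ≤ k)
      first = least (λ n → X₀ ∋ line n) M₀ (trans (cong (X₀ ∋_) (l b₀ (+ M₀) d)) b₀∈)
        where l : ∀ b m d → b +ᶻ (m -ᶻ m) *ᶻ d ≡ b
              l = ℤR.solve-∀

      n₀ : ℕ
      n₀ = proj₁ first

      y₀ : ℤ
      y₀ = line n₀

      y₀∈ : y₀ ∈ X₀
      y₀∈ = proj₁ (proj₂ first)

      small<p : ∀ {a} → a ≤ 3 * M₀ → a < p
      small<p h = ≤-trans (s≤s h) 3M<p

      -- A point to the left of y₀ is either some `line k` with k < n₀, against minimality, or lies
      -- more than M₀ and at most 2M₀ steps to the left of b₀, against `near`.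
      noLeft : ∀ u M → u ∈ X₀ → M ≤ M₀ → 1 ≤ M → -ᶻ (u -ᶻ y₀) ≈ + M *ᶻ d → ⊥
      noLeft u M u∈ M≤ M≥1 h = cases (≤-total M n₀)
        where
          u≈ : u ≈ b₀ +ᶻ ((+ n₀ -ᶻ + M₀) -ᶻ + M) *ᶻ d
          u≈ = ≈-trans (≡⇒≈ (l₁ u y₀)) (≈-trans (≈-- (≈-refl {y₀}) h) (≡⇒≈ (l₂ b₀ (+ n₀ -ᶻ + M₀) (+ M) d)))
            where l₁ : ∀ u y → u ≡ y -ᶻ (-ᶻ (u -ᶻ y))
                  l₁ = ℤR.solve-∀
                  l₂ : ∀ b a m d → (b +ᶻ a *ᶻ d) -ᶻ m *ᶻ d ≡ b +ᶻ (a -ᶻ m) *ᶻ d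
                  l₂ = ℤR.solve-∀
          inside : (∃ λ k → M + k ≡ n₀) → ⊥
          inside (k , e₁) = <⇒≱ (≤-trans (+-monoˡ-≤ k M≥1) (≤≡ e₁)) (proj₂ (proj₂ (proj₂ first)) k
              (trans (∈-≈ X₀ (≈-sym (≈-trans u≈ (≡⇒≈ (cong (λ z → b₀ +ᶻ z *ᶻ d) (trans (cong (λ z → (z -ᶻ + M₀) -ᶻ + M) (trans (cong +_ (sym e₁)) (ℤ.pos-+ M k))) (l₃ (+ M) (+ k) (+ M₀)))))))) u∈))
            where l₃ : ∀ M k M₀ → ((M +ᶻ k) -ᶻ M₀) -ᶻ M ≡ k -ᶻ M₀
                  l₃ = ℤR.solve-∀
          outside : (∃ λ k → n₀ + k ≡ M) → ⊥
          outside (zero , e₁) = inside (0 , trans (+-identityʳ M) (trans (sym e₁) (+-identityʳ n₀)))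
          outside (suc k , e₁) = go (near u b₀ u∈ b₀∈)
            where
              q : ℕ
              q = M₀ + suc k
              k≤M₀ : suc k ≤ M₀
              k≤M₀ = ≤-trans (m≤n+m (suc k) n₀) (≤-trans (≤≡ e₁) M≤)
              q≤ : q ≤ 2 * M₀
              q≤ = ≤-trans (+-monoʳ-≤ M₀ k≤M₀) (≤≡ (cong (λ z → M₀ + z) (sym (+-identityʳ M₀))))
              ub : b₀ -ᶻ u ≈ + q *ᶻ d
              ub = ≈-trans (≈-- (≈-refl {b₀}) u≈) (≡⇒≈ (trans (cong (λ z → b₀ -ᶻ (b₀ +ᶻ ((+ n₀ -ᶻ + M₀) -ᶻ z) *ᶻ d)) (trans (cong +_ (sym e₁)) (ℤ.pos-+ n₀ (suc k)))) (trans (l₃ b₀ (+ n₀) (+ M₀) (+ suc k) d) (cong (_*ᶻ d) (sym (ℤ.pos-+ M₀ (suc k)))))))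
                where l₃ : ∀ b n M k d → b -ᶻ (b +ᶻ ((n -ᶻ M) -ᶻ (n +ᶻ k)) *ᶻ d) ≡ (M +ᶻ k) *ᶻ d
                      l₃ = ℤR.solve-∀
              go : (∃ λ M' → M' ≤ M₀ × (u -ᶻ b₀ ≈ + M' *ᶻ d ⊎ -ᶻ (u -ᶻ b₀) ≈ + M' *ᶻ d)) → ⊥
              go (M' , M'≤ , inj₁ h′) = <⇒≢ (≤-trans (s≤s (z≤n {k})) (≤-trans (m≤n+m (suc k) M₀) (m≤n+m q M'))) (sym (≈⇒≡ (small<p (+-mono-≤ M'≤ q≤)) 0<p
                  (d-cancel (+ (M' + q)) (+ 0) (≈-trans (≡⇒≈ (trans (cong (_*ᶻ d) (ℤ.pos-+ M' q)) (ℤ.*-distribʳ-+ d (+ M') (+ q)))) (≈-trans (≈-+ (≈-sym h′) (≈-sym ub)) (≡⇒≈ (l₄ u b₀ d)))))))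
                where l₄ : ∀ u b d → (u -ᶻ b) +ᶻ (b -ᶻ u) ≡ + 0 *ᶻ d
                      l₄ = ℤR.solve-∀
              go (M' , M'≤ , inj₂ h′) = <⇒≢ (≤-trans (s≤s M'≤) (≤-trans (≤≡ (+-comm 1 M₀)) (+-monoʳ-≤ M₀ (s≤s (z≤n {k})))))
                  (≈⇒≡ (small<p (≤-trans M'≤ (m≤m+n M₀ _))) (small<p (≤-trans q≤ (m≤n+m _ M₀))) (d-cancel (+ M') (+ q) (≈-trans (≈-sym h′) (≈-trans (≡⇒≈ (l₄ u b₀)) ub))))
                where l₄ : ∀ u b → -ᶻ (u -ᶻ b) ≡ b -ᶻ u
                      l₄ = ℤR.solve-∀
          cases : M ≤ n₀ ⊎ n₀ ≤ M → ⊥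
          cases (inj₁ le) = inside (m≤n⇒∃[o]m+o≡n le)
          cases (inj₂ le) = outside (m≤n⇒∃[o]m+o≡n le)

      position : ∀ u → u ∈ X₀ → ∃ λ j → j ≤ M₀ × u -ᶻ y₀ ≈ + j *ᶻ d
      position u u∈ = go (near u y₀ u∈ y₀∈)
        where
          go : (∃ λ M → M ≤ M₀ × (u -ᶻ y₀ ≈ + M *ᶻ d ⊎ -ᶻ (u -ᶻ y₀) ≈ + M *ᶻ d)) → ∃ λ j → j ≤ M₀ × u -ᶻ y₀ ≈ + j *ᶻ d
          go (M , M≤ , inj₁ h) = M , M≤ , h
          go (zero , _ , inj₂ h) = 0 , z≤n , ≈-trans (≡⇒≈ (sym (ℤ.neg-involutive (u -ᶻ y₀)))) (≈-trans (≈-neg h) (≡⇒≈ (l d)))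
            where l : ∀ d → -ᶻ (+ 0 *ᶻ d) ≡ + 0 *ᶻ d
                  l = ℤR.solve-∀
          go (suc M , M≤ , inj₂ h) = ⊥-elim (noLeft u (suc M) u∈ M≤ (s≤s z≤n) h)

      V : ℤ → Bool
      V n = X₀ ∋ (y₀ +ᶻ d *ᶻ n)

      L≤p : suc M₀ ≤ p
      L≤p = small<p (m≤m+n M₀ _)

      V-out : ∀ n → n < p → suc M₀ ≤ n → V (+ n) ≡ false
      V-out n n<p n> = go (V (+ n)) refl
        where
          go : ∀ b → V (+ n) ≡ b → b ≡ false
          go false _ = refl
          go true h = ⊥-elim (hit (position _ h))
            where
              l : ∀ y d n → (y +ᶻ d *ᶻ n) -ᶻ y ≡ n *ᶻ d
              l = ℤR.solve-∀
              hit : (∃ λ j → j ≤ M₀ × (y₀ +ᶻ d *ᶻ + n) -ᶻ y₀ ≈ + j *ᶻ d) → ⊥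
              hit (j , j≤ , h′) = <⇒≱ n> (subst (_≤ M₀) (sym (≈⇒≡ n<p (≤-trans (s≤s j≤) L≤p) (d-cancel (+ n) (+ j) (≈-trans (≡⇒≈ (sym (l y₀ d (+ n)))) h′)))) j≤)

      -- In coordinates V lives on [0, M₀]. The norm counts n in V with n - i outside V, thus at
      -- most the gaps of the block after a shift by i. The block has M₀ + 1 - |X₀| gaps and the
      -- shift admits at most i new ones.
      N₀-bound : ∀ i → N X₀ (+ i *ᶻ d) + # X₀ ≤ i + suc M₀
      N₀-bound i = ≤-trans (≤≡ (cong₂ _+_ lhs rhs)) (≤-trans (+-monoˡ-≤ _ (≤-trans (∑-mono (suc M₀) (λ n _ → b (V (+ n)) (V (+ n -ᶻ + i)))) (∑-slide (suc M₀) (λ x → ⟦ not (V x) ⟧) (λ x → ⟦⟧≤1 _) i)))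
          (≤≡ (trans (+-assoc i _ _) (cong (λ z → i + z) (trans (sym (∑-+ (suc M₀) _ _)) (trans (∑-cong (suc M₀) (λ n _ → trans (+-comm ⟦ not (V (+ n)) ⟧ _) (⟦⟧+not (V (+ n))))) (trans (∑-const (suc M₀) 1) (*-identityʳ (suc M₀)))))))))
        where
          b : ∀ u v → ⟦ u ∧ not v ⟧ ≤ ⟦ not v ⟧
          b true v = ≤-refl
          b false v = z≤n
          l : ∀ y d n i → (y +ᶻ d *ᶻ n) -ᶻ i *ᶻ d ≡ y +ᶻ d *ᶻ (n -ᶻ i)
          l = ℤR.solve-∀
          lhs : N X₀ (+ i *ᶻ d) ≡ ∑ (suc M₀) (λ n → ⟦ V (+ n) ∧ not (V (+ n -ᶻ + i)) ⟧)
          lhs = trans (sym (#-affine (X₀ ∖ X₀ ⟨ + i *ᶻ d ⟩) y₀ d e de)) (trans (σ-cong λ n → cong (λ z → ⟦ V n ∧ not (X₀ ∋ z) ⟧) (l y₀ d n (+ i)))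
            (σ-support (λ n → ⟦ V n ∧ not (V (n -ᶻ + i)) ⟧) (suc M₀) L≤p (λ n n<p n> → cong (λ c → ⟦ c ∧ not (V (+ n -ᶻ + i)) ⟧) (V-out n n<p n>))))
          rhs : # X₀ ≡ ∑ (suc M₀) (λ n → ⟦ V (+ n) ⟧)
          rhs = trans (sym (#-affine X₀ y₀ d e de)) (σ-support (λ n → ⟦ V n ⟧) (suc M₀) L≤p (λ n n<p n> → cong ⟦_⟧ (V-out n n<p n>)))

      N-bound : ∀ i → N X (+ i *ᶻ d) + # X ≤ i + (2 * E + 1 + M₀)
      N-bound i = ext-ar (N X t) (# X₀) (# X) E i M₀ (≤-trans (+-monoˡ-≤ (# X₀) split) (≤-trans (≤≡ (+-assoc E _ _)) (+-monoʳ-≤ E (N₀-bound i)))) big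
        where
          t = + i *ᶻ d
          b : ∀ u u₀ v v₀ → (v₀ ≡ true → v ≡ true) → ⟦ u ∧ not v ⟧ ≤ ⟦ u ∧ not u₀ ⟧ + ⟦ u₀ ∧ not v₀ ⟧
          b false u₀ v v₀ _ = z≤n
          b true false v v₀ _ = ≤-trans (⟦⟧≤1 _) (m≤m+n 1 _)
          b true true v false _ = ⟦⟧≤1 (not v)
          b true true v true h with h refl
          ... | refl = z≤n
          rest : # (X ∖ X₀) ≤ E
          rest = +-cancelˡ-≤ (# (X ∩ X₀)) _ _ (≤-trans (≤≡ (#-∩∖ X X₀)) (≤-trans big (+-monoˡ-≤ E (#-mono X₀ (X ∩ X₀) (λ u h → ∧-i (sub u h) h)))))
          split : N X t ≤ E + N X₀ t
          split = ≤-trans (σ-mono λ u → b (X ∋ u) (X₀ ∋ u) (X ∋ (u -ᶻ t)) (X₀ ∋ (u -ᶻ t)) (sub _)) (≤-trans (≤≡ (σ-+ _ _)) (+-monoˡ-≤ _ rest))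

    record Direction (X : PSet) (c : ℕ) : Set where
      field
        d e : ℤ
        de : d *ᶻ e ≈ + 1
        small : ∀ i → N X (+ i *ᶻ d) ≤ i + c

    direction : ∀ K B g .{{_ : NonZero g}} (X Y Z : PSet) (E : ℕ) (tr : Triple X Y Z E)
                (hB : ∀ w → 300 * (80 * (80 * w)) ≤ B * w) (B≥1 : 1 ≤ B) (K≥ : 20400 ≤ K) (K≥g : 1127 + 1128 * g ≤ K) (g≥1 : 1 ≤ g)
                (E≪x : 12 * K * B * E ≤ # X)
                (x≪y : 4 * (suc (16 * K * B) * K) * # X < # Y) (x≪z : 4 * (suc (16 * K * B) * K) * # X < # Z) →
                Direction X (5 * E + 1 + (# X + 3 * E) / g)
    direction K B g X Y Z E tr hB B≥1 K≥ K≥g g≥1 E≪x x≪y x≪z = record { d = d ; e = proj₁ dinv ; de = proj₂ dinv ; small = λ i → core-ar _ (# X) E i q (Ext.N-bound i) }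
      where
        module C = Core K B X Y Z E tr hB B≥1 K≥ E≪x x≪y x≪z
        module Ch = Chain C.chain
        module Ge = Geometry C.chain K≥
        open Lattice C.chain K≥
        ρ = C.ρ
        q = ρ / g
        M₀ = ρ + q
        q≤ρ : q ≤ ρ
        q≤ρ = ≤-trans (≤-trans (≥≡ (*-identityʳ q)) (*-monoʳ-≤ q g≥1)) (≤-trans (m≤n+m _ (ρ % g)) (≥≡ (m≡m%n+[m/n]*n ρ g)))
        bnd : ∀ M → 2 * (1128 * g) * M ≤ # (Ch.D (1127 + 1128 * g)) → M ≤ M₀
        bnd M h = cases (≤-total M ρ)
          where
            gM : g * M ≤ ρ + g * ρ
            gM = tight-ar g ρ C.w M _ (Ch.upper _ K≥g) h Ge.w≤ρ
            cases : M ≤ ρ ⊎ ρ ≤ M → M ≤ M₀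
            cases (inj₁ le) = ≤-trans le (m≤m+n ρ q)
            cases (inj₂ le) = go (m≤n⇒∃[o]m+o≡n le)
              where go : (∃ λ m → ρ + m ≡ M) → M ≤ M₀
                    go (m , refl) = +-monoʳ-≤ ρ (≤-trans (≥≡ (m*n/n≡m m g)) (/-monoˡ-≤ g (≤-trans (≤≡ (*-comm m g)) (+-cancelʳ-≤ (g * ρ) _ _ (≤-trans (≤≡ (trans (+-comm (g * m) _) (sym (*-distribˡ-+ g ρ m)))) gM)))))
        near : ∀ u v → u ∈ C.Good → v ∈ C.Good → ∃ λ M → M ≤ M₀ × (u -ᶻ v ≈ + M *ᶻ d ⊎ -ᶻ (u -ᶻ v) ≈ + M *ᶻ d)
        -- With k = 1128 g, the 1127 levels lost in `tight` and the error w together cost a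
        -- proportion of at most 1/g, so M ≤ ρ + ρ/g.
        near u v u∈ v∈ = go (tight (1128 * g) (u -ᶻ v) K≥g (C.chain-D (u -ᶻ v) (C.good-diff u v u∈ v∈)))
          where go : (∃ λ M → (u -ᶻ v ≈ + M *ᶻ d ⊎ -ᶻ (u -ᶻ v) ≈ + M *ᶻ d) × 2 * (1128 * g) * M ≤ # (Ch.D (1127 + 1128 * g))) → ∃ λ M → M ≤ M₀ × (u -ᶻ v ≈ + M *ᶻ d ⊎ -ᶻ (u -ᶻ v) ≈ + M *ᶻ d)
                go (M , h , h′) = M , bnd M h′ , h
        base : ∃ λ b → b ∈ C.Good
        base = #⇒∈ C.Good C.good-nonempty
        module Ext = Extent X C.Good d (proj₁ dinv) (proj₂ dinv) M₀ E C.Good⊆X C.good-size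
          (six-ar ρ C.w _ p q (Ch.lower 4 (s≤s z≤n) (Ge.≤K 4)) (Ch.room 4 (Ge.≤K 4)) Ge.2w<ρ q≤ρ) (proj₁ base) (proj₂ base) near

    Aligned : PSet → ℤ → ℕ → Set
    Aligned U d h = ∀ i → i ≤ h → 10 * N U (+ i *ᶻ d) ≤ 11 * h

    record Alignable (G m : ℕ) (X Y Z : PSet) : Set where
      field
        d e : ℤ
        de : d *ᶻ e ≈ + 1
        h : ℕ
        h≥1 : 1 ≤ h
        Gh≤ : G * h ≤ m
        X-al : Aligned X d h
        Y-al : Aligned Y d h
        Z-al : Aligned Z d h

    -- Y belongs to both triples: the norm bound goes from X′ to Y in the reduced triple and from Y
    -- to X and Z in the original one. Each transfer costs 5E′ or 5E; h = |X′|/G is so large that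
    -- all errors together are at most h/10.
    align : ∀ G .{{_ : NonZero G}} (X′ X Y Z′ Z : PSet) E′ E → 4 ≤ G → Triple X′ Y Z′ E′ → Triple X Y Z E → E ≤ E′ →
            1000 * G * E′ ≤ # X′ → # X′ ≤ # X → # X′ ≤ # Y → # X′ ≤ # Z → # X′ ≤ # Z′ →
            .{{_ : NonZero (80 * G)}} → Direction X′ (5 * E′ + 1 + (# X′ + 3 * E′) / (80 * G)) → Alignable G (# X′) X Y Z
    align G X′ X Y Z′ Z E′ E G≥4 tr′ tr E≤E′ E≪ x≤x x≤y x≤z x≤z′ dir = record
      { d = d ; e = Direction.e dir ; de = Direction.de dir ; h = h ; h≥1 = h≥1 ; Gh≤ = Gh≤
      ; X-al = λ i i≤ → fin i _ i≤ (≤-trans (transfer (triple-comm tr) (t i) (room Y i x≤y i≤ (nY i i≤) E≤E′) (2E≤ X x≤x) (2E≤ Z x≤z)) (+-monoˡ-≤ (5 * E) (stepY i i≤)))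
      ; Y-al = λ i i≤ → nY i i≤
      ; Z-al = λ i i≤ → fin i _ i≤ (≤-trans (transfer (triple-swap (triple-comm tr)) (t i) (room Y i x≤y i≤ (nY i i≤) E≤E′) (2E≤ Z x≤z) (2E≤ X x≤x)) (+-monoˡ-≤ (5 * E) (stepY i i≤))) }
      where
        x = # X′
        h = x / G
        d = Direction.d dir
        q = (x + 3 * E′) / (80 * G)
        t : ℕ → ℤ
        t i = + i *ᶻ d
        G≥1 : 1 ≤ G
        G≥1 = ≤-trans (s≤s z≤n) G≥4
        xdiv : x ≡ x % G + h * G
        xdiv = m≡m%n+[m/n]*n x G
        x< : x < G * h + G
        x< = ≤-trans (≤≡ (cong suc xdiv)) (≤-trans (+-monoˡ-≤ (h * G) (m%n<n x G)) (≤≡ (trans (+-comm G _) (cong (_+ G) (*-comm h G)))))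
        Gh≤ : G * h ≤ x
        Gh≤ = ≤-trans (≤≡ (*-comm G h)) (≤-trans (m≤n+m _ (x % G)) (≥≡ xdiv))
        4h≤ : 4 * h ≤ x
        4h≤ = ≤-trans (*-monoˡ-≤ h G≥4) Gh≤
        12E : 12 * E′ ≤ x
        12E = ≤-trans (*-monoˡ-≤ E′ (≤-trans (lit 12 1000) (≤-trans (≥≡ (*-identityʳ 1000)) (*-monoʳ-≤ 1000 G≥1)))) E≪
        h≥1 : 1 ≤ h
        h≥1 = ≤-pred (*-cancelˡ-< G _ _ (hpos-ar G x E′ h x< E≪ (E≥1 tr′)))
        m = 15 * E′ + 1 + q
        10m≤h : 10 * m ≤ h
        10m≤h = *-cancelˡ-≤ G (slack-ar G x E′ h q x< E≪ (E≥1 tr′) (≤-trans (≤≡ (*-comm (80 * G) q)) (≤-trans (m≤n+m _ ((x + 3 * E′) % (80 * G))) (≥≡ (m≡m%n+[m/n]*n (x + 3 * E′) (80 * G))))) G≥1)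
        nX : ∀ i → N X′ (t i) ≤ i + (5 * E′ + 1 + q)
        nX i = Direction.small dir i
        fin : ∀ i n → i ≤ h → n ≤ i + (5 * E′ + 1 + q) + 5 * E′ + 5 * E → 10 * n ≤ 11 * h
        fin i n i≤ le = third-ineq n i h E E′ q m le i≤ E≤E′ refl 10m≤h
        2E≤ : ∀ U → x ≤ # U → 2 * E ≤ # U
        2E≤ U x≤ = ≤-trans (*-mono-≤ (lit 2 12) E≤E′) (≤-trans 12E x≤)
        room : ∀ U i → x ≤ # U → i ≤ h → 10 * N U (t i) ≤ 11 * h → ∀ {F} → F ≤ E′ → 2 * F ≤ r U (t i)
        room U i x≤ i≤ n≤ F≤ = ≤-trans (*-monoʳ-≤ 2 F≤) (left-ar (# U) (r U (t i)) (N U (t i)) h E′ (r+N U (t i)) n≤ (≤-trans 4h≤ x≤) (≤-trans 12E x≤))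
        rX : ∀ i → i ≤ h → 10 * N X′ (t i) ≤ 11 * h
        rX i i≤ = fin i _ i≤ (≤-trans (nX i) (≤-trans (m≤m+n _ (5 * E′)) (m≤m+n _ (5 * E))))
        stepY : ∀ i → i ≤ h → N Y (t i) ≤ i + (5 * E′ + 1 + q) + 5 * E′
        stepY i i≤ = ≤-trans (transfer tr′ (t i) (room X′ i ≤-refl i≤ (rX i i≤) ≤-refl) (≤-trans (*-monoˡ-≤ E′ (lit 2 12)) (≤-trans 12E x≤y)) (≤-trans (*-monoˡ-≤ E′ (lit 2 12)) (≤-trans 12E x≤z′))) (+-monoˡ-≤ (5 * E′) (nX i))
        nY : ∀ i → i ≤ h → 10 * N Y (t i) ≤ 11 * h
        nY i i≤ = fin i _ i≤ (≤-trans (stepY i i≤) (m≤m+n _ (5 * E)))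

  -- Sets nearly invariant under short translations are nearly intervals

  ∑-rev : ∀ (t : ℤ → ℕ) z j → ∑ (suc j) (λ i → t (z +ᶻ + i)) ≡ ∑ (suc j) (λ i → t ((z +ᶻ + j) -ᶻ + i))
  ∑-rev t z zero = cong t (sym (ℤ.+-identityʳ (z +ᶻ + 0)))
  ∑-rev t z (suc j) = trans (cong₂ _+_ (∑-rev t z j) refl) (trans (+-comm _ (t (z +ᶻ + suc j)))
    (trans (cong₂ _+_ (cong t (sym (ℤ.+-identityʳ (z +ᶻ + suc j)))) (∑-cong (suc j) (λ i _ → cong t (l z (+ j) (+ i))))) (sym (∑-head (suc j) _))))
    where l : ∀ z j i → (z +ᶻ j) -ᶻ i ≡ (z +ᶻ (+ 1 +ᶻ j)) -ᶻ (+ 1 +ᶻ i)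
          l = ℤR.solve-∀

  ∑-around : ∀ (t : ℤ → ℕ) z h j → j < h → ∑ h (λ i → t (z +ᶻ + i)) ≤ ∑ h (λ i → t ((z +ᶻ + j) +ᶻ + i)) + ∑ h (λ i → t ((z +ᶻ + j) -ᶻ + i))
  ∑-around t z h j j<h with m≤n⇒∃[o]m+o≡n (<⇒≤ j<h)
  ... | k , refl = ≤-trans (≤≡ (∑-split j k _)) (≤-trans (≤≡ (+-comm (∑ j _) _)) (+-mono-≤ upper lower))
    where
      upper : ∑ k (λ i → t (z +ᶻ + (j + i))) ≤ ∑ (j + k) (λ i → t ((z +ᶻ + j) +ᶻ + i))
      upper = ≤-trans (≤≡ (∑-cong k (λ i _ → cong t (trans (cong (z +ᶻ_) (ℤ.pos-+ j i)) (sym (ℤ.+-assoc z (+ j) (+ i))))))) (∑-mono-n _ (m≤n+m k j))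
      lower : ∑ j (λ i → t (z +ᶻ + i)) ≤ ∑ (j + k) (λ i → t ((z +ᶻ + j) -ᶻ + i))
      lower = ≤-trans (∑-mono-n _ (n≤1+n j)) (≤-trans (≤≡ (∑-rev t z j)) (∑-mono-n _ j<h))

  argmin : ∀ (f : ℕ → ℕ) n → ∃ λ i → i < suc n × (∀ j → j < suc n → f i ≤ f j)
  argmin f zero = 0 , s≤s z≤n , λ { zero _ → ≤-refl ; (suc j) (s≤s ()) }
  argmin f (suc n) with argmin f n
  ... | i , i< , h with ≤-total (f i) (f (suc n))
  ...   | inj₁ le = i , m≤n⇒m≤1+n i< , λ j j< → go j (m≤n⇒m<n∨m≡n (≤-pred j<))
    where go : ∀ j → j < suc n ⊎ j ≡ suc n → f i ≤ f j
          go j (inj₁ lt) = h j lt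
          go j (inj₂ refl) = le
  ...   | inj₂ ge = suc n , ≤-refl , λ j j< → go j (m≤n⇒m<n∨m≡n (≤-pred j<))
    where go : ∀ j → j < suc n ⊎ j ≡ suc n → f (suc n) ≤ f j
          go j (inj₁ lt) = ≤-trans ge (h j lt)
          go j (inj₂ refl) = ≤-refl

  Extremes : (ℕ → Bool) → ℕ → Set
  Extremes b m = ∃ λ i → ∃ λ j → i < m × j < m × i ≤ j × b i ≡ true × b j ≡ true × (∀ k → k < m → b k ≡ true → i ≤ k × k ≤ j)

  extremes : ∀ (b : ℕ → Bool) m → (∀ k → k < m → b k ≡ false) ⊎ Extremes b m
  extremes b zero = inj₁ λ k ()
  extremes b (suc m) with extremes b m | b m in e
  ... | inj₁ none | false = inj₁ λ k k< → go k (m≤n⇒m<n∨m≡n (≤-pred k<))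
    where go : ∀ k → k < m ⊎ k ≡ m → b k ≡ false
          go k (inj₁ lt) = none k lt
          go k (inj₂ refl) = e
  ... | inj₁ none | true = inj₂ (m , m , ≤-refl , ≤-refl , ≤-refl , e , e , λ k k< bk → go k bk (m≤n⇒m<n∨m≡n (≤-pred k<)))
    where go : ∀ k → b k ≡ true → k < m ⊎ k ≡ m → m ≤ k × k ≤ m
          go k bk (inj₁ lt) with trans (sym bk) (none k lt)
          ... | ()
          go k bk (inj₂ refl) = ≤-refl , ≤-refl
  ... | inj₂ (i , j , i< , j< , i≤j , bi , bj , h) | false = inj₂ (i , j , m≤n⇒m≤1+n i< , m≤n⇒m≤1+n j< , i≤j , bi , bj , λ k k< bk → go k bk (m≤n⇒m<n∨m≡n (≤-pred k<)))
    where go : ∀ k → b k ≡ true → k < m ⊎ k ≡ m → i ≤ k × k ≤ j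
          go k bk (inj₁ lt) = h k lt bk
          go k bk (inj₂ refl) with trans (sym bk) e
          ... | ()
  ... | inj₂ (i , j , i< , j< , i≤j , bi , bj , h) | true = inj₂ (i , m , m≤n⇒m≤1+n i< , ≤-refl , <⇒≤ i< , bi , e , λ k k< bk → go k bk (m≤n⇒m<n∨m≡n (≤-pred k<)))
    where go : ∀ k → b k ≡ true → k < m ⊎ k ≡ m → i ≤ k × k ≤ m
          go k bk (inj₁ lt) = proj₁ (h k lt bk) , <⇒≤ lt
          go k bk (inj₂ refl) = <⇒≤ i< , ≤-refl

  diff : Bool → Bool → ℕ
  diff u v = ⟦ u ∧ not v ⟧ + ⟦ not u ∧ v ⟧

  diff≤1 : ∀ u v → diff u v ≤ 1
  diff≤1 true v = ≤-trans (≤≡ (+-identityʳ _)) (⟦⟧≤1 _)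
  diff≤1 false v = ⟦⟧≤1 v

  range : ℕ → ℕ → ℕ → Bool
  range a b n = (a ≤ᵇ n) ∧ (suc n ≤ᵇ b)

  total-ar : ∀ h e S → h * e ≤ 20 * S → 10 * S ≤ 22 * h * h → h * e ≤ h * (44 * h)
  total-ar h e S h₁ h₂ = *-cancelˡ-≤ {h * e} {h * (44 * h)} 10 (lin 0 (10 ⊠ h₁ ⊞ 20 ⊠ h₂) (solve (h ∷ e ∷ S ∷ [])))

  ups-ar : ∀ h F₀ Fi Fl Fj g g' n → 20 * F₀ ≤ h → 20 * Fl ≤ h → 19 * h ≤ 20 * Fi → 19 * h ≤ 20 * Fj → Fi ≤ F₀ + g → Fj ≤ Fl + g' → g + g' ≤ n → 10 * n ≤ 11 * h → h ≤ 0
  ups-ar h F₀ Fi Fl Fj g g' n h₁ h₂ h₃ h₄ h₅ h₆ h₇ h₈ =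
    lin (13 * h) (h₁ ⊞ h₂ ⊞ h₃ ⊞ h₄ ⊞ 20 ⊠ h₅ ⊞ 20 ⊠ h₆ ⊞ 20 ⊠ h₇ ⊞ 2 ⊠ h₈) (solve (h ∷ F₀ ∷ Fi ∷ Fl ∷ Fj ∷ g ∷ g' ∷ n ∷ []))

  nothigh-ar : ∀ h F e → F + e ≡ h → 20 * F ≤ 19 * h → h ≤ 20 * e
  nothigh-ar _ F e refl h = lin 0 h (solve (F ∷ e ∷ []))

  ≤ᵇ-false : ∀ {a b} → b < a → (a ≤ᵇ b) ≡ false
  ≤ᵇ-false {a} {b} h with a ≤ᵇ b in e
  ... | false = refl
  ... | true = ⊥-elim (<⇒≱ h (≤ᵇ-true⁻¹ e))

  module Intervals (p : ℕ) (pr : Prime p) where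
    open Zp p pr
    open Sets p pr
    open PSet
    open Tri p pr
    open Coordinates p pr

    record NearInterval (U : PSet) (c : ℕ) : Set where
      field
        start : ℤ
        a b : ℕ
        a<b : a < b
        b≤p : b ≤ p
        close : ∑ p (λ n → diff (U ∋ (start +ᶻ + n)) (range a b n)) ≤ c

    module Interval (U : PSet) (h : ℕ) (h≥1 : 1 ≤ h) (al : ∀ i → i ≤ h → 10 * N U (+ i) ≤ 11 * h) where

      instance
        h≢0 : NonZero h
        h≢0 = >-nonZero h≥1

      win : ℤ → ℕ
      win x = ∑ h (λ j → ⟦ U ∋ (x +ᶻ + j) ⟧)

      win-≈ : ∀ {x y} → x ≈ y → win x ≡ win y
      win-≈ e = ∑-cong h λ j _ → cong ⟦_⟧ (∈-≈ U (≈-+ e (≈-refl {+ j})))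

      opaque
        -- Blocks are laid out from a window poorest in U. Either that first block is nearly empty
        -- and the cycle can be cut there, or no block is nearly empty.
        best : ∃ λ i → ∀ x → win (+ i) ≤ win x
        best = go p refl
          where
            go : ∀ q → q ≡ p → ∃ λ i → ∀ x → win (+ i) ≤ win x
            go zero e = ⊥-elim (<-irrefl e 0<p)
            go (suc q) e with argmin (λ i → win (+ i)) q
            ... | i , _ , mn = i , λ x → ≤-trans (mn (res x) (subst (res x <_) (sym e) (res<p x))) (≥≡ (win-≈ (≈res x)))

      x* : ℤ
      x* = + proj₁ best

      u : ℕ → Bool
      u n = U ∋ (x* +ᶻ + n)

      m rem : ℕ
      m = p / h
      rem = p % h

      pdiv : m * h + rem ≡ p
      pdiv = trans (+-comm (m * h) rem) (sym (m≡m%n+[m/n]*n p h))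

      mh≤p : m * h ≤ p
      mh≤p = ≤-trans (m≤m+n _ rem) (≤≡ pdiv)

      F F̄ : ℕ → ℕ
      F k = ∑ h (λ j → ⟦ u (k * h + j) ⟧)
      F̄ k = ∑ h (λ j → ⟦ not (u (k * h + j)) ⟧)

      F+F̄ : ∀ k → F k + F̄ k ≡ h
      F+F̄ k = trans (sym (∑-+ h _ _)) (trans (∑-cong h (λ j _ → ⟦⟧+not (u (k * h + j)))) (trans (∑-const h 1) (*-identityʳ h)))

      at : ∀ k j → x* +ᶻ + (k * h + j) ≡ (x* +ᶻ + (k * h)) +ᶻ + j
      at k j = trans (cong (x* +ᶻ_) (ℤ.pos-+ (k * h) j)) (sym (ℤ.+-assoc x* (+ (k * h)) (+ j)))

      F≡win : ∀ k → F k ≡ win (x* +ᶻ + (k * h))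
      F≡win k = ∑-cong h λ j _ → cong (λ z → ⟦ U ∋ z ⟧) (at k j)

      F₀-min : ∀ k → F 0 ≤ F k
      F₀-min k = ≤-trans (≤≡ (trans (F≡win 0) (cong win (ℤ.+-identityʳ x*)))) (≤-trans (proj₂ best (x* +ᶻ + (k * h))) (≥≡ (F≡win k)))

      opaque
        unfolding σ

        blocks≤σ : ∀ (f : ℤ → ℕ) → Per f → ∑ m (λ k → ∑ h (λ j → f (x* +ᶻ + (k * h + j)))) ≤ σ f
        blocks≤σ f pf = ≤-trans (≥≡ (∑-block m h (λ n → f (x* +ᶻ + n)))) (≤-trans (∑-mono-n _ mh≤p)
          (≤≡ (trans (∑-cong p (λ n _ → cong f (ℤ.+-comm x* (+ n)))) (σ-shift pf x*))))

      around : ℤ → ℕ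
      around y = ∑ h (λ i → ⟦ not (U ∋ (y +ᶻ + i)) ⟧) + ∑ h (λ i → ⟦ not (U ∋ (y -ᶻ + i)) ⟧)

      S : ℕ
      S = ∑ m (λ k → F k * F̄ k)

      -- A member and a nonmember of U in one block differ by less than h, so the pairs in S are
      -- counted by the norms of i and -i for i < h, each at most 11h/10.
      S≤ : 10 * S ≤ 22 * h * h
      S≤ = ≤-trans (*-monoʳ-≤ 10 (≤-trans (∑-mono m (λ k _ → blk k)) (≤-trans (blocks≤σ (λ y → ⟦ U ∋ y ⟧ * around y) per′) (≤≡ sum)))) bnd
        where
          per′ : Per (λ y → ⟦ U ∋ y ⟧ * around y)
          per′ = ≈-per λ {x} {y} e → cong₂ _*_ (cong ⟦_⟧ (∈-≈ U e)) (cong₂ _+_ (∑-cong h λ i _ → cong (λ b → ⟦ not b ⟧) (∈-≈ U (≈-+ e (≈-refl {+ i})))) (∑-cong h λ i _ → cong (λ b → ⟦ not b ⟧) (∈-≈ U (≈-- e (≈-refl {+ i})))))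
          blk : ∀ k → F k * F̄ k ≤ ∑ h (λ j → ⟦ U ∋ (x* +ᶻ + (k * h + j)) ⟧ * around (x* +ᶻ + (k * h + j)))
          blk k = ≤-trans (≤≡ (trans (*-comm (F k) (F̄ k)) (trans (sym (∑-* h (F̄ k) _)) (∑-cong h λ j _ → *-comm (F̄ k) _))))
            (∑-mono h (λ j j<h → *-monoʳ-≤ ⟦ u (k * h + j) ⟧ (≤-trans (≤≡ (∑-cong h λ j _ → cong (λ z → ⟦ not (U ∋ z) ⟧) (at k j)))
              (≤-trans (∑-around (λ z → ⟦ not (U ∋ z) ⟧) (x* +ᶻ + (k * h)) h j j<h) (≥≡ (cong around (at k j)))))))
          sum : σ (λ y → ⟦ U ∋ y ⟧ * around y) ≡ ∑ h (λ i → N U (-ᶻ (+ i)) + N U (+ i))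
          sum = trans (σ-cong λ y → trans (*-distribˡ-+ ⟦ U ∋ y ⟧ _ _) (cong₂ _+_ (sym (∑-* h ⟦ U ∋ y ⟧ _)) (sym (∑-* h ⟦ U ∋ y ⟧ _))))
            (trans (σ-+ _ _) (trans (cong₂ _+_ (sym (∑σ-swap h _)) (sym (∑σ-swap h _))) (trans (sym (∑-+ h _ _)) (∑-cong h λ i _ →
              cong₂ _+_ (σ-cong λ y → trans (cong (λ z → ⟦ U ∋ y ⟧ * ⟦ not (U ∋ z) ⟧) (l y (+ i))) (sym (⟦∧⟧ (U ∋ y) _))) (σ-cong λ y → sym (⟦∧⟧ (U ∋ y) _))))))
            where l : ∀ y i → y +ᶻ i ≡ y -ᶻ (-ᶻ i)
                  l = ℤR.solve-∀
          bnd : 10 * ∑ h (λ i → N U (-ᶻ (+ i)) + N U (+ i)) ≤ 22 * h * h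
          bnd = ≤-trans (≤≡ (sym (∑-* h 10 _))) (≤-trans (∑-mono h (λ i i<h → ≤-trans (≤≡ (cong (λ z → 10 * (z + N U (+ i))) (N-neg U (+ i)))) (ar (N U (+ i)) h (al i (<⇒≤ i<h)))))
            (≤≡ (trans (∑-const h (22 * h)) (*-comm h (22 * h)))))
            where ar : ∀ n h → 10 * n ≤ 11 * h → 10 * (n + n) ≤ 22 * h
                  ar n h e = lin 0 (2 ⊠ e) (solve (n ∷ h ∷ []))

      up : ℕ → ℕ
      up k = ∑ h (λ j → ⟦ (U ∖ U ⟨ + h ⟩) ∋ (x* +ᶻ + (k * h + j)) ⟧)

      ups≤ : ∑ m up ≤ N U (+ h)
      ups≤ = blocks≤σ (λ y → ⟦ (U ∖ U ⟨ + h ⟩) ∋ y ⟧) (per1 (U ∖ U ⟨ + h ⟩))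

      F-step : ∀ k → F (suc k) ≤ F k + up (suc k)
      F-step k = ≤-trans (∑-mono h (λ j _ → ≤-trans (b (u (suc k * h + j)) (u (k * h + j))) (≤≡ (cong (λ z → ⟦ u (k * h + j) ⟧ + ⟦ u (suc k * h + j) ∧ not (U ∋ z) ⟧) (eq j)))))
          (≤≡ (∑-+ h _ _))
        where
          b : ∀ x y → ⟦ x ⟧ ≤ ⟦ y ⟧ + ⟦ x ∧ not y ⟧
          b true true = ≤-refl
          b true false = ≤-refl
          b false y = z≤n
          l : ∀ x h k j → x +ᶻ (k +ᶻ j) ≡ (x +ᶻ ((h +ᶻ k) +ᶻ j)) -ᶻ h
          l = ℤR.solve-∀
          eq : ∀ j → x* +ᶻ + (k * h + j) ≡ (x* +ᶻ + (suc k * h + j)) -ᶻ + h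
          eq j = l x* (+ h) (+ (k * h)) (+ j)

      F-steps : ∀ l c → F (c + l) ≤ F l + ∑ c (λ i → up (suc l + i))
      F-steps l zero = m≤m+n _ _
      F-steps l (suc c) = ≤-trans (F-step (c + l)) (≤-trans (+-monoˡ-≤ _ (F-steps l c)) (≤≡ (trans (+-assoc (F l) _ _) (cong (λ k → F l + (∑ c (λ i → up (suc l + i)) + up (suc k))) (+-comm c l)))))

      high low : ℕ → Bool
      high k = 19 * h ≤ᵇ 20 * F k
      low k = 20 * F k ≤ᵇ h

      -- An upward crossing costs 9h/10 of the norm of h, so there is only one.
      oneUp : ∀ i l j → i ≤ l → l ≤ j → j < m → low 0 ≡ true → high i ≡ true → low l ≡ true → high j ≡ true → ⊥
      oneUp i l j i≤l l≤j j<m l0 hi ll hj = go (m≤n⇒∃[o]m+o≡n l≤j)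
        where
          go : (∃ λ c → l + c ≡ j) → ⊥
          go (c , refl) = <⇒≱ h≥1 (ups-ar h (F 0) (F i) (F l) (F (l + c)) (∑ i (λ k → up (suc k))) (∑ c (λ k → up (suc l + k))) (N U (+ h))
              (≤ᵇ-true⁻¹ l0) (≤ᵇ-true⁻¹ ll) (≤ᵇ-true⁻¹ hi) (≤ᵇ-true⁻¹ hj)
              (≤-trans (≤≡ (cong F (sym (+-identityʳ i)))) (F-steps 0 i)) (≤-trans (≤≡ (cong F (+-comm l c))) (F-steps l c)) both (al h ≤-refl))
            where
              both : ∑ i (λ k → up (suc k)) + ∑ c (λ k → up (suc l + k)) ≤ N U (+ h)
              both = ≤-trans (+-monoˡ-≤ _ (≤-trans (≤-trans (m≤n+m _ (up 0)) (≥≡ (∑-head i up))) (∑-mono-n up (s≤s i≤l))))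
                (≤-trans (≥≡ (∑-split (suc l) c up)) (≤-trans (∑-mono-n up j<m) ups≤))

      cost : (ℕ → Bool) → ℕ → ℕ
      cost sel k = if sel k then F̄ k else F k

      -- `sel` pronounces each block full or empty; the wrong points of a block must be paid for by
      -- its mixed pairs. The verdict "full" can be paid unless the block is `low`, and "empty"
      -- unless it is `high`, so intermediate blocks admit either.
      Sound : (ℕ → Bool) → Set
      Sound sel = ∀ k → k < m → h * cost sel k ≤ 20 * (F k * F̄ k)

      cost≤ : ∀ sel → Sound sel → ∑ m (cost sel) ≤ 44 * h
      cost≤ sel sd = *-cancelˡ-≤ h (total-ar h (∑ m (cost sel)) S (≤-trans (≤≡ (sym (∑-* m h _))) (≤-trans (∑-mono m sd) (≤≡ (∑-* m 20 _)))) S≤)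

      notLow⇒ : ∀ k → low k ≡ false → h * F̄ k ≤ 20 * (F k * F̄ k)
      notLow⇒ k e = ≤-trans (*-monoˡ-≤ (F̄ k) {h} {20 * F k} (<⇒≤ (≤ᵇ-false⁻¹ {20 * F k} e))) (≤≡ (*-assoc 20 (F k) (F̄ k)))

      notHigh⇒ : ∀ k → high k ≡ false → h * F k ≤ 20 * (F k * F̄ k)
      notHigh⇒ k e = ≤-trans (*-monoˡ-≤ (F k) (nothigh-ar h (F k) (F̄ k) (F+F̄ k) (<⇒≤ (≤ᵇ-false⁻¹ e)))) (≤≡ (l (F̄ k) (F k)))
        where l : ∀ a b → 20 * a * b ≡ 20 * (b * a)
              l = solve-∀

      -- The blocks contribute 44h, and the fewer than h points after the last complete block make
      -- it 45h.
      assemble : ∀ sel (R : ℕ → Bool) → Sound sel → (∀ k j → k < m → j < h → R (k * h + j) ≡ sel k) → ∑ p (λ n → diff (u n) (R n)) ≤ 45 * h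
      assemble sel R sd eq = ≤-trans (≤≡ (trans (cong (λ q → ∑ q (λ n → diff (u n) (R n))) (sym pdiv)) (∑-split (m * h) rem _)))
          (≤-trans (+-mono-≤ (≤-trans (≤≡ (∑-block m h _)) (≤-trans (∑-mono m blk) (cost≤ sel sd)))
            (≤-trans (∑-mono rem (λ i _ → diff≤1 (u (m * h + i)) (R (m * h + i)))) (≤-trans (≤≡ (trans (∑-const rem 1) (*-identityʳ rem))) (<⇒≤ (m%n<n p h))))) (≤≡ (+-comm (44 * h) h)))
        where
          one : ∀ s k → sel k ≡ s → (∀ j → j < h → R (k * h + j) ≡ s) → ∑ h (λ j → diff (u (k * h + j)) (R (k * h + j))) ≤ (if s then F̄ k else F k)
          one true k _ e = ∑-mono h λ j j<h → ≤≡ (trans (cong (diff (u (k * h + j))) (e j j<h)) (d (u (k * h + j))))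
            where d : ∀ u → diff u true ≡ ⟦ not u ⟧
                  d true = refl
                  d false = refl
          one false k _ e = ∑-mono h λ j j<h → ≤≡ (trans (cong (diff (u (k * h + j))) (e j j<h)) (d (u (k * h + j))))
            where d : ∀ u → diff u false ≡ ⟦ u ⟧
                  d true = refl
                  d false = refl
          blk : ∀ k → k < m → ∑ h (λ j → diff (u (k * h + j)) (R (k * h + j))) ≤ cost sel k
          blk k k<m = one (sel k) k refl (λ j j<h → eq k j k<m j<h)

      range-block : ∀ i j k r → r < h → range (i * h) (suc j * h) (k * h + r) ≡ (i ≤ᵇ k) ∧ (k ≤ᵇ j)
      range-block i j k r r<h = cong₂ _∧_ (left (i ≤? k)) (right (k ≤? j))
        where
          left : Dec (i ≤ k) → (i * h ≤ᵇ k * h + r) ≡ (i ≤ᵇ k)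
          left (yes le) = trans (≤ᵇ-true (≤-trans (*-monoˡ-≤ h le) (m≤m+n _ r))) (sym (≤ᵇ-true le))
          left (no gt) = trans (≤ᵇ-false (≤-trans (≤-trans (≤≡ (sym (+-suc (k * h) r))) (≤-trans (+-monoʳ-≤ (k * h) r<h) (≤≡ (+-comm (k * h) h)))) (*-monoˡ-≤ h (≰⇒> gt)))) (sym (≤ᵇ-false (≰⇒> gt)))
          right : Dec (k ≤ j) → (suc (k * h + r) ≤ᵇ suc j * h) ≡ (k ≤ᵇ j)
          right (yes le) = trans (≤ᵇ-true {suc (k * h + r)} (≤-trans (≤≡ (sym (+-suc (k * h) r))) (≤-trans (+-mono-≤ (*-monoˡ-≤ h le) r<h) (≤≡ (+-comm (j * h) h))))) (sym (≤ᵇ-true le))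
          right (no gt) = trans (≤ᵇ-false {suc (k * h + r)} (s≤s (≤-trans (*-monoˡ-≤ h (≰⇒> gt)) (m≤m+n _ r)))) (sym (≤ᵇ-false (≰⇒> gt)))

      45≤46 : 45 * h ≤ 46 * h
      45≤46 = *-monoˡ-≤ h (lit 45 46)

      full : low 0 ≡ false → NearInterval U (46 * h)
      full l0 = record { start = x* ; a = 0 ; b = p ; a<b = 0<p ; b≤p = ≤-refl
        ; close = ≤-trans (≤-trans (≤≡ (∑-cong p λ n n<p → cong (diff (u n)) (≤ᵇ-true {suc n} n<p))) (assemble (λ _ → true) (λ _ → true) sd (λ _ _ _ _ → refl))) 45≤46 }
        where sd : Sound (λ _ → true)
              sd k _ = notLow⇒ k (≤ᵇ-false (≤-trans (≤ᵇ-false⁻¹ {20 * F 0} l0) (*-monoʳ-≤ 20 (F₀-min k))))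

      empty : (∀ k → k < m → high k ≡ false) → NearInterval U (46 * h)
      -- The resulting progression has to be nonempty, so one point is taken; it costs at most one,
      -- hence 46h in place of 45h.
      empty nh = record { start = x* ; a = 0 ; b = 1 ; a<b = s≤s z≤n ; b≤p = 0<p
        ; close = ≤-trans (∑-mono p (λ n _ → b (u n) (range 0 1 n))) (≤-trans (≤≡ (∑-+ p _ _)) (≤-trans (+-mono-≤ (assemble (λ _ → false) (λ _ → false) sd (λ _ _ _ _ → refl)) point) (≤-trans (+-monoʳ-≤ (45 * h) h≥1) (≤≡ (+-comm (45 * h) h))))) }
        where
          sd : Sound (λ _ → false)
          sd k k<m = notHigh⇒ k (nh k k<m)
          b : ∀ u v → diff u v ≤ diff u false + ⟦ v ⟧
          b true true = z≤n
          b true false = ≤-refl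
          b false v = ≤-refl
          point : ∑ p (λ n → ⟦ range 0 1 n ⟧) ≤ 1
          point = ∑-atMost1 p _ (λ n → ⟦⟧≤1 _) λ i j _ _ hi hj → trans (z i hi) (sym (z j hj))
            where z : ∀ i → 1 ≤ ⟦ range 0 1 i ⟧ → i ≡ 0
                  z i h = n<1⇒n≡0 (≤ᵇ-true⁻¹ {suc i} (⟦⟧-pos h))

      -- The interval runs from the first high block to the last. No block outside is high; a low
      -- block inside would make two rises from low to high, starting with the low block 0, against
      -- `oneUp`.
      arc : low 0 ≡ true → Extremes high m → NearInterval U (46 * h)
      arc l0 (i , j , i<m , j<m , i≤j , hi , hj , ext) = record { start = x* ; a = i * h ; b = suc j * h ; a<b = ≤-trans (≤-trans (≤≡ (+-comm 1 (i * h))) (+-monoʳ-≤ (i * h) h≥1)) (≤-trans (≤≡ (+-comm (i * h) h)) (*-monoˡ-≤ h (s≤s i≤j)))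
        ; b≤p = ≤-trans (*-monoˡ-≤ h j<m) mh≤p
        ; close = ≤-trans (assemble sel (range (i * h) (suc j * h)) sd (λ k r _ r<h → range-block i j k r r<h)) 45≤46 }
        where
          sel : ℕ → Bool
          sel k = (i ≤ᵇ k) ∧ (k ≤ᵇ j)
          sd : Sound sel
          sd k k<m = go (sel k) refl
            where
              go : ∀ s → sel k ≡ s → h * (if s then F̄ k else F k) ≤ 20 * (F k * F̄ k)
              go true e = inner (low k) refl
                where inner : ∀ b → low k ≡ b → h * F̄ k ≤ 20 * (F k * F̄ k)
                      inner false lk = notLow⇒ k lk
                      inner true lk = ⊥-elim (oneUp i k j (≤ᵇ-true⁻¹ (∧-l e)) (≤ᵇ-true⁻¹ (∧-r {i ≤ᵇ k} e)) j<m l0 hi lk hj)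
              go false e = outer (high k) refl
                where outer : ∀ b → high k ≡ b → h * F k ≤ 20 * (F k * F̄ k)
                      outer false hk = notHigh⇒ k hk
                      outer true hk = ⊥-elim (tf (∧-i (≤ᵇ-true (proj₁ (ext k k<m hk))) (≤ᵇ-true (proj₂ (ext k k<m hk)))) e)

      interval : NearInterval U (46 * h)
      interval = go (low 0) refl
        where
          go : ∀ b → low 0 ≡ b → NearInterval U (46 * h)
          go false e = full e
          go true e = cases (extremes high m)
            where cases : (∀ k → k < m → high k ≡ false) ⊎ Extremes high m → NearInterval U (46 * h)
                  cases (inj₁ none) = empty none
                  cases (inj₂ ex) = arc e ex

  -- Counting samples without replacement

  negcorr-ar : ∀ n m b₂ b₁ b → suc n * b₂ ≡ m * b₁ → suc m * b ≡ suc (suc n) * b₁ → m ≤ suc n →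
    suc n * (suc (suc n) * suc (suc n) * b₂) ≤ suc n * (suc m * suc m * b)
  negcorr-ar n m b₂ b₁ b e₁ e₂ h = lin 0 (≤≡ (cong (suc (suc n) * suc (suc n) *_) e₁) ⊞ ≤≡ (cong (suc n * suc m *_) (sym e₂)) ⊞ (suc (suc n) * b₁) ⊠ h)
    (solve (n ∷ m ∷ b₂ ∷ b₁ ∷ b ∷ []))

  module Sampling where
    open import Data.Vec using ([]; _∷_; lookup)

    -- Sums over the m-element subsets of X

    ch : ∀ {n} → Subset n → ℕ → (Subset n → ℕ) → ℕ
    ch [] zero f = f []
    ch [] (suc m) f = 0
    ch (false ∷ X) m f = ch X m (f ∘ (false ∷_))
    ch (true ∷ X) zero f = ch X zero (f ∘ (false ∷_))
    ch (true ∷ X) (suc m) f = ch X m (f ∘ (true ∷_)) + ch X (suc m) (f ∘ (false ∷_))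

    ∑L : ∀ {A : Set} → (A → ℕ) → List A → ℕ
    ∑L f xs = sumℕ (map f xs)

    ∑L-cong : ∀ {A : Set} {f g : A → ℕ} → (∀ x → f x ≡ g x) → ∀ xs → ∑L f xs ≡ ∑L g xs
    ∑L-cong h xs = cong sumℕ (map-cong h xs)

    ∑L-+ : ∀ {A : Set} (f g : A → ℕ) xs → ∑L (λ x → f x + g x) xs ≡ ∑L f xs + ∑L g xs
    ∑L-+ f g [] = refl
    ∑L-+ f g (x ∷ xs) = trans (cong (λ z → (f x + g x) + z) (∑L-+ f g xs)) (l (f x) (g x) (∑L f xs) (∑L g xs))
      where l : ∀ a b c d → a + b + (c + d) ≡ a + c + (b + d)
            l = solve-∀

    ∑L-0 : ∀ {A : Set} {f : A → ℕ} → (∀ x → f x ≡ 0) → ∀ xs → ∑L f xs ≡ 0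
    ∑L-0 h [] = refl
    ∑L-0 h (x ∷ xs) = cong₂ _+_ (h x) (∑L-0 h xs)

    ∑L-filter : ∀ {A : Set} (b : A → Bool) (f : A → ℕ) xs → ∑L f (filter (λ x → T? (b x)) xs) ≡ ∑L (λ x → ⟦ b x ⟧ * f x) xs
    ∑L-filter b f [] = refl
    ∑L-filter b f (x ∷ xs) with b x
    ... | true = cong₂ _+_ (sym (+-identityʳ (f x))) (∑L-filter b f xs)
    ... | false = ∑L-filter b f xs

    ∑L-concatMap : ∀ {A B : Set} (f : B → ℕ) (g : A → List B) xs → ∑L f (concatMap g xs) ≡ ∑L (λ x → ∑L f (g x)) xs
    ∑L-concatMap f g [] = refl
    ∑L-concatMap f g (x ∷ xs) = trans (cong sumℕ (map-++ f (g x) (concatMap g xs))) (trans (sum-++ (map f (g x)) _) (cong (λ z → ∑L f (g x) + z) (∑L-concatMap f g xs)))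

    subset-∷ : ∀ {n} s x (S X : Subset n) → subsetᵇ (s ∷ S) (x ∷ X) ≡ (if s then x else true) ∧ subsetᵇ S X
    subset-∷ s x S X = cong (λ z → (if s then x else true) ∧ and z)
      (trans (map-tabulate suc (λ i → if mem i (s ∷ S) then mem i (x ∷ X) else true)) (sym (map-tabulate (λ i → i) (λ i → if mem i S then mem i X else true))))

    ok : ∀ {n} → Subset n → ℕ → Subset n → Bool
    ok X m S = subsetᵇ S X ∧ ⌊ ∣ S ∣ ≟ m ⌋

    -- Connects the filtered list behind `choose` with the recursion `ch`, on which the later counts
    -- proceed by induction.
    ∑L-subsets : ∀ {n} (X : Subset n) m f → ∑L (λ S → ⟦ ok X m S ⟧ * f S) (allSubsets n) ≡ ch X m f
    ∑L-subsets [] zero f = trans (+-identityʳ _) (+-identityʳ _)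
    ∑L-subsets [] (suc m) f = refl
    ∑L-subsets {suc n} (x ∷ X) m f = trans (∑L-concatMap (λ S → ⟦ ok (x ∷ X) m S ⟧ * f S) (λ S → (true ∷ S) ∷ (false ∷ S) ∷ []) (allSubsets n))
      (trans (∑L-cong (λ S → cong (λ z → g (true ∷ S) + z) (+-identityʳ (g (false ∷ S)))) (allSubsets n))
        (trans (∑L-+ (g ∘ (true ∷_)) (g ∘ (false ∷_)) (allSubsets n)) (split x m)))
      where
        g : Subset (suc n) → ℕ
        g S = ⟦ ok (x ∷ X) m S ⟧ * f S
        G : Bool → ℕ → Bool → Subset n → ℕ
        G x m s S = ⟦ ok (x ∷ X) m (s ∷ S) ⟧ * f (s ∷ S)
        out : ∀ x m S → G x m false S ≡ ⟦ ok X m S ⟧ * f (false ∷ S)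
        out x m S = cong (λ b → ⟦ b ∧ ⌊ ∣ S ∣ ≟ m ⌋ ⟧ * f (false ∷ S)) (subset-∷ false x S X)
        inn : ∀ m S → G true (suc m) true S ≡ ⟦ ok X m S ⟧ * f (true ∷ S)
        inn m S = cong₂ (λ b c → ⟦ b ∧ c ⟧ * f (true ∷ S)) (subset-∷ true true S X) (trans (isYes≗does (suc ∣ S ∣ ≟ suc m)) (sym (isYes≗does (∣ S ∣ ≟ m))))
        inn₀ : ∀ S → G true zero true S ≡ 0
        inn₀ S = cong (λ b → ⟦ b ⟧ * f (true ∷ S)) (∧-0 (subsetᵇ (true ∷ S) (true ∷ X)))
          where ∧-0 : ∀ b → b ∧ false ≡ false
                ∧-0 true = refl
                ∧-0 false = refl
        innF : ∀ m S → G false m true S ≡ 0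
        innF m S = cong (λ b → ⟦ b ∧ ⌊ suc ∣ S ∣ ≟ m ⌋ ⟧ * f (true ∷ S)) (subset-∷ true false S X)
        split : ∀ x m → ∑L (G x m true) (allSubsets n) + ∑L (G x m false) (allSubsets n) ≡ ch (x ∷ X) m f
        split false m = cong₂ _+_ (∑L-0 (innF m) (allSubsets n)) (trans (∑L-cong (out false m) (allSubsets n)) (∑L-subsets X m _))
        split true zero = cong₂ _+_ (∑L-0 inn₀ (allSubsets n)) (trans (∑L-cong (out true zero) (allSubsets n)) (∑L-subsets X zero _))
        split true (suc m) = cong₂ _+_ (trans (∑L-cong (inn m) (allSubsets n)) (∑L-subsets X m _)) (trans (∑L-cong (out true (suc m)) (allSubsets n)) (∑L-subsets X (suc m) _))

    ∑L-choose : ∀ {n} (X : Subset n) m f → ∑L f (choose X m) ≡ ch X m f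
    ∑L-choose {n} X m f = trans (∑L-filter (ok X m) f (allSubsets n)) (∑L-subsets X m f)

    ch-cong : ∀ {n} (X : Subset n) m {f g : Subset n → ℕ} → (∀ S → f S ≡ g S) → ch X m f ≡ ch X m g
    ch-cong [] zero h = h []
    ch-cong [] (suc m) h = refl
    ch-cong (false ∷ X) m h = ch-cong X m (λ S → h (false ∷ S))
    ch-cong (true ∷ X) zero h = ch-cong X zero (λ S → h (false ∷ S))
    ch-cong (true ∷ X) (suc m) h = cong₂ _+_ (ch-cong X m (λ S → h (true ∷ S))) (ch-cong X (suc m) (λ S → h (false ∷ S)))

    ch-mono : ∀ {n} (X : Subset n) m {f g : Subset n → ℕ} → (∀ S → f S ≤ g S) → ch X m f ≤ ch X m g
    ch-mono [] zero h = h []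
    ch-mono [] (suc m) h = z≤n
    ch-mono (false ∷ X) m h = ch-mono X m (λ S → h (false ∷ S))
    ch-mono (true ∷ X) zero h = ch-mono X zero (λ S → h (false ∷ S))
    ch-mono (true ∷ X) (suc m) h = ch-mono X m (λ S → h (true ∷ S)) ⊞ ch-mono X (suc m) (λ S → h (false ∷ S))

    ch-+ : ∀ {n} (X : Subset n) m (f g : Subset n → ℕ) → ch X m (λ S → f S + g S) ≡ ch X m f + ch X m g
    ch-+ [] zero f g = refl
    ch-+ [] (suc m) f g = refl
    ch-+ (false ∷ X) m f g = ch-+ X m _ _
    ch-+ (true ∷ X) zero f g = ch-+ X zero _ _
    ch-+ (true ∷ X) (suc m) f g = trans (cong₂ _+_ (ch-+ X m _ _) (ch-+ X (suc m) _ _)) (l (ch X m (f ∘ (true ∷_))) (ch X m (g ∘ (true ∷_))) (ch X (suc m) (f ∘ (false ∷_))) (ch X (suc m) (g ∘ (false ∷_))))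
      where l : ∀ a b c d → a + b + (c + d) ≡ a + c + (b + d)
            l = solve-∀

    ch-* : ∀ {n} (X : Subset n) m c (f : Subset n → ℕ) → ch X m (λ S → c * f S) ≡ c * ch X m f
    ch-* [] zero c f = refl
    ch-* [] (suc m) c f = sym (*-zeroʳ c)
    ch-* (false ∷ X) m c f = ch-* X m c _
    ch-* (true ∷ X) zero c f = ch-* X zero c _
    ch-* (true ∷ X) (suc m) c f = trans (cong₂ _+_ (ch-* X m c _) (ch-* X (suc m) c _)) (sym (*-distribˡ-+ c _ _))

    ch-*ʳ : ∀ {n} (X : Subset n) m c (f : Subset n → ℕ) → ch X m (λ S → f S * c) ≡ ch X m f * c
    ch-*ʳ X m c f = trans (ch-cong X m (λ S → *-comm (f S) c)) (trans (ch-* X m c f) (*-comm c _))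

    ch-0 : ∀ {n} (X : Subset n) m {f : Subset n → ℕ} → (∀ S → f S ≡ 0) → ch X m f ≡ 0
    ch-0 X m h = trans (ch-cong X m h) (ch-* X m 0 (λ _ → 0))

    ch-∑ : ∀ {n} (X : Subset n) m k (f : ℕ → Subset n → ℕ) → ch X m (λ S → ∑ k (λ i → f i S)) ≡ ∑ k (λ i → ch X m (f i))
    ch-∑ X m zero f = ch-0 X m (λ _ → refl)
    ch-∑ X m (suc k) f = trans (ch-+ X m _ (f k)) (cong (_+ ch X m (f k)) (ch-∑ X m k f))

    -- The binomial C(n, k), and the numbers C(n - 1, k - 1) and C(n - 2, k - 2) of k-subsets
    -- through one and through two given points, with value 0 out of range.
    bin bin₁ bin₂ : ℕ → ℕ → ℕ
    bin n zero = 1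
    bin zero (suc k) = 0
    bin (suc n) (suc k) = bin n k + bin n (suc k)
    bin₁ zero k = 0
    bin₁ (suc n) zero = 0
    bin₁ (suc n) (suc k) = bin n k
    bin₂ zero k = 0
    bin₂ (suc n) zero = 0
    bin₂ (suc n) (suc k) = bin₁ n k

    ch-1 : ∀ {n} (X : Subset n) m → ch X m (λ _ → 1) ≡ bin (∣ X ∣) m
    ch-1 [] zero = refl
    ch-1 [] (suc m) = refl
    ch-1 (false ∷ X) m = ch-1 X m
    ch-1 (true ∷ X) zero = trans (ch-1 X zero) (refl)
    ch-1 (true ∷ X) (suc m) = cong₂ _+_ (ch-1 X m) (ch-1 X (suc m))

    ∋⇒suc : ∀ {n} (X : Subset n) i → lookup X i ≡ true → ∃ λ a → (∣ X ∣) ≡ suc a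
    ∋⇒suc (true ∷ X) i h = (∣ X ∣) , refl
    ∋⇒suc (false ∷ X) (suc i) h = ∋⇒suc X i h

    bin₁-0 : ∀ n → bin₁ n 0 ≡ 0
    bin₁-0 zero = refl
    bin₁-0 (suc n) = refl

    bin₂-0 : ∀ n → bin₂ n 0 ≡ 0
    bin₂-0 zero = refl
    bin₂-0 (suc n) = refl

    bin₁-pascal : ∀ a k → bin₁ (suc a) k + bin₁ (suc a) (suc k) ≡ bin (suc a) k
    bin₁-pascal a zero = refl
    bin₁-pascal a (suc k) = refl

    bin₂-pascal : ∀ a k → bin₂ (suc (suc a)) k + bin₂ (suc (suc a)) (suc k) ≡ bin₁ (suc (suc a)) k
    bin₂-pascal a zero = refl
    bin₂-pascal a (suc k) = bin₁-pascal a k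

    ch-mem : ∀ {n} (X : Subset n) m i → lookup X i ≡ true → ch X m (λ S → ⟦ lookup S i ⟧) ≡ bin₁ (∣ X ∣) m
    ch-mem (true ∷ X) zero zero h = ch-0 X zero (λ _ → refl)
    ch-mem (true ∷ X) (suc m) zero h = trans (cong₂ _+_ (ch-1 X m) (ch-0 X (suc m) (λ _ → refl))) (+-identityʳ _)
    ch-mem (false ∷ X) m (suc i) h = ch-mem X m i h
    ch-mem (true ∷ X) zero (suc i) h = trans (ch-mem X zero i h) (bin₁-0 (∣ X ∣))
    ch-mem (true ∷ X) (suc m) (suc i) h = trans (cong₂ _+_ (ch-mem X m i h) (ch-mem X (suc m) i h)) (go (∋⇒suc X i h))
      where go : (∃ λ a → (∣ X ∣) ≡ suc a) → bin₁ (∣ X ∣) m + bin₁ (∣ X ∣) (suc m) ≡ bin (∣ X ∣) m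
            go (a , e) = trans (cong (λ z → bin₁ z m + bin₁ z (suc m)) e) (trans (bin₁-pascal a m) (cong (λ z → bin z m) (sym e)))

    ch-out : ∀ {n} (X : Subset n) m i → lookup X i ≡ false → (g : Subset n → ℕ) → ch X m (λ S → ⟦ lookup S i ⟧ * g S) ≡ 0
    ch-out (false ∷ X) m zero h g = ch-0 X m (λ _ → refl)
    ch-out (false ∷ X) m (suc i) h g = ch-out X m i h _
    ch-out (true ∷ X) zero (suc i) h g = ch-out X zero i h _
    ch-out (true ∷ X) (suc m) (suc i) h g = cong₂ _+_ (ch-out X m i h _) (ch-out X (suc m) i h _)

    two : ∀ {n} (X : Subset n) i j → i ≢ j → lookup X i ≡ true → lookup X j ≡ true → ∃ λ a → (∣ X ∣) ≡ suc (suc a)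
    two (x ∷ X) zero zero ne _ _ = ⊥-elim (ne refl)
    two (true ∷ X) zero (suc j) _ _ hj with ∋⇒suc X j hj
    ... | a , e = a , cong suc e
    two (true ∷ X) (suc i) zero _ hi _ with ∋⇒suc X i hi
    ... | a , e = a , cong suc e
    two (true ∷ X) (suc i) (suc j) ne hi hj with two X i j (λ { refl → ne refl }) hi hj
    ... | a , e = suc a , cong suc e
    two (false ∷ X) (suc i) (suc j) ne hi hj = two X i j (λ { refl → ne refl }) hi hj

    ch-mem² : ∀ {n} (X : Subset n) m i j → i ≢ j → lookup X i ≡ true → lookup X j ≡ true →
      ch X m (λ S → ⟦ lookup S i ⟧ * ⟦ lookup S j ⟧) ≡ bin₂ (∣ X ∣) m
    ch-mem² (x ∷ X) m zero zero ne _ _ = ⊥-elim (ne refl)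
    ch-mem² (true ∷ X) zero zero (suc j) _ _ hj = ch-0 X zero (λ _ → refl)
    ch-mem² (true ∷ X) (suc m) zero (suc j) _ _ hj = trans (cong₂ _+_ (trans (ch-cong X m (λ S → +-identityʳ _)) (ch-mem X m j hj)) (ch-0 X (suc m) (λ _ → refl))) (+-identityʳ _)
    ch-mem² (true ∷ X) zero (suc i) zero _ hi _ = ch-0 X zero (λ S → *-zeroʳ ⟦ lookup S i ⟧)
    ch-mem² (true ∷ X) (suc m) (suc i) zero _ hi _ = trans (cong₂ _+_ (trans (ch-cong X m (λ S → *-identityʳ _)) (ch-mem X m i hi)) (ch-0 X (suc m) (λ S → *-zeroʳ ⟦ lookup S i ⟧))) (+-identityʳ _)
    ch-mem² (false ∷ X) m (suc i) (suc j) ne hi hj = ch-mem² X m i j (λ { refl → ne refl }) hi hj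
    ch-mem² (true ∷ X) zero (suc i) (suc j) ne hi hj = trans (ch-mem² X zero i j (λ { refl → ne refl }) hi hj) (bin₂-0 (∣ X ∣))
    ch-mem² (true ∷ X) (suc m) (suc i) (suc j) ne hi hj = trans (cong₂ _+_ (ch-mem² X m i j ne′ hi hj) (ch-mem² X (suc m) i j ne′ hi hj)) (go (two X i j ne′ hi hj))
      where
        ne′ : i ≢ j
        ne′ refl = ne refl
        go : (∃ λ a → (∣ X ∣) ≡ suc (suc a)) → bin₂ (∣ X ∣) m + bin₂ (∣ X ∣) (suc m) ≡ bin₁ (∣ X ∣) m
        go (a , e) = trans (cong (λ z → bin₂ z m + bin₂ z (suc m)) e) (trans (bin₂-pascal a m) (cong (λ z → bin₁ z m) (sym e)))

    bin-absorb : ∀ a k → suc k * bin (suc a) (suc k) ≡ suc a * bin a k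
    bin-absorb zero zero = refl
    bin-absorb zero (suc k) = *-zeroʳ (suc (suc k))
    bin-absorb (suc a) zero = cong (λ z → suc z) (trans (+-identityʳ _) (trans (sym (+-identityʳ _)) (trans (bin-absorb a zero) refl)))
    bin-absorb (suc a) (suc k) = trans (l k (bin (suc a) (suc k)) (bin (suc a) (suc (suc k))))
      (trans (cong₂ (λ x y → bin (suc a) (suc k) + x + y) (bin-absorb a k) (bin-absorb a (suc k))) (l′ a (bin a k) (bin a (suc k))))
      where l : ∀ k x y → suc (suc k) * (x + y) ≡ x + suc k * x + suc (suc k) * y
            l = solve-∀
            l′ : ∀ a x y → (x + y) + suc a * x + suc a * y ≡ suc (suc a) * (x + y)
            l′ = solve-∀

    bin₁-absorb : ∀ n m → n * bin₁ n m ≡ m * bin n m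
    bin₁-absorb zero zero = refl
    bin₁-absorb zero (suc m) = sym (*-zeroʳ (suc m))
    bin₁-absorb (suc n) zero = *-zeroʳ (suc n)
    bin₁-absorb (suc n) (suc m) = sym (bin-absorb n m)

    -- Sampling without replacement is negatively correlated.
    bin₂-bound : ∀ n m → m ≤ n → n * n * bin₂ n m ≤ m * m * bin n m
    bin₂-bound zero m _ = z≤n
    bin₂-bound (suc n) zero _ = ≤≡ (*-zeroʳ (suc n * suc n))
    bin₂-bound (suc zero) (suc m) _ = z≤n
    bin₂-bound (suc (suc n)) (suc m) (s≤s m≤n) = *-cancelˡ-≤ (suc n) (negcorr-ar n m (bin₁ (suc n) m) (bin (suc n) m) (bin (suc (suc n)) (suc m)) (bin₁-absorb (suc n) m) (bin-absorb (suc n) m) m≤n)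

    bin-pos : ∀ n m → m ≤ n → 1 ≤ bin n m
    bin-pos n zero _ = ≤-refl
    bin-pos (suc n) (suc m) (s≤s h) = ≤-trans (bin-pos n m h) (m≤m+n _ _)

  -- The second moment method and the popular sums

  moment-ar : ∀ r q κ N β₁ β₂ P → q * β₁ ≡ κ * N → q * q * β₂ ≤ κ * κ * N → r * (β₁ * β₁) ≤ (β₁ + r * β₂) * P →
    κ * N * (r * κ * N) ≤ κ * N * (P * (q + r * κ))
  moment-ar r q κ N β₁ β₂ P e h₁ h₂ =
    lin 0 ((q * q) ⊠ h₂ ⊞ (r * P) ⊠ h₁ ⊞ (r * q * β₁) ⊠ ≥≡ e ⊞ (r * κ * N) ⊠ ≥≡ e ⊞ (q * P) ⊠ ≤≡ e) (solve (r ∷ q ∷ κ ∷ N ∷ β₁ ∷ β₂ ∷ P ∷ []))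

  moment₂-ar : ∀ r β₁ β₂ P M₂ → M₂ ≤ r * β₁ + r * r * β₂ →
    2 * (r * β₁ * (r * β₁ + r * r * β₂)) * (r * β₁) ≤ r * β₁ * (r * β₁) * M₂ + (r * β₁ + r * r * β₂) * (r * β₁ + r * r * β₂) * P →
    (r * β₁ + r * r * β₂) * (r * (r * (β₁ * β₁))) ≤ (r * β₁ + r * r * β₂) * (r * ((β₁ + r * β₂) * P))
  moment₂-ar r β₁ β₂ P M₂ h₁ h₂ = lin 0 (h₂ ⊞ (r * β₁ * (r * β₁)) ⊠ h₁) (solve (r ∷ β₁ ∷ β₂ ∷ P ∷ M₂ ∷ []))

  dominate-ar : ∀ r c mn mx k N P → P ≤ N → r * (c * mx + k) * N ≤ P * (mn * mx + r * (c * mx + k)) → mx * (N * (r * c)) ≤ mx * (P * (mn + r * c))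
  dominate-ar r c mn mx k N P h₁ h₂ = lin 0 ((r * k) ⊠ h₁ ⊞ h₂) (solve (r ∷ c ∷ mn ∷ mx ∷ k ∷ N ∷ P ∷ []))

  popular-ar : ∀ mn K k N P → P ≤ N → N * (K * mn + k) ≤ P * (mn + (K * mn + k)) → mn * (N * K) ≤ mn * (suc K * P)
  popular-ar mn K k N P h₁ h₂ = lin 0 (k ⊠ h₁ ⊞ h₂) (solve (mn ∷ K ∷ k ∷ N ∷ P ∷ []))

  scaled-ar : ∀ α e t mn → 1 ≤ e → 1 ≤ α → t ≤ 2 * α * mn → 4 * e * t + mn ≤ 12 * α * e * mn
  scaled-ar α e t mn h₁ h₂ h₃ = lin (3 * α * e * mn) ((4 * e) ⊠ h₃ ⊞ mn ⊠ h₁ ⊞ (e * mn) ⊠ h₂) (solve (α ∷ e ∷ t ∷ mn ∷ []))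

  size-ar : ∀ K e t mn s E → 4 * e * t + mn ≤ K * mn → mn ≤ 2 * e * E → 4 * e * (s * K) ≤ suc K * (4 * e * t + mn) → 4 * e * K * s ≤ 4 * e * K * (t + E)
  size-ar K e t mn s E h₁ h₂ h₃ = lin 0 (h₁ ⊞ (2 * K) ⊠ h₂ ⊞ h₃) (solve (K ∷ e ∷ t ∷ mn ∷ s ∷ E ∷ []))

  mass-ar : ∀ K e u mn T E c → c ≡ suc K * suc K * (4 * (e * e)) → u ≤ K * mn → mn ≤ 2 * e * E → 4 * e * (T * c) ≤ mn * suc K * u → 
    c * (4 * e * T) ≤ c * (E * E)
  mass-ar K e u mn T E _ refl h₁ h₂ h₃ = lin (suc K * mn * mn) ((mn * suc K) ⊠ h₁ ⊞ (suc K * suc K * mn) ⊠ h₂ ⊞ (suc K * suc K * (2 * e * E)) ⊠ h₂ ⊞ h₃)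
    (solve (K ∷ e ∷ u ∷ mn ∷ T ∷ E ∷ []))

  quot-ar : ∀ mn e E → mn < e * E + e → 1 ≤ E → mn ≤ 2 * e * E
  quot-ar mn e E h₁ h₂ = lin 1 (h₁ ⊞ e ⊠ h₂) (solve (mn ∷ e ∷ E ∷ []))

  ⊓*⊔ : ∀ a b → (a ⊓ b) * (a ⊔ b) ≡ a * b
  ⊓*⊔ a b = go (≤-total a b)
    where go : a ≤ b ⊎ b ≤ a → (a ⊓ b) * (a ⊔ b) ≡ a * b
          go (inj₁ h) = cong₂ _*_ (m≤n⇒m⊓n≡m h) (m≤n⇒m⊔n≡n h)
          go (inj₂ h) = trans (cong₂ _*_ (m≥n⇒m⊓n≡n h) (m≥n⇒m⊔n≡m h)) (*-comm b a)

  square-ar : ∀ l m x → 2 * (l * m) * x ≤ l * l * (x * x) + m * m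
  square-ar l m x = go (≤-total (l * x) m)
    where
      a₁ : ∀ l x k → 2 * (l * (l * x + k)) * x ≤ l * l * (x * x) + (l * x + k) * (l * x + k)
      a₁ l x k = lin (k * k) (z≤n {0}) (solve (l ∷ x ∷ k ∷ []))
      a₂ : ∀ a m k → a ≡ m + k → 2 * (a * m) ≤ a * a + m * m
      a₂ _ m k refl = lin (k * k) (z≤n {0}) (solve (m ∷ k ∷ []))
      l₁ : ∀ l m x → 2 * (l * m) * x ≡ 2 * (l * x * m)
      l₁ = solve-∀
      l₂ : ∀ l x → l * x * (l * x) ≡ l * l * (x * x)
      l₂ = solve-∀
      go : l * x ≤ m ⊎ m ≤ l * x → 2 * (l * m) * x ≤ l * l * (x * x) + m * m
      go (inj₁ h) with m≤n⇒∃[o]m+o≡n h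
      ... | k , refl = a₁ l x k
      go (inj₂ h) with m≤n⇒∃[o]m+o≡n h
      ... | k , e = ≤-trans (≤≡ (l₁ l m x)) (≤-trans (a₂ (l * x) m k (sym e)) (≤≡ (cong (_+ m * m) (l₂ l x))))

  any-intro : ∀ {n} {A : Set} (q : A → Bool) (f : Fin n → A) i → q (f i) ≡ true → any q (tabulate f) ≡ true
  any-intro q f zero h rewrite h = refl
  any-intro q f (suc i) h with q (f zero)
  ... | true = refl
  ... | false = any-intro q (λ j → f (suc j)) i h

  module Expectation (p : ℕ) (pr : Prime p) where
    open Zp p pr
    open Sets p pr
    open PSet
    open Tri p pr
    open Coordinates p pr
    open Sampling

    look : ∀ {n} → Subset n → ℕ → Bool
    look Vec.[] _ = false
    look (x Vec.∷ A) zero = x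
    look (x Vec.∷ A) (suc i) = look A i

    look-lookup : ∀ {n} (A : Subset n) f → look A (toℕ f) ≡ Vec.lookup A f
    look-lookup (x Vec.∷ A) zero = refl
    look-lookup (x Vec.∷ A) (suc f) = look-lookup A f

    ∑-look : ∀ {n} (A : Subset n) → ∑ n (λ i → ⟦ look A i ⟧) ≡ ∣ A ∣
    ∑-look Vec.[] = refl
    ∑-look {suc n} (true Vec.∷ A) = trans (∑-head n _) (cong suc (∑-look A))
    ∑-look {suc n} (false Vec.∷ A) = trans (∑-head n _) (∑-look A)

    ⌜_⌝ : Subset p → PSet
    ⌜ A ⌝ = pset (λ x → look A (res x)) (≈-per λ h → cong (look A) (res-≈ h))

    res-+ : ∀ i → i < p → res (+ i) ≡ i
    res-+ i i<p = ≈⇒≡ (res<p (+ i)) i<p (res≈ (+ i))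

    opaque
      unfolding σ

      #-⌜⌝ : ∀ A → # ⌜ A ⌝ ≡ ∣ A ∣
      #-⌜⌝ A = trans (∑-cong p (λ i i<p → cong (λ n → ⟦ look A n ⟧) (res-+ i i<p))) (∑-look A)

      ch-σ : ∀ (X : Subset p) m (f : ℤ → Subset p → ℕ) → ch X m (λ S → σ (λ x → f x S)) ≡ σ (λ x → ch X m (f x))
      ch-σ X m f = ch-∑ X m p (λ i → f (+ i))

    ix : ℤ → Fin p
    ix x = fromℕ< (res<p x)

    toℕ-ix : ∀ x → toℕ (ix x) ≡ res x
    toℕ-ix x = toℕ-fromℕ< (res<p x)

    at-ix : ∀ (A : Subset p) x → (⌜ A ⌝ ∋ x) ≡ Vec.lookup A (ix x)
    at-ix A x = trans (cong (look A) (sym (toℕ-ix x))) (look-lookup A (ix x))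

    ix-≢ : ∀ {x y} → ¬ (x ≈ y) → ix x ≢ ix y
    ix-≢ {x} {y} n e = n (≈-trans (≈res x) (≈-trans (≡⇒≈ (cong +_ (trans (sym (toℕ-ix x)) (trans (cong toℕ e) (toℕ-ix y))))) (res≈ y)))

    single : ∀ X m x → ch X m (λ S → ⟦ ⌜ S ⌝ ∋ x ⟧) ≡ ⟦ ⌜ X ⌝ ∋ x ⟧ * bin₁ (∣ X ∣) m
    single X m x = trans (ch-cong X m (λ S → cong ⟦_⟧ (at-ix S x))) (go (Vec.lookup X (ix x)) refl)
      where
        go : ∀ b → Vec.lookup X (ix x) ≡ b → ch X m (λ S → ⟦ Vec.lookup S (ix x) ⟧) ≡ ⟦ ⌜ X ⌝ ∋ x ⟧ * bin₁ (∣ X ∣) m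
        go true e = trans (ch-mem X m (ix x) e) (sym (trans (cong (λ b → ⟦ b ⟧ * bin₁ (∣ X ∣) m) (trans (at-ix X x) e)) (+-identityʳ _)))
        go false e = trans (trans (ch-cong X m (λ S → sym (*-identityʳ _))) (ch-out X m (ix x) e (λ _ → 1))) (sym (cong (λ b → ⟦ b ⟧ * bin₁ (∣ X ∣) m) (trans (at-ix X x) e)))

    sq-ind : ∀ b → ⟦ b ⟧ * ⟦ b ⟧ ≡ ⟦ b ⟧
    sq-ind true = refl
    sq-ind false = refl

    pair-≈ : ∀ X m x y → x ≈ y → ch X m (λ S → ⟦ ⌜ S ⌝ ∋ x ⟧ * ⟦ ⌜ S ⌝ ∋ y ⟧) ≡ ⟦ ⌜ X ⌝ ∋ x ⟧ * ⟦ ⌜ X ⌝ ∋ y ⟧ * bin₁ (∣ X ∣) m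
    pair-≈ X m x y e = trans (ch-cong X m (λ S → trans (cong (λ b → ⟦ ⌜ S ⌝ ∋ x ⟧ * ⟦ b ⟧) (∈-≈ ⌜ S ⌝ (≈-sym e))) (sq-ind (⌜ S ⌝ ∋ x))))
      (trans (single X m x) (cong (_* bin₁ (∣ X ∣) m) (sym (trans (cong (λ b → ⟦ ⌜ X ⌝ ∋ x ⟧ * ⟦ b ⟧) (∈-≈ ⌜ X ⌝ (≈-sym e))) (sq-ind (⌜ X ⌝ ∋ x))))))

    pair-≉ : ∀ X m x y → ¬ (x ≈ y) → ch X m (λ S → ⟦ ⌜ S ⌝ ∋ x ⟧ * ⟦ ⌜ S ⌝ ∋ y ⟧) ≡ ⟦ ⌜ X ⌝ ∋ x ⟧ * ⟦ ⌜ X ⌝ ∋ y ⟧ * bin₂ (∣ X ∣) m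
    pair-≉ X m x y n = trans (ch-cong X m (λ S → cong₂ (λ a b → ⟦ a ⟧ * ⟦ b ⟧) (at-ix S x) (at-ix S y)))
        (trans (go (Vec.lookup X (ix x)) (Vec.lookup X (ix y)) refl refl) (cong₂ (λ a b → ⟦ a ⟧ * ⟦ b ⟧ * bin₂ (∣ X ∣) m) (sym (at-ix X x)) (sym (at-ix X y))))
      where
        go : ∀ a b → Vec.lookup X (ix x) ≡ a → Vec.lookup X (ix y) ≡ b → ch X m (λ S → ⟦ Vec.lookup S (ix x) ⟧ * ⟦ Vec.lookup S (ix y) ⟧) ≡ ⟦ Vec.lookup X (ix x) ⟧ * ⟦ Vec.lookup X (ix y) ⟧ * bin₂ (∣ X ∣) m
        go false b ea eb = trans (ch-out X m (ix x) ea _) (sym (cong (λ a → ⟦ a ⟧ * ⟦ Vec.lookup X (ix y) ⟧ * bin₂ (∣ X ∣) m) ea))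
        go true false ea eb = trans (trans (ch-cong X m (λ S → *-comm ⟦ Vec.lookup S (ix x) ⟧ _)) (ch-out X m (ix y) eb _)) (sym (cong₂ (λ a b → ⟦ a ⟧ * ⟦ b ⟧ * bin₂ (∣ X ∣) m) ea eb))
        go true true ea eb = trans (ch-mem² X m (ix x) (ix y) (ix-≢ n) ea eb) (sym (trans (cong₂ (λ a b → ⟦ a ⟧ * ⟦ b ⟧ * bin₂ (∣ X ∣) m) ea eb) (+-identityʳ _)))

    module Random (A B : Subset p) (c₁ c₂ : ℕ) where

      -- Unnormalised: a true expectation is this sum divided by the number `Nn` of sample pairs,
      -- which keeps the argument inside ℕ.
      𝔼 : (Subset p → Subset p → ℕ) → ℕ
      𝔼 f = ch A c₁ (λ A' → ch B c₂ (f A'))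

      𝔼-mono : ∀ {f g} → (∀ A' B' → f A' B' ≤ g A' B') → 𝔼 f ≤ 𝔼 g
      𝔼-mono h = ch-mono A c₁ λ A' → ch-mono B c₂ (h A')

      𝔼-cong : ∀ {f g} → (∀ A' B' → f A' B' ≡ g A' B') → 𝔼 f ≡ 𝔼 g
      𝔼-cong h = ch-cong A c₁ λ A' → ch-cong B c₂ (h A')

      𝔼-+ : ∀ f g → 𝔼 (λ A' B' → f A' B' + g A' B') ≡ 𝔼 f + 𝔼 g
      𝔼-+ f g = trans (ch-cong A c₁ λ A' → ch-+ B c₂ _ _) (ch-+ A c₁ _ _)

      𝔼-* : ∀ c f → 𝔼 (λ A' B' → c * f A' B') ≡ c * 𝔼 f
      𝔼-* c f = trans (ch-cong A c₁ λ A' → ch-* B c₂ c _) (ch-* A c₁ c _)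

      𝔼-σ : ∀ (f : ℤ → Subset p → Subset p → ℕ) → 𝔼 (λ A' B' → σ (λ x → f x A' B')) ≡ σ (λ x → 𝔼 (f x))
      𝔼-σ f = trans (ch-cong A c₁ λ A' → ch-σ B c₂ (λ x → f x A')) (ch-σ A c₁ (λ x A' → ch B c₂ (f x A')))

      𝔼-prod : ∀ (f g : Subset p → ℕ) → 𝔼 (λ A' B' → f A' * g B') ≡ ch A c₁ f * ch B c₂ g
      𝔼-prod f g = trans (ch-cong A c₁ λ A' → ch-* B c₂ (f A') g) (ch-*ʳ A c₁ (ch B c₂ g) f)

      Nn β₁ β₂ q κ : ℕ
      Nn = bin (∣ A ∣) c₁ * bin (∣ B ∣) c₂
      β₁ = bin₁ (∣ A ∣) c₁ * bin₁ (∣ B ∣) c₂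
      β₂ = bin₂ (∣ A ∣) c₁ * bin₂ (∣ B ∣) c₂
      q = ∣ A ∣ * ∣ B ∣
      κ = c₁ * c₂

      𝔼-1 : 𝔼 (λ _ _ → 1) ≡ Nn
      𝔼-1 = trans (𝔼-prod (λ _ → 1) (λ _ → 1)) (cong₂ _*_ (ch-1 A c₁) (ch-1 B c₂))

      hit : ℤ → Subset p → Subset p → ℤ → ℕ
      hit z A' B' x = ⟦ ⌜ A' ⌝ ∋ x ⟧ * ⟦ ⌜ B' ⌝ ∋ (z -ᶻ x) ⟧

      stat : ℤ → Subset p → Subset p → ℕ
      stat z A' B' = σ (hit z A' B')

      R : ℤ → ℕ
      R z = stat z A B

      swap* : ∀ a b c d → a * b * (c * d) ≡ a * c * (b * d)
      swap* = solve-∀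

      first : ∀ z → 𝔼 (stat z) ≡ R z * β₁
      first z = trans (𝔼-σ (λ x A' B' → hit z A' B' x)) (trans (σ-cong λ x →
          trans (𝔼-prod (λ A' → ⟦ ⌜ A' ⌝ ∋ x ⟧) (λ B' → ⟦ ⌜ B' ⌝ ∋ (z -ᶻ x) ⟧)) (trans (cong₂ _*_ (single A c₁ x) (single B c₂ (z -ᶻ x))) (swap* ⟦ ⌜ A ⌝ ∋ x ⟧ _ _ _)))
        (σ-*ʳ β₁ (hit z A B)))

      -- The off-diagonal terms are handled by negative correlation.
      second : ∀ z → 𝔼 (λ A' B' → stat z A' B' * stat z A' B') ≤ R z * β₁ + R z * R z * β₂
      second z = ≤-trans (≤≡ expand) (≤-trans (σ-mono λ x → σ-mono λ y → pw x y) (≤≡ total))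
        where
          u : ℤ → ℕ
          u = hit z A B
          E2 : ℤ → ℤ → ℕ
          E2 x y = ch A c₁ (λ A' → ⟦ ⌜ A' ⌝ ∋ x ⟧ * ⟦ ⌜ A' ⌝ ∋ y ⟧) * ch B c₂ (λ B' → ⟦ ⌜ B' ⌝ ∋ (z -ᶻ x) ⟧ * ⟦ ⌜ B' ⌝ ∋ (z -ᶻ y) ⟧)
          expand : 𝔼 (λ A' B' → stat z A' B' * stat z A' B') ≡ σ (λ x → σ (E2 x))
          expand = trans (𝔼-cong λ A' B' → trans (sym (σ-*ʳ (stat z A' B') (hit z A' B'))) (σ-cong λ x → sym (σ-* (hit z A' B' x) (hit z A' B'))))
            (trans (𝔼-σ _) (σ-cong λ x → trans (𝔼-σ _) (σ-cong λ y → trans (𝔼-cong λ A' B' → swap* ⟦ ⌜ A' ⌝ ∋ x ⟧ _ ⟦ ⌜ A' ⌝ ∋ y ⟧ _) (𝔼-prod _ _))))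
          re : ∀ a b c d k l → a * b * k * (c * d * l) ≡ a * c * (b * d) * (k * l)
          re = solve-∀
          pw : ∀ x y → E2 x y ≤ u x * u y * (δ (y -ᶻ x) * β₁ + β₂)
          pw x y = go (x ≈? y)
            where
              go : Dec (x ≈ y) → E2 x y ≤ u x * u y * (δ (y -ᶻ x) * β₁ + β₂)
              go (yes e) = ≤-trans (≤≡ (trans (cong₂ _*_ (pair-≈ A c₁ x y e) (pair-≈ B c₂ (z -ᶻ x) (z -ᶻ y) (≈-- (≈-refl {z}) e))) (re ⟦ ⌜ A ⌝ ∋ x ⟧ ⟦ ⌜ A ⌝ ∋ y ⟧ ⟦ ⌜ B ⌝ ∋ (z -ᶻ x) ⟧ ⟦ ⌜ B ⌝ ∋ (z -ᶻ y) ⟧ (bin₁ (∣ A ∣) c₁) (bin₁ (∣ B ∣) c₂))))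
                (*-monoʳ-≤ (u x * u y) (≤-trans (≤≡ (sym (trans (cong (_* β₁) δ1) (*-identityˡ β₁)))) (m≤m+n _ β₂)))
                where δ1 : δ (y -ᶻ x) ≡ 1
                      δ1 = cong ⟦_⟧ (does-≈ (≈-trans (≈-- (≈-sym e) (≈-refl {x})) (≡⇒≈ (ℤ.+-inverseʳ x))))
              go (no n) = ≤-trans (≤≡ (trans (cong₂ _*_ (pair-≉ A c₁ x y n) (pair-≉ B c₂ (z -ᶻ x) (z -ᶻ y) n′)) (re ⟦ ⌜ A ⌝ ∋ x ⟧ ⟦ ⌜ A ⌝ ∋ y ⟧ ⟦ ⌜ B ⌝ ∋ (z -ᶻ x) ⟧ ⟦ ⌜ B ⌝ ∋ (z -ᶻ y) ⟧ (bin₂ (∣ A ∣) c₁) (bin₂ (∣ B ∣) c₂))))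
                (*-monoʳ-≤ (u x * u y) (m≤n+m β₂ _))
                where
                  l : ∀ z x → z -ᶻ (z -ᶻ x) ≡ x
                  l = ℤR.solve-∀
                  n′ : ¬ (z -ᶻ x ≈ z -ᶻ y)
                  n′ e = n (≈-trans (≡⇒≈ (sym (l z x))) (≈-trans (≈-- (≈-refl {z}) e) (≡⇒≈ (l z y))))
          per-u : Per u
          per-u = per-* (per1 ⌜ A ⌝) (≈-per λ h → cong ⟦_⟧ (∈-≈ ⌜ B ⌝ (≈-- (≈-refl {z}) h)))
          sq-u : ∀ x → u x * u x ≡ u x
          sq-u x = trans (swap* ⟦ ⌜ A ⌝ ∋ x ⟧ _ _ _) (cong₂ _*_ (sq-ind (⌜ A ⌝ ∋ x)) (sq-ind (⌜ B ⌝ ∋ (z -ᶻ x))))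
          sh : ∀ a b d β γ → a * b * (d * β + γ) ≡ a * β * (d * b) + a * γ * b
          sh = solve-∀
          total : σ (λ x → σ (λ y → u x * u y * (δ (y -ᶻ x) * β₁ + β₂))) ≡ R z * β₁ + R z * R z * β₂
          total = trans (σ-cong λ x → trans (σ-cong λ y → sh (u x) (u y) (δ (y -ᶻ x)) β₁ β₂) (trans (σ-+ _ _) (cong₂ _+_ (trans (σ-* (u x * β₁) _) (cong (u x * β₁ *_) (σ-eval per-u x))) (σ-* (u x * β₂) u))))
            (trans (σ-+ _ _) (cong₂ _+_ (trans (σ-cong λ x → trans (s₂ (u x) β₁) (cong (_* β₁) (sq-u x))) (σ-*ʳ β₁ u))
              (trans (σ-cong λ x → s₃ (u x) β₂ (R z)) (trans (σ-*ʳ (R z * β₂) u) (sym (*-assoc (R z) (R z) β₂))))))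
            where s₂ : ∀ a b → a * b * a ≡ a * a * b
                  s₂ = solve-∀
                  s₃ : ∀ a b c → a * b * c ≡ a * (c * b)
                  s₃ = solve-∀

      -- Divided by `Nn`, this is the probability that z lies in A' + B'.
      Pr : ℤ → ℕ
      Pr z = 𝔼 (λ A' B' → ⟦ 1 ≤ᵇ stat z A' B' ⟧)

      Pr≤N : ∀ z → Pr z ≤ Nn
      Pr≤N z = ≤-trans (𝔼-mono λ A' B' → ⟦⟧≤1 _) (≤≡ 𝔼-1)

      -- Chebyshev, in the form 2λμX ≤ λ²X² + μ²[X ≥ 1] with λ = 𝔼X and μ the bound on 𝔼X².
      secondMoment : ∀ z → 1 ≤ R z → 1 ≤ β₁ → R z * (β₁ * β₁) ≤ (β₁ + R z * β₂) * Pr z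
      secondMoment z r≥1 β≥1 = *-cancelˡ-≤ (R z) {{>-nonZero r≥1}} (*-cancelˡ-≤ μ {{>-nonZero (≤-trans (*-mono-≤ r≥1 β≥1) (m≤m+n _ _))}} (moment₂-ar (R z) β₁ β₂ (Pr z) M₂ (second z)
          (≤-trans (≤≡ (trans (cong (2 * (lam * μ) *_) (sym (first z))) (sym (𝔼-* (2 * (lam * μ)) (stat z))))) (≤-trans (𝔼-mono pw) (≤≡ (trans (𝔼-+ _ _) (cong₂ _+_ (𝔼-* (lam * lam) _) (𝔼-* (μ * μ) _))))))))
        where
          lam = R z * β₁
          μ = R z * β₁ + R z * R z * β₂
          M₂ = 𝔼 (λ A' B' → stat z A' B' * stat z A' B')
          pw : ∀ A' B' → 2 * (lam * μ) * stat z A' B' ≤ lam * lam * (stat z A' B' * stat z A' B') + μ * μ * ⟦ 1 ≤ᵇ stat z A' B' ⟧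
          pw A' B' = go (stat z A' B')
            where go : ∀ x → 2 * (lam * μ) * x ≤ lam * lam * (x * x) + μ * μ * ⟦ 1 ≤ᵇ x ⟧
                  go zero = ≤-trans (≤≡ (*-zeroʳ (2 * (lam * μ)))) z≤n
                  go x@(suc _) = ≤-trans (square-ar lam μ x) (≤≡ (cong (λ w → lam * lam * (x * x) + w) (sym (*-identityʳ (μ * μ)))))

      sumset-∋ : ∀ z A' B' → 1 ≤ stat z A' B' → z ∈ ⌜ sumset A' B' ⌝
      sumset-∋ z A' B' h = go (σ-pos _ h)
        where
          go : (∃ λ x → 1 ≤ hit z A' B' x) → z ∈ ⌜ sumset A' B' ⌝
          go (x , h′) = trans (at-ix (sumset A' B') z) (trans (Vec.lookup∘tabulate _ (ix z)) (any-intro _ (λ i → i) (ix x) (any-intro _ (λ i → i) (ix (z -ᶻ x)) all3)))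
            where
              pos : ∀ a b → 1 ≤ ⟦ a ⟧ * ⟦ b ⟧ → a ≡ true × b ≡ true
              pos true true _ = refl , refl
              sum-ix : ix x ⊕ ix (z -ᶻ x) ≡ ix z
              sum-ix = toℕ-injective (trans (toℕ-fromℕ< _) (trans (cong₂ (λ a b → (a + b) % p) (toℕ-ix x) (toℕ-ix (z -ᶻ x))) (trans (≈⇒≡ (m%n<n _ p) (res<p z) eq) (sym (toℕ-ix z)))))
                where
                  l : ∀ x z → x +ᶻ (z -ᶻ x) ≡ z
                  l = ℤR.solve-∀
                  mod : ∀ n → + (n % p) ≈ + n
                  mod n = ≈-sym ((+ (n / p)) by trans (cong +_ (m≡m%n+[m/n]*n n p)) (trans (ℤ.pos-+ (n % p) _) (cong (+ (n % p) +ᶻ_) (ℤ.pos-* (n / p) p))))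
                  eq : + ((res x + res (z -ᶻ x)) % p) ≈ + res z
                  eq = ≈-trans (mod _) (≈-trans (≡⇒≈ (ℤ.pos-+ (res x) _)) (≈-trans (≈-+ (res≈ x) (res≈ (z -ᶻ x))) (≈-trans (≡⇒≈ (l x z)) (≈res z))))
              all3 : mem (ix x) A' ∧ mem (ix (z -ᶻ x)) B' ∧ ⌊ (ix x ⊕ ix (z -ᶻ x)) Fin.≟ ix z ⌋ ≡ true
              all3 = ∧-i (trans (sym (at-ix A' x)) (proj₁ (pos _ _ h′))) (∧-i (trans (sym (at-ix B' (z -ᶻ x))) (proj₂ (pos (⌜ A' ⌝ ∋ x) _ h′))) (yes! (_ Fin.≟ _) sum-ix))
                where yes! : ∀ {X : Set} (d : Dec X) → X → ⌊ d ⌋ ≡ true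
                      yes! (yes _) _ = refl
                      yes! (no n) x = ⊥-elim (n x)

      W : ℕ
      W = 𝔼 (λ A' B' → ∣ sumset A' B' ∣)

      ΣPr≤W : σ Pr ≤ W
      ΣPr≤W = ≤-trans (≤≡ (sym (𝔼-σ _))) (𝔼-mono λ A' B' → ≤-trans (σ-mono λ z → ⟦⟧-mono (λ e → sumset-∋ z A' B' (≤ᵇ-true⁻¹ {1} e))) (≤≡ (#-⌜⌝ (sumset A' B'))))

      module Popular (c α e : ℕ) (1≤c₁ : 1 ≤ c₁) (c₁≤ : c₁ ≤ ∣ A ∣) (1≤c₂ : 1 ≤ c₂) (c₂≤ : c₂ ≤ ∣ B ∣)
                     (c-big : c * (∣ A ∣ ⊔ ∣ B ∣) ≤ c₁ * c₂) (comparable : ∣ A ∣ ⊔ ∣ B ∣ ≤ α * (∣ A ∣ ⊓ ∣ B ∣))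
                     (α≥1 : 1 ≤ α) (e≥1 : 1 ≤ e) (mn-big : 2 * e ≤ ∣ A ∣ ⊓ ∣ B ∣)
                     (c≡ : c ≡ suc (12 * α * e) * suc (12 * α * e) * (4 * (e * e)))
                     (hyp : 4 * e * W ≤ Nn * (4 * e * (∣ A ∣ + ∣ B ∣) + (∣ A ∣ ⊓ ∣ B ∣))) where

        a b mn mx K E t : ℕ
        a = ∣ A ∣
        b = ∣ B ∣
        mn = a ⊓ b
        mx = a ⊔ b
        K = 12 * α * e
        t = a + b

        instance
          e≢0 : NonZero e
          e≢0 = >-nonZero e≥1

        E = mn / e

        mn≥1 : 1 ≤ mn
        mn≥1 = ≤-trans (*-mono-≤ (s≤s (z≤n {1})) e≥1) mn-big

        mx≥1 : 1 ≤ mx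
        mx≥1 = ≤-trans 1≤c₁ (≤-trans c₁≤ (m≤m⊔n a b))

        κ≥1 : 1 ≤ κ
        κ≥1 = *-mono-≤ 1≤c₁ 1≤c₂

        N≥1 : 1 ≤ Nn
        N≥1 = *-mono-≤ (bin-pos a c₁ c₁≤) (bin-pos b c₂ c₂≤)

        qβ₁ : q * β₁ ≡ κ * Nn
        qβ₁ = trans (swap* a b _ _) (trans (cong₂ _*_ (bin₁-absorb a c₁) (bin₁-absorb b c₂)) (swap* c₁ _ c₂ _))

        qβ₂ : q * q * β₂ ≤ κ * κ * Nn
        qβ₂ = ≤-trans (≤≡ (l a b (bin₂ a c₁) (bin₂ b c₂))) (≤-trans (*-mono-≤ (bin₂-bound a c₁ c₁≤) (bin₂-bound b c₂ c₂≤)) (≥≡ (l c₁ c₂ (bin a c₁) (bin b c₂))))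
          where l : ∀ a b x y → a * b * (a * b) * (x * y) ≡ a * a * x * (b * b * y)
                l = solve-∀

        β₁≥1 : 1 ≤ β₁
        β₁≥1 = n≢0⇒n>0 λ z → <⇒≢ (*-mono-≤ κ≥1 N≥1) (sym (trans (sym qβ₁) (trans (cong (q *_) z) (*-zeroʳ q))))

        -- With λ = R z κ / q the expected number of surviving representations, the second moment
        -- bound is a probability of at least λ/(1 + λ). As q = mn * mx and κ ≥ c mx, λ is at least
        -- R z c / mn.
        likely : ∀ z → Nn * (R z * c) ≤ Pr z * (mn + R z * c)
        likely z = cases (R z) refl
          where
            cases : ∀ r → R z ≡ r → Nn * (r * c) ≤ Pr z * (mn + r * c)
            cases zero _ = ≤-trans (≤≡ (*-zeroʳ Nn)) z≤n
            cases r@(suc _) er = go (m≤n⇒∃[o]m+o≡n c-big)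
              where
                main : r * κ * Nn ≤ Pr z * (q + r * κ)
                main = *-cancelˡ-≤ (κ * Nn) {{>-nonZero (*-mono-≤ κ≥1 N≥1)}} (moment-ar r q κ Nn β₁ β₂ (Pr z) qβ₁ qβ₂
                  (subst (λ r → r * (β₁ * β₁) ≤ (β₁ + r * β₂) * Pr z) er (secondMoment z (≤-trans (s≤s z≤n) (≥≡ er)) β₁≥1)))
                go : (∃ λ k → c * mx + k ≡ κ) → Nn * (r * c) ≤ Pr z * (mn + r * c)
                go (k , ek) = *-cancelˡ-≤ mx {{>-nonZero mx≥1}} (dominate-ar r c mn mx k Nn (Pr z) (Pr≤N z)
                  (subst₂ (λ x y → r * x * Nn ≤ Pr z * (y + r * x)) (sym ek) (sym (⊓*⊔ a b)) main))

        R-≈ : ∀ {x y} → x ≈ y → R x ≡ R y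
        R-≈ h = σ-cong λ x → cong (λ b → ⟦ ⌜ A ⌝ ∋ x ⟧ * ⟦ b ⟧) (∈-≈ ⌜ B ⌝ (≈-- h (≈-refl {x})))

        -- The threshold is set so that sums in S survive with probability at least K/(K + 1). C
        -- consists of the negatives of the other sums, so zero-sum triples are the pairs with
        -- unpopular sum.
        S C : PSet
        S = level R (≈-per R-≈) (λ r → K * mn ≤ᵇ r * c)
        C = neg (∁ S)

        popular : ∀ z → ⟦ S ∋ z ⟧ * (Nn * K) ≤ suc K * Pr z
        popular z = go (S ∋ z) refl
          where
            go : ∀ b → (S ∋ z) ≡ b → ⟦ b ⟧ * (Nn * K) ≤ suc K * Pr z
            go false _ = z≤n
            go true h = ≤-trans (≤≡ (+-identityʳ _)) (fin (m≤n⇒∃[o]m+o≡n (≤ᵇ-true⁻¹ {K * mn} h)))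
              where fin : (∃ λ k → K * mn + k ≡ R z * c) → Nn * K ≤ suc K * Pr z
                    fin (k , ek) = *-cancelˡ-≤ mn {{>-nonZero mn≥1}} (popular-ar mn K k Nn (Pr z) (Pr≤N z) (subst (λ x → Nn * x ≤ Pr z * (mn + x)) (sym ek) (likely z)))

        unpopular : ∀ z → ⟦ ∁ S ∋ z ⟧ * R z * (c * Nn) ≤ mn * suc K * Pr z
        unpopular z = go (S ∋ z) refl
          where
            l : ∀ r c n → 1 * r * (c * n) ≡ n * (r * c)
            l = solve-∀
            l′ : ∀ p m K → p * (m + K * m) ≡ m * suc K * p
            l′ = solve-∀
            go : ∀ b → (S ∋ z) ≡ b → ⟦ not b ⟧ * R z * (c * Nn) ≤ mn * suc K * Pr z
            go true _ = z≤n
            go false h = ≤-trans (≤≡ (l (R z) c Nn)) (≤-trans (likely z) (≤-trans (*-monoʳ-≤ (Pr z) (+-monoʳ-≤ mn (<⇒≤ (≤ᵇ-false⁻¹ {K * mn} h)))) (≤≡ (l′ (Pr z) mn K))))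

        t≤ : t ≤ 2 * α * mn
        t≤ = ≤-trans (+-mono-≤ (≤-trans (m≤m⊔n a b) comparable) (≤-trans (m≤n⊔m a b) comparable)) (≤≡ (l α mn))
          where l : ∀ α m → α * m + α * m ≡ 2 * α * m
                l = solve-∀

        mdiv : mn ≡ mn % e + E * e
        mdiv = m≡m%n+[m/n]*n mn e

        mn< : mn < e * E + e
        mn< = ≤-trans (≤≡ (cong suc mdiv)) (≤-trans (+-monoˡ-≤ (E * e) (m%n<n mn e)) (≤≡ (trans (+-comm e _) (cong (_+ e) (*-comm E e)))))

        E≥1 : 1 ≤ E
        E≥1 = ≤-pred (*-cancelˡ-< e 1 (suc E) (ar e mn E mn-big mn<))
          where ar : ∀ e mn E → 2 * e ≤ mn → mn < e * E + e → e * 1 < e * suc E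
                ar e mn E h₁ h₂ = lin e (h₁ ⊞ h₂) (solve (e ∷ mn ∷ E ∷ []))

        mn≤ : mn ≤ 2 * e * E
        mn≤ = quot-ar mn e E mn< E≥1

        scaled : 4 * e * t + mn ≤ K * mn
        scaled = scaled-ar α e t mn e≥1 α≥1 t≤

        instance
          Nn≢0 : NonZero Nn
          Nn≢0 = >-nonZero N≥1

        -- Popularity gives K|S| ≤ (K + 1)(t + mn/(4e)). By `scaled` the extra 1/K of the bracket is
        -- at most another mn/(4e), and mn/(2e) ≤ E.
        s≤ : # S ≤ t + E
        s≤ = *-cancelˡ-≤ (4 * e * K) {{>-nonZero (*-mono-≤ (*-mono-≤ (s≤s (z≤n {3})) e≥1) (*-mono-≤ (*-mono-≤ (s≤s (z≤n {11})) α≥1) e≥1))}} (size-ar K e t mn (# S) E scaled mn≤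
          (*-cancelˡ-≤ Nn (≤-trans (≤≡ (l₁ Nn e (# S) K)) (≤-trans (*-monoʳ-≤ (4 * e) (≤-trans (≤≡ (sym (σ-*ʳ (Nn * K) _))) (≤-trans (σ-mono popular) (≤-trans (≤≡ (σ-* (suc K) Pr)) (*-monoʳ-≤ (suc K) ΣPr≤W)))))
            (≤-trans (≤≡ (l₂ e K W)) (≤-trans (*-monoʳ-≤ (suc K) hyp) (≤≡ (l₃ K Nn (4 * e * t + mn)))))))))
          where l₁ : ∀ n e s K → n * (4 * e * (s * K)) ≡ 4 * e * (s * (n * K))
                l₁ = solve-∀
                l₂ : ∀ e K w → 4 * e * (suc K * w) ≡ suc K * (4 * e * w)
                l₂ = solve-∀
                l₃ : ∀ K n x → suc K * (n * x) ≡ n * (suc K * x)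
                l₃ = solve-∀

        T≡ : T ⌜ A ⌝ ⌜ B ⌝ C ≡ σ (λ z → ⟦ ∁ S ∋ z ⟧ * R z)
        T≡ = trans (sym (Energy.σ-Zc ⌜ A ⌝ ⌜ B ⌝ C)) (σ-cong λ z → cong (λ w → ⟦ ∁ S ∋ w ⟧ * R z) (ℤ.neg-involutive z))

        c≥1 : 1 ≤ c
        c≥1 = ≤-trans (*-mono-≤ {1} {suc K * suc K} (s≤s z≤n) (*-mono-≤ (s≤s (z≤n {3})) (*-mono-≤ e≥1 e≥1))) (≥≡ c≡)

        -- Each unpopular sum is charged to its survival probability, which bounds the pairs by mn(K
        -- + 1)(t + mn/(4e))/c. The value of c brings this below (mn/(2e))² ≤ E².
        mass : T ⌜ A ⌝ ⌜ B ⌝ C ≤ E * E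
        mass = ≤-trans (≤-trans (≥≡ (*-identityˡ _)) (*-monoˡ-≤ _ (*-mono-≤ (s≤s (z≤n {3})) e≥1))) (*-cancelˡ-≤ c {{>-nonZero c≥1}} (mass-ar K e (4 * e * t + mn) mn (T ⌜ A ⌝ ⌜ B ⌝ C) E c c≡ scaled mn≤
          (*-cancelˡ-≤ Nn (≤-trans (≤≡ (l₁ Nn e (T ⌜ A ⌝ ⌜ B ⌝ C) c)) (≤-trans (*-monoʳ-≤ (4 * e) (≤-trans (≤≡ (trans (cong (_* (c * Nn)) T≡) (sym (σ-*ʳ (c * Nn) _)))) (≤-trans (σ-mono unpopular) (≤-trans (≤≡ (σ-* (mn * suc K) Pr)) (*-monoʳ-≤ (mn * suc K) ΣPr≤W)))))
            (≤-trans (≤≡ (l₂ e (mn * suc K) W)) (≤-trans (*-monoʳ-≤ (mn * suc K) hyp) (≤≡ (l₃ (mn * suc K) Nn (4 * e * t + mn))))))))))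
          where l₁ : ∀ n e s c → n * (4 * e * (s * c)) ≡ 4 * e * (s * (c * n))
                l₁ = solve-∀
                l₂ : ∀ e K w → 4 * e * (K * w) ≡ K * (4 * e * w)
                l₂ = solve-∀
                l₃ : ∀ K n x → K * (n * x) ≡ n * (K * x)
                l₃ = solve-∀

        triple : Triple ⌜ A ⌝ ⌜ B ⌝ C E
        triple = record { E≥1 = E≥1 ; T≤ = mass ; size = subst₂ (λ x y → p ≤ x + y + # C + E) (sym (#-⌜⌝ A)) (sym (#-⌜⌝ B)) (ar p (# S) (# C) t E c# s≤) }
          where
            c# : # S + # C ≡ p
            c# = trans (cong (λ z → # S + z) (#-neg (∁ S))) (#-∁ S)
            ar : ∀ p s c t E → s + c ≡ p → s ≤ t + E → p ≤ t + c + E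
            ar _ s c t E refl h = ≤-trans (+-monoˡ-≤ c h) (≤≡ (l t E c))
              where l : ∀ t E c → t + E + c ≡ t + c + E
                    l = solve-∀

  -- From near-extremal triples to arithmetic progressions

  any-upTo : ∀ (q : ℕ → Bool) (f : ℕ → ℕ) n i → i < n → q (f i) ≡ true → any q (applyUpTo f n) ≡ true
  any-upTo q f (suc n) zero _ h rewrite h = refl
  any-upTo q f (suc n) (suc i) (s≤s i<n) h with q (f 0)
  ... | true = refl
  ... | false = any-upTo q (f ∘ suc) n i i<n h

  any-upTo⁻¹ : ∀ (q : ℕ → Bool) (f : ℕ → ℕ) n → any q (applyUpTo f n) ≡ true → ∃ λ i → i < n × q (f i) ≡ true
  any-upTo⁻¹ q f (suc n) h with q (f 0) in e
  ... | true = 0 , s≤s z≤n , e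
  ... | false with any-upTo⁻¹ q (f ∘ suc) n h
  ...   | i , i<n , h′ = suc i , s≤s i<n , h′

  ⌊⌋-true : ∀ {X : Set} (d : Dec X) → X → ⌊ d ⌋ ≡ true
  ⌊⌋-true (yes _) _ = refl
  ⌊⌋-true (no n) x = ⊥-elim (n x)

  ⌊⌋-true⁻¹ : ∀ {X : Set} (d : Dec X) → ⌊ d ⌋ ≡ true → X
  ⌊⌋-true⁻¹ (yes x) _ = x

  -- Where density enters: p - |A| - |B| ≥ p/b₀, whereas E ≤ mn/e ≤ p/(b₀(C₂ + 1)). So |C| ≥ (C₂ +
  -- 1)E - E.
  third-size : ∀ b₀ p a b c mn E e C₂ → e ≡ b₀ * suc C₂ → b₀ * (a + b) + p ≤ b₀ * p → p ≤ a + b + c + E → mn ≤ p → e * E ≤ mn → b₀ * (C₂ * E) ≤ b₀ * c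
  third-size b₀ p a b c mn E _ C₂ refl h₁ h₂ h₃ h₄ = lin 0 (h₁ ⊞ b₀ ⊠ h₂ ⊞ h₃ ⊞ h₄) (solve (b₀ ∷ p ∷ a ∷ b ∷ c ∷ mn ∷ E ∷ C₂ ∷ []))

  -- `G` relates set size to block length, `K` bounds the chain levels, 1/`B` is the relative chain
  -- error, `k` the size ratio sought by the reduction. `C₁` and `C₂` are the ratios of set size to
  -- E required after and before it; `C₂` pays for a factor 6 in each of 50k² steps.
  record Parameters : Set where
    field
      G K B k C₁ C₂ : ℕ
      G≥4 : 4 ≤ G
      hB : ∀ w → 300 * (80 * (80 * w)) ≤ B * w
      B≥1 : 1 ≤ B
      K≥ : 20400 ≤ K
      K≥g : 1127 + 1128 * (80 * G) ≤ K
      k≥ : suc (4 * (suc (16 * K * B) * K)) ≤ k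
      C₁≥ : 12 * K * B ≤ C₁
      C₁≥′ : 1000 * G ≤ C₁
      C₂≥ : C₁ * 6 ^ (k * (50 * k)) * (k * (50 * k)) ≤ C₂
      C₁≤C₂ : C₁ ≤ C₂

  module Main (p : ℕ) (pr : Prime p) where
    open Zp p pr
    open Sets p pr
    open PSet
    open Tri p pr
    open Triple
    open Coordinates p pr
    open Cores p pr
    open Alignment p pr
    open Intervals p pr
    open Expectation p pr

    module Structured (ps : Parameters) where
      open Parameters ps

      k≥1 : 1 ≤ k
      k≥1 = ≤-trans (s≤s z≤n) k≥

      G≥1 : 1 ≤ G
      G≥1 = ≤-trans (s≤s z≤n) G≥4

      instance
        G≢0 : NonZero G
        G≢0 = >-nonZero G≥1
        80G≢0 : NonZero (80 * G)
        80G≢0 = >-nonZero (*-mono-≤ (lit 1 80) G≥1)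

      strict : ∀ X Y → 1 ≤ # X → k * # X ≤ # Y → 4 * (suc (16 * K * B) * K) * # X < # Y
      strict X Y x≥1 h = ≤-trans (≤-trans (+-monoˡ-≤ _ x≥1) (*-monoˡ-≤ (# X) k≥)) h

      sorted : ∀ X Y Z E → Triple X Y Z E → # X ≤ # Y → # Y ≤ # Z → C₂ * E ≤ # X → Alignable G (# X) X Y Z
      sorted X Y Z E tr x≤y y≤z small = widen (align G X′ X Y Z′ Z E′ E G≥4 triple tr E≤E′ (≤-trans (*-monoˡ-≤ E′ C₁≥′) err)
          x′≤x (≤-trans x′≤x x≤y) (≤-trans x′≤x (≤-trans x≤y y≤z)) (≤-trans kx≤ x≪z)
          (direction K B (80 * G) X′ Y Z′ E′ triple hB B≥1 K≥ K≥g (*-mono-≤ (lit 1 80) G≥1) (≤-trans (*-monoˡ-≤ E′ C₁≥) err)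
            (strict X′ Y x′≥1 x≪y) (strict X′ Z′ x′≥1 x≪z)))
        where
          -- |X| ≤ |Y| at the start, so this fuel meets the requirement of `reduce`.
          fuel = k * (50 * k)
          red : Reduced k C₁ E X Y
          red = reduce fuel k C₁ X Y Z E k≥1 (≤-trans (≤-trans (lit 12 1000) (≤-trans (≥≡ (*-identityʳ 1000)) (*-monoʳ-≤ 1000 G≥1))) C₁≥′) tr x≤y y≤z
            (≤-trans (*-monoˡ-≤ E C₁≤C₂) small) (*-monoʳ-≤ fuel x≤y) (≤-trans (≤≡ (l C₁ (6 ^ fuel) E fuel)) (≤-trans (*-monoˡ-≤ E C₂≥) (≤-trans small x≤y)))
            where l : ∀ a b c d → a * (b * c) * d ≡ a * b * d * c
                  l = solve-∀
          open Reduced red hiding (y≤z)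
          x≪z : k * # X′ ≤ # Z′
          x≪z = ≤-trans x≪y (Reduced.y≤z red)
          kx≤ : # X′ ≤ k * # X′
          kx≤ = ≤-trans (≥≡ (*-identityˡ (# X′))) (*-monoˡ-≤ (# X′) k≥1)
          x′≥1 : 1 ≤ # X′
          x′≥1 = ≤-trans (*-mono-≤ (≤-trans (*-mono-≤ (lit 1 1000) G≥1) C₁≥′) (E≥1 triple)) err
          widen : Alignable G (# X′) X Y Z → Alignable G (# X) X Y Z
          widen a = record { Alignable a hiding (Gh≤) ; Gh≤ = ≤-trans (Alignable.Gh≤ a) x′≤x }

      record Pair (X Y : PSet) : Set where
        field
          d e : ℤ
          de : d *ᶻ e ≈ + 1
          h : ℕ
          h≥1 : 1 ≤ h
          Gh≤x : G * h ≤ # X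
          Gh≤y : G * h ≤ # Y
          X-al : Aligned X d h
          Y-al : Aligned Y d h

      -- The reduction wants the sizes in increasing order. Zero-sum triples are symmetric in the
      -- three sets, so each of the six orders is reached by a permutation.
      pair : ∀ X Y Z E → Triple X Y Z E → C₂ * E ≤ # X → C₂ * E ≤ # Y → C₂ * E ≤ # Z → Pair X Y
      pair X Y Z E tr hx hy hz = go (≤-total (# X) (# Y)) (≤-total (# Y) (# Z)) (≤-total (# X) (# Z))
        where
          XYZ : # X ≤ # Y → # Y ≤ # Z → Pair X Y
          XYZ p q = record { Alignable a hiding (Gh≤; Z-al) ; Gh≤x = Alignable.Gh≤ a ; Gh≤y = ≤-trans (Alignable.Gh≤ a) p }
            where a = sorted X Y Z E tr p q hx
          XZY : # X ≤ # Z → # Z ≤ # Y → Pair X Y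
          XZY p q = record { Alignable a hiding (Gh≤; Y-al; Z-al) ; Y-al = Alignable.Z-al a ; Gh≤x = Alignable.Gh≤ a ; Gh≤y = ≤-trans (Alignable.Gh≤ a) (≤-trans p q) }
            where a = sorted X Z Y E (triple-swap tr) p q hx
          YXZ : # Y ≤ # X → # X ≤ # Z → Pair X Y
          YXZ p q = record { Alignable a hiding (Gh≤; X-al; Y-al; Z-al) ; X-al = Alignable.Y-al a ; Y-al = Alignable.X-al a ; Gh≤x = ≤-trans (Alignable.Gh≤ a) p ; Gh≤y = Alignable.Gh≤ a }
            where a = sorted Y X Z E (triple-comm tr) p q hy
          YZX : # Y ≤ # Z → # Z ≤ # X → Pair X Y
          YZX p q = record { Alignable a hiding (Gh≤; X-al; Y-al; Z-al) ; X-al = Alignable.Z-al a ; Y-al = Alignable.X-al a ; Gh≤x = ≤-trans (Alignable.Gh≤ a) (≤-trans p q) ; Gh≤y = Alignable.Gh≤ a }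
            where a = sorted Y Z X E (triple-swap (triple-comm tr)) p q hy
          ZXY : # Z ≤ # X → # X ≤ # Y → Pair X Y
          ZXY p q = record { Alignable a hiding (Gh≤; X-al; Y-al; Z-al) ; X-al = Alignable.Y-al a ; Y-al = Alignable.Z-al a ; Gh≤x = ≤-trans (Alignable.Gh≤ a) p ; Gh≤y = ≤-trans (Alignable.Gh≤ a) (≤-trans p q) }
            where a = sorted Z X Y E (triple-comm (triple-swap tr)) p q hz
          ZYX : # Z ≤ # Y → # Y ≤ # X → Pair X Y
          ZYX p q = record { Alignable a hiding (Gh≤; X-al; Y-al; Z-al) ; X-al = Alignable.Z-al a ; Y-al = Alignable.Y-al a ; Gh≤x = ≤-trans (Alignable.Gh≤ a) (≤-trans p q) ; Gh≤y = ≤-trans (Alignable.Gh≤ a) p }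
            where a = sorted Z Y X E (triple-swap (triple-comm (triple-swap tr))) p q hz
          go : # X ≤ # Y ⊎ # Y ≤ # X → # Y ≤ # Z ⊎ # Z ≤ # Y → # X ≤ # Z ⊎ # Z ≤ # X → Pair X Y
          go (inj₁ xy) (inj₁ yz) _ = XYZ xy yz
          go (inj₁ xy) (inj₂ zy) (inj₁ xz) = XZY xz zy
          go (inj₁ xy) (inj₂ zy) (inj₂ zx) = ZXY zx xy
          go (inj₂ yx) (inj₁ yz) (inj₁ xz) = YXZ yx xz
          go (inj₂ yx) (inj₁ yz) (inj₂ zx) = YZX yz zx
          go (inj₂ yx) (inj₂ zy) _ = ZYX zy yx

    -- From nearly translation-invariant sets to progressions

    -- This is U divided by d: translating it by i amounts to translating U by i d.
    dilate : PSet → ℤ → PSet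
    dilate U d = pset (λ n → U ∋ (d *ᶻ n)) (≈-per λ h → ∈-≈ U (≈-* d h))

    N-dilate : ∀ U d e → d *ᶻ e ≈ + 1 → ∀ i → N (dilate U d) (+ i) ≡ N U (+ i *ᶻ d)
    N-dilate U d e de i = trans (σ-cong λ n → cong₂ (λ x y → ⟦ (U ∋ x) ∧ not (U ∋ y) ⟧) (sym (ℤ.+-identityˡ (d *ᶻ n))) (l d n (+ i)))
        (#-affine (U ∖ U ⟨ + i *ᶻ d ⟩) (+ 0) d e de)
      where l : ∀ d n i → d *ᶻ (n -ᶻ i) ≡ (+ 0 +ᶻ d *ᶻ n) -ᶻ i *ᶻ d
            l = ℤR.solve-∀

    nearInterval : ∀ U d e h → d *ᶻ e ≈ + 1 → 1 ≤ h → Aligned U d h → NearInterval (dilate U d) (46 * h)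
    nearInterval U d e h de h≥1 al = Interval.interval (dilate U d) h h≥1 λ i i≤ → ≤-trans (≤≡ (cong (10 *_) (N-dilate U d e de i))) (al i i≤)

    look-zip : ∀ {n} (S T : Subset n) i → look (S Δ T) i ≡ (look S i ∧ not (look T i)) ∨ (look T i ∧ not (look S i))
    look-zip Vec.[] Vec.[] i = refl
    look-zip (s Vec.∷ S) (t Vec.∷ T) zero = b s t
      where
        b : ∀ s t → look ((s Vec.∷ S) Δ (t Vec.∷ T)) 0 ≡ (s ∧ not t) ∨ (t ∧ not s)
        b true true = refl
        b true false = refl
        b false true = refl
        b false false = refl
    look-zip (s Vec.∷ S) (t Vec.∷ T) (suc i) = look-zip S T i

    Δ-diff : ∀ (A Q : Subset p) x b → (⌜ Q ⌝ ∋ x) ≡ b → ⟦ ⌜ A Δ Q ⌝ ∋ x ⟧ ≡ diff (⌜ A ⌝ ∋ x) b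
    Δ-diff A Q x b e = trans (cong ⟦_⟧ (look-zip A Q (res x))) (trans (go (look A (res x)) (look Q (res x))) (cong (diff (⌜ A ⌝ ∋ x)) e))
      where go : ∀ s t → ⟦ (s ∧ not t) ∨ (t ∧ not s) ⟧ ≡ diff s t
            go true true = refl
            go true false = refl
            go false true = refl
            go false false = refl

    mod≈ : ∀ n → + (n % p) ≈ + n
    mod≈ n = ≈-sym ((+ (n / p)) by trans (cong +_ (m≡m%n+[m/n]*n n p)) (trans (ℤ.pos-+ (n % p) _) (cong (+ (n % p) +ᶻ_) (ℤ.pos-* (n / p) p))))

    ix≈ : ∀ x → + toℕ (ix x) ≈ x
    ix≈ x = ≈-trans (≡⇒≈ (cong +_ (toℕ-ix x))) (res≈ x)

    term≈ : ∀ x d i → + toℕ (ix x ⊕ (i · ix d)) ≈ x +ᶻ + i *ᶻ d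
    term≈ x d i = ≈-trans (≡⇒≈ (cong +_ (toℕ-fromℕ< _))) (≈-trans (mod≈ _) (≈-trans (≡⇒≈ (ℤ.pos-+ (toℕ (ix x)) _))
      (≈-+ (ix≈ x) (≈-trans (≡⇒≈ (cong +_ (toℕ-fromℕ< _))) (≈-trans (mod≈ _) (≈-trans (≡⇒≈ (ℤ.pos-* i (toℕ (ix d)))) (≈-* (+ i) (ix≈ d))))))))

    ix-cong : ∀ {f : Fin p} {x} → + toℕ f ≈ x → f ≡ ix x
    ix-cong {f} {x} h = toℕ-injective (trans (≈⇒≡ (toℕ<n f) (res<p x) (≈-trans h (≈res x))) (sym (toℕ-ix x)))

    opaque
      unfolding σ

      σ-run : ∀ (f : ℤ → ℕ) → σ f ≡ ∑ p (λ n → f (+ n))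
      σ-run f = refl

    module Progression (A : Subset p) (d e : ℤ) (de : d *ᶻ e ≈ + 1) (c : ℕ) (ni : NearInterval (dilate ⌜ A ⌝ d) c) where
      open NearInterval ni

      x₀ : ℤ
      x₀ = d *ᶻ (start +ᶻ + a)

      k : ℕ
      k = b ∸ a

      ab : a + k ≡ b
      ab = m+[n∸m]≡n (<⇒≤ a<b)

      Q : Subset p
      Q = AP (ix x₀) (ix d) k

      d-cancel : ∀ u v → d *ᶻ u ≈ d *ᶻ v → u ≈ v
      d-cancel u v h = ≈-trans (≈-sym (one u)) (≈-trans (≈-* e h) (one v))
        where
          l : ∀ e a d → e *ᶻ (d *ᶻ a) ≡ a *ᶻ (d *ᶻ e)
          l = ℤR.solve-∀
          one : ∀ a → e *ᶻ (d *ᶻ a) ≈ a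
          one a = ≈-trans (≡⇒≈ (l e a d)) (≈-trans (≈-* a de) (≡⇒≈ (ℤ.*-identityʳ a)))

      pos : ℕ → ℤ
      pos n = d *ᶻ start +ᶻ d *ᶻ + n

      l₁ : ∀ d s a i → d *ᶻ (s +ᶻ a) +ᶻ i *ᶻ d ≡ d *ᶻ s +ᶻ d *ᶻ (a +ᶻ i)
      l₁ = ℤR.solve-∀

      member : ∀ n → n < p → (⌜ Q ⌝ ∋ pos n) ≡ range a b n
      member n n<p = trans (at-ix Q (pos n)) (trans (Vec.lookup∘tabulate _ (ix (pos n))) (go (range a b n) refl (any q (upTo k)) refl))
        where
          q : ℕ → Bool
          q i = ⌊ (ix x₀ ⊕ (i · ix d)) Fin.≟ ix (pos n) ⌋
          to : range a b n ≡ true → any q (upTo k) ≡ true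
          to h = fin (m≤n⇒∃[o]m+o≡n (≤ᵇ-true⁻¹ (∧-l h)))
            where
              fin : (∃ λ i → a + i ≡ n) → any q (upTo k) ≡ true
              fin (i , ei) = any-upTo q (λ i → i) k i (+-cancelˡ-< a i k (≤-trans (≤-trans (≤≡ (cong suc ei)) (≤ᵇ-true⁻¹ {suc n} (∧-r {a ≤ᵇ n} h))) (≥≡ ab)))
                (⌊⌋-true (_ Fin.≟ _) (ix-cong (≈-trans (term≈ x₀ d i) (≡⇒≈ (trans (l₁ d start (+ a) (+ i)) (cong (λ m → d *ᶻ start +ᶻ d *ᶻ m) (trans (sym (ℤ.pos-+ a i)) (cong +_ ei))))))))
          from : any q (upTo k) ≡ true → range a b n ≡ true
          from h = fin (any-upTo⁻¹ q (λ i → i) k h)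
            where
              fin : (∃ λ i → i < k × q i ≡ true) → range a b n ≡ true
              fin (i , i<k , h′) = ∧-i (≤ᵇ-true (≤-trans (m≤m+n a i) (≤≡ n≡))) (≤ᵇ-true {suc n} (≤-trans (≤≡ (cong suc (sym n≡))) ai<b))
                where
                  ai<b : a + i < b
                  ai<b = ≤-trans (+-monoʳ-< a i<k) (≤≡ ab)
                  same : x₀ +ᶻ + i *ᶻ d ≈ pos n
                  same = ≈-trans (≈-sym (term≈ x₀ d i)) (≈-trans (≡⇒≈ (cong (λ f → + toℕ f) (⌊⌋-true⁻¹ (_ Fin.≟ _) h′))) (ix≈ (pos n)))
                  n≡ : a + i ≡ n
                  n≡ = ≈⇒≡ (≤-trans ai<b b≤p) n<p (d-cancel (+ (a + i)) (+ n) (≈-cancelˡ (d *ᶻ start) (≈-trans (≡⇒≈ (trans (cong (λ m → d *ᶻ start +ᶻ d *ᶻ m) (ℤ.pos-+ a i)) (sym (l₁ d start (+ a) (+ i))))) same)))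
          go : ∀ b₁ → range a b n ≡ b₁ → ∀ b₂ → any q (upTo k) ≡ b₂ → b₂ ≡ b₁
          go true e₁ b₂ e₂ = trans (sym e₂) (to e₁)
          go false e₁ false e₂ = refl
          go false e₁ true e₂ = ⊥-elim (tf (from e₂) e₁)

      near : ∣ A Δ Q ∣ ≤ c
      near = ≤-trans (≤≡ (trans (sym (#-⌜⌝ (A Δ Q))) (trans (sym (#-affine ⌜ A Δ Q ⌝ (d *ᶻ start) d e de)) (trans (σ-run _)
        (∑-cong p λ n n<p → trans (Δ-diff A Q (pos n) (range a b n) (member n n<p)) (cong (λ z → diff (⌜ A ⌝ ∋ z) (range a b n)) (sym (ℤ.*-distribˡ-+ d start (+ n))))))))) close

      k≥1 : 1 ≤ k
      k≥1 = m<n⇒0<n∸m a<b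

  -- The embedding ℕ → ℚ

  ιᵘ : ℕ → ℚᵘ
  ιᵘ n = mkℚᵘ (+ n) 0

  opaque
    ι : ℕ → ℚ
    ι = ℕ→ℚ

    ι≃ : ∀ n → toℚᵘ (ι n) ℚᵘ.≃ ιᵘ n
    ι≃ n = ℚ.toℚᵘ-fromℚᵘ (ιᵘ n)

    ι-0 : ι 0 ≡ 0ℚ
    ι-0 = refl

    ι-1 : ι 1 ≡ 1ℚ
    ι-1 = refl

  ι-+ : ∀ m n → ι (m + n) ≡ ι m ℚ.+ ι n
  ι-+ m n = ℚ.toℚᵘ-injective (ℚᵘ.≃-trans (ι≃ (m + n)) (ℚᵘ.≃-trans (*≡* (trans (cong (ℤ._* + 1) (ℤ.pos-+ m n)) (l (+ m) (+ n))))
    (ℚᵘ.≃-sym (ℚᵘ.≃-trans (ℚ.toℚᵘ-homo-+ (ι m) (ι n)) (ℚᵘ.+-cong (ι≃ m) (ι≃ n))))))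
    where l : ∀ m n → (m +ᶻ n) *ᶻ + 1 ≡ (m *ᶻ + 1 +ᶻ n *ᶻ + 1) *ᶻ + 1
          l = ℤR.solve-∀

  ι-* : ∀ m n → ι (m * n) ≡ ι m ℚ.* ι n
  ι-* m n = ℚ.toℚᵘ-injective (ℚᵘ.≃-trans (ι≃ (m * n)) (ℚᵘ.≃-trans (*≡* (cong (ℤ._* + 1) (ℤ.pos-* m n)))
    (ℚᵘ.≃-sym (ℚᵘ.≃-trans (ℚ.toℚᵘ-homo-* (ι m) (ι n)) (ℚᵘ.*-cong (ι≃ m) (ι≃ n))))))

  ι-mono : ∀ {m n} → m ≤ n → ι m ℚ.≤ ι n
  ι-mono {m} {n} h = ℚ.toℚᵘ-cancel-≤ (ℚᵘ.≤-respˡ-≃ (ℚᵘ.≃-sym (ι≃ m)) (ℚᵘ.≤-respʳ-≃ (ℚᵘ.≃-sym (ι≃ n)) (*≤* (ℤ.*-monoʳ-≤-nonNeg (+ 1) (ℤ.+≤+ h)))))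

  ι-cancel : ∀ {m n} → ι m ℚ.≤ ι n → m ≤ n
  ι-cancel {m} {n} h with ℚᵘ.≤-respˡ-≃ (ι≃ m) (ℚᵘ.≤-respʳ-≃ (ι≃ n) (ℚ.toℚᵘ-mono-≤ h))
  ... | *≤* le = ℤ.drop‿+≤+ (subst₂ ℤ._≤_ (ℤ.*-identityʳ (+ m)) (ℤ.*-identityʳ (+ n)) le)

  0≤ι : ∀ n → 0ℚ ℚ.≤ ι n
  0≤ι n = subst (ℚ._≤ ι n) ι-0 (ι-mono {0} z≤n)

  instance
    ι-nonNeg : ∀ {n} → ℚ.NonNegative (ι n)
    ι-nonNeg {n} = ℚ.nonNegative (0≤ι n)

  -- A positive rational has numerator at least 1, so it may be replaced by the reciprocal of its
  -- denominator.
  denominator : ∀ q → 0ℚ ℚ.< q → 1ℚ ℚ.≤ ι (↧ₙ q) ℚ.* q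
  denominator (mkℚ (+ zero) d c) (ℚ.*<* (ℤ.+<+ ()))
  denominator (mkℚ -[1+ n ] d c) (ℚ.*<* ())
  denominator q@(mkℚ (+ suc n) d c) _ = subst (ℚ._≤ ι (suc d) ℚ.* q) ι-1 (ℚ.toℚᵘ-cancel-≤ (ℚᵘ.≤-respˡ-≃ (ℚᵘ.≃-sym (ι≃ 1)) (ℚᵘ.≤-respʳ-≃ (ℚᵘ.≃-sym (ℚᵘ.≃-trans (ℚ.toℚᵘ-homo-* (ι (suc d)) q) (ℚᵘ.*-cong (ι≃ (suc d)) (ℚᵘ.≃-refl {toℚᵘ q}))))
    (*≤* (subst₂ ℤ._≤_ (ℤ.pos-* 1 (1 * suc d)) (trans (ℤ.pos-* (suc d * suc n) 1) (cong (_*ᶻ + 1) (ℤ.pos-* (suc d) (suc n)))) (ℤ.+≤+ (ar d n)))))))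
    where ar : ∀ d n → 1 * (1 * suc d) ≤ suc d * suc n * 1
          ar d n = ≤-trans (≤≡ (l d)) (≤-trans (*-monoʳ-≤ (suc d) (s≤s (z≤n {n}))) (≥≡ (*-identityʳ _)))
            where l : ∀ d → 1 * (1 * suc d) ≡ suc d * 1
                  l = solve-∀

  average-* : ∀ xs n → length xs ≡ suc n → ι (suc n) ℚ.* average xs ≡ ι (sumℕ xs)
  average-* (x ∷ xs) n refl = ℚ.toℚᵘ-injective (ℚᵘ.≃-trans (ℚᵘ.≃-trans (ℚ.toℚᵘ-homo-* (ι (suc n)) (average (x ∷ xs))) (ℚᵘ.*-cong (ι≃ (suc n)) (ℚ.toℚᵘ-fromℚᵘ (mkℚᵘ (+ s) n))))
    (ℚᵘ.≃-trans (*≡* (trans (l (+ suc n) (+ s)) (cong (+ s *ᶻ_) (sym (cong +_ (+-identityʳ (suc n))))))) (ℚᵘ.≃-sym (ι≃ s))))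
    where
      s = sumℕ (x ∷ xs)
      l : ∀ n s → n *ᶻ s *ᶻ + 1 ≡ s *ᶻ n
      l = ℤR.solve-∀

  inv : ∀ n → ι (suc n) ℚ.* ((+ 1) ℚ./ suc n) ≡ 1ℚ
  inv n = ℚ.toℚᵘ-injective (ℚᵘ.≃-trans (ℚᵘ.≃-trans (ℚ.toℚᵘ-homo-* (ι (suc n)) ((+ 1) ℚ./ suc n)) (ℚᵘ.*-cong (ι≃ (suc n)) (ℚ.toℚᵘ-fromℚᵘ (mkℚᵘ (+ 1) n))))
    (*≡* (trans (l (+ suc n)) (cong (λ z → + 1 *ᶻ + z) (sym (+-identityʳ (suc n)))))))
    where l : ∀ n → n *ᶻ + 1 *ᶻ + 1 ≡ + 1 *ᶻ n
          l = ℤR.solve-∀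

  open +-*-Solver using (_:+_; _:*_; _:-_; _:=_; con) renaming (solve to ringℚ)

  comparable-ℚ : ∀ α a b → 0ℚ ℚ.< α → α ℚ.* ι b ℚ.≤ ι a → b ≤ ↧ₙ α * a
  comparable-ℚ α a b 0<α h = ι-cancel (begin
    ι b                        ≡⟨ sym (ℚ.*-identityˡ (ι b)) ⟩
    1ℚ ℚ.* ι b                 ≤⟨ ℚ.*-monoʳ-≤-nonNeg (ι b) (denominator α 0<α) ⟩
    (ι α₀ ℚ.* α) ℚ.* ι b       ≡⟨ ℚ.*-assoc (ι α₀) α (ι b) ⟩
    ι α₀ ℚ.* (α ℚ.* ι b)       ≤⟨ ℚ.*-monoˡ-≤-nonNeg (ι α₀) h ⟩
    ι α₀ ℚ.* ι a               ≡⟨ sym (ι-* α₀ a) ⟩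
    ι (α₀ * a) ∎)
    where
      open ℚ.≤-Reasoning
      α₀ = ↧ₙ α

  density-ℚ : ∀ β t p → 0ℚ ℚ.< β → ι t ℚ.≤ (1ℚ ℚ.- β) ℚ.* ι p → ↧ₙ β * t + p ≤ ↧ₙ β * p
  density-ℚ β t p 0<β h = ι-cancel (begin
    ι (b₀ * t + p)                                        ≡⟨ trans (ι-+ (b₀ * t) p) (cong₂ ℚ._+_ (ι-* b₀ t) (sym (ℚ.*-identityˡ (ι p)))) ⟩
    ι b₀ ℚ.* ι t ℚ.+ 1ℚ ℚ.* ι p                           ≤⟨ ℚ.+-mono-≤ (ℚ.*-monoˡ-≤-nonNeg (ι b₀) h) (ℚ.*-monoʳ-≤-nonNeg (ι p) (denominator β 0<β)) ⟩
    ι b₀ ℚ.* ((1ℚ ℚ.- β) ℚ.* ι p) ℚ.+ (ι b₀ ℚ.* β) ℚ.* ι p ≡⟨ ringℚ 3 (λ b β p → b :* ((con 1ℚ :- β) :* p) :+ (b :* β) :* p := b :* p) refl (ι b₀) β (ι p) ⟩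
    ι b₀ ℚ.* ι p                                          ≡⟨ sym (ι-* b₀ p) ⟩
    ι (b₀ * p) ∎)
    where
      open ℚ.≤-Reasoning
      b₀ = ↧ₙ β

  expect-ℚ : ∀ xs n e t m W → length xs ≡ suc n → sumℕ xs ≡ W → average xs ℚ.≤ ι t ℚ.- 1ℚ ℚ.+ ((+ 1) ℚ./ suc e) ℚ.* ι m →
    suc e * W ≤ suc n * (suc e * t + m)
  expect-ℚ xs n e t m _ len refl h = ι-cancel (begin
    ι (suc e * sumℕ xs)                                   ≡⟨ trans (ι-* (suc e) (sumℕ xs)) (cong (ι (suc e) ℚ.*_) (sym (average-* xs n len))) ⟩
    ι (suc e) ℚ.* (ι (suc n) ℚ.* average xs)              ≤⟨ ℚ.*-monoˡ-≤-nonNeg (ι (suc e)) (ℚ.*-monoˡ-≤-nonNeg (ι (suc n)) h) ⟩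
    ι (suc e) ℚ.* (ι (suc n) ℚ.* (ι t ℚ.- 1ℚ ℚ.+ ε ℚ.* ι m)) ≡⟨ ringℚ 5 (λ e n t ε m → e :* (n :* (t :- con 1ℚ :+ ε :* m)) := n :* ((e :* t :- e) :+ (e :* ε) :* m)) refl (ι (suc e)) (ι (suc n)) (ι t) ε (ι m) ⟩
    ι (suc n) ℚ.* ((ι (suc e) ℚ.* ι t ℚ.- ι (suc e)) ℚ.+ (ι (suc e) ℚ.* ε) ℚ.* ι m) ≡⟨ cong (λ z → ι (suc n) ℚ.* ((ι (suc e) ℚ.* ι t ℚ.- ι (suc e)) ℚ.+ z)) (trans (cong (ℚ._* ι m) (inv e)) (ℚ.*-identityˡ (ι m))) ⟩
    ι (suc n) ℚ.* ((ι (suc e) ℚ.* ι t ℚ.- ι (suc e)) ℚ.+ ι m) ≤⟨ ℚ.*-monoˡ-≤-nonNeg (ι (suc n)) (ℚ.+-monoˡ-≤ (ι m) drop) ⟩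
    ι (suc n) ℚ.* (ι (suc e) ℚ.* ι t ℚ.+ ι m)             ≡⟨ cong (ι (suc n) ℚ.*_) (sym (trans (ι-+ (suc e * t) m) (cong (ℚ._+ ι m) (ι-* (suc e) t)))) ⟩
    ι (suc n) ℚ.* ι (suc e * t + m)                       ≡⟨ sym (ι-* (suc n) (suc e * t + m)) ⟩
    ι (suc n * (suc e * t + m)) ∎)
    where
      open ℚ.≤-Reasoning
      ε = (+ 1) ℚ./ suc e
      drop : ι (suc e) ℚ.* ι t ℚ.- ι (suc e) ℚ.≤ ι (suc e) ℚ.* ι t
      drop = begin
        ι (suc e) ℚ.* ι t ℚ.- ι (suc e)     ≤⟨ ℚ.+-monoʳ-≤ (ι (suc e) ℚ.* ι t) (ℚ.neg-antimono-≤ (0≤ι (suc e))) ⟩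
        ι (suc e) ℚ.* ι t ℚ.+ ℚ.- 0ℚ        ≡⟨ ℚ.+-identityʳ _ ⟩
        ι (suc e) ℚ.* ι t ∎

  close-ℚ : ∀ γ x m → 0ℚ ℚ.< γ → ↧ₙ γ * x ≤ m → ι x ℚ.≤ γ ℚ.* ι m
  close-ℚ γ x m 0<γ h = begin
    ι x                    ≡⟨ sym (ℚ.*-identityˡ (ι x)) ⟩
    1ℚ ℚ.* ι x             ≤⟨ ℚ.*-monoʳ-≤-nonNeg (ι x) (denominator γ 0<γ) ⟩
    (ι g₀ ℚ.* γ) ℚ.* ι x   ≡⟨ ringℚ 3 (λ g γ x → (g :* γ) :* x := γ :* (g :* x)) refl (ι g₀) γ (ι x) ⟩
    γ ℚ.* (ι g₀ ℚ.* ι x)   ≡⟨ cong (γ ℚ.*_) (sym (ι-* g₀ x)) ⟩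
    γ ℚ.* ι (g₀ * x)       ≤⟨ ℚ.*-monoˡ-≤-nonNeg γ {{ℚ.nonNegative (ℚ.<⇒≤ 0<γ)}} (ι-mono h) ⟩
    γ ℚ.* ι m ∎
    where
      open ℚ.≤-Reasoning
      g₀ = ↧ₙ γ

  -- The first five parameters are universally quantified so that no numeral is ever unfolded.
  parameters-from : ∀ G K B k C₁ → 4 ≤ G → (∀ w → 300 * (80 * (80 * w)) ≤ B * w) → 1 ≤ B → 20400 ≤ K → 1127 + 1128 * (80 * G) ≤ K →
    suc (4 * (suc (16 * K * B) * K)) ≤ k → 12 * K * B ≤ C₁ → 1000 * G ≤ C₁ → Parameters
  parameters-from G K B k C₁ G≥4 hB B≥1 K≥ K≥g k≥ C₁≥ C₁≥′ = record
    { G = G ; K = K ; B = B ; k = k ; C₁ = C₁ ; C₂ = C₁ * 6 ^ (k * (50 * k)) * (k * (50 * k)) + C₁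
    ; G≥4 = G≥4 ; hB = hB ; B≥1 = B≥1 ; K≥ = K≥ ; K≥g = K≥g ; k≥ = k≥ ; C₁≥ = C₁≥ ; C₁≥′ = C₁≥′
    ; C₂≥ = m≤m+n (C₁ * 6 ^ (k * (50 * k)) * (k * (50 * k))) C₁ ; C₁≤C₂ = m≤n+m C₁ (C₁ * 6 ^ (k * (50 * k)) * (k * (50 * k))) }

  opaque
    -- 46 is the constant of the interval approximation: G h ≤ min(|A|, |B|) with G = 46g turns the
    -- error 46h into min(|A|, |B|)/g.
    parameters : ∀ g → 1 ≤ g → Σ Parameters λ ps → Parameters.G ps ≡ 46 * g
    parameters g g≥1 = go (300 * (80 * 80)) (1127 + 1128 * (80 * (46 * g)) + 20400) (λ w → ≤≡ (l 300 80 80 w)) (s≤s z≤n) (m≤n+m 20400 (1127 + 1128 * (80 * (46 * g)))) (m≤m+n (1127 + 1128 * (80 * (46 * g))) 20400)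
      where
        l : ∀ a b c w → a * (b * (c * w)) ≡ a * (b * c) * w
        l = solve-∀
        go : ∀ B K → (∀ w → 300 * (80 * (80 * w)) ≤ B * w) → 1 ≤ B → 20400 ≤ K → 1127 + 1128 * (80 * (46 * g)) ≤ K → Σ Parameters λ ps → Parameters.G ps ≡ 46 * g
        go B K hB B≥1 K≥ K≥g = parameters-from (46 * g) K B (suc (4 * (suc (16 * K * B) * K))) (12 * K * B + 1000 * (46 * g))
          (≤-trans (lit 4 46) (≤-trans (≥≡ (*-identityʳ 46)) (*-monoʳ-≤ 46 g≥1))) hB B≥1 K≥ K≥g ≤-refl (m≤m+n (12 * K * B) (1000 * (46 * g))) (m≤n+m (1000 * (46 * g)) (12 * K * B)) , refl

  -- Choice of the constants and conclusion

  module Conclusion (ps : Parameters) (g₀ b₀ α₀ : ℕ) (G≡ : Parameters.G ps ≡ 46 * g₀) (b₀≥1 : 1 ≤ b₀) (α₀≥1 : 1 ≤ α₀) where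
    open Parameters ps using (G; C₂)

    -- `e` makes E = mn/e small enough for `third-size`; `c` is dictated by `mass`, with K = 12 α₀ e
    -- there.
    e c : ℕ
    e = b₀ * suc C₂
    c = suc (12 * α₀ * e) * suc (12 * α₀ * e) * (4 * (e * e))

    e≥1 : 1 ≤ e
    e≥1 = *-mono-≤ b₀≥1 (s≤s z≤n)

    2e≤c : 2 * e ≤ c
    2e≤c = ≤-trans (*-mono-≤ (lit 2 4) (≤-trans (≥≡ (*-identityʳ e)) (*-monoʳ-≤ e e≥1))) (≤-trans (≥≡ (*-identityˡ _)) (*-monoˡ-≤ (4 * (e * e)) {1} {suc (12 * α₀ * e) * suc (12 * α₀ * e)} (s≤s z≤n)))

    module _ (p : ℕ) (pr : Prime p) (A B : Subset p) (c₁ c₂ : ℕ)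
             (1≤c₁ : 1 ≤ c₁) (c₁≤ : c₁ ≤ ∣ A ∣) (1≤c₂ : 1 ≤ c₂) (c₂≤ : c₂ ≤ ∣ B ∣)
             (c-big : c * (∣ A ∣ ⊔ ∣ B ∣) ≤ c₁ * c₂)
             (b≤ : ∣ B ∣ ≤ α₀ * ∣ A ∣) (a≤ : ∣ A ∣ ≤ α₀ * ∣ B ∣)
             (dense : b₀ * (∣ A ∣ + ∣ B ∣) + p ≤ b₀ * p) where
      open Zp p pr
      open Sets p pr
      open Tri p pr
      open Expectation p pr
      open Main p pr
      open Structured ps using (pair; module Pair)
      module Rnd = Random A B c₁ c₂
      open Sampling

      mn mx : ℕ
      mn = ∣ A ∣ ⊓ ∣ B ∣
      mx = ∣ A ∣ ⊔ ∣ B ∣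

      samples : List ℕ
      samples = concatMap (λ A' → map (λ B' → ∣ sumset A' B' ∣) (choose B c₂)) (choose A c₁)

      samples-∑ : ∀ f → ∑L f samples ≡ Rnd.𝔼 (λ A' B' → f (∣ sumset A' B' ∣))
      samples-∑ f = trans (∑L-concatMap f _ (choose A c₁)) (trans (∑L-cong (λ A' → trans (cong sumℕ (sym (map-∘ (choose B c₂)))) (∑L-choose B c₂ _)) (choose A c₁)) (∑L-choose A c₁ _))

      samples-sum : sumℕ samples ≡ Rnd.W
      samples-sum = trans (cong sumℕ (sym (map-id samples))) (samples-∑ (λ x → x))

      samples-length : length samples ≡ Rnd.Nn
      samples-length = trans (go samples) (trans (samples-∑ (λ _ → 1)) Rnd.𝔼-1)
        where go : ∀ (xs : List ℕ) → length xs ≡ ∑L (λ _ → 1) xs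
              go [] = refl
              go (x ∷ xs) = cong suc (go xs)

      mx≤ : mx ≤ α₀ * mn
      mx≤ = ⊔-lub (go (≤-total (∣ A ∣) (∣ B ∣))) (go′ (≤-total (∣ A ∣) (∣ B ∣)))
        where
          one : ∀ x → x ≤ α₀ * x
          one x = ≤-trans (≥≡ (*-identityˡ x)) (*-monoˡ-≤ x α₀≥1)
          go : ∣ A ∣ ≤ ∣ B ∣ ⊎ ∣ B ∣ ≤ ∣ A ∣ → ∣ A ∣ ≤ α₀ * mn
          go (inj₁ h) = ≤-trans (one (∣ A ∣)) (≥≡ (cong (α₀ *_) (m≤n⇒m⊓n≡m h)))
          go (inj₂ h) = ≤-trans a≤ (≥≡ (cong (α₀ *_) (m≥n⇒m⊓n≡n h)))
          go′ : ∣ A ∣ ≤ ∣ B ∣ ⊎ ∣ B ∣ ≤ ∣ A ∣ → ∣ B ∣ ≤ α₀ * mn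
          go′ (inj₁ h) = ≤-trans b≤ (≥≡ (cong (α₀ *_) (m≤n⇒m⊓n≡m h)))
          go′ (inj₂ h) = ≤-trans (one (∣ B ∣)) (≥≡ (cong (α₀ *_) (m≥n⇒m⊓n≡n h)))

      mx≥1 : 1 ≤ mx
      mx≥1 = ≤-trans 1≤c₁ (≤-trans c₁≤ (m≤m⊔n (∣ A ∣) (∣ B ∣)))

      -- From c mx ≤ c₁c₂ ≤ |A||B| = mn mx: the condition on the sample sizes forces both sets to be
      -- large, so that E = mn/e is positive.
      c≤mn : c ≤ mn
      c≤mn = *-cancelʳ-≤ c mn mx {{>-nonZero mx≥1}} (≤-trans c-big (≤-trans (*-mono-≤ c₁≤ c₂≤) (≥≡ (⊓*⊔ (∣ A ∣) (∣ B ∣)))))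

      progressionPair : Structured.Pair ps ⌜ A ⌝ ⌜ B ⌝ →
        Σ (Fin p) λ a → Σ (Fin p) λ a′ → Σ (Fin p) λ d → Σ ℕ λ k → Σ ℕ λ l →
          1 ≤ k × 1 ≤ l × g₀ * (∣ A Δ AP a d k ∣ ⊔ ∣ B Δ AP a′ d l ∣) ≤ mn
      progressionPair pr = ix PA.x₀ , ix PB.x₀ , ix d , PA.k , PB.k , PA.k≥1 , PB.k≥1 ,
          ≤-trans (*-monoʳ-≤ g₀ (⊔-lub PA.near PB.near)) (≤-trans (≤≡ (trans (l g₀ h) (cong (_* h) (sym G≡)))) (⊓-glb (≤-trans Gh≤x (≤≡ (#-⌜⌝ A))) (≤-trans Gh≤y (≤≡ (#-⌜⌝ B)))))
        where
          open Pair pr renaming (e to e′)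
          l : ∀ g h → g * (46 * h) ≡ 46 * g * h
          l = solve-∀
          module PA = Progression A d e′ de (46 * h) (nearInterval ⌜ A ⌝ d e′ h de h≥1 X-al)
          module PB = Progression B d e′ de (46 * h) (nearInterval ⌜ B ⌝ d e′ h de h≥1 Y-al)

      answer : 4 * e * Rnd.W ≤ Rnd.Nn * (4 * e * (∣ A ∣ + ∣ B ∣) + mn) →
        Σ (Fin p) λ a → Σ (Fin p) λ a′ → Σ (Fin p) λ d → Σ ℕ λ k → Σ ℕ λ l →
          1 ≤ k × 1 ≤ l × g₀ * (∣ A Δ AP a d k ∣ ⊔ ∣ B Δ AP a′ d l ∣) ≤ mn
      answer hyp = progressionPair (pair ⌜ A ⌝ ⌜ B ⌝ Pop.C E Pop.triple (≤-trans small (≤-trans (m⊓n≤m (∣ A ∣) (∣ B ∣)) (≥≡ (#-⌜⌝ A)))) (≤-trans small (≤-trans (m⊓n≤n (∣ A ∣) (∣ B ∣)) (≥≡ (#-⌜⌝ B)))) smallC)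
        where
          module Pop = Rnd.Popular c α₀ e 1≤c₁ c₁≤ 1≤c₂ c₂≤ c-big mx≤ α₀≥1 e≥1 (≤-trans 2e≤c c≤mn) refl hyp
          E = Pop.E
          eE≤ : e * E ≤ mn
          eE≤ = ≤-trans (≤≡ (*-comm e E)) (≤-trans (m≤n+m _ (_%_ mn e {{Pop.e≢0}})) (≥≡ Pop.mdiv))
          C₂≤e : C₂ ≤ e
          C₂≤e = ≤-trans (n≤1+n C₂) (≤-trans (≥≡ (*-identityˡ (suc C₂))) (*-monoˡ-≤ (suc C₂) b₀≥1))
          small : C₂ * E ≤ mn
          small = ≤-trans (*-monoˡ-≤ E C₂≤e) eE≤
          mn≤p : mn ≤ p
          mn≤p = ≤-trans (m⊓n≤m (∣ A ∣) (∣ B ∣)) (≤-trans (≥≡ (#-⌜⌝ A)) (#≤p ⌜ A ⌝))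
          smallC : C₂ * E ≤ # Pop.C
          smallC = *-cancelˡ-≤ b₀ {{>-nonZero b₀≥1}} (third-size b₀ p (∣ A ∣) (∣ B ∣) (# Pop.C) mn E e C₂ refl dense
            (subst₂ (λ x y → p ≤ x + y + # Pop.C + E) (#-⌜⌝ A) (#-⌜⌝ B) (Triple.size Pop.triple)) mn≤p eE≤)

  opaque
    unfolding ι

    comparable-ℕ→ℚ : ∀ α a b → 0ℚ ℚ.< α → α ℚ.* ℕ→ℚ b ℚ.≤ ℕ→ℚ a → b ≤ ↧ₙ α * a
    comparable-ℕ→ℚ = comparable-ℚ

    density-ℕ→ℚ : ∀ β t p → 0ℚ ℚ.< β → ℕ→ℚ t ℚ.≤ (1ℚ ℚ.- β) ℚ.* ℕ→ℚ p → ↧ₙ β * t + p ≤ ↧ₙ β * p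
    density-ℕ→ℚ = density-ℚ

    expect-ℕ→ℚ : ∀ xs n e t m W → length xs ≡ suc n → sumℕ xs ≡ W → average xs ℚ.≤ ℕ→ℚ t ℚ.- 1ℚ ℚ.+ ((+ 1) ℚ./ suc e) ℚ.* ℕ→ℚ m →
      suc e * W ≤ suc n * (suc e * t + m)
    expect-ℕ→ℚ = expect-ℚ

    close-ℕ→ℚ : ∀ γ x m → 0ℚ ℚ.< γ → ↧ₙ γ * x ≤ m → ℕ→ℚ x ℚ.≤ γ ℚ.* ℕ→ℚ m
    close-ℕ→ℚ = close-ℚ

  ↧ₙ≥1 : ∀ q → 1 ≤ ↧ₙ q
  ↧ₙ≥1 (mkℚ n d c) = s≤s z≤n

  module Bounds (β γ : ℚ) (0<β : 0ℚ ℚ.< β) (0<γ : 0ℚ ℚ.< γ) where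

    ps : Parameters
    ps = proj₁ (parameters (↧ₙ γ) (↧ₙ≥1 γ))

    G≡ : Parameters.G ps ≡ 46 * ↧ₙ γ
    G≡ = proj₂ (parameters (↧ₙ γ) (↧ₙ≥1 γ))

    4e : ℕ
    4e = 4 * (↧ₙ β * suc (Parameters.C₂ ps))

    4e≡ : suc (pred 4e) ≡ 4e
    4e≡ = suc-pred 4e {{>-nonZero (*-mono-≤ (s≤s (z≤n {3})) (*-mono-≤ (↧ₙ≥1 β) (s≤s (z≤n {Parameters.C₂ ps}))))}}

    ε : ℚ
    -- The successor form shows the denominator to be nonzero; the value is 1/(4e), as `Popular`
    -- expects.
    ε = (+ 1) ℚ./ suc (pred 4e)

    0<ε : 0ℚ ℚ.< ε
    0<ε = ℚ.positive⁻¹ ε {{ℚ.normalize-pos 1 (suc (pred 4e))}}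

    module _ (α : ℚ) (0<α : 0ℚ ℚ.< α) where
      module Con = Conclusion ps (↧ₙ γ) (↧ₙ β) (↧ₙ α) G≡ (↧ₙ≥1 β) (↧ₙ≥1 α)

      progressions : (p : ℕ) .{{_ : NonZero p}} → Prime p → (A B : Subset p) (c₁ c₂ : ℕ) →
        1 ≤ c₁ → c₁ ≤ ∣ A ∣ → 1 ≤ c₂ → c₂ ≤ ∣ B ∣ → Con.c * (∣ A ∣ ⊔ ∣ B ∣) ≤ c₁ * c₂ → 2 ≤ ∣ A ∣ ⊓ ∣ B ∣ →
        α ℚ.* ℕ→ℚ ∣ B ∣ ℚ.≤ ℕ→ℚ ∣ A ∣ → α ℚ.* ℕ→ℚ ∣ A ∣ ℚ.≤ ℕ→ℚ ∣ B ∣ →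
        ℕ→ℚ (∣ A ∣ + ∣ B ∣) ℚ.≤ (1ℚ ℚ.- β) ℚ.* ℕ→ℚ p →
        expectedSumsetSize A B c₁ c₂ ℚ.≤ ℕ→ℚ (∣ A ∣ + ∣ B ∣) ℚ.- 1ℚ ℚ.+ ε ℚ.* ℕ→ℚ (∣ A ∣ ⊓ ∣ B ∣) →
        Σ (Fin p) λ a → Σ (Fin p) λ a' → Σ (Fin p) λ d → Σ ℕ λ k → Σ ℕ λ l →
          1 ≤ k × 1 ≤ l × ℕ→ℚ (∣ A Δ AP a d k ∣ ⊔ ∣ B Δ AP a' d l ∣) ℚ.≤ γ ℚ.* ℕ→ℚ (∣ A ∣ ⊓ ∣ B ∣)
      progressions p pr A B c₁ c₂ 1≤c₁ c₁≤ 1≤c₂ c₂≤ c-big _ b≤ a≤ dense small = finish (Con.answer p pr A B c₁ c₂ 1≤c₁ c₁≤ 1≤c₂ c₂≤ c-big b≤ℕ a≤ℕ denseℕ hyp)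
        where
          finish : (Σ (Fin p) λ a → Σ (Fin p) λ a' → Σ (Fin p) λ d → Σ ℕ λ k → Σ ℕ λ l →
                      1 ≤ k × 1 ≤ l × ↧ₙ γ * (∣ A Δ AP a d k ∣ ⊔ ∣ B Δ AP a' d l ∣) ≤ ∣ A ∣ ⊓ ∣ B ∣) →
                   Σ (Fin p) λ a → Σ (Fin p) λ a' → Σ (Fin p) λ d → Σ ℕ λ k → Σ ℕ λ l →
                      1 ≤ k × 1 ≤ l × ℕ→ℚ (∣ A Δ AP a d k ∣ ⊔ ∣ B Δ AP a' d l ∣) ℚ.≤ γ ℚ.* ℕ→ℚ (∣ A ∣ ⊓ ∣ B ∣)
          finish (a , a' , d , k , l , k≥1 , l≥1 , near) = a , a' , d , k , l , k≥1 , l≥1 ,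
            close-ℕ→ℚ γ (∣ A Δ AP a d k ∣ ⊔ ∣ B Δ AP a' d l ∣) (∣ A ∣ ⊓ ∣ B ∣) 0<γ near
          b≤ℕ : ∣ B ∣ ≤ ↧ₙ α * ∣ A ∣
          b≤ℕ = comparable-ℕ→ℚ α (∣ A ∣) (∣ B ∣) 0<α b≤
          a≤ℕ : ∣ A ∣ ≤ ↧ₙ α * ∣ B ∣
          a≤ℕ = comparable-ℕ→ℚ α (∣ B ∣) (∣ A ∣) 0<α a≤
          denseℕ : ↧ₙ β * (∣ A ∣ + ∣ B ∣) + p ≤ ↧ₙ β * p
          denseℕ = density-ℕ→ℚ β (∣ A ∣ + ∣ B ∣) p 0<β dense
          module R = Expectation.Random p pr A B c₁ c₂
          N≥1 : 1 ≤ R.Nn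
          N≥1 = *-mono-≤ (bin-pos (∣ A ∣) c₁ c₁≤) (bin-pos (∣ B ∣) c₂ c₂≤)
            where open Sampling using (bin-pos)
          N≡ : suc (pred R.Nn) ≡ R.Nn
          N≡ = suc-pred R.Nn {{>-nonZero N≥1}}
          hyp : 4e * R.W ≤ R.Nn * (4e * (∣ A ∣ + ∣ B ∣) + (∣ A ∣ ⊓ ∣ B ∣))
          hyp = subst₂ (λ x n → x * R.W ≤ n * (x * (∣ A ∣ + ∣ B ∣) + (∣ A ∣ ⊓ ∣ B ∣))) 4e≡ N≡
            (expect-ℕ→ℚ (Con.samples p pr A B c₁ c₂ 1≤c₁ c₁≤ 1≤c₂ c₂≤ c-big b≤ℕ a≤ℕ denseℕ) (pred R.Nn) (pred 4e) (∣ A ∣ + ∣ B ∣) (∣ A ∣ ⊓ ∣ B ∣) R.W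
              (trans (Con.samples-length p pr A B c₁ c₂ 1≤c₁ c₁≤ 1≤c₂ c₂≤ c-big b≤ℕ a≤ℕ denseℕ) (sym N≡)) (Con.samples-sum p pr A B c₁ c₂ 1≤c₁ c₁≤ 1≤c₂ c₂≤ c-big b≤ℕ a≤ℕ denseℕ) small)

open import Defs
open import Data.Nat using (ℕ; NonZero; _⊔_; _⊓_) renaming (_≤_ to _≤ℕ_; _*_ to _*ℕ_; _+_ to _+ℕ_)
open import Data.Nat.Primality using (Prime)
open import Data.Fin using (Fin)
open import Data.Fin.Subset using (Subset; ∣_∣)
open import Data.Rational using (ℚ; 0ℚ; 1ℚ; _<_; _≤_; _*_; _+_; _-_)
open import Data.Product using (Σ; _×_; ∃-syntax; _,_)

theorem6 : (β γ : ℚ) → 0ℚ < β → 0ℚ < γ →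
    ∃[ ε ] (0ℚ < ε × ((α : ℚ) → 0ℚ < α →
    ∃[ c ] ((p : ℕ) .{{_ : NonZero p}} → Prime p →
    (A B : Subset p) (c₁ c₂ : ℕ) →
    1 ≤ℕ c₁ → c₁ ≤ℕ ∣ A ∣ → 1 ≤ℕ c₂ → c₂ ≤ℕ ∣ B ∣ →
    c *ℕ (∣ A ∣ ⊔ ∣ B ∣) ≤ℕ c₁ *ℕ c₂ →
    2 ≤ℕ ∣ A ∣ ⊓ ∣ B ∣ →
    α * ℕ→ℚ ∣ B ∣ ≤ ℕ→ℚ ∣ A ∣ →
    α * ℕ→ℚ ∣ A ∣ ≤ ℕ→ℚ ∣ B ∣ →
    ℕ→ℚ (∣ A ∣ +ℕ ∣ B ∣) ≤ (1ℚ - β) * ℕ→ℚ p →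
    expectedSumsetSize A B c₁ c₂ ≤ ℕ→ℚ (∣ A ∣ +ℕ ∣ B ∣) - 1ℚ + ε * ℕ→ℚ (∣ A ∣ ⊓ ∣ B ∣) →
    Σ (Fin p) λ a → Σ (Fin p) λ a' → Σ (Fin p) λ d → Σ ℕ λ k → Σ ℕ λ l →
    1 ≤ℕ k × 1 ≤ℕ l ×
    ℕ→ℚ (∣ A Δ AP a d k ∣ ⊔ ∣ B Δ AP a' d l ∣) ≤ γ * ℕ→ℚ (∣ A ∣ ⊓ ∣ B ∣))))
theorem6 β γ 0<β 0<γ = ε , 0<ε , λ α 0<α → Con.c α 0<α , progressions α 0<α
  where open StabilityProof.Bounds β γ 0<β 0<γ
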